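{- Let $w\in\mathfrak S_n$ and $I\subseteq J(w)$, where $J(w)=\{j\in[n-1]: w^{ -1}(j)>w^{ -1}(j+1)\}$. The Schubert variety $X_w\subseteq GL_n/B$ is $L_I$-spherical if and only if $w$ is $I$-spherical.
   Context: $GL_n$ is the group of invertible $n\times n$ complex matrices, $B$ the subgroup of upper triangular matrices, and $X_w=\overline{BwB/B}\subseteq GL_n/B$ the Schubert variety of $w$ (viewed as a permutation matrix). Write $D=[n-1]\setminus I=\{d_1<\dots<d_k\}$, $d_0=0$, $d_{k+1}=n$. $L_I\cong GL_{d_1-d_0}\times\cdots\times GL_{d_{k+1}-d_k}$ is the Levi subgroup of invertible block diagonal matrices with consecutive blocks of sizes $d_1-d_0,\dots,d_{k+1}-d_k$; since $I\subseteq J(w)$, $L_I$ acts on $X_w$ by left multiplication. $X_w$ is called $L_I$-spherical if $X_w$ has a dense orbit of a Borel subgroup of $L_I$. $w$ is called $I$-spherical if $w_0(I)w$ is a standard Coxeter element of some parabolic subgroup of $\mathfrak S_n$, i.e. a product of distinct simple transpositions $s_i=(i\ i{+}1)$ (each used at most once, in some order), where $w_0(I)$ is the longest element of the subgroup generated by $\{s_i:i\in I\}$. (Equivalently, as the paper shows, there is a reduced expression $w=s_{i_1}\cdots s_{i_{\ell(w)}}$ in which each $s_{d_i}$ appears at most once and $\#\{m:d_{t-1}<i_m<d_t\}<\binom{d_t-d_{t-1}+1}{2}$ for $1\le t\le k+1$.) -}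

module Defs where

open import Level using (0ℓ) renaming (suc to lsuc)
open import Algebra.Apartness.Bundles using (HeytingField)
open import Algebra.Bundles using (Group; Semiring; CommutativeRing)
open import Algebra.Morphism.Structures using (IsRingHomomorphism)
import Algebra.Definitions.RawMonoid as RawMonoidDefs
import Algebra.Properties.Semiring.Exp as Exp
import Algebra.Properties.Semiring.Sum as Sum
open import Data.Bool.Base using (if_then_else_)
open import Data.Fin.Base using (Fin; zero; suc; toℕ; inject₁) renaming (_<_ to _<ᶠ_)
open import Data.Fin.Permutation as Perm using (Permutation′; _⟨$⟩ʳ_; _⟨$⟩ˡ_; _∘ₚ_; transpose)
open import Data.Fin.Properties using (_≟_)
open import Data.Fin.Subset using (Subset; _∈_; _∉_)
open import Data.List.Base using (List; foldr; length)
open import Data.List.Relation.Unary.All using (All)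
open import Data.List.Relation.Unary.Unique.Propositional using (Unique)
open import Data.Nat.Base as ℕ using (ℕ; zero; suc)
open import Data.Product.Base using (Σ; ∃; ∃₂; _×_; _,_)
open import Data.Sum.Base using (_⊎_)
open import Function.Bundles using (_⇔_)
open import Relation.Binary.Core using (Rel)
open import Relation.Binary.Definitions using (_Respects_)
open import Relation.Binary.PropositionalEquality.Core as ≡ using (_≡_)
open import Relation.Binary.Structures using (IsStrictPartialOrder)
open import Relation.Nullary using (¬_; does; yes; no)
open import Relation.Nullary.Negation using (contradiction)
import Relation.Binary.Reasoning.Setoid as SetoidReasoning
import Relation.Unary as U
open U using (Pred)

-- The standard library has neither ℝ nor ℂ.  They are specified by the axioms
-- that determine them up to isomorphism: ℝ is the Cauchy complete Archimedean
-- ordered field and ℂ = ℝ(𝕚).  Both are Heyting fields (_≈_ need not be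
-- decidable), so that the constructive Cauchy reals are a model.

record RealNumbers : Set₁ where
  infix 4 _<_
  field
    heytingField : HeytingField 0ℓ 0ℓ 0ℓ

  open HeytingField heytingField public

  commutativeRing : CommutativeRing 0ℓ 0ℓ
  commutativeRing = record { isCommutativeRing = isCommutativeRing }

  open RawMonoidDefs (CommutativeRing.+-rawMonoid commutativeRing) public
    using () renaming (_×_ to _·_)

  field
    _<_                  : Rel Carrier 0ℓ
    isStrictPartialOrder : IsStrictPartialOrder _≈_ _<_
    #⇔≶                  : ∀ x y → x # y ⇔ (x < y ⊎ y < x)
    +-mono-<             : ∀ {x y} z → x < y → x + z < y + z
    *-pos                : ∀ {x y} → 0# < x → 0# < y → 0# < x * y

  Cauchy : (ℕ → Carrier) → Set
  Cauchy x = ∀ ε → 0# < ε → ∃ λ N → ∀ m n → N ℕ.≤ m → N ℕ.≤ n → x m < x n + ε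

  _ConvergesTo_ : (ℕ → Carrier) → Carrier → Set
  x ConvergesTo l = ∀ ε → 0# < ε → ∃ λ N → ∀ n → N ℕ.≤ n → x n < l + ε × l < x n + ε

  field
    archimedean : ∀ x → ∃ λ n → x < n · 1#
    complete    : ∀ x → Cauchy x → ∃ (x ConvergesTo_)

record ComplexNumbers : Set₁ where
  field
    ℝ : RealNumbers
    ℂ : HeytingField 0ℓ 0ℓ 0ℓ

  private module ℝ = RealNumbers ℝ
  open HeytingField ℂ public

  commutativeRing : CommutativeRing 0ℓ 0ℓ
  commutativeRing = record { isCommutativeRing = isCommutativeRing }

  semiring : Semiring 0ℓ 0ℓ
  semiring = CommutativeRing.semiring commutativeRing

  open Exp semiring public using (_^_)
  open Sum semiring public using (sum)

  field
    ι                   : ℝ.Carrier → Carrier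
    ι-isHomomorphism    : IsRingHomomorphism (CommutativeRing.rawRing ℝ.commutativeRing)
                                             (CommutativeRing.rawRing commutativeRing) ι
    𝕚                   : Carrier
    𝕚²≈-1               : 𝕚 * 𝕚 ≈ - 1#
    cartesian           : ∀ z → ∃₂ λ x y → z ≈ ι x + 𝕚 * ι y
    -- The fundamental theorem of algebra, for z^(d+1) + a_d z^d + ⋯ + a_0.  It
    -- follows from the other axioms, and is part of the interface of ℂ here.
    algebraicallyClosed : ∀ {d} (a : Fin (suc d) → Carrier) →
                          ∃ λ z → z ^ suc d + sum (λ k → a k * z ^ toℕ k) ≈ 0#

module Subgroups (G : Group 0ℓ 0ℓ) where
  open Group G

  record IsSubgroup (H : Pred Carrier 0ℓ) : Set where
    field
      resp : H Respects _≈_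
      ε∈   : H ε
      ∙∈   : ∀ {x y} → H x → H y → H (x ∙ y)
      ⁻¹∈  : ∀ {x} → H x → H (x ⁻¹)

  data Commutators (H : Pred Carrier 0ℓ) : Pred Carrier 0ℓ where
    comm : ∀ {x y} → H x → H y → Commutators H (((x ∙ y) ∙ x ⁻¹) ∙ y ⁻¹)
    resp : Commutators H Respects _≈_
    ε∈   : Commutators H ε
    ∙∈   : ∀ {x y} → Commutators H x → Commutators H y → Commutators H (x ∙ y)
    ⁻¹∈  : ∀ {x} → Commutators H x → Commutators H (x ⁻¹)

  derived : ℕ → Pred Carrier 0ℓ → Pred Carrier 0ℓ
  derived zero    H = H
  derived (suc k) H = Commutators (derived k H)

  Solvable : Pred Carrier 0ℓ → Set
  Solvable H = ∃ λ k → derived k H U.⊆ (_≈ ε)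

module SymmetricGroup {m : ℕ} where
  infixl 7 _·_

  -- (u · v) i = u (v i), whereas _∘ₚ_ applies its left argument first.
  _·_ : Permutation′ (suc m) → Permutation′ (suc m) → Permutation′ (suc m)
  u · v = v ∘ₚ u

  -- j : Fin m stands for the element toℕ j + 1 of [n - 1], and likewise for
  -- Fin (suc m) and [n], where n = suc m.
  s : Fin m → Permutation′ (suc m)
  s j = transpose (inject₁ j) (suc j)

  product : List (Fin m) → Permutation′ (suc m)
  product = foldr (λ j u → s j · u) Perm.id

  Expresses : List (Fin m) → Permutation′ (suc m) → Set
  Expresses js u = u Perm.≈ product js

  HasLength : Permutation′ (suc m) → ℕ → Set
  HasLength u k = (∃ λ js → Expresses js u × length js ≡ k)
                × (∀ js → Expresses js u → k ℕ.≤ length js)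

  Parabolic : Subset m → Pred (Permutation′ (suc m)) 0ℓ
  Parabolic I u = ∃ λ js → All (_∈ I) js × Expresses js u

  IsLongestElement : Subset m → Pred (Permutation′ (suc m)) 0ℓ
  IsLongestElement I u = Parabolic I u
    × (∀ v k l → Parabolic I v → HasLength u k → HasLength v l → l ℕ.≤ k)

  IsStandardCoxeter : Pred (Permutation′ (suc m)) 0ℓ
  IsStandardCoxeter u = ∃ λ js → Unique js × Expresses js u

  J : Permutation′ (suc m) → Pred (Fin m) 0ℓ
  J w j = (w ⟨$⟩ˡ suc j) <ᶠ (w ⟨$⟩ˡ inject₁ j)

  IsSpherical : Subset m → Permutation′ (suc m) → Set
  IsSpherical I w = ∃ λ w₀ → IsLongestElement I w₀ × IsStandardCoxeter (w₀ · w)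

module GeneralLinear (𝒞 : ComplexNumbers) where
  open ComplexNumbers 𝒞 hiding (zero)
  open Sum semiring using (sum-cong-≋; sum-replicate-zero; ∑-comm; *-distribˡ-sum; *-distribʳ-sum)
  open SetoidReasoning setoid

  Matrix : ℕ → Set
  Matrix n = Fin n → Fin n → Carrier

  infix  4 _≈ₘ_
  infixl 7 _*ₘ_

  _≈ₘ_ : ∀ {n} → Rel (Matrix n) 0ℓ
  M ≈ₘ N = ∀ i j → M i j ≈ N i j

  _*ₘ_ : ∀ {n} → Matrix n → Matrix n → Matrix n
  (M *ₘ N) i j = sum (λ k → M i k * N k j)

  permMatrix : ∀ {n} → Permutation′ n → Matrix n
  permMatrix w i j = if does (i ≟ w ⟨$⟩ʳ j) then 1# else 0#

  1ₘ : ∀ {n} → Matrix n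
  1ₘ = permMatrix Perm.id

  *ₘ-cong : ∀ {n} {M M′ N N′ : Matrix n} → M ≈ₘ M′ → N ≈ₘ N′ → M *ₘ N ≈ₘ M′ *ₘ N′
  *ₘ-cong p q i j = sum-cong-≋ (λ k → *-cong (p i k) (q k j))

  *ₘ-assoc : ∀ {n} (L M N : Matrix n) → (L *ₘ M) *ₘ N ≈ₘ L *ₘ (M *ₘ N)
  *ₘ-assoc L M N i j = begin
    sum (λ k → sum (λ l → L i l * M l k) * N k j)
      ≈⟨ sum-cong-≋ (λ k → *-distribʳ-sum (N k j) (λ l → L i l * M l k)) ⟩
    sum (λ k → sum (λ l → (L i l * M l k) * N k j))
      ≈⟨ ∑-comm (λ k l → (L i l * M l k) * N k j) ⟩
    sum (λ l → sum (λ k → (L i l * M l k) * N k j))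
      ≈⟨ sum-cong-≋ (λ l → sum-cong-≋ (λ k → *-assoc (L i l) (M l k) (N k j))) ⟩
    sum (λ l → sum (λ k → L i l * (M l k * N k j)))
      ≈⟨ sum-cong-≋ (λ l → *-distribˡ-sum (L i l) (λ k → M l k * N k j)) ⟨
    sum (λ l → L i l * sum (λ k → M l k * N k j)) ∎

  sum-δ : ∀ {n} (x : Fin n → Carrier) (d : Fin n → Carrier) (i : Fin n) →
          d i ≈ 1# → (∀ k → ¬ k ≡ i → d k ≈ 0#) → sum (λ k → x k * d k) ≈ x i
  sum-δ {suc n} x d zero p q = begin
    x zero * d zero + sum (λ k → x (suc k) * d (suc k))
      ≈⟨ +-cong (trans (*-congˡ p) (*-identityʳ _))
                (sum-cong-≋ (λ k → trans (*-congˡ (q (suc k) λ ())) (zeroʳ _))) ⟩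
    x zero + sum {n} (λ _ → 0#) ≈⟨ +-congˡ (sum-replicate-zero n) ⟩
    x zero + 0#             ≈⟨ +-identityʳ _ ⟩
    x zero                  ∎
  sum-δ {suc n} x d (suc i) p q = begin
    x zero * d zero + sum (λ k → x (suc k) * d (suc k))
      ≈⟨ +-cong (trans (*-congˡ (q zero λ ())) (zeroʳ _))
                (sum-δ (λ k → x (suc k)) (λ k → d (suc k)) i p
                       (λ k k≢i → q (suc k) λ { ≡.refl → k≢i ≡.refl })) ⟩
    0# + x (suc i) ≈⟨ +-identityˡ _ ⟩
    x (suc i)      ∎

  permMatrix-1 : ∀ {n} (w : Permutation′ n) {i j} → i ≡ w ⟨$⟩ʳ j → permMatrix w i j ≈ 1#
  permMatrix-1 w {i} {j} e with i ≟ w ⟨$⟩ʳ j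
  ... | yes _ = refl
  ... | no ne = contradiction e ne

  permMatrix-0 : ∀ {n} (w : Permutation′ n) {i j} → ¬ i ≡ w ⟨$⟩ʳ j → permMatrix w i j ≈ 0#
  permMatrix-0 w {i} {j} ne with i ≟ w ⟨$⟩ʳ j
  ... | yes e = contradiction e ne
  ... | no  _ = refl

  *ₘ-permMatrix : ∀ {n} (M : Matrix n) w i j → (M *ₘ permMatrix w) i j ≈ M i (w ⟨$⟩ʳ j)
  *ₘ-permMatrix M w i j =
    sum-δ (M i) (λ k → permMatrix w k j) (w ⟨$⟩ʳ j) (permMatrix-1 w ≡.refl) (λ _ → permMatrix-0 w)

  *ₘ-identityˡ : ∀ {n} (M : Matrix n) → 1ₘ *ₘ M ≈ₘ M
  *ₘ-identityˡ M i j = trans (sum-cong-≋ (λ k → *-comm (1ₘ i k) (M k j)))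
    (sum-δ (λ k → M k j) (1ₘ i) i (permMatrix-1 Perm.id {i} {i} ≡.refl)
           (λ k k≢i → permMatrix-0 Perm.id (λ i≡k → k≢i (≡.sym i≡k))))

  *ₘ-identityʳ : ∀ {n} (M : Matrix n) → M *ₘ 1ₘ ≈ₘ M
  *ₘ-identityʳ M = *ₘ-permMatrix M Perm.id

  permMatrix-inverse : ∀ {n} (u v : Permutation′ n) → (∀ i → u ⟨$⟩ʳ (v ⟨$⟩ʳ i) ≡ i) →
                       permMatrix u *ₘ permMatrix v ≈ₘ 1ₘ
  permMatrix-inverse u v uv i j = trans (*ₘ-permMatrix (permMatrix u) v i j)
    (reflexive (≡.cong (λ k → if does (i ≟ k) then 1# else 0#) (uv j)))

  record GL (n : ℕ) : Set where
    field
      matrix   : Matrix n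
      inverse  : Matrix n
      inverseˡ : inverse *ₘ matrix ≈ₘ 1ₘ
      inverseʳ : matrix *ₘ inverse ≈ₘ 1ₘ
  open GL

  private
    cancel : ∀ {n} (A B C D : Matrix n) → B *ₘ C ≈ₘ 1ₘ → A *ₘ D ≈ₘ 1ₘ →
             (A *ₘ B) *ₘ (C *ₘ D) ≈ₘ 1ₘ
    cancel A B C D p q i j = begin
      ((A *ₘ B) *ₘ (C *ₘ D)) i j ≈⟨ *ₘ-assoc A B (C *ₘ D) i j ⟩
      (A *ₘ (B *ₘ (C *ₘ D))) i j ≈⟨ *ₘ-cong {M = A} (λ _ _ → refl) (*ₘ-assoc B C D) i j ⟨
      (A *ₘ ((B *ₘ C) *ₘ D)) i j ≈⟨ *ₘ-cong {M = A} (λ _ _ → refl) (*ₘ-cong {N = D} p (λ _ _ → refl)) i j ⟩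
      (A *ₘ (1ₘ *ₘ D)) i j       ≈⟨ *ₘ-cong {M = A} (λ _ _ → refl) (*ₘ-identityˡ D) i j ⟩
      (A *ₘ D) i j               ≈⟨ q i j ⟩
      1ₘ i j                     ∎

    inverse-cong : ∀ {n} (g h : GL n) → matrix g ≈ₘ matrix h → inverse g ≈ₘ inverse h
    inverse-cong g h p i j = begin
      inverse g i j                                ≈⟨ *ₘ-identityʳ (inverse g) i j ⟨
      (inverse g *ₘ 1ₘ) i j                        ≈⟨ *ₘ-cong {M = inverse g} (λ _ _ → refl) (inverseʳ h) i j ⟨
      (inverse g *ₘ (matrix h *ₘ inverse h)) i j   ≈⟨ *ₘ-assoc (inverse g) (matrix h) (inverse h) i j ⟨
      ((inverse g *ₘ matrix h) *ₘ inverse h) i j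
        ≈⟨ *ₘ-cong {N = inverse h} (*ₘ-cong {M = inverse g} (λ _ _ → refl) p) (λ _ _ → refl) i j ⟨
      ((inverse g *ₘ matrix g) *ₘ inverse h) i j   ≈⟨ *ₘ-cong {N = inverse h} (inverseˡ g) (λ _ _ → refl) i j ⟩
      (1ₘ *ₘ inverse h) i j                        ≈⟨ *ₘ-identityˡ (inverse h) i j ⟩
      inverse h i j                                ∎

  GL-group : ℕ → Group 0ℓ 0ℓ
  GL-group n = record
    { Carrier = GL n
    ; _≈_     = λ g h → matrix g ≈ₘ matrix h
    ; _∙_     = λ g h → record
      { matrix   = matrix g *ₘ matrix h
      ; inverse  = inverse h *ₘ inverse g
      ; inverseˡ = cancel (inverse h) (inverse g) (matrix g) (matrix h) (inverseˡ g) (inverseˡ h)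
      ; inverseʳ = cancel (matrix g) (matrix h) (inverse h) (inverse g) (inverseʳ h) (inverseʳ g)
      }
    ; ε       = record
      { matrix = 1ₘ ; inverse = 1ₘ ; inverseˡ = *ₘ-identityˡ 1ₘ ; inverseʳ = *ₘ-identityˡ 1ₘ }
    ; _⁻¹     = λ g → record
      { matrix = inverse g ; inverse = matrix g ; inverseˡ = inverseʳ g ; inverseʳ = inverseˡ g }
    ; isGroup = record
      { isMonoid = record
        { isSemigroup = record
          { isMagma = record
            { isEquivalence = record
              { refl  = λ _ _ → refl
              ; sym   = λ p i j → sym (p i j)
              ; trans = λ p q i j → trans (p i j) (q i j)
              }
            ; ∙-cong = *ₘ-cong
            }
          ; assoc = λ g h k → *ₘ-assoc (matrix g) (matrix h) (matrix k)
          }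
        ; identity = (λ g → *ₘ-identityˡ (matrix g)) , (λ g → *ₘ-identityʳ (matrix g))
        }
      ; inverse = inverseˡ , inverseʳ
      ; ⁻¹-cong = λ {g} {h} → inverse-cong g h
      }
    }

  perm : ∀ {n} → Permutation′ n → GL n
  perm w = record
    { matrix   = permMatrix w
    ; inverse  = permMatrix (Perm.flip w)
    ; inverseˡ = permMatrix-inverse (Perm.flip w) w (λ _ → Perm.inverseˡ w)
    ; inverseʳ = permMatrix-inverse w (Perm.flip w) (λ _ → Perm.inverseʳ w)
    }

module Spherical (𝒞 : ComplexNumbers) {m : ℕ} where
  open ComplexNumbers 𝒞 using (Carrier; _≈_; _+_; _*_; 0#)
  open GeneralLinear 𝒞
  open GL using (matrix)

  G : Group 0ℓ 0ℓ
  G = GL-group (suc m)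

  open Group G using (_∙_; _⁻¹)
  open Subgroups G

  GLₙ : Set
  GLₙ = GL (suc m)

  data Polynomial : Set where
    con       : Carrier → Polynomial
    var       : Fin (suc m) → Fin (suc m) → Polynomial
    _:+_ _:*_ : Polynomial → Polynomial → Polynomial

  eval : Polynomial → GLₙ → Carrier
  eval (con c)   g = c
  eval (var i j) g = matrix g i j
  eval (p :+ q)  g = eval p g + eval q g
  eval (p :* q)  g = eval p g * eval q g

  -- The coordinate ring of GLₙ is generated by the entries and 1/det, and powers
  -- of det can be cleared, so polynomials in the entries cut out all closed sets.
  Closed : Pred GLₙ 0ℓ → Set₁
  Closed Z = Σ (Pred Polynomial 0ℓ) λ 𝓕 → ∀ g → Z g ⇔ (∀ p → 𝓕 p → eval p g ≈ 0#)

  -- Points of Y ∪ Z are those outside neither: a union of Zariski closed sets is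
  -- cut out by products p q, and p q ≈ 0# does not decide which factor vanishes.
  Connected : Pred GLₙ 0ℓ → Set₁
  Connected S = ∀ {Y Z} → Closed Y → Closed Z →
    (∀ g → S g → ¬ (¬ Y g × ¬ Z g)) →
    U.Satisfiable (S U.∩ Y) → U.Satisfiable (S U.∩ Z) → ¬ U.Empty (S U.∩ (Y U.∩ Z))

  record ConnectedSolvableClosedSubgroup (L H : Pred GLₙ 0ℓ) : Set₁ where
    field
      isSubgroup : IsSubgroup H
      H⊆L        : H U.⊆ L
      closed     : Closed H
      connected  : Connected H
      solvable   : Solvable H

  IsBorelSubgroup : (L H : Pred GLₙ 0ℓ) → Set₁
  IsBorelSubgroup L H = ConnectedSolvableClosedSubgroup L H
    × (∀ H′ → ConnectedSolvableClosedSubgroup L H′ → H U.⊆ H′ → H′ U.⊆ H)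

  B : Pred GLₙ 0ℓ
  B g = ∀ i j → j <ᶠ i → matrix g i j ≈ 0#

  -- i and j are in the same block iff no d ∈ [n - 1] ∖ I separates them.
  SameBlock : Subset m → Rel (Fin (suc m)) 0ℓ
  SameBlock I i j = ∀ d → d ∉ I → toℕ i ℕ.≤ toℕ d ⇔ toℕ j ℕ.≤ toℕ d

  Levi : Subset m → Pred GLₙ 0ℓ
  Levi I g = ∀ i j → ¬ SameBlock I i j → matrix g i j ≈ 0#

  -- A point gB of GLₙ/B is given by g, so a subset of GLₙ/B is a predicate on
  -- GLₙ respecting _~_.  The topology is the quotient of that of GLₙ.
  infix 4 _~_
  _~_ : Rel GLₙ 0ℓ
  g ~ h = B (g ⁻¹ ∙ h)

  ClosedInFlag : Pred GLₙ 0ℓ → Set₁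
  ClosedInFlag Z = Z Respects _~_ × Closed Z

  closure : Pred GLₙ 0ℓ → Pred GLₙ (lsuc 0ℓ)
  closure S g = ∀ Z → ClosedInFlag Z → S U.⊆ Z → Z g

  SchubertCell : Permutation′ (suc m) → Pred GLₙ 0ℓ
  SchubertCell w g = ∃ λ b → B b × g ~ b ∙ perm w

  SchubertVariety : Permutation′ (suc m) → Pred GLₙ (lsuc 0ℓ)
  SchubertVariety w = closure (SchubertCell w)

  Orbit : Pred GLₙ 0ℓ → GLₙ → Pred GLₙ 0ℓ
  Orbit H x g = ∃ λ h → H h × g ~ h ∙ x

  _DenseIn_ : Pred GLₙ 0ℓ → Pred GLₙ (lsuc 0ℓ) → Set₁
  S DenseIn X = S U.⊆ X × X U.⊆ closure S

  IsLeviSpherical : Subset m → Permutation′ (suc m) → Set₁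
  IsLeviSpherical I w = ∃ λ H → IsBorelSubgroup (Levi I) H
    × ∃ λ x → Orbit H x DenseIn SchubertVariety w

{-# OPTIONS --safe #-}
module Submission where

-- Let B_L be the group of upper triangular matrices of the Levi subgroup and T its torus,
-- and let Φ be the set of positions (i , j) with i < j, w⁻¹(i) > w⁻¹(j) and i, j in
-- different blocks.  Since I ⊆ J(w), every point of the cell B w B/B is h u w B with h in B_L
-- and u in the unipotent group U_Φ of matrices 1 + (entries at Φ), and T scales the entry of
-- u at (i , j) by τᵢ/τⱼ.  So B_L has a dense orbit iff these characters are independent, iff
-- the graph Φ is a forest.
--
-- The longest element w₀(I) carries Φ to the inversions of v = w₀(I) w.  If v is a product
-- of distinct simple transpositions, then every choice of nonzero entries on Φ is of the
-- form τᵢ/τⱼ (induction on the word), so that the generic points of U_Φ form one T-orbit.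
-- If v is not, then four positions r₁, r₂ against c₁, c₂ lie in Φ or on the diagonal, and
-- the ratio of u(r₁,c₁) u(r₂,c₂) to u(r₁,c₂) u(r₂,c₁) is a nonconstant B_L-invariant
-- rational function on the cell.  A solvable connected subgroup with a dense orbit is moved
-- into B_L by an element of the Levi (Lie–Kolchin), and the Levi preserves X_w.
--
-- Apartness is tight, so equations are stable under double negation and are proved
-- classically; ranges of generic parameters are replaced by large natural numbers.

open import Defs using (ComplexNumbers; module RealNumbers; module SymmetricGroup; module Spherical;
  module Subgroups; module GeneralLinear)
open import Algebra.Bundles using (CommutativeRing; Group; RawRing)
open import Algebra.Morphism.Structures using (IsRingHomomorphism)
import Algebra.Properties.AbelianGroup as AbelianGroupProperties
import Algebra.Properties.CommutativeMonoid.Sum as MonoidSum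
import Algebra.Properties.Group as GroupProperties
import Algebra.Properties.Ring as RingProperties
import Algebra.Properties.Semiring.Mult as Mult
import Algebra.Properties.Semiring.Sum as Sum
import Algebra.Solver.Ring as RingSolver
open import Algebra.Solver.Ring.AlmostCommutativeRing
  using (fromCommutativeRing; _-Raw-AlmostCommutative⟶_)
open import Data.Bool.Base using (true; false; if_then_else_; _∧_)
open import Data.Empty using (⊥)
open import Data.Fin.Base using (Fin; zero; suc; toℕ; inject₁; punchIn; punchOut)
  renaming (_<_ to _<ᶠ_; _≤_ to _≤ᶠ_)
import Data.Fin.Induction as FinInduction
open import Data.Fin.Permutation as Perm using (Permutation′; _⟨$⟩ʳ_; _⟨$⟩ˡ_)
import Data.Fin.Permutation.Components as PC
open import Data.Fin.Properties using (_≟_)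
import Data.Fin.Properties as Finₚ
open import Data.Fin.Subset using (Subset; _∈_; _∉_)
open import Data.Fin.Subset.Properties using (_∈?_)
open import Data.List.Base using (List; []; _∷_; _++_; length)
open import Data.List.Relation.Unary.All as All using (All; []; _∷_)
open import Data.List.Relation.Unary.AllPairs using ([]; _∷_)
open import Data.List.Relation.Unary.Unique.Propositional using (Unique)
open import Data.Maybe.Base using (just; nothing)
open import Data.Nat.Base as ℕ using (ℕ; zero; suc; z≤n; s≤s; _⊔_)
import Data.Nat.Properties as ℕₚ
open import Data.Product.Base using (∃; _×_; _,_; proj₁; proj₂)
open import Data.Sum.Base using (_⊎_; inj₁; inj₂)
open import Function.Base using (_∘_)
open import Function.Bundles using (_⇔_; mk⇔; module Equivalence)
open import Level using (0ℓ)
open import Relation.Binary.Core using (Rel)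
open import Relation.Binary.Definitions
  using (Decidable; Reflexive; Symmetric; Transitive; WeaklyDecidable; tri<; tri≈; tri>)
open import Relation.Binary.PropositionalEquality as ≡ using (_≡_; _≢_)
import Relation.Binary.Reasoning.Setoid as SetoidReasoning
open import Relation.Binary.Structures using (IsStrictPartialOrder)
open import Relation.Nullary using (¬_; Dec; yes; no; does)
open import Relation.Nullary.Decidable
  using (_×-dec_; _⊎-dec_; _→-dec_; ¬?; map′; dec-true; dec-false; decidable-stable)
open import Relation.Nullary.Negation using (contradiction)
open import Relation.Unary using (Pred; _∩_; _⊆_; Satisfiable; Empty)

-- A double negation can be removed from an equation but not from an existence statement.
-- Sufficiency therefore produces its data outright (subgroup, base point, tori) and leaves only
-- equations to classical reasoning. Necessity uses its hypothesis only to refute a `Square`; the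
-- word for w₀(I) w is then found by decidable sorting, so that eigenvectors, roots and generic
-- points on the way need exist only doubly negated.
--
-- Closed sets are tested by polynomials, so the normal form h u w B of a point is computed without
-- division, inverses being replaced by `adj` and `den`. The coordinates of u are then correct only
-- up to row and column scalings. The ratio attached to a square is insensitive to these, since each
-- of its two monomials uses both rows and both columns once.
--
-- Borel subgroups are given by maximality. For B_L it is shown by finding, in a group that contains
-- B_L and an element outside it, two opposite root subgroups, hence an SL₂ inside every derived
-- subgroup. Derived subgroups are abstract, not Zariski closures, so their connectedness needs an
-- argument of its own.

infix 3 ¬¬_
¬¬_ : ∀ {a} → Set a → Set a
¬¬ A = ¬ ¬ A

infixl 1 _>>=_
_>>=_ : ∀ {a b} {A : Set a} {B : Set b} → ¬¬ A → (A → ¬¬ B) → ¬¬ B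
(m >>= f) k = m (λ x → f x k)

pure : ∀ {a} {A : Set a} → A → ¬¬ A
pure x k = k x

em : ∀ {a} (A : Set a) → ¬¬ (A ⊎ ¬ A)
em A k = k (inj₂ (k ∘ inj₁))

¬¬-∀Fin : ∀ {p n} {P : Fin n → Set p} → (∀ i → ¬¬ P i) → ¬¬ (∀ i → P i)
¬¬-∀Fin {n = zero}  h = pure λ ()
¬¬-∀Fin {n = suc n} h = h zero >>= λ h₀ → ¬¬-∀Fin (h ∘ suc) >>= λ hₛ →
  pure λ { zero → h₀ ; (suc i) → hₛ i }

¬∀⇒∃¬ : ∀ {a p} {A : Set a} {P : A → Set p} → ¬ (∀ x → P x) → (∀ x → ¬¬ P x → P x) →
  ¬¬ (∃ λ x → ¬ P x)
¬∀⇒∃¬ ¬all stb k = ¬all λ x → stb x λ ¬px → k (x , ¬px)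

-- Plays the part of "for a generic parameter": it is closed under finite conjunctions and satisfied
-- somewhere. Naturals can serve as parameters because `nat` is injective.
Ev : ∀ {p} → (ℕ → Set p) → Set p
Ev P = ¬¬ (∃ λ M → ∀ k → M ℕ.≤ k → P k)

module _ {p q} {P : ℕ → Set p} {Q : ℕ → Set q} where

  Ev-map : (∀ k → P k → Q k) → Ev P → Ev Q
  Ev-map f e = e >>= λ (M , h) → pure (M , λ k le → f k (h k le))

  Ev-∩ : Ev P → Ev Q → Ev (λ k → P k × Q k)
  Ev-∩ e e′ = e >>= λ (M , h) → e′ >>= λ (M′ , h′) → pure
    (M ⊔ M′ , λ k le → h k (ℕₚ.≤-trans (ℕₚ.m≤m⊔n M M′) le) , h′ k (ℕₚ.≤-trans (ℕₚ.m≤n⊔m M M′) le))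

Ev-∀Fin : ∀ {p n} {P : Fin n → ℕ → Set p} → (∀ i → Ev (P i)) → Ev (λ k → ∀ i → P i k)
Ev-∀Fin {n = zero}  h = pure (0 , λ _ _ ())
Ev-∀Fin {n = suc n} h = Ev-map (λ { k (h₀ , hₛ) zero → h₀ ; k (h₀ , hₛ) (suc i) → hₛ i })
  (Ev-∩ (h zero) (Ev-∀Fin (h ∘ suc)))

Ev-always : ∀ {p} {P : ℕ → Set p} → (∀ k → P k) → Ev P
Ev-always h = pure (0 , λ k _ → h k)

Ev-∃ : ∀ {p} {P : ℕ → Set p} → Ev P → ¬¬ ∃ P
Ev-∃ e = e >>= λ (M , h) → pure (M , h M ℕₚ.≤-refl)

-- A ring solver with integer coefficients

-- Integers are represented by differences of naturals, one of which is zero, so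
-- that the solver compares coefficients definitionally.
module IntegerCoefficients (R : CommutativeRing 0ℓ 0ℓ) where
  open CommutativeRing R
  open Mult semiring using (×-homo-+; ×1-homo-*) renaming (_×_ to _·_)
  open RingProperties ring using (-0#≈0#; -‿distribˡ-*; -‿distribʳ-*; -‿involutive)
  open AbelianGroupProperties +-abelianGroup using () renaming (⁻¹-∙-comm to -‿+-comm)
  open SetoidReasoning setoid

  Coeff : Set
  Coeff = ℕ × ℕ

  difference : Coeff → Carrier
  difference (a , b) = a · 1# + - (b · 1#)

  -- The first two clauses make the constants 0 and 1 definitionally 0# and 1#.
  ⟦_⟧ᶜ : Coeff → Carrier
  ⟦ zero        , zero ⟧ᶜ = 0#
  ⟦ suc zero    , zero ⟧ᶜ = 1#
  ⟦ c ⟧ᶜ                  = difference c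

  ⟦⟧-difference : ∀ c → ⟦ c ⟧ᶜ ≈ difference c
  ⟦⟧-difference (zero        , zero)  = sym (-‿inverseʳ 0#)
  ⟦⟧-difference (suc zero    , zero)  = sym
    (trans (+-cong (+-identityʳ 1#) -0#≈0#) (+-identityʳ 1#))
  ⟦⟧-difference (suc (suc a) , zero)  = refl
  ⟦⟧-difference (zero        , suc b) = refl
  ⟦⟧-difference (suc zero    , suc b) = refl
  ⟦⟧-difference (suc (suc a) , suc b) = refl

  normalise : Coeff → Coeff
  normalise (a , b) = a ℕ.∸ b , b ℕ.∸ a

  medial : ∀ a b c d → (a + b) + (c + d) ≈ (a + c) + (b + d)
  medial a b c d = begin
    (a + b) + (c + d) ≈⟨ +-assoc a b (c + d) ⟩
    a + (b + (c + d)) ≈⟨ +-congˡ (+-assoc b c d) ⟨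
    a + ((b + c) + d) ≈⟨ +-congˡ (+-congʳ (+-comm b c)) ⟩
    a + ((c + b) + d) ≈⟨ +-congˡ (+-assoc c b d) ⟩
    a + (c + (b + d)) ≈⟨ +-assoc a c (b + d) ⟨
    (a + c) + (b + d) ∎

  normalise-sound : ∀ c → difference (normalise c) ≈ difference c
  normalise-sound (zero  , zero)  = refl
  normalise-sound (zero  , suc b) = refl
  normalise-sound (suc a , zero)  = refl
  normalise-sound (suc a , suc b) = begin
    difference (normalise (a , b))            ≈⟨ normalise-sound (a , b) ⟩
    a · 1# + - (b · 1#)                       ≈⟨ +-identityˡ _ ⟨
    0# + (a · 1# + - (b · 1#))                ≈⟨ +-congʳ (-‿inverseʳ 1#) ⟨
    (1# + - 1#) + (a · 1# + - (b · 1#))       ≈⟨ medial 1# (- 1#) _ _ ⟩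
    (1# + a · 1#) + (- 1# + - (b · 1#))       ≈⟨ +-congˡ (-‿+-comm 1# (b · 1#)) ⟩
    (1# + a · 1#) + - (1# + b · 1#)           ∎

  rawCoeff : RawRing 0ℓ 0ℓ
  rawCoeff = record
    { Carrier = Coeff
    ; _≈_     = _≡_
    ; _+_     = λ (a , b) (c , d) → normalise (a ℕ.+ c , b ℕ.+ d)
    ; _*_     = λ (a , b) (c , d) → normalise (a ℕ.* c ℕ.+ b ℕ.* d , a ℕ.* d ℕ.+ b ℕ.* c)
    ; -_      = λ (a , b) → b , a
    ; 0#      = 0 , 0
    ; 1#      = 1 , 0
    }

  morphism : rawCoeff -Raw-AlmostCommutative⟶ fromCommutativeRing R
  morphism = record
    { ⟦_⟧    = ⟦_⟧ᶜ
    ; +-homo = λ (a , b) (c , d) → begin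
        ⟦ normalise (a ℕ.+ c , b ℕ.+ d) ⟧ᶜ
          ≈⟨ ⟦⟧-difference (normalise (a ℕ.+ c , b ℕ.+ d)) ⟩
        difference (normalise (a ℕ.+ c , b ℕ.+ d))
          ≈⟨ normalise-sound (a ℕ.+ c , b ℕ.+ d) ⟩
        (a ℕ.+ c) · 1# + - ((b ℕ.+ d) · 1#)
          ≈⟨ +-cong (×-homo-+ 1# a c) (-‿cong (×-homo-+ 1# b d)) ⟩
        (a · 1# + c · 1#) + - (b · 1# + d · 1#)
          ≈⟨ +-congˡ (-‿+-comm _ _) ⟨
        (a · 1# + c · 1#) + (- (b · 1#) + - (d · 1#))
          ≈⟨ medial _ _ _ _ ⟩
        difference (a , b) + difference (c , d)
          ≈⟨ +-cong (⟦⟧-difference (a , b)) (⟦⟧-difference (c , d)) ⟨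
        ⟦ a , b ⟧ᶜ + ⟦ c , d ⟧ᶜ ∎
    ; *-homo = λ (a , b) (c , d) → let A = a · 1# ; B = b · 1# ; C = c · 1# ; D = d · 1# in begin
        ⟦ normalise (a ℕ.* c ℕ.+ b ℕ.* d , a ℕ.* d ℕ.+ b ℕ.* c) ⟧ᶜ
          ≈⟨ ⟦⟧-difference (normalise (a ℕ.* c ℕ.+ b ℕ.* d , a ℕ.* d ℕ.+ b ℕ.* c)) ⟩
        difference (normalise (a ℕ.* c ℕ.+ b ℕ.* d , a ℕ.* d ℕ.+ b ℕ.* c))
          ≈⟨ normalise-sound (a ℕ.* c ℕ.+ b ℕ.* d , a ℕ.* d ℕ.+ b ℕ.* c) ⟩
        (a ℕ.* c ℕ.+ b ℕ.* d) · 1# + - ((a ℕ.* d ℕ.+ b ℕ.* c) · 1#)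
          ≈⟨ +-cong (trans (×-homo-+ 1# (a ℕ.* c) (b ℕ.* d))
            (+-cong (×1-homo-* a c) (×1-homo-* b d)))
                    (-‿cong (trans (×-homo-+ 1# (a ℕ.* d) (b ℕ.* c))
                      (+-cong (×1-homo-* a d) (×1-homo-* b c)))) ⟩
        (A * C + B * D) + - (A * D + B * C)
          ≈⟨ +-congˡ (-‿+-comm _ _) ⟨
        (A * C + B * D) + (- (A * D) + - (B * C))
          ≈⟨ medial _ _ _ _ ⟩
        (A * C + - (A * D)) + (B * D + - (B * C))
          ≈⟨ +-congˡ (trans (+-comm _ _) (+-congˡ (trans (sym (-‿involutive _))
               (-‿cong (-‿distribʳ-* B D))))) ⟩
        (A * C + - (A * D)) + (- (B * C) + - (B * - D))
          ≈⟨ +-cong (+-congˡ (-‿distribʳ-* A D))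
            (+-cong (-‿distribˡ-* B C) (-‿distribˡ-* B (- D))) ⟩
        (A * C + A * - D) + (- B * C + - B * - D)
          ≈⟨ +-cong (distribˡ A C (- D)) (distribˡ (- B) C (- D)) ⟨
        A * (C + - D) + - B * (C + - D)
          ≈⟨ distribʳ (C + - D) A (- B) ⟨
        difference (a , b) * difference (c , d)
          ≈⟨ *-cong (⟦⟧-difference (a , b)) (⟦⟧-difference (c , d)) ⟨
        ⟦ a , b ⟧ᶜ * ⟦ c , d ⟧ᶜ ∎
    ; -‿homo = λ (a , b) → trans (⟦⟧-difference (b , a)) (trans (trans (+-comm _ _)
        (trans (+-congˡ (sym (-‿involutive _))) (-‿+-comm _ _)))
          (-‿cong (sym (⟦⟧-difference (a , b)))))
    ; 0-homo = refl
    ; 1-homo = refl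
    }

  x-0≈x : ∀ x → x - 0# ≈ x
  x-0≈x x = trans (+-congˡ -0#≈0#) (+-identityʳ x)

  _coeff≟_ : WeaklyDecidable (λ c d → ⟦ c ⟧ᶜ ≈ ⟦ d ⟧ᶜ)
  (a , b) coeff≟ (c , d) with a ℕₚ.≟ c | b ℕₚ.≟ d
  ... | yes ≡.refl | yes ≡.refl = just refl
  ... | _          | _          = nothing

  open RingSolver rawCoeff (fromCommutativeRing R) morphism _coeff≟_ public
    using (Polynomial; solve; con; _:+_; _:*_; _:-_; :-_; _:=_)

  :0 :1 : ∀ {n} → Polynomial n
  :0 = con (0 , 0)
  :1 = con (1 , 0)

-- Field arithmetic and polynomial functions of one variable

module Field (𝒞 : ComplexNumbers) where
  open ComplexNumbers 𝒞 hiding (zero) public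
  open IntegerCoefficients commutativeRing using (solve; :0; :1; _:+_; _:*_; _:-_; :-_; _:=_; x-0≈x)
    public
  open SetoidReasoning setoid public
  private
    module ℝ = RealNumbers ℝ
    module ι = IsRingHomomorphism ι-isHomomorphism

  Unit : Carrier → Set
  Unit x = ∃ λ y → x * y ≈ 1#

  #⇒Unit : ∀ {x} → x # 0# → Unit x
  #⇒Unit {x} x#0 = let (y , yx , xy) = #⇒invertible x#0 in
    y , trans (*-congʳ (sym (x-0≈x x))) xy

  stable : ∀ {x y} → ¬¬ (x ≈ y) → x ≈ y
  stable {x} {y} ¬¬e = proj₁ (tight x y) λ x#y → ¬¬e λ e → proj₂ (tight x y) e x#y

  ≈0? : ∀ x → ¬¬ (x ≈ 0# ⊎ Unit x)
  ≈0? x k = k (inj₁ (proj₁ (tight x 0#) λ x#0 → k (inj₂ (#⇒Unit x#0))))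

  ≉0⇒Unit : ∀ {x} → ¬ x ≈ 0# → ¬¬ Unit x
  ≉0⇒Unit {x} x≉0 = ≈0? x >>= λ { (inj₁ x≈0) → contradiction x≈0 x≉0 ; (inj₂ u) → pure u }

  Unit-cong : ∀ {x y} → x ≈ y → Unit x → Unit y
  Unit-cong x≈y (z , xz) = z , trans (*-congʳ (sym x≈y)) xz

  Unit-1 : Unit 1#
  Unit-1 = 1# , *-identityˡ 1#

  Unit-* : ∀ {x y} → Unit x → Unit y → Unit (x * y)
  Unit-* {x} {y} (x′ , xx′) (y′ , yy′) = x′ * y′ , (begin
    (x * y) * (x′ * y′) ≈⟨ solve 4 (λ a b c d → (a :* b) :* (c :* d) := (a :* c) :* (b :* d)) refl x
      y x′ y′ ⟩
    (x * x′) * (y * y′) ≈⟨ *-cong xx′ yy′ ⟩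
    1# * 1#             ≈⟨ *-identityˡ 1# ⟩
    1#                  ∎)

  Unit-inverse : ∀ {x} ((y , _) : Unit x) → Unit y
  Unit-inverse {x} (y , xy) = x , trans (*-comm y x) xy

  Unit-*⁻ʳ : ∀ {x y} → Unit (x * y) → Unit y
  Unit-*⁻ʳ {x} {y} (z , e) = x * z , trans
    (solve 3 (λ x y z → y :* (x :* z) := (x :* y) :* z) refl x y z) e

  Unit-*⁻ˡ : ∀ {x y} → Unit (x * y) → Unit x
  Unit-*⁻ˡ {x} {y} u = Unit-*⁻ʳ (Unit-cong (*-comm x y) u)

  Unit-cancel : ∀ {x y} → Unit x → x * y ≈ 0# → y ≈ 0#
  Unit-cancel {x} {y} (z , xz) e = begin
    y           ≈⟨ *-identityˡ y ⟨
    1# * y      ≈⟨ *-congʳ xz ⟨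
    (x * z) * y ≈⟨ solve 3 (λ x y z → (x :* z) :* y := z :* (x :* y)) refl x y z ⟩
    z * (x * y) ≈⟨ *-congˡ e ⟩
    z * 0#      ≈⟨ zeroʳ z ⟩
    0#          ∎

  x-y≈0⇒x≈y : ∀ {x y} → x - y ≈ 0# → x ≈ y
  x-y≈0⇒x≈y {x} {y} e = begin
    x         ≈⟨ solve 2 (λ x y → x := (x :- y) :+ y) refl x y ⟩
    x - y + y ≈⟨ +-congʳ e ⟩
    0# + y    ≈⟨ +-identityˡ y ⟩
    y         ∎

  x≈y⇒x-y≈0 : ∀ {x y} → x ≈ y → x - y ≈ 0#
  x≈y⇒x-y≈0 {x} {y} e = trans (+-congʳ e) (-‿inverseʳ y)

  Unit-cancelˡ : ∀ {x y z} → Unit x → x * y ≈ x * z → y ≈ z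
  Unit-cancelˡ {x} {y} {z} u e = x-y≈0⇒x≈y (Unit-cancel u (trans
    (solve 3 (λ x y z → x :* (y :- z) := x :* y :- x :* z) refl x y z) (x≈y⇒x-y≈0 e)))

  1≉0 : ¬ 1# ≈ 0#
  1≉0 1≈0 = proj₂ (tight 1# 0#) 1≈0 (invertible⇒#
    (1# , trans (*-identityˡ _) (x-0≈x 1#) , trans (*-identityʳ _) (x-0≈x 1#)))

  Unit⇒≉0 : ∀ {x} → Unit x → ¬ x ≈ 0#
  Unit⇒≉0 (y , xy) x≈0 = 1≉0 (trans (sym xy) (trans (*-congʳ x≈0) (zeroˡ y)))

  *-≉0 : ∀ {x y} → ¬ x ≈ 0# → ¬ y ≈ 0# → ¬ x * y ≈ 0#
  *-≉0 x≉0 y≉0 e = ≉0⇒Unit x≉0 λ u → y≉0 (Unit-cancel u e)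

  x*0≈0 : ∀ {x y} → y ≈ 0# → x * y ≈ 0#
  x*0≈0 {x} e = trans (*-congˡ e) (zeroʳ x)

  0*x≈0 : ∀ {x y} → y ≈ 0# → y * x ≈ 0#
  0*x≈0 {x} e = trans (*-congʳ e) (zeroˡ x)

  nat : ℕ → Carrier
  nat zero    = 0#
  nat (suc k) = 1# + nat k

  private
    module ℝₛ = IntegerCoefficients ℝ.commutativeRing
    module < = IsStrictPartialOrder ℝ.isStrictPartialOrder

    -- Invertibility makes 1 apart from 0, so one of them is the smaller. If 1 < 0, then -1 is
    -- positive, and so is its square, which is 1.
    ℝ-0<1 : ℝ.0# ℝ.< ℝ.1#
    ℝ-0<1 with Equivalence.to (ℝ.#⇔≶ ℝ.1# ℝ.0#) (ℝ.invertible⇒#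
                 (ℝ.1# , ℝ.trans (ℝ.*-identityˡ _) (ℝₛ.x-0≈x _) , ℝ.trans (ℝ.*-identityʳ _)
                   (ℝₛ.x-0≈x _)))
    ... | inj₂ 0<1 = 0<1
    ... | inj₁ 1<0 = <.<-respʳ-≈ [-1]²≈1 (ℝ.*-pos 0<-1 0<-1)
      where
      0<-1 : ℝ.0# ℝ.< ℝ.- ℝ.1#
      0<-1 = <.<-respˡ-≈ (ℝ.-‿inverseʳ ℝ.1#)
        (<.<-respʳ-≈ (ℝ.+-identityˡ _) (ℝ.+-mono-< (ℝ.- ℝ.1#) 1<0))

      [-1]²≈1 : ℝ.- ℝ.1# ℝ.* ℝ.- ℝ.1# ℝ.≈ ℝ.1#
      [-1]²≈1 = ℝ.trans (ℝₛ.solve 1 (λ x → ℝₛ.:- x ℝₛ.:* ℝₛ.:- x ℝₛ.:= x ℝₛ.:* x) ℝ.refl ℝ.1#)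
        (ℝ.*-identityˡ _)

    ℝnat : ℕ → ℝ.Carrier
    ℝnat zero    = ℝ.0#
    ℝnat (suc k) = ℝ.1# ℝ.+ ℝnat k

    ℝnat-pos : ∀ k → ℝ.0# ℝ.< ℝnat (suc k)
    ℝnat-pos zero    = <.<-respʳ-≈ (ℝ.sym (ℝ.+-identityʳ _)) ℝ-0<1
    ℝnat-pos (suc k) = <.trans ℝ-0<1 (<.<-respˡ-≈ (ℝ.+-identityˡ _)
      (<.<-respʳ-≈ (ℝ.+-comm _ _) (ℝ.+-mono-< ℝ.1# (ℝnat-pos k))))

    ι-nat : ∀ k → ι (ℝnat k) ≈ nat k
    ι-nat zero    = ι.0#-homo
    ι-nat (suc k) = trans (ι.+-homo _ _) (+-cong ι.1#-homo (ι-nat k))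

  -- Characteristic zero comes from the order of ℝ: the positive real is invertible there, and `ι`
  -- carries its inverse over.
  Unit-nat : ∀ k → Unit (nat (suc k))
  Unit-nat k =
    let (y , _ , xy) = ℝ.#⇒invertible (Equivalence.from (ℝ.#⇔≶ _ _) (inj₂ (ℝnat-pos k)))
    in ι y , (begin
      nat (suc k) * ι y                    ≈⟨ *-congʳ (ι-nat (suc k)) ⟨
      ι (ℝnat (suc k)) * ι y               ≈⟨ ι.*-homo _ _ ⟨
      ι (ℝnat (suc k) ℝ.* y)               ≈⟨ ι.⟦⟧-cong (ℝ.*-congʳ (ℝₛ.x-0≈x _)) ⟨
      ι ((ℝnat (suc k) ℝ.- ℝ.0#) ℝ.* y)    ≈⟨ ι.⟦⟧-cong xy ⟩
      ι ℝ.1#                               ≈⟨ ι.1#-homo ⟩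
      1#                                   ∎)

  nat-injective : ∀ j k → nat j ≈ nat k → j ≡ k
  nat-injective zero    zero    e = ≡.refl
  nat-injective zero    (suc k) e = contradiction (sym e) (Unit⇒≉0 (Unit-nat k))
  nat-injective (suc j) zero    e = contradiction e (Unit⇒≉0 (Unit-nat j))
  nat-injective (suc j) (suc k) e = ≡.cong suc (nat-injective j k (x-y≈0⇒x≈y (trans
    (solve 3 (λ x y z → x :- y := (z :+ x) :- (z :+ y)) refl _ _ 1#) (x≈y⇒x-y≈0 e))))

  -- The matrix constructions below are shown to be polynomial once, for any such class, and then
  -- used for functions of a curve parameter, for regular functions on GLₙ and for polynomials on
  -- all matrices.
  record PolynomialClass (X : Set) : Set₁ where
    field
      𝒫     : (X → Carrier) → Set
      resp  : ∀ {f g} → (∀ x → f x ≈ g x) → 𝒫 f → 𝒫 g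
      const : ∀ c → 𝒫 (λ _ → c)
      _:⊕_  : ∀ {f g} → 𝒫 f → 𝒫 g → 𝒫 (λ x → f x + g x)
      _:⊗_  : ∀ {f g} → 𝒫 f → 𝒫 g → 𝒫 (λ x → f x * g x)

    neg : ∀ {f} → 𝒫 f → 𝒫 (λ x → - f x)
    neg {f} p = resp (λ x → trans (solve 2 (λ o x → :- o :* x := :- (o :* x)) refl 1# (f x))
      (-‿cong (*-identityˡ _)))
                     (const (- 1#) :⊗ p)

    _:⊖_ : ∀ {f g} → 𝒫 f → 𝒫 g → 𝒫 (λ x → f x - g x)
    p :⊖ q = p :⊕ neg q

    :sum : ∀ {n} {f : X → Fin n → Carrier} → (∀ i → 𝒫 (λ x → f x i)) → 𝒫 (λ x → sum (f x))
    :sum {zero}  h = const 0#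
    :sum {suc n} h = h zero :⊕ :sum (h ∘ suc)

  -- Polynomial functions of degree less than N, by iterated exact division of
  -- f t - f z by t - z.
  Deg : ℕ → (Carrier → Carrier) → Set
  Deg zero    f = ∀ t → f t ≈ 0#
  Deg (suc N) f = ∀ z → ∃ λ q → Deg N q × (∀ t → f t ≈ f z + (t - z) * q t)

  Deg-resp : ∀ N {f g} → (∀ t → f t ≈ g t) → Deg N f → Deg N g
  Deg-resp zero    e d t = trans (sym (e t)) (d t)
  Deg-resp (suc N) e d z = let (q , dq , h) = d z in
    q , dq , λ t → trans (sym (e t)) (trans (h t) (+-congʳ (e z)))

  Deg-suc : ∀ N {f} → Deg N f → Deg (suc N) f
  Deg-suc zero    {f} d z = (λ _ → 0#) , (λ _ → refl) , λ t →
    trans (d t) (sym (trans (+-cong (d z) (zeroʳ _)) (+-identityʳ _)))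
  Deg-suc (suc N) d z = let (q , dq , h) = d z in q , Deg-suc N dq , h

  Deg-weaken : ∀ {N} M {f} → Deg N f → Deg (M ℕ.+ N) f
  Deg-weaken zero    d = d
  Deg-weaken (suc M) d = Deg-suc _ (Deg-weaken M d)

  Deg-+ : ∀ N {f g} → Deg N f → Deg N g → Deg N (λ t → f t + g t)
  Deg-+ zero    d e t = trans (+-cong (d t) (e t)) (+-identityʳ _)
  Deg-+ (suc N) {f} {g} d e z = let (q , dq , h) = d z ; (r , dr , k) = e z in
    (λ t → q t + r t) , Deg-+ N dq dr , λ t → trans (+-cong (h t) (k t))
      (solve 5 (λ a b c q r → (a :+ c :* q) :+ (b :+ c :* r) := (a :+ b) :+ c :* (q :+ r)) refl
        (f z) (g z) (t - z) (q t) (r t))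

  Deg-scale : ∀ N c {f} → Deg N f → Deg N (λ t → c * f t)
  Deg-scale zero    c d t = trans (*-congˡ (d t)) (zeroʳ c)
  Deg-scale (suc N) c {f} d z = let (q , dq , h) = d z in
    (λ t → c * q t) , Deg-scale N c dq , λ t → trans (*-congˡ (h t))
      (solve 4 (λ c a b q → c :* (a :+ b :* q) := c :* a :+ b :* (c :* q)) refl c (f z) (t - z)
        (q t))

  Deg-* : ∀ N M {f g} → Deg N f → Deg M g → Deg (N ℕ.+ M) (λ t → f t * g t)
  Deg-* zero    M d e = Deg-resp M (λ t → sym (0*x≈0 (d t)))
    (≡.subst (λ k → Deg k (λ _ → 0#)) (ℕₚ.+-identityʳ M) (Deg-weaken M (λ _ → refl)))
  -- f g - f(z) g(z) = (t - z) (q g + f(z) r). Raising the bound of g by `Deg-suc` provides the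
  -- quotient r even for M = 0, and r then has bound M.
  Deg-* (suc N) M {f} {g} d e z = let (q , dq , h) = d z ; (r , dr , k) = Deg-suc M e z in
    (λ t → q t * g t + f z * r t) ,
    Deg-+ (N ℕ.+ M) (Deg-* N M dq e) (Deg-weaken N (Deg-scale M (f z) dr)) ,
    λ t → begin
      f t * g t                             ≈⟨ *-congʳ (h t) ⟩
      (f z + (t - z) * q t) * g t
        ≈⟨ solve 4 (λ a b q g → (a :+ b :* q) :* g := a :* g :+ b :* (q :* g)) refl (f z) (t - z)
          (q t) (g t) ⟩
      f z * g t + (t - z) * (q t * g t)     ≈⟨ +-congʳ (*-congˡ (k t)) ⟩
      f z * (g z + (t - z) * r t) + (t - z) * (q t * g t)
        ≈⟨ solve 5 (λ a g b r p → a :* (g :+ b :* r) :+ b :* p := a :* g :+ b :* (p :+ a :* r)) refl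
             (f z) (g z) (t - z) (r t) (q t * g t) ⟩
      f z * g z + (t - z) * (q t * g t + f z * r t) ∎

  Curve : PolynomialClass Carrier
  Curve = record
    { 𝒫     = λ f → ∃ λ N → Deg N f
    ; resp  = λ e (N , d) → N , Deg-resp N e d
    ; const = λ c → 1 , λ z → (λ _ → 0#) , (λ _ → refl) , λ t → sym
      (trans (+-congˡ (zeroʳ _)) (+-identityʳ c))
    ; _:⊕_  = λ {f} {g} (N , d) (M , e) → M ℕ.+ N , Deg-+ (M ℕ.+ N) (Deg-weaken M d)
                (≡.subst (λ k → Deg k g) (ℕₚ.+-comm N M) (Deg-weaken N e))
    ; _:⊗_  = λ (N , d) (M , e) → N ℕ.+ M , Deg-* N M d e
    }

  module Curve = PolynomialClass Curve

  Curve-id : Curve.𝒫 (λ t → t)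
  Curve-id = 2 , λ z → (λ _ → 1#) ,
    (λ y → (λ _ → 0#) , (λ _ → refl) , λ t → sym (trans (+-congˡ (zeroʳ _)) (+-identityʳ 1#))) ,
    λ t → sym (trans (+-congˡ (*-identityʳ _)) (solve 2 (λ z t → z :+ (t :- z) := t) refl z t))

  -- Either no natural number is a root, or division at a root k₀ lowers the degree bound, and
  -- beyond k₀ the factor t - k₀ does not vanish.
  Deg-eventually≉0 : ∀ N {f} → Deg N f → ¬ (∀ t → f t ≈ 0#) → Ev (λ k → ¬ f (nat k) ≈ 0#)
  Deg-eventually≉0 zero    d f≢0 = contradiction d f≢0
  Deg-eventually≉0 (suc N) {f} d f≢0 = em (∃ λ k → f (nat k) ≈ 0#) >>= λ
    { (inj₂ no-root)    → pure (0 , λ k _ e → no-root (k , e))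
    ; (inj₁ (k₀ , root)) → let (q , dq , h) = d (nat k₀) in
        let fq = λ t → trans (h t) (trans (+-congʳ root) (+-identityˡ _)) in
        Deg-eventually≉0 N dq (λ q≡0 → f≢0 λ t → trans (fq t) (x*0≈0 (q≡0 t))) >>= λ (M , hM) →
        pure (suc k₀ ⊔ M , λ k le e → *-≉0
          (λ e′ → ℕₚ.<⇒≢ (ℕₚ.≤-trans (ℕₚ.m≤m⊔n (suc k₀) M) le)
                    (≡.sym (nat-injective k k₀ (x-y≈0⇒x≈y e′))))
          (hM k (ℕₚ.≤-trans (ℕₚ.m≤n⊔m (suc k₀) M) le))
          (trans (sym (fq (nat k))) e))
    }

  Curve-eventually≉0 : ∀ {f} → Curve.𝒫 f → ∀ {t} → ¬ f t ≈ 0# → Ev (λ k → ¬ f (nat k) ≈ 0#)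
  Curve-eventually≉0 (N , d) {t} ft≉0 = Deg-eventually≉0 N d (λ f≡0 → ft≉0 (f≡0 t))

  -- Serves as the density argument: an equation that holds at the generic points of a line passes
  -- to every point of it.
  Curve-identity : ∀ {f} → Curve.𝒫 f → Ev (λ k → f (nat k) ≈ 0#) → ∀ t → f t ≈ 0#
  Curve-identity pf ev t = stable λ ft≉0 →
    Ev-∃ (Ev-∩ ev (Curve-eventually≉0 pf ft≉0)) λ (k , e , ne) → ne e

-- Dot products, rank-one perturbations and the fraction-free inverse

module Linear (𝒞 : ComplexNumbers) where
  open Field 𝒞
  open GeneralLinear 𝒞
  open Sum semiring using (sum-cong-≋; sum-replicate-zero; ∑-comm; ∑-distrib-+; *-distribˡ-sum;
    *-distribʳ-sum)

  sum-≈0 : ∀ {n} {f : Fin n → Carrier} → (∀ i → f i ≈ 0#) → sum f ≈ 0#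
  sum-≈0 {n} h = trans (sum-cong-≋ h) (sum-replicate-zero n)

  sum-only : ∀ {n} {f : Fin n → Carrier} i → (∀ k → k ≢ i → f k ≈ 0#) → sum f ≈ f i
  sum-only {suc n} zero    h = trans (+-congˡ (sum-≈0 (λ k → h (suc k) λ ()))) (+-identityʳ _)
  sum-only {suc n} (suc i) h = trans (+-cong
    (h zero λ ()) (sum-only i (λ k k≢i → h (suc k) λ { ≡.refl → k≢i ≡.refl })))
                                     (+-identityˡ _)

  sum-neg : ∀ {n} (f : Fin n → Carrier) → sum (λ k → - f k) ≈ - sum f
  sum-neg {zero}  f = sym (trans (sym (+-identityˡ _)) (-‿inverseʳ 0#))
  sum-neg {suc n} f = trans (+-congˡ (sum-neg (f ∘ suc)))
    (solve 2 (λ x y → :- x :+ :- y := :- (x :+ y)) refl (f zero) (sum (f ∘ suc)))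

  sum-sub : ∀ {n} (f g : Fin n → Carrier) → sum (λ k → f k - g k) ≈ sum f - sum g
  sum-sub f g = trans (∑-distrib-+ f (λ k → - g k)) (+-congˡ (sum-neg g))

  Vector : ℕ → Set
  Vector n = Fin n → Carrier

  infix 4 _≈ᵥ_
  _≈ᵥ_ : ∀ {n} → Vector n → Vector n → Set
  u ≈ᵥ v = ∀ i → u i ≈ v i

  0ᵥ : ∀ {n} → Vector n
  0ᵥ _ = 0#

  infix 7 _∙_ _*ᵥ_ _ᵥ*_
  _∙_ : ∀ {n} → Vector n → Vector n → Carrier
  u ∙ v = sum (λ k → u k * v k)

  _*ᵥ_ : ∀ {n} → Matrix n → Vector n → Vector n
  (M *ᵥ v) i = M i ∙ v

  _ᵥ*_ : ∀ {n} → Vector n → Matrix n → Vector n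
  (u ᵥ* M) j = u ∙ (λ k → M k j)

  ∙-cong : ∀ {n} {u u′ v v′ : Vector n} → u ≈ᵥ u′ → v ≈ᵥ v′ → u ∙ v ≈ u′ ∙ v′
  ∙-cong e e′ = sum-cong-≋ (λ k → *-cong (e k) (e′ k))

  ∙-comm : ∀ {n} (u v : Vector n) → u ∙ v ≈ v ∙ u
  ∙-comm u v = sum-cong-≋ (λ k → *-comm (u k) (v k))

  ∙-scaleˡ : ∀ {n} c (u v : Vector n) → (λ k → c * u k) ∙ v ≈ c * (u ∙ v)
  ∙-scaleˡ c u v = trans (sum-cong-≋ (λ k → *-assoc c (u k) (v k)))
    (sym (*-distribˡ-sum c (λ k → u k * v k)))

  ∙-scaleʳ : ∀ {n} c (u v : Vector n) → u ∙ (λ k → c * v k) ≈ c * (u ∙ v)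
  ∙-scaleʳ c u v = trans (∙-comm u _) (trans (∙-scaleˡ c v u) (*-congˡ (∙-comm v u)))

  ∙-scaleʳ′ : ∀ {n} c (u v : Vector n) → u ∙ (λ k → v k * c) ≈ (u ∙ v) * c
  ∙-scaleʳ′ c u v = trans (∙-cong (λ _ → refl) (λ k → *-comm (v k) c))
    (trans (∙-scaleʳ c u v) (*-comm c _))

  ∙-+ʳ : ∀ {n} (u v w : Vector n) → u ∙ (λ k → v k + w k) ≈ u ∙ v + u ∙ w
  ∙-+ʳ u v w = trans (sum-cong-≋ (λ k → distribˡ (u k) (v k) (w k)))
                     (∑-distrib-+ (λ k → u k * v k) (λ k → u k * w k))

  ∙-subʳ : ∀ {n} (u v w : Vector n) → u ∙ (λ k → v k - w k) ≈ u ∙ v - u ∙ w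
  ∙-subʳ u v w = trans (sum-cong-≋ (λ k → solve 3 (λ u v w → u :* (v :- w) := u :* v :- u :* w) refl
    (u k) (v k) (w k)))
                       (sum-sub (λ k → u k * v k) (λ k → u k * w k))

  ∙-0ʳ : ∀ {n} (u : Vector n) {v : Vector n} → v ≈ᵥ 0ᵥ → u ∙ v ≈ 0#
  ∙-0ʳ u e = sum-≈0 (λ k → x*0≈0 (e k))

  ∙-0ˡ : ∀ {n} {u : Vector n} (v : Vector n) → u ≈ᵥ 0ᵥ → u ∙ v ≈ 0#
  ∙-0ˡ v e = sum-≈0 (λ k → 0*x≈0 (e k))

  ∙-assoc : ∀ {n} (u : Vector n) (M : Matrix n) (v : Vector n) → (u ᵥ* M) ∙ v ≈ u ∙ (M *ᵥ v)
  ∙-assoc u M v = begin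
    sum (λ k → sum (λ l → u l * M l k) * v k)   ≈⟨ sum-cong-≋
      (λ k → *-distribʳ-sum (v k) (λ l → u l * M l k)) ⟩
    sum (λ k → sum (λ l → (u l * M l k) * v k)) ≈⟨ ∑-comm (λ k l → (u l * M l k) * v k) ⟩
    sum (λ l → sum (λ k → (u l * M l k) * v k)) ≈⟨ sum-cong-≋
      (λ l → sum-cong-≋ (λ k → *-assoc (u l) (M l k) (v k))) ⟩
    sum (λ l → sum (λ k → u l * (M l k * v k))) ≈⟨ sum-cong-≋
      (λ l → *-distribˡ-sum (u l) (λ k → M l k * v k)) ⟨
    sum (λ l → u l * sum (λ k → M l k * v k))   ∎

  *ᵥ-assoc : ∀ {n} (M N : Matrix n) (v : Vector n) → (M *ₘ N) *ᵥ v ≈ᵥ M *ᵥ (N *ᵥ v)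
  *ᵥ-assoc M N v i = ∙-assoc (M i) N v

  ∙-1ₘ : ∀ {n} (u : Vector n) i → u ∙ (λ k → 1ₘ k i) ≈ u i
  ∙-1ₘ u i = sum-δ u (λ k → 1ₘ k i) i (permMatrix-1 Perm.id {i} {i} ≡.refl)
    (λ _ → permMatrix-0 Perm.id)

  1ₘ-diag : ∀ {n} (i : Fin n) → 1ₘ i i ≈ 1#
  1ₘ-diag i = permMatrix-1 Perm.id {i} {i} ≡.refl

  1ₘ-off : ∀ {n} (i j : Fin n) → i ≢ j → 1ₘ i j ≈ 0#
  1ₘ-off i j = permMatrix-0 Perm.id {i} {j}

  1ₘ-suc : ∀ {n} (i j : Fin n) → 1ₘ (suc i) (suc j) ≈ 1ₘ i j
  1ₘ-suc i j with i ≟ j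
  ... | yes ≡.refl = refl
  ... | no  _      = refl

  1ₘ-sym : ∀ {n} (i j : Fin n) → 1ₘ i j ≈ 1ₘ j i
  1ₘ-sym i j with i ≟ j
  ... | yes ≡.refl = sym (1ₘ-diag i)
  ... | no  i≢j    = sym (1ₘ-off j i (i≢j ∘ ≡.sym))

  1ₘ-∙ : ∀ {n} (v : Vector n) i → 1ₘ i ∙ v ≈ v i
  1ₘ-∙ v i = trans (∙-comm (1ₘ i) v) (trans (∙-cong {u = v} (λ _ → refl) (1ₘ-sym i)) (∙-1ₘ v i))

  rank-one : ∀ {n} → Vector n → Vector n → Matrix n
  rank-one a φ i j = 1ₘ i j + a i * φ j

  -- The product is 1 + (a + b + a φ(b)) φ, so the hypothesis removes the correction term.
  rank-one-* : ∀ {n} (a b φ : Vector n) → (∀ i → a i + b i + a i * (φ ∙ b) ≈ 0#) → rank-one a φ *ₘ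
    rank-one b φ ≈ₘ 1ₘ
  rank-one-* a b φ h i j = begin
    sum (λ k → (1ₘ i k + a i * φ k) * (1ₘ k j + b k * φ j))
      ≈⟨ ∙-+ʳ (rank-one a φ i) (λ k → 1ₘ k j) (λ k → b k * φ j) ⟩
    rank-one a φ i ∙ (λ k → 1ₘ k j) + rank-one a φ i ∙ (λ k → b k * φ j)
      ≈⟨ +-cong (∙-1ₘ (rank-one a φ i) j)
        (trans (∙-scaleʳ′ (φ j) (rank-one a φ i) b) (*-congʳ (trans (∙-comm (rank-one a φ i) b)
         (trans (∙-+ʳ b (1ₘ i) (λ k → a i * φ k))
           (+-cong (trans (∙-comm b (1ₘ i)) (1ₘ-∙ b i))
             (trans (∙-scaleʳ (a i) b φ) (*-congˡ (∙-comm b φ)))))))) ⟩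
    (1ₘ i j + a i * φ j) + (b i + a i * (φ ∙ b)) * φ j
      ≈⟨ solve 5 (λ o a p b f → (o :+ a :* p) :+ (b :+ a :* f) :* p := o :+ (a :+ b :+ a :* f) :* p)
        refl (1ₘ i j) (a i) (φ j) (b i) (φ ∙ b) ⟩
    1ₘ i j + (a i + b i + a i * (φ ∙ b)) * φ j ≈⟨ +-congˡ (0*x≈0 (h i)) ⟩
    1ₘ i j + 0# ≈⟨ +-identityʳ _ ⟩
    1ₘ i j ∎

  -- A fraction-free inverse, by recursion on Schur complements: it is defined
  -- where the leading principal minors do not vanish, in particular near 1ₘ.
  schur : ∀ {n} → Matrix (suc n) → Matrix n
  schur x i j = x zero zero * x (suc i) (suc j) - x (suc i) zero * x zero (suc j)

  -- A monomial in the leading principal minors rather than the determinant: each step of `schur`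
  -- carries the corner entry along as a factor.
  den : ∀ {n} → Matrix n → Carrier
  den {zero}  x = 1#
  den {suc n} x = x zero zero * den (schur x)

  -- Blockwise inversion of the matrix with corner a, row b, column c and block D through S = a D -
  -- c b, multiplied by a · `den S`: the corner (1 + b S⁻¹ c) / a becomes `den S` + b (`adj S`) c,
  -- and the block a S⁻¹ becomes a² `adj S`.
  adj : ∀ {n} → Matrix n → Matrix n
  adj {suc n} x zero    zero    = den (schur x) + ((λ k → x zero (suc k)) ᵥ* adj (schur x)) ∙
    (λ k → x (suc k) zero)
  adj {suc n} x zero    (suc j) = - (x zero zero * ((λ k → x zero (suc k)) ᵥ* adj (schur x)) j)
  adj {suc n} x (suc i) zero    = - (x zero zero * (adj (schur x) *ᵥ (λ k → x (suc k) zero)) i)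
  adj {suc n} x (suc i) (suc j) = x zero zero * (x zero zero * adj (schur x) i j)

  module _ {n} (x : Matrix (suc n)) where
    private
      a d : Carrier
      a = x zero zero
      d = den (schur x)
      A D S : Matrix n
      A = adj (schur x)
      D i j = x (suc i) (suc j)
      S = schur x
      b c : Vector n
      b k = x zero (suc k)
      c k = x (suc k) zero

    ∙-schur : ∀ (u : Vector n) j → a * (u ∙ (λ k → D k j)) ≈ u ∙ (λ k → S k j) + (u ∙ c) * b j
    ∙-schur u j = begin
      a * (u ∙ (λ k → D k j))                       ≈⟨ ∙-scaleʳ a u (λ k → D k j) ⟨
      u ∙ (λ k → a * D k j)                         ≈⟨ ∙-cong {u = u} (λ _ → refl) (λ k →
        solve 2 (λ p q → p := (p :- q) :+ q) refl (a * D k j) (c k * b j)) ⟩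
      u ∙ (λ k → S k j + c k * b j)                 ≈⟨ ∙-+ʳ u (λ k → S k j) (λ k → c k * b j) ⟩
      u ∙ (λ k → S k j) + u ∙ (λ k → c k * b j)     ≈⟨ +-congˡ (∙-scaleʳ′ (b j) u c) ⟩
      u ∙ (λ k → S k j) + (u ∙ c) * b j             ∎

    schur-∙ : ∀ i (v : Vector n) → a * (D i ∙ v) ≈ S i ∙ v + c i * (b ∙ v)
    schur-∙ i v = begin
      a * (D i ∙ v)                                 ≈⟨ ∙-scaleˡ a (D i) v ⟨
      (λ k → a * D i k) ∙ v                         ≈⟨ ∙-cong {v = v} (λ k →
        solve 2 (λ p q → p := (p :- q) :+ q) refl (a * D i k) (c i * b k)) (λ _ → refl) ⟩
      (λ k → S i k + c i * b k) ∙ v                 ≈⟨ ∙-comm (λ k → S i k + c i * b k) v ⟩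
      v ∙ (λ k → S i k + c i * b k)                 ≈⟨ ∙-+ʳ v (S i) (λ k → c i * b k) ⟩
      v ∙ S i + v ∙ (λ k → c i * b k)               ≈⟨ +-cong (∙-comm v (S i))
        (trans (∙-scaleʳ (c i) v b) (*-congˡ (∙-comm v b))) ⟩
      S i ∙ v + c i * (b ∙ v)                       ∎

    adj-inverseˡ-step : (∀ i j → (A *ₘ S) i j ≈ d * 1ₘ i j) →
                        ∀ i j → (adj x *ₘ x) i j ≈ (a * d) * 1ₘ i j
    adj-inverseˡ-step ih zero zero = begin
      (d + (b ᵥ* A) ∙ c) * a + (λ k → - (a * (b ᵥ* A) k)) ∙ c
        ≈⟨ +-congˡ (trans (∙-cong {v = c}
          (λ k → solve 2 (λ a y → :- (a :* y) := (:- a) :* y) refl a ((b ᵥ* A) k)) (λ _ → refl))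
                          (∙-scaleˡ (- a) (b ᵥ* A) c)) ⟩
      (d + (b ᵥ* A) ∙ c) * a + (- a) * ((b ᵥ* A) ∙ c)
        ≈⟨ solve 3 (λ a d y → (d :+ y) :* a :+ (:- a) :* y := a :* d) refl a d ((b ᵥ* A) ∙ c) ⟩
      a * d ≈⟨ *-identityʳ _ ⟨
      (a * d) * 1# ∎
    adj-inverseˡ-step ih zero (suc j) = begin
      (d + (b ᵥ* A) ∙ c) * b j + (λ k → - (a * (b ᵥ* A) k)) ∙ (λ k → D k j)
        ≈⟨ +-congˡ (trans (∙-cong {v = λ k → D k j}
          (λ k → solve 2 (λ a y → :- (a :* y) := (:- a) :* y) refl a ((b ᵥ* A) k)) (λ _ → refl))
                          (∙-scaleˡ (- a) (b ᵥ* A) (λ k → D k j))) ⟩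
      (d + (b ᵥ* A) ∙ c) * b j + (- a) * ((b ᵥ* A) ∙ (λ k → D k j))
        ≈⟨ solve 5 (λ a d y b z → (d :+ y) :* b :+ (:- a) :* z := (d :+ y) :* b :- a :* z) refl a d
          ((b ᵥ* A) ∙ c) (b j) ((b ᵥ* A) ∙ (λ k → D k j)) ⟩
      (d + (b ᵥ* A) ∙ c) * b j - a * ((b ᵥ* A) ∙ (λ k → D k j))
        ≈⟨ +-congˡ (-‿cong (∙-schur (b ᵥ* A) j)) ⟩
      (d + (b ᵥ* A) ∙ c) * b j - ((b ᵥ* A) ∙ (λ k → S k j) + ((b ᵥ* A) ∙ c) * b j)
        ≈⟨ +-congˡ (-‿cong (+-congʳ (trans (∙-assoc b A (λ k → S k j))
             (trans (∙-cong {u = b} (λ _ → refl) (λ l → ih l j))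
               (trans (∙-scaleʳ d b (λ k → 1ₘ k j)) (*-congˡ (∙-1ₘ b j))))))) ⟩
      (d + (b ᵥ* A) ∙ c) * b j - (d * b j + ((b ᵥ* A) ∙ c) * b j)
        ≈⟨ solve 3 (λ d y b → (d :+ y) :* b :- (d :* b :+ y :* b) := :0) refl d ((b ᵥ* A) ∙ c)
          (b j) ⟩
      0# ≈⟨ zeroʳ _ ⟨
      (a * d) * 0# ∎
    adj-inverseˡ-step ih (suc i) zero = begin
      - (a * (A *ᵥ c) i) * a + (λ k → a * (a * A i k)) ∙ c
        ≈⟨ +-congˡ (trans (∙-scaleˡ a (λ k → a * A i k) c) (*-congˡ (∙-scaleˡ a (A i) c))) ⟩
      - (a * (A *ᵥ c) i) * a + a * (a * (A *ᵥ c) i)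
        ≈⟨ solve 2 (λ a y → :- (a :* y) :* a :+ a :* (a :* y) := :0) refl a ((A *ᵥ c) i) ⟩
      0# ≈⟨ zeroʳ _ ⟨
      (a * d) * 0# ∎
    adj-inverseˡ-step ih (suc i) (suc j) = begin
      - (a * (A *ᵥ c) i) * b j + (λ k → a * (a * A i k)) ∙ (λ k → D k j)
        ≈⟨ +-congˡ (trans (∙-scaleˡ a (λ k → a * A i k) (λ k → D k j))
          (*-congˡ (trans (∙-scaleˡ a (A i) (λ k → D k j)) (∙-schur (A i) j)))) ⟩
      - (a * (A *ᵥ c) i) * b j + a * ((A *ₘ S) i j + (A *ᵥ c) i * b j)
        ≈⟨ solve 4 (λ a y b z → :- (a :* y) :* b :+ a :* (z :+ y :* b) := a :* z) refl a
          ((A *ᵥ c) i) (b j) ((A *ₘ S) i j) ⟩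
      a * (A *ₘ S) i j   ≈⟨ *-congˡ (ih i j) ⟩
      a * (d * 1ₘ i j)   ≈⟨ *-assoc a d _ ⟨
      (a * d) * 1ₘ i j   ≈⟨ *-congˡ (1ₘ-suc i j) ⟨
      (a * d) * 1ₘ (suc i) (suc j) ∎

    adj-inverseʳ-step : (∀ i j → (S *ₘ A) i j ≈ d * 1ₘ i j) →
                        ∀ i j → (x *ₘ adj x) i j ≈ (a * d) * 1ₘ i j
    adj-inverseʳ-step ih zero zero = begin
      a * (d + (b ᵥ* A) ∙ c) + b ∙ (λ k → - (a * (A *ᵥ c) k))
        ≈⟨ +-congˡ (trans (∙-cong {u = b} (λ _ → refl)
          (λ k → solve 2 (λ a y → :- (a :* y) := (:- a) :* y) refl a ((A *ᵥ c) k)))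
                          (trans (∙-scaleʳ (- a) b (A *ᵥ c)) (*-congˡ (sym (∙-assoc b A c))))) ⟩
      a * (d + (b ᵥ* A) ∙ c) + (- a) * ((b ᵥ* A) ∙ c)
        ≈⟨ solve 3 (λ a d y → a :* (d :+ y) :+ (:- a) :* y := a :* d) refl a d ((b ᵥ* A) ∙ c) ⟩
      a * d ≈⟨ *-identityʳ _ ⟨
      (a * d) * 1# ∎
    adj-inverseʳ-step ih zero (suc j) = begin
      a * - (a * (b ᵥ* A) j) + b ∙ (λ k → a * (a * A k j))
        ≈⟨ +-congˡ (trans (∙-scaleʳ a b (λ k → a * A k j)) (*-congˡ (∙-scaleʳ a b (λ k → A k j)))) ⟩
      a * - (a * (b ᵥ* A) j) + a * (a * (b ᵥ* A) j)
        ≈⟨ solve 2 (λ a y → a :* :- (a :* y) :+ a :* (a :* y) := :0) refl a ((b ᵥ* A) j) ⟩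
      0# ≈⟨ zeroʳ _ ⟨
      (a * d) * 0# ∎
    adj-inverseʳ-step ih (suc i) zero = begin
      c i * (d + (b ᵥ* A) ∙ c) + D i ∙ (λ k → - (a * (A *ᵥ c) k))
        ≈⟨ +-congˡ (trans (∙-cong {u = D i} (λ _ → refl)
          (λ k → solve 2 (λ a y → :- (a :* y) := (:- a) :* y) refl a ((A *ᵥ c) k)))
                          (∙-scaleʳ (- a) (D i) (A *ᵥ c))) ⟩
      c i * (d + (b ᵥ* A) ∙ c) + (- a) * (D i ∙ (A *ᵥ c))
        ≈⟨ solve 5 (λ a d y c z → c :* (d :+ y) :+ (:- a) :* z := c :* (d :+ y) :- a :* z) refl a d
          ((b ᵥ* A) ∙ c) (c i) (D i ∙ (A *ᵥ c)) ⟩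
      c i * (d + (b ᵥ* A) ∙ c) - a * (D i ∙ (A *ᵥ c))
        ≈⟨ +-congˡ (-‿cong (schur-∙ i (A *ᵥ c))) ⟩
      c i * (d + (b ᵥ* A) ∙ c) - (S i ∙ (A *ᵥ c) + c i * (b ∙ (A *ᵥ c)))
        ≈⟨ +-congˡ (-‿cong (+-cong (trans (sym (∙-assoc (S i) A c))
          (trans (∙-cong {v = c} (ih i) (λ _ → refl))
             (trans (∙-scaleˡ d (1ₘ i) c) (*-congˡ (1ₘ-∙ c i)))))
               (*-congˡ (sym (∙-assoc b A c))))) ⟩
      c i * (d + (b ᵥ* A) ∙ c) - (d * c i + c i * ((b ᵥ* A) ∙ c))
        ≈⟨ solve 3 (λ d y c → c :* (d :+ y) :- (d :* c :+ c :* y) := :0) refl d ((b ᵥ* A) ∙ c)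
          (c i) ⟩
      0# ≈⟨ zeroʳ _ ⟨
      (a * d) * 0# ∎
    adj-inverseʳ-step ih (suc i) (suc j) = begin
      c i * - (a * (b ᵥ* A) j) + D i ∙ (λ k → a * (a * A k j))
        ≈⟨ +-congˡ (trans (∙-scaleʳ a (D i) (λ k → a * A k j))
          (*-congˡ (trans (∙-scaleʳ a (D i) (λ k → A k j)) (schur-∙ i (λ k → A k j))))) ⟩
      c i * - (a * (b ᵥ* A) j) + a * ((S *ₘ A) i j + c i * (b ᵥ* A) j)
        ≈⟨ solve 4 (λ a y c z → c :* :- (a :* y) :+ a :* (z :+ c :* y) := a :* z) refl a
          ((b ᵥ* A) j) (c i) ((S *ₘ A) i j) ⟩
      a * (S *ₘ A) i j   ≈⟨ *-congˡ (ih i j) ⟩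
      a * (d * 1ₘ i j)   ≈⟨ *-assoc a d _ ⟨
      (a * d) * 1ₘ i j   ≈⟨ *-congˡ (1ₘ-suc i j) ⟨
      (a * d) * 1ₘ (suc i) (suc j) ∎

  adj-inverseˡ : ∀ {n} (x : Matrix n) i j → (adj x *ₘ x) i j ≈ den x * 1ₘ i j
  adj-inverseˡ {suc n} x = adj-inverseˡ-step x (adj-inverseˡ (schur x))

  adj-inverseʳ : ∀ {n} (x : Matrix n) i j → (x *ₘ adj x) i j ≈ den x * 1ₘ i j
  adj-inverseʳ {suc n} x = adj-inverseʳ-step x (adj-inverseʳ (schur x))

-- Matrices with prescribed support, column reduction and block parts

module Support (𝒞 : ComplexNumbers) where
  open Field 𝒞
  open GeneralLinear 𝒞
  open Linear 𝒞
  open GL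
  open Sum semiring using (sum-cong-≋)

  module PolynomialMatrix {X : Set} (C : PolynomialClass X) where
    open PolynomialClass C

    :∙ : ∀ {n} {u v : X → Vector n} → (∀ i → 𝒫 (λ x → u x i)) → (∀ i → 𝒫 (λ x → v x i)) →
         𝒫 (λ x → u x ∙ v x)
    :∙ p q = :sum (λ k → p k :⊗ q k)

    𝒫ₘ : ∀ {n} → (X → Matrix n) → Set
    𝒫ₘ M = ∀ i j → 𝒫 (λ x → M x i j)

    :*ₘ : ∀ {n} {M N : X → Matrix n} → 𝒫ₘ M → 𝒫ₘ N → 𝒫ₘ (λ x → M x *ₘ N x)
    :*ₘ p q i j = :∙ (p i) (λ k → q k j)

    :schur : ∀ {n} {M : X → Matrix (suc n)} → 𝒫ₘ M → 𝒫ₘ (λ x → schur (M x))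
    :schur p i j = (p zero zero :⊗ p (suc i) (suc j)) :⊖ (p (suc i) zero :⊗ p zero (suc j))

    :den : ∀ {n} {M : X → Matrix n} → 𝒫ₘ M → 𝒫 (λ x → den (M x))
    :den {zero}  p = const 1#
    :den {suc n} p = p zero zero :⊗ :den (:schur p)

    :adj : ∀ {n} {M : X → Matrix n} → 𝒫ₘ M → 𝒫ₘ (λ x → adj (M x))
    :adj {suc n} p zero    zero    = :den (:schur p) :⊕
      :∙ (λ j → :∙ (λ k → p zero (suc k)) (λ k → :adj (:schur p) k j)) (λ k → p (suc k) zero)
    :adj {suc n} p zero    (suc j) = neg
      (p zero zero :⊗ :∙ (λ k → p zero (suc k)) (λ k → :adj (:schur p) k j))
    :adj {suc n} p (suc i) zero    = neg
      (p zero zero :⊗ :∙ (:adj (:schur p) i) (λ k → p (suc k) zero))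
    :adj {suc n} p (suc i) (suc j) = p zero zero :⊗ (p zero zero :⊗ :adj (:schur p) i j)

  *ₘ-cong₁ : ∀ {n} {L M : Matrix n} N → L ≈ₘ M → L *ₘ N ≈ₘ M *ₘ N
  *ₘ-cong₁ N e = *ₘ-cong {N = N} e (λ _ _ → refl)

  *ₘ-cong₂ : ∀ {n} (L : Matrix n) {M N} → M ≈ₘ N → L *ₘ M ≈ₘ L *ₘ N
  *ₘ-cong₂ L e = *ₘ-cong {M = L} (λ _ _ → refl) e

  *ₘ-cancelˡ : ∀ {n} (L M N : Matrix n) → L *ₘ M ≈ₘ 1ₘ → L *ₘ (M *ₘ N) ≈ₘ N
  *ₘ-cancelˡ L M N e i j =
    trans (sym (*ₘ-assoc L M N i j)) (trans (*ₘ-cong₁ N e i j) (*ₘ-identityˡ N i j))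

  *ₘ-inverse : ∀ {n} (A B C D : Matrix n) → B *ₘ C ≈ₘ 1ₘ → A *ₘ D ≈ₘ 1ₘ → (A *ₘ B) *ₘ (C *ₘ D) ≈ₘ 1ₘ
  *ₘ-inverse A B C D p q i j =
    trans (*ₘ-assoc A B (C *ₘ D) i j) (trans (*ₘ-cong₂ A (*ₘ-cancelˡ B C D p) i j) (q i j))

  Upper : ∀ {n} → Matrix n → Set
  Upper x = ∀ i j → j <ᶠ i → x i j ≈ 0#

  den-upper : ∀ {n} (x : Matrix n) → Upper x → (∀ i → Unit (x i i)) → Unit (den x)
  den-upper {zero}  x up u = Unit-1
  den-upper {suc n} x up u = Unit-* (u zero) (den-upper (schur x)
    (λ i j j<i → trans (+-cong (x*0≈0 (up _ _ (s≤s j<i)))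
      (-‿cong (0*x≈0 (up (suc i) zero (s≤s z≤n))))) (-‿inverseʳ 0#))
    (λ i → Unit-cong (sym (trans (+-congˡ (-‿cong (0*x≈0 (up (suc i) zero (s≤s z≤n))))) (x-0≈x _)))
                     (Unit-* (u zero) (u (suc i)))))

  toGL : ∀ {n} (x : Matrix n) → Unit (den x) → GL n
  toGL x (e , de) = record
    { matrix   = x
    ; inverse  = λ i j → e * adj x i j
    ; inverseˡ = λ i j → trans (∙-scaleˡ e (adj x i) (λ k → x k j))
        (trans (*-congˡ (adj-inverseˡ x i j)) (cancelled i j))
    ; inverseʳ = λ i j → trans (∙-scaleʳ e (x i) (λ k → adj x k j))
        (trans (*-congˡ (adj-inverseʳ x i j)) (cancelled i j))
    }
    where
    cancelled : ∀ i j → e * (den x * 1ₘ i j) ≈ 1ₘ i j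
    cancelled i j = trans (solve 3 (λ e d y → e :* (d :* y) := (d :* e) :* y) refl e (den x)
      (1ₘ i j))
                          (trans (*-congʳ de) (*-identityˡ _))

  upperGL : ∀ {n} (x : Matrix n) → Upper x → (∀ i → Unit (x i i)) → GL n
  upperGL x up u = toGL x (den-upper x up u)

  -- One notion for triangular, block diagonal and diagonal shapes: multiplication of shapes is
  -- composition of relations, and a transitive reflexive relation gives a shape closed under
  -- products.
  Supp : ∀ {n} → Rel (Fin n) 0ℓ → Matrix n → Set
  Supp R M = ∀ i j → ¬ R i j → M i j ≈ 0#

  Supp-⊆ : ∀ {n} {R S : Rel (Fin n) 0ℓ} {M} → (∀ {i j} → R i j → S i j) → Supp R M → Supp S M
  Supp-⊆ R⊆S s i j ¬Sij = s i j (¬Sij ∘ R⊆S)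

  Supp-≈ : ∀ {n} {R : Rel (Fin n) 0ℓ} {M N} → M ≈ₘ N → Supp R M → Supp R N
  Supp-≈ e s i j ¬r = trans (sym (e i j)) (s i j ¬r)

  Upper⇒Supp : ∀ {n} {x : Matrix n} → Upper x → Supp _≤ᶠ_ x
  Upper⇒Supp up i j i≰j = up i j (ℕₚ.≰⇒> i≰j)

  Supp⇒Upper : ∀ {n} {x : Matrix n} → Supp _≤ᶠ_ x → Upper x
  Supp⇒Upper s i j j<i = s i j (ℕₚ.<⇒≱ j<i)

  Supp-1ₘ : ∀ {n} {R : Rel (Fin n) 0ℓ} → Reflexive R → Supp R 1ₘ
  Supp-1ₘ rfl i j ¬r = 1ₘ-off i j λ { ≡.refl → ¬r rfl }

  entries-≈0 : ∀ {p} {P Q : Set p} {x y} → ¬ (P × Q) → (¬ P → x ≈ 0#) → (¬ Q → y ≈ 0#) → x * y ≈ 0#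
  entries-≈0 {P = P} ¬pq hx hy = stable λ ne → em P λ
    { (inj₁ p)  → ne (x*0≈0 (hy λ q → ¬pq (p , q)))
    ; (inj₂ ¬p) → ne (0*x≈0 (hx ¬p)) }

  Supp-* : ∀ {n} {R S T : Rel (Fin n) 0ℓ} {M N} → (∀ {i k j} → R i k → S k j → T i j) →
           Supp R M → Supp S N → Supp T (M *ₘ N)
  Supp-* comp sM sN i j ¬t = sum-≈0 λ k →
    entries-≈0 (λ (r , s) → ¬t (comp r s)) (sM i k) (sN k j)

  *ₘ-diag : ∀ {n} {R S : Rel (Fin n) 0ℓ} {M N} → (∀ {i k} → R i k → S k i → k ≡ i) →
            Supp R M → Supp S N → ∀ i → (M *ₘ N) i i ≈ M i i * N i i
  *ₘ-diag anti sM sN i = sum-only i λ k k≢i →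
    entries-≈0 (λ (r , s) → k≢i (anti r s)) (sM i k) (sN k i)

  Diagonal : ∀ {n} → Matrix n → Set
  Diagonal = Supp _≡_

  *ₘ-diagonalʳ : ∀ {n} (M : Matrix n) {τ} → Diagonal τ → ∀ i j → (M *ₘ τ) i j ≈ M i j * τ j j
  *ₘ-diagonalʳ M dτ i j = sum-only j λ k k≢j → x*0≈0 (dτ k j k≢j)

  *ₘ-diagonalˡ : ∀ {n} {τ} (M : Matrix n) → Diagonal τ → ∀ i j → (τ *ₘ M) i j ≈ τ i i * M i j
  *ₘ-diagonalˡ M dτ i j = sum-only i λ k k≢i → 0*x≈0 (dτ i k (k≢i ∘ ≡.sym))

  -- The `rank` tells in which order the columns of an inverse are to be found.
  record Order {n} (R : Rel (Fin n) 0ℓ) : Set where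
    field
      rfl   : Reflexive R
      tran  : Transitive R
      rank  : Fin n → ℕ
      mono  : ∀ {i j} → R i j → i ≢ j → rank i ℕ.< rank j

    antisym : ∀ {i j} → R i j → R j i → i ≡ j
    antisym {i} {j} r s with i ≟ j
    ... | yes e = e
    ... | no ne = contradiction (mono s (ne ∘ ≡.sym)) (ℕₚ.<-asym (mono r ne))

    module _ {x y : Matrix n} (yx : y *ₘ x ≈ₘ 1ₘ) {M}
      (sx : ∀ i j → rank j ℕ.< M → ¬ R i j → x i j ≈ 0#) where

      -- In the (i , j) entry of y x, a summand with k ≠ j can survive only if R k j, hence at a
      -- column of smaller rank, where the support of y is already known; what remains is yᵢⱼ xⱼⱼ.
      -- Only columns of x of rank below M enter, so a matrix can be used here while it is known to
      -- be triangular in its first columns only.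
      inverse-column : ∀ m j → m ℕ.≤ M → rank j ℕ.< m →
                       (y j j * x j j ≈ 1#) × (∀ i → ¬ R i j → y i j ≈ 0#)
      inverse-column (suc m) j m<M (s≤s rj≤m) = yx-diag , λ i ¬r → Unit-cancel
        (y j j , trans (*-comm _ _) yx-diag)
        (trans (*-comm _ _) (trans (sym (sum-only j (other-terms i λ r s → ¬r (tran r s))))
          (trans (yx i j) (1ₘ-off i j λ { ≡.refl → ¬r rfl }))))
        where
        ih : ∀ {k} → k ≢ j → R k j → ∀ i → ¬ R i k → y i k ≈ 0#
        ih {k} k≢j rkj = proj₂ (inverse-column m k (ℕₚ.<⇒≤ m<M) (ℕₚ.<-≤-trans (mono rkj k≢j) rj≤m))

        term : ∀ {i k} → k ≢ j → (R k j → ¬ R i k) → y i k * x k j ≈ 0#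
        term {i} {k} k≢j ¬r = stable λ ne → em (R k j) λ
          { (inj₁ rkj)  → ne (0*x≈0 (ih k≢j rkj i (¬r rkj)))
          ; (inj₂ ¬rkj) → ne (x*0≈0 (sx k j (ℕₚ.<-≤-trans (s≤s rj≤m) m<M) ¬rkj)) }

        other-terms : ∀ i → (∀ {k} → R i k → ¬ R k j) → ∀ k → k ≢ j → y i k * x k j ≈ 0#
        other-terms i ¬rs k k≢j = term k≢j λ rkj rik → ¬rs rik rkj

        yx-diag : y j j * x j j ≈ 1#
        yx-diag = trans (sym (sum-only j λ k k≢j → term k≢j λ rkj rjk → k≢j (antisym rkj rjk)))
          (trans (yx j j) (1ₘ-diag j))

    module _ {x y : Matrix n} (yx : y *ₘ x ≈ₘ 1ₘ) (sx : Supp R x) where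

      private
        column : ∀ j → (y j j * x j j ≈ 1#) × (∀ i → ¬ R i j → y i j ≈ 0#)
        column j = inverse-column yx {suc (rank j)} (λ i j _ → sx i j)
          (suc (rank j)) j ℕₚ.≤-refl ℕₚ.≤-refl

      Supp-inverse : Supp R y
      Supp-inverse i j = proj₂ (column j) i

      diag-unit : ∀ j → Unit (x j j)
      diag-unit j = y j j , trans (*-comm _ _) (proj₁ (column j))

  ≤-Order : ∀ {n} → Order {n} _≤ᶠ_
  ≤-Order = record
    { rfl = ℕₚ.≤-refl ; tran = ℕₚ.≤-trans ; rank = toℕ
    ; mono = λ i≤j i≢j → ℕₚ.≤∧≢⇒< i≤j (i≢j ∘ Finₚ.toℕ-injective) }

  -- Column j of reduction x is found by Cramer's rule on the minor of x with row and
  -- column indices in N _ j, which masked embeds into a matrix of full size.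
  module ColumnReduction {n} {N : Rel (Fin n) 0ℓ} (N? : Decidable N)
    (N-irrefl : ∀ j → ¬ N j j) where

    masked : Matrix n → Fin n → Matrix n
    masked x j i k = if does (N? i j) ∧ does (N? k j) then x i k else 1ₘ i k

    maskedColumn : Matrix n → Fin n → Vector n
    maskedColumn x j l = if does (N? l j) then x l j else 0#

    coefficient : Matrix n → Fin n → Vector n
    coefficient x j k = if does (N? k j) then adj (masked x j) k ∙ maskedColumn x j else 0#

    -- Column j of x · `reduction x` is `den` times column j of x minus a combination of the columns
    -- k with N k j, chosen to vanish in the rows i with N i j. The scaling by `den` keeps every
    -- entry polynomial in x.
    reduction : Matrix n → Matrix n
    reduction x k j = den (masked x j) * 1ₘ k j - coefficient x j k

    pivots : Matrix n → Fin n → Carrier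
    pivots x j = den (masked x j)

    coefficient-0 : ∀ x {j k} → ¬ N k j → coefficient x j k ≈ 0#
    coefficient-0 x {j} {k} ¬n with N? k j
    ... | yes n = contradiction n ¬n
    ... | no  _ = refl

    reduction-diag : ∀ x j → reduction x j j ≈ pivots x j
    reduction-diag x j = trans (+-cong (trans (*-congˡ (1ₘ-diag j)) (*-identityʳ _))
                                       (-‿cong (coefficient-0 x (N-irrefl j)))) (x-0≈x _)

    reduction-0 : ∀ x {k j} → ¬ N k j → k ≢ j → reduction x k j ≈ 0#
    reduction-0 x {k} {j} ¬n k≢j = trans
      (+-cong (x*0≈0 (1ₘ-off k j k≢j)) (-‿cong (coefficient-0 x ¬n))) (x-0≈x _)

    -- `adj` of the masked matrix, applied to the masked column, solves the linear system of the
    -- minor up to the factor `den`. Outside the minor the masked matrix is the identity and the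
    -- column is zero, so nothing foreign enters.
    row-masked : ∀ x {i j} → N i j → x i ∙ coefficient x j ≈ den (masked x j) * x i j
    row-masked x {i} {j} nij = begin
      x i ∙ coefficient x j
        ≈⟨ sum-cong-≋ step ⟩
      masked x j i ∙ (adj (masked x j) *ᵥ maskedColumn x j)
        ≈⟨ ∙-assoc (masked x j i) (adj (masked x j)) (maskedColumn x j) ⟨
      (masked x j *ₘ adj (masked x j)) i ∙ maskedColumn x j
        ≈⟨ ∙-cong {v = maskedColumn x j} (adj-inverseʳ (masked x j) i) (λ _ → refl) ⟩
      (λ k → den (masked x j) * 1ₘ i k) ∙ maskedColumn x j
        ≈⟨ ∙-scaleˡ (den (masked x j)) (1ₘ i) (maskedColumn x j) ⟩
      den (masked x j) * (1ₘ i ∙ maskedColumn x j)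
        ≈⟨ *-congˡ (trans (1ₘ-∙ (maskedColumn x j) i) at-i) ⟩
      den (masked x j) * x i j ∎
      where
      at-i : maskedColumn x j i ≈ x i j
      at-i with N? i j
      ... | yes _ = refl
      ... | no ¬n = contradiction nij ¬n
      step : ∀ k → x i k * coefficient x j k ≈ masked x j i k *
        (adj (masked x j) k ∙ maskedColumn x j)
      step k with N? k j | N? i j
      ... | _        | no ¬nij = contradiction nij ¬nij
      ... | yes _    | yes _   = refl
      ... | no ¬nkj  | yes _   = trans (zeroʳ _) (sym (0*x≈0 (1ₘ-off i k λ { ≡.refl → ¬nkj nij })))

    reduced-0 : ∀ x {i j} → N i j → (x *ₘ reduction x) i j ≈ 0#
    reduced-0 x {i} {j} nij = begin
      x i ∙ (λ k → d * 1ₘ k j - coefficient x j k)      ≈⟨ ∙-subʳ (x i) (λ k → d * 1ₘ k j)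
        (coefficient x j) ⟩
      x i ∙ (λ k → d * 1ₘ k j) - x i ∙ coefficient x j
        ≈⟨ +-cong (trans (∙-scaleʳ d (x i) (λ k → 1ₘ k j)) (*-congˡ (∙-1ₘ (x i) j)))
          (-‿cong (row-masked x nij)) ⟩
      d * x i j - d * x i j                             ≈⟨ -‿inverseʳ _ ⟩
      0# ∎
      where d = den (masked x j)

    -- Upper triangular matrices supply the points at which the pivots are known not to vanish;
    -- their nonvanishing at generic points of a line is deduced from these.
    pivots-upper : ∀ x → Upper x → (∀ i → Unit (x i i)) → ∀ j → Unit (pivots x j)
    pivots-upper x up u j = den-upper (masked x j) masked-up masked-unit
      where
      masked-up : Upper (masked x j)
      masked-up i k k<i with does (N? i j) ∧ does (N? k j)
      ... | true  = up i k k<i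
      ... | false = 1ₘ-off i k λ { ≡.refl → ℕₚ.<-irrefl ≡.refl k<i }
      masked-unit : ∀ i → Unit (masked x j i i)
      masked-unit i with does (N? i j) ∧ does (N? i j)
      ... | true  = u i
      ... | false = Unit-cong (sym (1ₘ-diag i)) Unit-1

    module _ {X : Set} (C : PolynomialClass X) where
      open PolynomialClass C
      open PolynomialMatrix C

      :masked : ∀ {M : X → Matrix n} → 𝒫ₘ M → ∀ j → 𝒫ₘ (λ x → masked (M x) j)
      :masked p j i k with does (N? i j) ∧ does (N? k j)
      ... | true  = p i k
      ... | false = const (1ₘ i k)

      :pivots : ∀ {M : X → Matrix n} → 𝒫ₘ M → ∀ j → 𝒫 (λ x → pivots (M x) j)
      :pivots p j = :den (:masked p j)

      :reduction : ∀ {M : X → Matrix n} → 𝒫ₘ M → 𝒫ₘ (λ x → reduction (M x))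
      :reduction {M} p k j = (:pivots p j :⊗ const (1ₘ k j)) :⊖ coeff
        where
        col : ∀ l → 𝒫 (λ x → maskedColumn (M x) j l)
        col l with does (N? l j)
        ... | true  = p l j
        ... | false = const 0#
        coeff : 𝒫 (λ x → coefficient (M x) j k)
        coeff with does (N? k j)
        ... | true  = :∙ (:adj (:masked p j) k) col
        ... | false = const 0#

  module BlockPart {n} {E : Rel (Fin n) 0ℓ} (E? : Decidable E)
                   (E-sym : Symmetric E) (E-trans : Transitive E) where

    blk : Matrix n → Matrix n
    blk M i j = if does (E? i j) then M i j else 0#

    blk-in : ∀ M {i j} → E i j → blk M i j ≈ M i j
    blk-in M {i} {j} e with E? i j
    ... | yes _ = refl
    ... | no ¬e = contradiction e ¬e

    blk-Supp : ∀ M → Supp E (blk M)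
    blk-Supp M i j ¬e with E? i j
    ... | yes e = contradiction e ¬e
    ... | no  _ = refl

    blk-Supp′ : ∀ {R : Rel (Fin n) 0ℓ} {M} → Supp R M → Supp R (blk M)
    blk-Supp′ s i j ¬r with E? i j
    ... | yes _ = s i j ¬r
    ... | no  _ = refl

    blk-unique : ∀ {M N} → Supp E N → (∀ {i j} → E i j → N i j ≈ M i j) → N ≈ₘ blk M
    blk-unique {M} sN h i j with E? i j
    ... | yes e = h e
    ... | no ¬e = sN i j ¬e

    -- If E i j, then a summand with hᵢₖ ≠ 0 has E i k, hence also E k j, so that it uses only the
    -- block part of M.
    blk-*ˡ : ∀ h M → Supp E h → h *ₘ blk M ≈ₘ blk (h *ₘ M)
    blk-*ˡ h M sh = blk-unique {M = h *ₘ M} (Supp-* E-trans sh (blk-Supp M)) λ {i} {j} e →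
      sum-cong-≋ λ k → stable λ ne → em (E i k) λ
        { (inj₁ eik)  → ne (*-congˡ (blk-in M (E-trans (E-sym eik) e)))
        ; (inj₂ ¬eik) → ne (trans (0*x≈0 (sh i k ¬eik)) (sym (0*x≈0 (sh i k ¬eik)))) }

    blk-*ʳ : ∀ M h → Supp E h → blk M *ₘ h ≈ₘ blk (M *ₘ h)
    blk-*ʳ M h sh = blk-unique {M = M *ₘ h} (Supp-* E-trans (blk-Supp M) sh) λ {i} {j} e →
      sum-cong-≋ λ k → stable λ ne → em (E k j) λ
        { (inj₁ ekj)  → ne (*-congʳ (blk-in M (E-trans e (E-sym ekj))))
        ; (inj₂ ¬ekj) → ne (trans (x*0≈0 (sh k j ¬ekj)) (sym (x*0≈0 (sh k j ¬ekj)))) }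

    blk-cong : ∀ {M N} → M ≈ₘ N → blk M ≈ₘ blk N
    blk-cong e i j with E? i j
    ... | yes _ = e i j
    ... | no  _ = refl

    module _ {X : Set} (C : PolynomialClass X) where
      open PolynomialClass C
      open PolynomialMatrix C

      :blk : ∀ {M : X → Matrix n} → 𝒫ₘ M → 𝒫ₘ (λ x → blk (M x))
      :blk p i j with does (E? i j)
      ... | true  = p i j
      ... | false = const 0#

-- Linear dependence, subspaces and eigenvectors

module Eigen (𝒞 : ComplexNumbers) where
  open Field 𝒞
  open GeneralLinear 𝒞
  open Linear 𝒞
  open Support 𝒞
  open Sum semiring using (sum-cong-≋; ∑-comm; ∑-distrib-+; *-distribˡ-sum; *-distribʳ-sum;
    sum-remove)

  comb : ∀ {k d} → (Fin k → Carrier) → (Fin k → Vector d) → Vector d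
  comb c f j = sum (λ i → c i * f i j)

  infix 4 _≢0
  _≢0 : ∀ {d} → Vector d → Set
  v ≢0 = ¬ v ≈ᵥ 0ᵥ

  *ᵥ-cong : ∀ {d} (A : Matrix d) {u v} → u ≈ᵥ v → A *ᵥ u ≈ᵥ A *ᵥ v
  *ᵥ-cong A e i = ∙-cong {u = A i} (λ _ → refl) e

  *ᵥ-comb : ∀ {k d} (A : Matrix d) c (f : Fin k → Vector d) →
            A *ᵥ comb c f ≈ᵥ comb c (λ i → A *ᵥ f i)
  *ᵥ-comb A c f j = begin
    sum (λ k → A j k * sum (λ i → c i * f i k))   ≈⟨ sum-cong-≋
      (λ k → *-distribˡ-sum (A j k) (λ i → c i * f i k)) ⟩
    sum (λ k → sum (λ i → A j k * (c i * f i k))) ≈⟨ ∑-comm (λ k i → A j k * (c i * f i k)) ⟩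
    sum (λ i → sum (λ k → A j k * (c i * f i k))) ≈⟨ sum-cong-≋ (λ i → ∙-scaleʳ (c i) (A j) (f i)) ⟩
    sum (λ i → c i * (A *ᵥ f i) j)                ∎

  Dependent : ∀ {k d} → (Fin k → Vector d) → Set
  Dependent f = ∃ λ c → (∃ λ i → ¬ c i ≈ 0#) × comb c f ≈ᵥ 0ᵥ

  -- Gaussian elimination on the first coordinate: a vector p with nonzero first entry clears it
  -- from the others, which leaves one vector and one coordinate less. If all first entries vanish,
  -- some vector may be dropped.
  dependent : ∀ {d} (f : Fin (suc d) → Vector d) → ¬¬ Dependent f
  dependent {zero}  f = pure ((λ _ → 1#) , (zero , 1≉0) , λ ())
  dependent {suc d} f = em (∃ λ p → ¬ f p zero ≈ 0#) >>= λ
    { (inj₂ none) → dependent (λ i j → f (suc i) (suc j)) >>= λ (c , (i , ci≉0) , e) → pure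
        ( (λ { zero → 0# ; (suc i) → c i }) , (suc i , ci≉0)
        , λ { zero → trans (+-cong (zeroˡ _)
          (sum-≈0 λ i → x*0≈0 {c i} (stable λ ne → none (suc i , ne)))) (+-identityʳ _)
            ; (suc j) → trans (+-cong (zeroˡ _) (e j)) (+-identityʳ _) })
    ; (inj₁ (p , fp≉0)) → ≉0⇒Unit fp≉0 >>= λ (y , fp*y) →
        let r = λ i → f (punchIn p i) zero * y in
        dependent (λ i j → f (punchIn p i) (suc j) - r i * f p (suc j)) >>= λ (c , (i , ci≉0) , e) →
        -- The coefficient - s of the pivot vector compensates for the multiples r i of it that the
        -- elimination subtracted.
        let s = sum (λ i → c i * r i)
            c′ = λ k → coeffs p c (- s) k in
        pure (c′ , (punchIn p i , λ e′ → ci≉0 (trans (sym (coeffs-in p c (- s) i)) e′)) , λ j →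
          begin
          comb c′ f j
            ≈⟨ sum-remove {i = p} (λ k → c′ k * f k j) ⟩
          c′ p * f p j + sum (λ i → c′ (punchIn p i) * f (punchIn p i) j)
            ≈⟨ +-cong (*-congʳ (coeffs-at p c (- s)))
              (sum-cong-≋ λ i → *-congʳ {f (punchIn p i) j} (coeffs-in p c (- s) i)) ⟩
          (- s) * f p j + sum (λ i → c i * f (punchIn p i) j)
            ≈⟨ +-congˡ (sum-cong-≋ λ i → solve 4
              (λ c f r g → c :* f := c :* (f :- r :* g) :+ (c :* r) :* g) refl
                 (c i) (f (punchIn p i) j) (r i) (f p j)) ⟩
          (- s) * f p j + sum (λ i → c i * (f (punchIn p i) j - r i * f p j) + (c i * r i) * f p j)
            ≈⟨ +-congˡ (∑-distrib-+ (λ i → c i * (f (punchIn p i) j - r i * f p j))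
              (λ i → (c i * r i) * f p j)) ⟩
          (- s) * f p j + (sum (λ i → c i * (f (punchIn p i) j - r i * f p j)) + sum
            (λ i → (c i * r i) * f p j))
            ≈⟨ +-congˡ (+-cong (rest p y fp*y c e j)
              (sym (*-distribʳ-sum (f p j) (λ i → c i * r i)))) ⟩
          (- s) * f p j + (0# + s * f p j)
            ≈⟨ solve 3 (λ s g o → :- s :* g :+ (o :+ s :* g) := o) refl s (f p j) 0# ⟩
          0# ∎) }
    where
    coeffs : ∀ {n} (p : Fin (suc n)) (c : Fin n → Carrier) → Carrier → Fin (suc n) → Carrier
    coeffs p c x k with p ≟ k
    ... | yes _  = x
    ... | no p≢k = c (punchOut p≢k)
    coeffs-at : ∀ {n} p (c : Fin n → Carrier) x → coeffs p c x p ≈ x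
    coeffs-at p c x with p ≟ p
    ... | yes _ = refl
    ... | no ne = contradiction ≡.refl ne
    coeffs-in : ∀ {n} p (c : Fin n → Carrier) x i → coeffs p c x (punchIn p i) ≈ c i
    coeffs-in p c x i with p ≟ punchIn p i
    ... | yes e = contradiction (≡.sym e) (Finₚ.punchInᵢ≢i p i)
    ... | no ne = reflexive (≡.cong c (Finₚ.punchOut-punchIn p))
    rest : ∀ p y → f p zero * y ≈ 1# → ∀ c →
           comb c (λ i j → f (punchIn p i) (suc j) - f (punchIn p i) zero * y * f p (suc j)) ≈ᵥ 0ᵥ →
           ∀ j → sum (λ i → c i * (f (punchIn p i) j - f (punchIn p i) zero * y * f p j)) ≈ 0#
    rest p y fp*y c e (suc j) = e j
    rest p y fp*y c e zero = sum-≈0 λ i → x*0≈0 {c i} (begin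
      g i - g i * y * f p zero   ≈⟨ solve 3 (λ g y f → g :- g :* y :* f := g :- g :* (f :* y)) refl
        (g i) y (f p zero) ⟩
      g i - g i * (f p zero * y) ≈⟨ +-congˡ (-‿cong (trans (*-congˡ fp*y) (*-identityʳ _))) ⟩
      g i - g i                  ≈⟨ -‿inverseʳ (g i) ⟩
      0#                         ∎)
      where g = λ i → f (punchIn p i) zero

  -- Dimension is bounded through dependences alone, since a subspace given by a predicate comes
  -- without a basis.
  DimAtMost : ∀ {d} → ℕ → (Vector d → Set) → Set
  DimAtMost k W = ∀ (f : Fin (suc k) → Vector _) → (∀ i → W (f i)) → ¬¬ Dependent f

  record IsSubspace {d} (W : Vector d → Set) : Set where
    field
      resp  : ∀ {u v} → u ≈ᵥ v → W u → W v
      0∈    : W 0ᵥ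
      +∈    : ∀ {u v} → W u → W v → W (λ i → u i + v i)
      scale : ∀ c {u} → W u → W (λ i → c * u i)

    comb∈ : ∀ {k} c (f : Fin k → Vector d) → (∀ i → W (f i)) → W (comb c f)
    comb∈ {zero}  c f h = 0∈
    comb∈ {suc k} c f h = +∈ (scale (c zero) (h zero)) (comb∈ (c ∘ suc) (f ∘ suc) (h ∘ suc))

  module _ {d} {W W′ : Vector d → Set} (sub : IsSubspace W′) (W′⊆W : ∀ {v} → W′ v → W v) where
    open IsSubspace sub

    -- Together with y, k + 1 vectors of W′ are dependent in W. The coefficient of y must vanish, as
    -- otherwise y would be a combination of vectors of W′.
    DimAtMost-smaller : ∀ {k y} → W y → ¬ W′ y → DimAtMost (suc k) W → DimAtMost k W′
    DimAtMost-smaller {k} {y} y∈ y∉ dim f f∈ =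
      dim (λ { zero → y ; (suc i) → f i }) (λ { zero → y∈ ; (suc i) → W′⊆W (f∈ i) }) >>=
        λ (c , nz , e) →
      ≈0? (c zero) >>= λ
      { (inj₁ c₀≈0)     → pure (c ∘ suc , nonzero-suc c c₀≈0 nz , λ j →
          trans (sym (trans (+-congʳ (0*x≈0 c₀≈0)) (+-identityˡ _))) (e j))
      ; (inj₂ (x , cx)) → contradiction
        (resp (λ j → sym (solved c x cx e j)) (comb∈ (λ i → - (x * c (suc i))) f f∈)) y∉ }
      where
      nonzero-suc : ∀ (c : Fin (suc (suc k)) → Carrier) → c zero ≈ 0# → (∃ λ i → ¬ c i ≈ 0#) →
        ∃ λ i → ¬ c (suc i) ≈ 0#
      nonzero-suc c c₀≈0 (zero  , ne) = contradiction c₀≈0 ne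
      nonzero-suc c c₀≈0 (suc i , ne) = i , ne
      solved : ∀ (c : Fin (suc (suc k)) → Carrier) x → c zero * x ≈ 1# →
               (∀ j → c zero * y j + sum (λ i → c (suc i) * f i j) ≈ 0#) →
               ∀ j → y j ≈ sum (λ i → - (x * c (suc i)) * f i j)
      solved c x cx e j = begin
        y j ≈⟨ *-identityˡ _ ⟨
        1# * y j ≈⟨ *-congʳ cx ⟨
        (c zero * x) * y j
          ≈⟨ solve 4 (λ c x y s → (c :* x) :* y := x :* (c :* y :+ s) :- x :* s) refl (c zero) x
            (y j) s ⟩
        x * (c zero * y j + s) - x * s ≈⟨ +-congʳ (x*0≈0 (e j)) ⟩
        0# - x * s ≈⟨ +-identityˡ _ ⟩
        - (x * s) ≈⟨ solve 2 (λ x s → :- (x :* s) := (:- x) :* s) refl x s ⟩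
        - x * s ≈⟨ *-distribˡ-sum (- x) (λ i → c (suc i) * f i j) ⟩
        sum (λ i → - x * (c (suc i) * f i j))
          ≈⟨ sum-cong-≋ (λ i → solve 3 (λ x c f → :- x :* (c :* f) := :- (x :* c) :* f) refl x
            (c (suc i)) (f i j)) ⟩
        sum (λ i → - (x * c (suc i)) * f i j) ∎
        where s = sum (λ i → c (suc i) * f i j)

  module Operator {d} (A : Matrix d) where

    shift : Carrier → Vector d → Vector d
    shift a v i = (A *ᵥ v) i - a * v i

    shift-cong : ∀ a {u v} → u ≈ᵥ v → shift a u ≈ᵥ shift a v
    shift-cong a e i = +-cong (*ᵥ-cong A e i) (-‿cong (*-congˡ (e i)))

    shift-0 : ∀ a {v} → v ≈ᵥ 0ᵥ → shift a v ≈ᵥ 0ᵥ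
    shift-0 a e i = trans (+-cong (∙-0ʳ (A i) e) (-‿cong (x*0≈0 (e i)))) (x-0≈x 0#)

    shift-comb : ∀ a {k} c (f : Fin k → Vector d) → shift a (comb c f) ≈ᵥ comb c
      (λ i → shift a (f i))
    shift-comb a c f j = begin
      (A *ᵥ comb c f) j - a * comb c f j
        ≈⟨ +-cong (*ᵥ-comb A c f j) (-‿cong (*-distribˡ-sum a (λ i → c i * f i j))) ⟩
      comb c (λ i → A *ᵥ f i) j - sum (λ i → a * (c i * f i j))
        ≈⟨ sum-sub (λ i → c i * (A *ᵥ f i) j) (λ i → a * (c i * f i j)) ⟨
      sum (λ i → c i * (A *ᵥ f i) j - a * (c i * f i j))
        ≈⟨ sum-cong-≋ (λ i → solve 4 (λ c x a f → c :* x :- a :* (c :* f) := c :* (x :- a :* f))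
          refl (c i) ((A *ᵥ f i) j) a (f i j)) ⟩
      comb c (λ i → shift a (f i)) j ∎

    shift-comm : ∀ a b v → shift a (shift b v) ≈ᵥ shift b (shift a v)
    shift-comm a b v i = begin
      A i ∙ (λ k → (A *ᵥ v) k - b * v k) - a * ((A *ᵥ v) i - b * v i) ≈⟨ +-congʳ (expand b) ⟩
      (A i ∙ (A *ᵥ v) - b * (A i ∙ v)) - a * ((A *ᵥ v) i - b * v i)
        ≈⟨ solve 5 (λ a b x y v → (x :- b :* y) :- a :* (y :- b :* v) := (x :- a :* y) :- b :*
          (y :- a :* v)) refl
             a b (A i ∙ (A *ᵥ v)) (A i ∙ v) (v i) ⟩
      (A i ∙ (A *ᵥ v) - a * (A i ∙ v)) - b * ((A *ᵥ v) i - a * v i) ≈⟨ +-congʳ (expand a) ⟨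
      A i ∙ (λ k → (A *ᵥ v) k - a * v k) - b * ((A *ᵥ v) i - a * v i) ∎
      where
      expand : ∀ b → A i ∙ (λ k → (A *ᵥ v) k - b * v k) ≈ A i ∙ (A *ᵥ v) - b * (A i ∙ v)
      expand b = trans (∙-subʳ (A i) (A *ᵥ v) (λ k → b * v k))
        (+-congˡ (-‿cong (∙-scaleʳ b (A i) v)))

    -- A monic polynomial in A is kept as the list of its roots.
    shifts : List Carrier → Vector d → Vector d
    shifts []       v = v
    shifts (a ∷ as) v = shift a (shifts as v)

    shifts-0 : ∀ as {v} → v ≈ᵥ 0ᵥ → shifts as v ≈ᵥ 0ᵥ
    shifts-0 []       e = e
    shifts-0 (a ∷ as) e = shift-0 a (shifts-0 as e)

    shifts-cong : ∀ as {u v} → u ≈ᵥ v → shifts as u ≈ᵥ shifts as v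
    shifts-cong []       e = e
    shifts-cong (a ∷ as) e = shift-cong a (shifts-cong as e)

    shifts-comb : ∀ as {k} c (f : Fin k → Vector d) → shifts as (comb c f) ≈ᵥ comb c
      (λ i → shifts as (f i))
    shifts-comb []       c f j = refl
    shifts-comb (a ∷ as) c f j = trans (shift-cong a (shifts-comb as c f) j)
      (shift-comb a c (λ i → shifts as (f i)) j)

    shifts-shift : ∀ as b v → shifts as (shift b v) ≈ᵥ shift b (shifts as v)
    shifts-shift []       b v i = refl
    shifts-shift (a ∷ as) b v i = trans (shift-cong a (shifts-shift as b v) i)
      (shift-comm a b (shifts as v) i)

    shifts-++ : ∀ as bs v → shifts (as ++ bs) v ≈ᵥ shifts as (shifts bs v)
    shifts-++ []       bs v i = refl
    shifts-++ (a ∷ as) bs v i = shift-cong a (shifts-++ as bs v) i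

    shifts-comm : ∀ as bs v → shifts as (shifts bs v) ≈ᵥ shifts bs (shifts as v)
    shifts-comm []       bs v i = refl
    shifts-comm (a ∷ as) bs v i = trans (shift-cong a (shifts-comm as bs v) i)
      (sym (shifts-shift bs a (shifts as v) i))

    -- The monic polynomial with lower coefficients a, lowest first.
    monicValue : ∀ {k} → Carrier → (Fin k → Carrier) → Carrier
    monicValue {zero}  z a = 1#
    monicValue {suc k} z a = a zero + z * monicValue z (a ∘ suc)

    monicAct : ∀ {k} → (Fin k → Carrier) → Vector d → Vector d
    monicAct {zero}  a w = w
    monicAct {suc k} a w i = a zero * w i + (A *ᵥ monicAct (a ∘ suc) w) i

    monicValue-expand : ∀ {k} z (a : Fin k → Carrier) →
                        z ^ k + sum (λ i → a i * z ^ toℕ i) ≈ monicValue z a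
    monicValue-expand {zero}  z a = +-identityʳ 1#
    monicValue-expand {suc k} z a = begin
      z * z ^ k + (a zero * 1# + sum (λ i → a (suc i) * (z * z ^ toℕ i)))
        ≈⟨ +-congˡ (+-cong (*-identityʳ _)
          (trans (sum-cong-≋ λ i → solve 3 (λ a z p → a :* (z :* p) := z :* (a :* p)) refl
             (a (suc i)) z (z ^ toℕ i)) (sym (*-distribˡ-sum z (λ i → a (suc i) * z ^ toℕ i))))) ⟩
      z * z ^ k + (a zero + z * sum (λ i → a (suc i) * z ^ toℕ i))
        ≈⟨ solve 4 (λ z p a s → z :* p :+ (a :+ z :* s) := a :+ z :* (p :+ s)) refl z (z ^ k)
          (a zero) _ ⟩
      a zero + z * (z ^ k + sum (λ i → a (suc i) * z ^ toℕ i))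
        ≈⟨ +-congˡ (*-congˡ (monicValue-expand z (a ∘ suc))) ⟩
      a zero + z * monicValue z (a ∘ suc) ∎

    -- Synthetic division by t - z: the coefficients of the quotient are the Horner values of the
    -- tails at z.
    quotient : ∀ {k} → Carrier → (Fin (suc k) → Carrier) → Fin k → Carrier
    quotient z a zero    = monicValue z (a ∘ suc)
    quotient z a (suc i) = quotient z (a ∘ suc) i

    division : ∀ {k} z (a : Fin (suc k) → Carrier) w i →
               monicAct a w i ≈ shift z (monicAct (quotient z a) w) i + monicValue z a * w i
    division {zero} z a w i = solve 4 (λ a w x z → a :* w :+ x := (x :- z :* w) :+
      (a :+ z :* :1) :* w)
      refl (a zero) (w i) ((A *ᵥ w) i) z
    division {suc k} z a w i = begin
      a zero * w i + A i ∙ monicAct (a ∘ suc) w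
        ≈⟨ +-congˡ (∙-cong {u = A i} (λ _ → refl) (division z (a ∘ suc) w)) ⟩
      a zero * w i + A i ∙ (λ j → ((A *ᵥ h) j - z * h j) + σ * w j)
        ≈⟨ +-congˡ (trans (∙-+ʳ (A i) (shift z h) (λ j → σ * w j))
          (+-cong (trans (∙-subʳ (A i) (A *ᵥ h) (λ j → z * h j))
             (+-congˡ (-‿cong (∙-scaleʳ z (A i) h)))) (∙-scaleʳ σ (A i) w))) ⟩
      a zero * w i + ((AAh - z * (A i ∙ h)) + σ * (A i ∙ w))
        ≈⟨ solve 7 (λ a w x z y σ v → a :* w :+ ((x :- z :* y) :+ σ :* v) :=
             ((σ :* v :+ x) :- z :* (σ :* w :+ y)) :+ (a :+ z :* σ) :* w) refl (a zero) (w i) AAh z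
               (A i ∙ h) σ (A i ∙ w) ⟩
      ((σ * (A i ∙ w) + AAh) - z * (σ * w i + A i ∙ h)) + (a zero + z * σ) * w i
        ≈⟨ +-congʳ (+-congʳ (trans (∙-+ʳ (A i) (λ j → σ * w j) (A *ᵥ h))
          (+-congʳ (∙-scaleʳ σ (A i) w)))) ⟨
      shift z (monicAct (quotient z a) w) i + monicValue z a * w i ∎
      where
      σ = monicValue z (a ∘ suc)
      h = monicAct (quotient z (a ∘ suc)) w
      AAh = A i ∙ (A *ᵥ h)

    factor : ∀ {k} (a : Fin k → Carrier) → ∃ λ as → ∀ w → monicAct a w ≈ᵥ shifts as w
    factor {zero}  a = [] , λ _ _ → refl
    factor {suc k} a =
      let (z , root) = algebraicallyClosed a
          (as , h)   = factor (quotient z a) in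
      z ∷ as , λ w i → trans (division z a w i) (trans
        (+-cong (shift-cong z (h w) i) (0*x≈0 (trans (sym (monicValue-expand z a)) root)))
        (+-identityʳ _))

    power : ℕ → Vector d → Vector d
    power zero    w = w
    power (suc k) w = A *ᵥ power k w

    act : ∀ {k} → (Fin k → Carrier) → Vector d → Vector d
    act {zero}  c w = 0ᵥ
    act {suc k} c w i = c zero * w i + (A *ᵥ act (c ∘ suc) w) i

    act-powers : ∀ {k} (c : Fin k → Carrier) w → comb c (λ i → power (toℕ i) w) ≈ᵥ act c w
    act-powers {zero}  c w j = refl
    act-powers {suc k} c w j = +-congˡ (trans (sym (*ᵥ-comb A (c ∘ suc) (λ i → power (toℕ i) w) j))
                                             (*ᵥ-cong A (act-powers (c ∘ suc) w) j))

    act-0 : ∀ {k} (c : Fin k → Carrier) → (∀ i → c i ≈ 0#) → ∀ w → act c w ≈ᵥ 0ᵥ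
    act-0 {zero}  c h w j = refl
    act-0 {suc k} c h w j = trans (+-cong (0*x≈0 (h zero))
      (∙-0ʳ (A j) (act-0 (c ∘ suc) (h ∘ suc) w))) (+-identityʳ _)

    -- The last nonzero coefficient becomes the leading one; if it is the constant coefficient, the
    -- monic polynomial is 1.
    normalise-monic : ∀ {k} (c : Fin k → Carrier) → (∃ λ i → ¬ c i ≈ 0#) →
      ¬¬ (∃ λ c₀ → Unit c₀ × ∃ λ k′ → ∃ λ (a : Fin k′ → Carrier) →
          ∀ w i → act c w i ≈ c₀ * monicAct a w i)
    normalise-monic {suc k} c (i , ci≉0) = em (∃ λ i → ¬ c (suc i) ≈ 0#) >>= λ
      { (inj₁ ne)   → normalise-monic (c ∘ suc) ne >>= λ (c₀ , (x , cx) , k′ , a , h) → pure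
          (c₀ , (x , cx) , suc k′ , (λ { zero → x * c zero ; (suc i) → a i }) , λ w i → begin
            c zero * w i + A i ∙ act (c ∘ suc) w
              ≈⟨ +-cong (trans (sym (*-identityˡ _)) (*-congʳ (sym cx)))
                        (trans (∙-cong {u = A i} (λ _ → refl) (h w))
                          (∙-scaleʳ c₀ (A i) (monicAct a w))) ⟩
            (c₀ * x) * (c zero * w i) + c₀ * (A i ∙ monicAct a w)
              ≈⟨ solve 5 (λ c x d w y → (c :* x) :* (d :* w) :+ c :* y := c :* ((x :* d) :* w :+ y))
                refl
                   c₀ x (c zero) (w i) _ ⟩
            c₀ * ((x * c zero) * w i + A i ∙ monicAct a w) ∎)
      ; (inj₂ none) → ≉0⇒Unit (c₀≉0 i ci≉0 none) >>= λ u → pure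
          (c zero , u , 0 , (λ ()) , λ w i → trans
            (+-congˡ (∙-0ʳ (A i) (act-0 (c ∘ suc) (λ i → stable λ ne → none (i , ne)) w)))
              (+-identityʳ _)) }
      where
      c₀≉0 : ∀ i → ¬ c i ≈ 0# → ¬ (∃ λ i → ¬ c (suc i) ≈ 0#) → ¬ c zero ≈ 0#
      c₀≉0 zero    ne none = ne
      c₀≉0 (suc i) ne none = contradiction (i , ne) none

    -- The d + 1 vectors w, A w, up to A^d w are dependent. The dependence is a polynomial in A
    -- killing w, which is made monic and split into linear factors.
    annihilates-vector : ∀ w → ¬¬ (∃ λ as → shifts as w ≈ᵥ 0ᵥ)
    annihilates-vector w = dependent (λ i → power (toℕ i) w) >>= λ (c , nz , e) →
      normalise-monic c nz >>= λ (c₀ , u , k′ , a , h) →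
      let (as , f) = factor a in
      pure (as , λ i → trans (sym (f w i))
        (Unit-cancel u (trans (sym (h w i)) (trans (sym (act-powers c w i)) (e i)))))

    annihilates-all : ∀ {k} (f : Fin k → Vector d) → ¬¬ (∃ λ as → ∀ i → shifts as (f i) ≈ᵥ 0ᵥ)
    annihilates-all {zero}  f = pure ([] , λ ())
    annihilates-all {suc k} f = annihilates-vector (f zero) >>= λ (as , h) → annihilates-all
      (f ∘ suc) >>= λ (bs , hs) →
      pure (as ++ bs , λ
        { zero    j → trans (shifts-++ as bs (f zero) j)
          (trans (shifts-comm as bs (f zero) j) (shifts-0 bs h j))
        ; (suc i) j → trans (shifts-++ as bs (f (suc i)) j) (shifts-0 as (hs i) j) })

    annihilator : ¬¬ (∃ λ as → ∀ v → shifts as v ≈ᵥ 0ᵥ)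
    annihilator = annihilates-all (λ j i → 1ₘ i j) >>= λ (as , h) → pure (as , λ v i → begin
      shifts as v i                              ≈⟨ shifts-cong as
        (λ j → sym (trans (sum-cong-≋ λ k → *-comm (v k) (1ₘ j k)) (1ₘ-∙ v j))) i ⟩
      shifts as (comb v (λ j i → 1ₘ i j)) i      ≈⟨ shifts-comb as v (λ j i → 1ₘ i j) i ⟩
      comb v (λ j → shifts as (λ i → 1ₘ i j)) i  ≈⟨ sum-≈0 (λ j → x*0≈0 (h j i)) ⟩
      0#                                         ∎)

    Eigen : Carrier → Vector d → Set
    Eigen a v = ∀ i → (A *ᵥ v) i ≈ a * v i

    differences : List Carrier → Carrier → Carrier
    differences []       a = 1#
    differences (b ∷ bs) a = (a - b) * differences bs a

    shifts-eigen : ∀ bs {a v} → Eigen a v → ∀ i → shifts bs v i ≈ differences bs a * v i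
    shifts-eigen []       e i = sym (*-identityˡ _)
    shifts-eigen (b ∷ bs) {a} {v} e i = begin
      shift b (shifts bs v) i             ≈⟨ shift-cong b (shifts-eigen bs e) i ⟩
      A i ∙ (λ j → p * v j) - b * (p * v i) ≈⟨ +-congʳ
        (trans (∙-scaleʳ p (A i) v) (*-congˡ (e i))) ⟩
      p * (a * v i) - b * (p * v i)
        ≈⟨ solve 4 (λ p a v b → p :* (a :* v) :- b :* (p :* v) := ((a :- b) :* p) :* v) refl p a
          (v i) b ⟩
      ((a - b) * p) * v i ∎
      where p = differences bs a

    -- Apply the factors A - a of an annihilating polynomial to w one by one: the last nonzero
    -- vector before zero is reached is an eigenvector, and it lies in W by stability.
    eigenvector : ∀ {W} → IsSubspace W → (∀ {v} → W v → W (A *ᵥ v)) →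
                  ∀ {w} → W w → w ≢0 → ¬¬ (∃ λ v → W v × v ≢0 × ∃ λ a → Eigen a v)
    eigenvector {W} sub stb {w} w∈ w≢0 = annihilates-vector w >>= λ (as , h) → go as h
      where
      open IsSubspace sub
      shifts∈ : ∀ as → W (shifts as w)
      shifts∈ []       = w∈
      shifts∈ (a ∷ as) = resp (λ i → +-congˡ
        (solve 2 (λ a x → :- a :* x := :- (a :* x)) refl a (shifts as w i)))
        (+∈ (stb (shifts∈ as)) (scale (- a) (shifts∈ as)))
      go : ∀ as → shifts as w ≈ᵥ 0ᵥ → ¬¬ (∃ λ v → W v × v ≢0 × ∃ λ a → Eigen a v)
      go []       h = contradiction h w≢0
      go (a ∷ as) h = em (shifts as w ≈ᵥ 0ᵥ) >>= λ
        { (inj₁ h′) → go as h′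
        ; (inj₂ ne) → pure (shifts as w , shifts∈ as , ne , a , λ i → x-y≈0⇒x≈y (h i)) }

    -- Drops all occurrences of a, which yields a polynomial that vanishes at the other roots but
    -- not at a.
    remove-root : ∀ as a → ¬¬ (∃ λ bs → Unit (differences bs a) ×
                  (∀ b → differences as b ≈ 0# → ¬ b ≈ a → differences bs b ≈ 0#))
    remove-root []       a = pure ([] , Unit-1 , λ b e _ → e)
    remove-root (c ∷ as) a = remove-root as a >>= λ (bs , u , h) → ≈0? (a - c) >>= λ
      { (inj₁ a≈c) → pure (bs , u , λ b e b≉a → h b (stable λ ne → *-≉0
          (λ b≈c → b≉a (trans (x-y≈0⇒x≈y b≈c) (sym (x-y≈0⇒x≈y a≈c)))) ne e) b≉a)
      ; (inj₂ u′) → pure (c ∷ bs , Unit-* u′ u , λ b e b≉a → stable λ ne → *-≉0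
          (λ b≈c → ne (0*x≈0 b≈c)) (λ e′ → ne (x*0≈0 (h b e′ b≉a))) e) }

-- Commutator identities and connectedness of commutator subgroups

module GroupIdentities (G : Group 0ℓ 0ℓ) where
  open Group G
  open Subgroups G
  open SetoidReasoning setoid
  open GroupProperties G using (ε⁻¹≈ε; ⁻¹-involutive)

  cancel-right : ∀ x y → (x ∙ y ⁻¹) ∙ y ≈ x
  cancel-right x y = trans (assoc x (y ⁻¹) y) (trans (∙-congˡ (inverseˡ y)) (identityʳ x))

  cancel-left : ∀ x y → x ∙ (x ⁻¹ ∙ y) ≈ y
  cancel-left x y = trans (sym (assoc x (x ⁻¹) y)) (trans (∙-congʳ (inverseʳ x)) (identityˡ y))

  cancel-left′ : ∀ x y → x ⁻¹ ∙ (x ∙ y) ≈ y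
  cancel-left′ x y = trans (sym (assoc (x ⁻¹) x y)) (trans (∙-congʳ (inverseˡ x)) (identityˡ y))

  trivial-commutator : ∀ c y → c ∙ (((ε ∙ y) ∙ ε ⁻¹) ∙ y ⁻¹) ≈ c
  trivial-commutator c y = begin
    c ∙ (((ε ∙ y) ∙ ε ⁻¹) ∙ y ⁻¹) ≈⟨ ∙-congˡ
      (∙-congʳ (trans (∙-cong (identityˡ y) ε⁻¹≈ε) (identityʳ y))) ⟩
    c ∙ (y ∙ y ⁻¹)                ≈⟨ ∙-congˡ (inverseʳ y) ⟩
    c ∙ ε                         ≈⟨ identityʳ c ⟩
    c                             ∎

  commutator-swap : ∀ x y → (((x ∙ y) ∙ x ⁻¹) ∙ y ⁻¹) ∙ (y ∙ x) ≈ x ∙ y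
  commutator-swap x y = begin
    (((x ∙ y) ∙ x ⁻¹) ∙ y ⁻¹) ∙ (y ∙ x) ≈⟨ assoc ((x ∙ y) ∙ x ⁻¹) (y ⁻¹) (y ∙ x) ⟩
    ((x ∙ y) ∙ x ⁻¹) ∙ (y ⁻¹ ∙ (y ∙ x)) ≈⟨ ∙-congˡ (cancel-left′ y x) ⟩
    ((x ∙ y) ∙ x ⁻¹) ∙ x                ≈⟨ cancel-right (x ∙ y) x ⟩
    x ∙ y                               ∎

  -- Writes g⁻¹ n g as n [n⁻¹ , g⁻¹], which lies in the commutator subgroup whenever n does.
  conjugate-by-commutator : ∀ g n → g ∙ (n ∙ (((n ⁻¹ ∙ g ⁻¹) ∙ n ⁻¹ ⁻¹) ∙ g ⁻¹ ⁻¹)) ≈ n ∙ g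
  conjugate-by-commutator g n = begin
    g ∙ (n ∙ (((n ⁻¹ ∙ g ⁻¹) ∙ n ⁻¹ ⁻¹) ∙ g ⁻¹ ⁻¹))
      ≈⟨ ∙-congˡ (∙-congˡ (∙-cong (∙-congˡ (⁻¹-involutive n)) (⁻¹-involutive g))) ⟩
    g ∙ (n ∙ (((n ⁻¹ ∙ g ⁻¹) ∙ n) ∙ g)) ≈⟨ ∙-congˡ
      (∙-congˡ (trans (assoc _ n g) (assoc (n ⁻¹) (g ⁻¹) (n ∙ g)))) ⟩
    g ∙ (n ∙ (n ⁻¹ ∙ (g ⁻¹ ∙ (n ∙ g)))) ≈⟨ ∙-congˡ (cancel-left n _) ⟩
    g ∙ (g ⁻¹ ∙ (n ∙ g))                ≈⟨ cancel-left g (n ∙ g) ⟩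
    n ∙ g                               ∎

  commutatorMap : Carrier → Carrier → Carrier → Carrier
  commutatorMap c y x = c ∙ (((x ∙ y) ∙ x ⁻¹) ∙ y ⁻¹)

  Commutators-isSubgroup : ∀ H → IsSubgroup (Commutators H)
  Commutators-isSubgroup H = record { resp = resp ; ε∈ = ε∈ ; ∙∈ = ∙∈ ; ⁻¹∈ = ⁻¹∈ }

  Commutators-⊆ : ∀ {H} → IsSubgroup H → ∀ {g} → Commutators H g → H g
  Commutators-⊆ sub (comm x∈ y∈) = let module S = IsSubgroup sub in S.∙∈
                                         (S.∙∈ (S.∙∈ x∈ y∈) (S.⁻¹∈ x∈)) (S.⁻¹∈ y∈)
  Commutators-⊆ sub (resp e c)   = IsSubgroup.resp sub e (Commutators-⊆ sub c)
  Commutators-⊆ sub ε∈           = IsSubgroup.ε∈ sub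
  Commutators-⊆ sub (∙∈ c d)     = IsSubgroup.∙∈ sub (Commutators-⊆ sub c) (Commutators-⊆ sub d)
  Commutators-⊆ sub (⁻¹∈ c)      = IsSubgroup.⁻¹∈ sub (Commutators-⊆ sub c)

  derived-Commutators : ∀ k H → derived k (Commutators H) ≡ derived (suc k) H
  derived-Commutators zero    H = ≡.refl
  derived-Commutators (suc k) H = ≡.cong Commutators (derived-Commutators k H)

-- The closed sets are abstracted, so that the group operations stay opaque: the proof
-- components of GL make its elements expensive to compare.
module ConnectedGroups (G : Group 0ℓ 0ℓ) (Closed : Pred (Group.Carrier G) 0ℓ → Set₁)
  (Closed-resp : ∀ {Z} → Closed Z → ∀ {g h} → Group._≈_ G g h → Z g → Z h)
  (Closed-stable : ∀ {Z} → Closed Z → ∀ {g} → ¬¬ Z g → Z g)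
  (Closed-preimage : ∀ c y {Z} → Closed Z → Closed
    (λ x → Z (GroupIdentities.commutatorMap G c y x)))
  where
  open Group G
  open GroupIdentities G
  open Subgroups G

  Connected : Pred Carrier 0ℓ → Set₁
  Connected S = ∀ {Y Z} → Closed Y → Closed Z →
    (∀ g → S g → ¬ (¬ Y g × ¬ Z g)) →
    Satisfiable (S ∩ Y) → Satisfiable (S ∩ Z) → ¬ Empty (S ∩ (Y ∩ Z))

  module _ {S : Pred Carrier 0ℓ} (sub : IsSubgroup S) (conn : Connected S) where

    private
      Separates : Pred Carrier 0ℓ → Pred Carrier 0ℓ → Set
      Separates Y Z = (∀ g → Commutators S g → ¬ (¬ Y g × ¬ Z g)) × Empty (Commutators S ∩ (Y ∩ Z))

      swap : ∀ {Y Z} → Separates Y Z → Separates Z Y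
      swap (cover , empty) = (λ g g∈ (z , y) → cover g g∈ (y , z)) , λ g (g∈ , z , y) → empty g
        (g∈ , y , z)

    -- Multiplying by one commutator stays inside Y, since x ↦ c [x , y] maps the
    -- connected set S to Y ∪ Z and 1 to c.
    stays : ∀ {Y Z d} → Closed Y → Closed Z → Separates Y Z → Commutators S d →
            ∀ {c} → Commutators S c → Y c → Y (c ∙ d)
    stays {Y} {Z} clY clZ (cover , empty) (comm {x} {y} x∈ y∈) {c} c∈ Yc = Closed-stable clY λ ¬Y →
      cover (φ x) (φ∈ x∈) (¬Y , λ Zx →
      conn {λ x → Y (φ x)} {λ x → Z (φ x)} (Closed-preimage c y clY) (Closed-preimage c y clZ)
        (λ g g∈ → cover (φ g) (φ∈ g∈))
        (ε , IsSubgroup.ε∈ sub , Closed-resp clY (sym (trivial-commutator c y)) Yc)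
        (x , x∈ , Zx)
        λ g (g∈ , yz) → empty (φ g) (φ∈ g∈ , yz))
      where
      φ = commutatorMap c y
      φ∈ : ∀ {x} → S x → Commutators S (φ x)
      φ∈ x∈ = ∙∈ c∈ (comm x∈ y∈)
    stays clY clZ sep (resp e d∈) c∈ Yc = Closed-resp clY (∙-congˡ e) (stays clY clZ sep d∈ c∈ Yc)
    stays clY clZ sep ε∈ c∈ Yc = Closed-resp clY (sym (identityʳ _)) Yc
    stays clY clZ sep (∙∈ d∈ e∈) c∈ Yc = Closed-resp clY (assoc _ _ _)
      (stays clY clZ sep e∈ (∙∈ c∈ d∈) (stays clY clZ sep d∈ c∈ Yc))
    -- If c x⁻¹ left Y it would lie in Z; multiplying by x then stays in Z by the same statement
    -- with Y and Z exchanged, so that c would lie in both.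
    stays clY clZ sep@(cover , empty) (⁻¹∈ {x} d∈) {c} c∈ Yc = Closed-stable clY λ ¬Y →
      cover (c ∙ x ⁻¹) (∙∈ c∈ (⁻¹∈ d∈)) (¬Y , λ Zcd → empty c (c∈ , Yc ,
        Closed-resp clZ (cancel-right c x) (stays clZ clY (swap sep) d∈ (∙∈ c∈ (⁻¹∈ d∈)) Zcd)))

    -- If a is in Y and b in Z, then multiplying a by a⁻¹ b, itself in the commutator subgroup, does
    -- not leave Y.
    Connected-Commutators : Connected (Commutators S)
    Connected-Commutators clY clZ cover (a , a∈ , Ya) (b , b∈ , Zb) empty =
      empty b (b∈ , Closed-resp clY (cancel-left a b)
        (stays clY clZ (cover , empty) (∙∈ (⁻¹∈ a∈) b∈) a∈ Ya) , Zb)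

-- Regular functions, closed sets and rational maps on the general linear group

module Zariski (𝒞 : ComplexNumbers) {m : ℕ} where
  open Field 𝒞
  open GeneralLinear 𝒞
  open Linear 𝒞
  open Support 𝒞
  open GL
  open Spherical 𝒞 {m} using (GLₙ; G; Polynomial; var; eval; Closed)
    renaming (con to conᵖ; _:+_ to _+ᵖ_; _:*_ to _*ᵖ_)
  open Group G using () renaming (_≈_ to _≋_)
  open GroupIdentities G using (commutatorMap)

  evalₘ : Polynomial → Matrix (suc m) → Carrier
  evalₘ (conᵖ c)  x = c
  evalₘ (var i j) x = x i j
  evalₘ (p +ᵖ q)  x = evalₘ p x + evalₘ q x
  evalₘ (p *ᵖ q)  x = evalₘ p x * evalₘ q x

  eval≡evalₘ : ∀ p g → eval p g ≡ evalₘ p (matrix g)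
  eval≡evalₘ (conᵖ c)  g = ≡.refl
  eval≡evalₘ (var i j) g = ≡.refl
  eval≡evalₘ (p +ᵖ q)  g = ≡.cong₂ _+_ (eval≡evalₘ p g) (eval≡evalₘ q g)
  eval≡evalₘ (p *ᵖ q)  g = ≡.cong₂ _*_ (eval≡evalₘ p g) (eval≡evalₘ q g)

  evalₘ-cong : ∀ p {x y} → x ≈ₘ y → evalₘ p x ≈ evalₘ p y
  evalₘ-cong (conᵖ c)  e = refl
  evalₘ-cong (var i j) e = e i j
  evalₘ-cong (p +ᵖ q)  e = +-cong (evalₘ-cong p e) (evalₘ-cong q e)
  evalₘ-cong (p *ᵖ q)  e = *-cong (evalₘ-cong p e) (evalₘ-cong q e)

  eval-evalₘ : ∀ p g {x} → matrix g ≈ₘ x → eval p g ≈ evalₘ p x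
  eval-evalₘ p g e = trans (reflexive (eval≡evalₘ p g)) (evalₘ-cong p e)

  eval-cong : ∀ p {g h} → g ≋ h → eval p g ≈ eval p h
  eval-cong p {g} {h} e = trans (eval-evalₘ p g e) (reflexive (≡.sym (eval≡evalₘ p h)))

  :evalₘ : ∀ {X} (C : PolynomialClass X) {M : X → Matrix (suc m)} →
           PolynomialMatrix.𝒫ₘ C M → ∀ p → PolynomialClass.𝒫 C (λ x → evalₘ p (M x))
  :evalₘ C h (conᵖ c)  = PolynomialClass.const C c
  :evalₘ C h (var i j) = h i j
  :evalₘ C h (p +ᵖ q)  = PolynomialClass._:⊕_ C (:evalₘ C h p) (:evalₘ C h q)
  :evalₘ C h (p *ᵖ q)  = PolynomialClass._:⊗_ C (:evalₘ C h p) (:evalₘ C h q)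

  Regular : PolynomialClass GLₙ
  Regular = record
    { 𝒫     = λ f → ∃ λ p → ∀ g → eval p g ≈ f g
    ; resp  = λ e (p , h) → p , λ g → trans (h g) (e g)
    ; const = λ c → conᵖ c , λ _ → refl
    ; _:⊕_  = λ (p , h) (q , k) → (p +ᵖ q) , λ g → +-cong (h g) (k g)
    ; _:⊗_  = λ (p , h) (q , k) → (p *ᵖ q) , λ g → *-cong (h g) (k g)
    }

  open PolynomialClass Regular renaming (resp to :resp)
  open PolynomialMatrix Regular

  :matrix : 𝒫ₘ matrix
  :matrix i j = var i j , λ _ → refl

  :constₘ : ∀ {n} (M : Matrix n) → 𝒫ₘ (λ _ → M)
  :constₘ M i j = const (M i j)

  regular-cong : ∀ {f} → 𝒫 f → ∀ {g h} → g ≋ h → f g ≈ f h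
  regular-cong (p , e) {g} {h} g≋h = trans (sym (e g)) (trans (eval-cong p {g} {h} g≋h) (e h))

  Closed-zeros : ∀ {I : Set} {F : I → GLₙ → Carrier} → (∀ i → 𝒫 (F i)) → Closed
    (λ g → ∀ i → F i g ≈ 0#)
  Closed-zeros {F = F} h = (λ p → ∃ λ i → ∀ g → eval p g ≈ F i g) , λ g → mk⇔
    (λ z p (i , e) → trans (e g) (z i))
    (λ z i → let (p , e) = h i in trans (sym (e g)) (z p (i , e)))

  Closed-resp : ∀ {Z} → Closed Z → ∀ {g h} → g ≋ h → Z g → Z h
  Closed-resp (𝓕 , Z⇔) {g} {h} g≋h z = Equivalence.from (Z⇔ h) λ p p∈ →
    trans (eval-cong p {h} {g} (λ i j → sym (g≋h i j))) (Equivalence.to (Z⇔ g) z p p∈)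

  Closed-stable : ∀ {Z} → Closed Z → ∀ {g} → ¬¬ Z g → Z g
  Closed-stable (𝓕 , Z⇔) {g} ¬¬z = Equivalence.from (Z⇔ g) λ p p∈ →
    stable (¬¬z >>= λ z → pure (Equivalence.to (Z⇔ g) z p p∈))

  pow : Carrier → ℕ → Carrier
  pow x zero    = 1#
  pow x (suc k) = x * pow x k

  Unit-pow : ∀ {x} k → Unit x → Unit (pow x k)
  Unit-pow zero    u = Unit-1
  Unit-pow (suc k) u = Unit-* u (Unit-pow k u)

  pow-+ : ∀ x k l → pow x (k ℕ.+ l) ≈ pow x k * pow x l
  pow-+ x zero    l = sym (*-identityˡ _)
  pow-+ x (suc k) l = trans (*-congˡ (pow-+ x k l)) (sym (*-assoc x _ _))

  :pow : ∀ {d} → 𝒫 d → ∀ k → 𝒫 (λ g → pow (d g) k)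
  :pow p zero    = const 1#
  :pow p (suc k) = p :⊗ :pow p k

  clear-denominators : ∀ {d : GLₙ → Carrier} {M : GLₙ → Matrix (suc m)} → 𝒫 d →
    𝒫ₘ (λ g i j → d g * M g i j) → ∀ p → ∃ λ k → 𝒫 (λ g → pow (d g) k * evalₘ p (M g))
  clear-denominators pd pM (conᵖ c)  = 0 , :resp (λ _ → sym (*-identityˡ c)) (const c)
  clear-denominators pd pM (var i j) = 1 , :resp (λ _ → *-congʳ (sym (*-identityʳ _))) (pM i j)
  clear-denominators {d} {M} pd pM (p +ᵖ q) =
    let (k , hp) = clear-denominators pd pM p ; (l , hq) = clear-denominators pd pM q in
    k ℕ.+ l , :resp (λ g → begin
      pow (d g) l * (pow (d g) k * evalₘ p (M g)) + pow (d g) k * (pow (d g) l * evalₘ q (M g))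
        ≈⟨ solve 4 (λ a b p q → a :* (b :* p) :+ b :* (a :* q) := (b :* a) :* (p :+ q)) refl
             (pow (d g) l) (pow (d g) k) (evalₘ p (M g)) (evalₘ q (M g)) ⟩
      (pow (d g) k * pow (d g) l) * (evalₘ p (M g) + evalₘ q (M g)) ≈⟨ *-congʳ (pow-+ (d g) k l) ⟨
      pow (d g) (k ℕ.+ l) * (evalₘ p (M g) + evalₘ q (M g)) ∎)
      ((:pow pd l :⊗ hp) :⊕ (:pow pd k :⊗ hq))
  clear-denominators {d} {M} pd pM (p *ᵖ q) =
    let (k , hp) = clear-denominators pd pM p ; (l , hq) = clear-denominators pd pM q in
    k ℕ.+ l , :resp (λ g → begin
      (pow (d g) k * evalₘ p (M g)) * (pow (d g) l * evalₘ q (M g))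
        ≈⟨ solve 4 (λ a b p q → (b :* p) :* (a :* q) := (b :* a) :* (p :* q)) refl
             (pow (d g) l) (pow (d g) k) (evalₘ p (M g)) (evalₘ q (M g)) ⟩
      (pow (d g) k * pow (d g) l) * (evalₘ p (M g) * evalₘ q (M g)) ≈⟨ *-congʳ (pow-+ (d g) k l) ⟨
      pow (d g) (k ℕ.+ l) * (evalₘ p (M g) * evalₘ q (M g)) ∎)
      (hp :⊗ hq)

  Rational : (GLₙ → GLₙ) → Set
  Rational φ = ∀ x₀ → ∃ λ d → 𝒫 d × Unit (d x₀) × 𝒫ₘ (λ x i j → d x * matrix (φ x) i j)

  -- The preimage is cut out by all polynomials of the form δ · (p ∘ φ) with p among the equations
  -- of Z and δ an arbitrary function. They vanish where p ∘ φ does; conversely, at each point the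
  -- local denominator provides an invertible δ, so their vanishing there forces that of p ∘ φ.
  Closed-preimage : ∀ {φ Z} → Rational φ → Closed Z → Closed (λ x → Z (φ x))
  Closed-preimage {φ} {Z} rat (𝓕 , Z⇔) = 𝓕′ , λ x → mk⇔
    (λ z q (p , p∈ , δ , h) → trans (h x) (x*0≈0 (Equivalence.to (Z⇔ (φ x)) z p p∈)))
    (λ h → Equivalence.from (Z⇔ (φ x)) λ p p∈ →
      let (d , pd , u , pM)  = rat x
          (k , q , e)        = clear-denominators pd pM p
          e′ = λ g → trans (e g) (*-congˡ (reflexive (≡.sym (eval≡evalₘ p (φ g)))))
      in Unit-cancel (Unit-pow k u) (trans (sym (e′ x)) (h q (p , p∈ , (λ g → pow (d g) k) , e′))))
    where
    𝓕′ : Pred Polynomial 0ℓ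
    𝓕′ q = ∃ λ p → 𝓕 p × ∃ λ δ → ∀ x → eval q x ≈ δ x * eval p (φ x)

  -- By Cramer's rule near x₀: den (x₀⁻¹ x) does not vanish at x₀.
  Rational-commutator : ∀ c y → Rational (commutatorMap c y)
  Rational-commutator c y x₀ = d , :den :X , den-unit , λ i j →
    :resp (λ x → trans (expand x i j) (sym (scaleM x i j)))
      (:*ₘ {M = λ _ → matrix c} (:constₘ (matrix c)) (:*ₘ {N = λ _ → inverse y} (:*ₘ
        (:*ₘ {N = λ _ → matrix y} :matrix (:constₘ (matrix y)))
        (:*ₘ {N = λ _ → inverse x₀} (:adj :X) (:constₘ (inverse x₀)))) (:constₘ (inverse y))) i j)
    where
    X : GLₙ → Matrix (suc m)
    X x = inverse x₀ *ₘ matrix x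
    d : GLₙ → Carrier
    d x = den (X x)
    :X : 𝒫ₘ X
    :X = :*ₘ {M = λ _ → inverse x₀} (:constₘ (inverse x₀)) :matrix
    den-unit : Unit (d x₀)
    den-unit = den-upper (X x₀)
      (λ i j j<i → trans (inverseˡ x₀ i j) (1ₘ-off i j λ { ≡.refl → ℕₚ.<-irrefl ≡.refl j<i }))
      (λ i → Unit-cong (sym (trans (inverseˡ x₀ i i) (1ₘ-diag i))) Unit-1)
    scaled : Carrier → Matrix (suc m) → Matrix (suc m)
    scaled a M i j = a * M i j
    scaled-inverse : ∀ x → adj (X x) *ₘ inverse x₀ ≈ₘ scaled (d x) (inverse x)
    scaled-inverse x i j = begin
      (adj (X x) *ₘ inverse x₀) i j
        ≈⟨ *ₘ-identityʳ (adj (X x) *ₘ inverse x₀) i j ⟨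
      ((adj (X x) *ₘ inverse x₀) *ₘ 1ₘ) i j
        ≈⟨ *ₘ-cong₂ (adj (X x) *ₘ inverse x₀) (inverseʳ x) i j ⟨
      ((adj (X x) *ₘ inverse x₀) *ₘ (matrix x *ₘ inverse x)) i j
        ≈⟨ *ₘ-assoc (adj (X x) *ₘ inverse x₀) (matrix x) (inverse x) i j ⟨
      (((adj (X x) *ₘ inverse x₀) *ₘ matrix x) *ₘ inverse x) i j
        ≈⟨ *ₘ-cong₁ (inverse x) (*ₘ-assoc (adj (X x)) (inverse x₀) (matrix x)) i j ⟩
      ((adj (X x) *ₘ X x) *ₘ inverse x) i j
        ≈⟨ *ₘ-cong₁ (inverse x) (adj-inverseˡ (X x)) i j ⟩
      (scaled (d x) 1ₘ *ₘ inverse x) i j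
        ≈⟨ ∙-scaleˡ (d x) (1ₘ i) (λ k → inverse x k j) ⟩
      d x * (1ₘ *ₘ inverse x) i j
        ≈⟨ *-congˡ (*ₘ-identityˡ (inverse x) i j) ⟩
      d x * inverse x i j ∎
    expand : ∀ x → matrix c *ₘ (((matrix x *ₘ matrix y) *ₘ (adj (X x) *ₘ inverse x₀)) *ₘ inverse y)
      ≈ₘ
                   matrix c *ₘ (scaled (d x) ((matrix x *ₘ matrix y) *ₘ inverse x) *ₘ inverse y)
    expand x = *ₘ-cong₂ (matrix c) (*ₘ-cong₁ (inverse y) λ i j →
      trans (*ₘ-cong₂ (matrix x *ₘ matrix y) (scaled-inverse x) i j)
            (∙-scaleʳ (d x) ((matrix x *ₘ matrix y) i) (λ k → inverse x k j)))
    scaleM : ∀ x i j → d x * (matrix c *ₘ (((matrix x *ₘ matrix y) *ₘ inverse x) *ₘ inverse y)) i j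
      ≈
                       (matrix c *ₘ (scaled (d x) ((matrix x *ₘ matrix y) *ₘ inverse x) *ₘ
                         inverse y)) i j
    scaleM x i j = sym (trans (*ₘ-cong₂ (matrix c)
      (λ k l → ∙-scaleˡ (d x) (((matrix x *ₘ matrix y) *ₘ inverse x) k) (λ o → inverse y o l)) i j)
                              (∙-scaleʳ (d x) (matrix c i)
                                (λ k → (((matrix x *ₘ matrix y) *ₘ inverse x) *ₘ inverse y) k j)))

-- The Lie-Kolchin theorem

module LieKolchin (𝒞 : ComplexNumbers) (G : Group 0ℓ 0ℓ)
  (Regular : Field.PolynomialClass 𝒞 (Group.Carrier G))
  (regular-cong : ∀ {f} → Field.PolynomialClass.𝒫 Regular f → ∀ {g h} → Group._≈_ G g h →
    ComplexNumbers._≈_ 𝒞 (f g) (f h))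
  (Closed : Pred (Group.Carrier G) 0ℓ → Set₁)
  (Closed-zeros : ∀ {I : Set} {F : I → Group.Carrier G → ComplexNumbers.Carrier 𝒞} →
     (∀ i → Field.PolynomialClass.𝒫 Regular (F i)) → Closed
       (λ g → ∀ i → ComplexNumbers._≈_ 𝒞 (F i g) (ComplexNumbers.0# 𝒞)))
  (Closed-resp : ∀ {Z} → Closed Z → ∀ {g h} → Group._≈_ G g h → Z g → Z h)
  (Closed-stable : ∀ {Z} → Closed Z → ∀ {g} → ¬¬ Z g → Z g)
  (Closed-preimage : ∀ c y {Z} → Closed Z → Closed
    (λ x → Z (GroupIdentities.commutatorMap G c y x)))
  where
  open Field 𝒞
  open GeneralLinear 𝒞 hiding (module GL; GL; GL-group; perm)
  open Linear 𝒞 renaming (_∙_ to _⊙_)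
  open Support 𝒞
  open Eigen 𝒞
  open Operator
  private module 𝔾 = Group G
  open 𝔾 using (_∙_; _⁻¹; ε) renaming (Carrier to Γ; _≈_ to _≋_)
  open GroupIdentities G
  open ConnectedGroups G Closed Closed-resp Closed-stable Closed-preimage
  open Subgroups G hiding (resp; ε∈)
  open PolynomialClass Regular using (𝒫; const; _:⊗_; _:⊖_)
  open PolynomialMatrix Regular

  -- The map is polynomial on the whole group, so that closed conditions can be stated, but
  -- multiplicative only on S: the lower right block formed in `triangularise` is a homomorphism
  -- only there.
  record Representation (S : Pred Γ 0ℓ) (d : ℕ) : Set where
    field
      ρ    : Γ → Matrix d
      poly : 𝒫ₘ ρ
      homo : ∀ {g h} → S g → S h → ρ (g ∙ h) ≈ₘ ρ g *ₘ ρ h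
      unit : ρ ε ≈ₘ 1ₘ

    cong : ∀ {g h} → g ≋ h → ρ g ≈ₘ ρ h
    cong e i j = regular-cong (poly i j) e

    cong-act : ∀ {g h} → g ≋ h → ∀ v → ρ g *ᵥ v ≈ᵥ ρ h *ᵥ v
    cong-act e v i = ∙-cong {v = v} (cong e i) (λ _ → refl)

    homo-act : ∀ {g h} → S g → S h → ∀ v → ρ (g ∙ h) *ᵥ v ≈ᵥ ρ g *ᵥ (ρ h *ᵥ v)
    homo-act {g} {h} g∈ h∈ v i = trans (∙-cong {v = v} (homo g∈ h∈ i) (λ _ → refl))
      (*ᵥ-assoc (ρ g) (ρ h) v i)

    unit-act : ∀ v → ρ ε *ᵥ v ≈ᵥ v
    unit-act v i = trans (∙-cong {v = v} (unit i) (λ _ → refl)) (1ₘ-∙ v i)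

    Stable : (Vector d → Set) → Set
    Stable W = ∀ {g v} → S g → W v → W (ρ g *ᵥ v)

    Minimal : (Vector d → Set) → Set₁
    Minimal W = ∀ W′ → IsSubspace W′ → Stable W′ → (∀ {v} → W′ v → W v) → (∃ λ v → W′ v × v ≢0) →
                ∀ {v} → W v → ¬¬ W′ v

    record MinimalSubspace (W : Vector d → Set) : Set₁ where
      field
        W₀       : Vector d → Set
        subspace : IsSubspace W₀
        stb      : Stable W₀
        W₀⊆W     : ∀ {v} → W₀ v → W v
        v        : Vector d
        v∈       : W₀ v
        v≢0      : v ≢0
        minimal  : Minimal W₀

    -- Unless W is minimal, a stable subspace misses some vector of W, and its dimension bound is
    -- smaller by `DimAtMost-smaller`.
    minimal-subspace : ∀ k W → IsSubspace W → Stable W → DimAtMost k W → (∃ λ v → W v × v ≢0) →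
      ¬¬ MinimalSubspace W
    minimal-subspace zero    W sub stb dim (v , v∈ , v≢0) = dim (λ _ → v) (λ _ → v∈) >>= λ
      { (c , (zero , c≉0) , e) → contradiction
        (λ j → stable λ ne → *-≉0 c≉0 ne (trans (sym (+-identityʳ _)) (e j))) v≢0 }
    minimal-subspace (suc k) W sub stb dim (v , v∈ , v≢0) = em (Minimal W) >>= λ
      { (inj₁ min)  → pure (record { W₀ = W ; subspace = sub ; stb = stb ; W₀⊆W = λ w →
        w ; v∈ = v∈ ; v≢0 = v≢0 ; minimal = min })
      ; (inj₂ ¬min) → λ done → ¬min λ W′ sub′ stb′ W′⊆W nz′ {y} y∈ y∉ →
          minimal-subspace k W′ sub′ stb′ (DimAtMost-smaller sub′ W′⊆W y∈ y∉ dim) nz′ λ M →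
          let open MinimalSubspace M in
          done (record { W₀ = W₀ ; subspace = subspace ; stb = MinimalSubspace.stb M ; W₀⊆W = λ w →
            W′⊆W (W₀⊆W w)
                       ; v∈ = MinimalSubspace.v∈ M ; v≢0 = MinimalSubspace.v≢0 M ; minimal =
                         minimal }) }

    -- Asking for eigenvectors along the whole orbit makes this a stable subspace, whatever A is. In
    -- a minimal W it is therefore everything as soon as it is nonzero, so that A acts on W as the
    -- scalar a.
    EigenOrbit : Matrix d → Carrier → (Vector d → Set) → Vector d → Set
    EigenOrbit A a W v = W v × (∀ g → S g → Eigen A a (ρ g *ᵥ v))

    EigenOrbit-subspace : ∀ {A a W} → IsSubspace W → IsSubspace (EigenOrbit A a W)
    EigenOrbit-subspace {A} {a} sub = record
      { resp  = λ {u} {v} e (w , h) → resp e w , λ g g∈ i → trans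
        (*ᵥ-cong A (*ᵥ-cong (ρ g) (λ j → sym (e j))) i)
          (trans (h g g∈ i) (*-congˡ (*ᵥ-cong (ρ g) e i)))
      ; 0∈    = 0∈ , λ g g∈ i → trans (∙-0ʳ (A i) (λ j → ∙-0ʳ (ρ g j) (λ _ → refl)))
        (sym (x*0≈0 (∙-0ʳ (ρ g i) (λ _ → refl))))
      ; +∈    = λ {u} {v} (u∈ , hu) (v∈ , hv) → +∈ u∈ v∈ , λ g g∈ i → begin
          A i ⊙ (ρ g *ᵥ (λ k → u k + v k)) ≈⟨ ∙-cong {u = A i} (λ _ → refl)
            (λ j → ∙-+ʳ (ρ g j) u v) ⟩
          A i ⊙ (λ j → (ρ g *ᵥ u) j + (ρ g *ᵥ v) j) ≈⟨ ∙-+ʳ (A i) (ρ g *ᵥ u) (ρ g *ᵥ v) ⟩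
          A i ⊙ (ρ g *ᵥ u) + A i ⊙ (ρ g *ᵥ v) ≈⟨ +-cong (hu g g∈ i) (hv g g∈ i) ⟩
          a * (ρ g *ᵥ u) i + a * (ρ g *ᵥ v) i ≈⟨ distribˡ a _ _ ⟨
          a * ((ρ g *ᵥ u) i + (ρ g *ᵥ v) i) ≈⟨ *-congˡ (∙-+ʳ (ρ g i) u v) ⟨
          a * (ρ g *ᵥ (λ k → u k + v k)) i ∎
      ; scale = λ c {u} (u∈ , hu) → scale c u∈ , λ g g∈ i → begin
          A i ⊙ (ρ g *ᵥ (λ k → c * u k)) ≈⟨ ∙-cong {u = A i} (λ _ → refl)
            (λ j → ∙-scaleʳ c (ρ g j) u) ⟩
          A i ⊙ (λ j → c * (ρ g *ᵥ u) j) ≈⟨ ∙-scaleʳ c (A i) (ρ g *ᵥ u) ⟩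
          c * (A i ⊙ (ρ g *ᵥ u)) ≈⟨ *-congˡ (hu g g∈ i) ⟩
          c * (a * (ρ g *ᵥ u) i) ≈⟨ solve 3 (λ c a x → c :* (a :* x) := a :* (c :* x)) refl c a _ ⟩
          a * (c * (ρ g *ᵥ u) i) ≈⟨ *-congˡ (∙-scaleʳ c (ρ g i) u) ⟨
          a * (ρ g *ᵥ (λ k → c * u k)) i ∎
      }
      where open IsSubspace sub

    module _ (sub : IsSubgroup S) where
      private module S = IsSubgroup sub

      orbit-≢0 : ∀ {g v} → S g → v ≢0 → (ρ g *ᵥ v) ≢0
      orbit-≢0 {g} {v} g∈ v≢0 e = v≢0 λ i → begin
        v i                                ≈⟨ unit-act v i ⟨
        (ρ ε *ᵥ v) i                       ≈⟨ cong-act (𝔾.inverseˡ g) v i ⟨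
        (ρ (g ⁻¹ ∙ g) *ᵥ v) i              ≈⟨ homo-act (S.⁻¹∈ g∈) g∈ v i ⟩
        (ρ (g ⁻¹) *ᵥ (ρ g *ᵥ v)) i         ≈⟨ ∙-0ʳ (ρ (g ⁻¹) i) e ⟩
        0#                                 ∎

      EigenOrbit-stable : ∀ {A a W} → Stable W → Stable (EigenOrbit A a W)
      EigenOrbit-stable {A} stb {h} {v} h∈ (v∈ , e) = stb h∈ v∈ , λ g g∈ i →
        trans (*ᵥ-cong A (λ j → sym (homo-act g∈ h∈ v j)) i)
          (trans (e (g ∙ h) (S.∙∈ g∈ h∈) i) (*-congˡ (homo-act g∈ h∈ v i)))

      -- The eigenvalue at ρ g v is a root of a fixed polynomial, hence locally
      -- constant in g.
      eigenvalue-constant : Connected S → ∀ A {a v} → v ≢0 → Eigen A a v →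
        (∀ {g} → S g → ¬¬ (∃ λ b → Eigen A b (ρ g *ᵥ v))) → ∀ {g} → S g → Eigen A a (ρ g *ᵥ v)
      eigenvalue-constant conn A {a} {v} v≢0 ev eigen {g} g∈ i = stable λ g∉Y →
        annihilator A λ (as , ann) → remove-root A as a λ (bs , u , root) →
        -- At ρ g v the eigenvalue is a root of the annihilating polynomial `as`: it is a on Y and
        -- some other root on Z. The two cannot meet on S, since `differences bs a` is invertible
        -- and ρ g v is nonzero.
        let Y = λ g → ∀ i → shift A a (F g) i ≈ 0#
            Z = λ g → ∀ i → shifts A bs (F g) i ≈ 0#
            cover : ∀ g → S g → ¬ (¬ Y g × ¬ Z g)
            cover g g∈ (¬Y , ¬Z) = eigen g∈ λ (b , e) → ¬Z λ i → trans (shifts-eigen A bs e i)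
              (0*x≈0
              (root b (stable λ ne → ≢0⇒entry (orbit-≢0 g∈ v≢0) λ (j , Fj≉0) → *-≉0 ne Fj≉0
                         (trans (sym (shifts-eigen A as e j)) (ann (F g) j)))
                      λ b≈a → ¬Y λ i → x≈y⇒x-y≈0 (trans (e i) (*-congʳ b≈a))))
        in cover g g∈ ((λ y → g∉Y (x-y≈0⇒x≈y (y i))) , λ z →
           conn {Y} {Z} (Closed-zeros (:shift a {F} :F)) (Closed-zeros (:shifts bs)) cover
             (ε , S.ε∈ , λ i → trans (shift-cong A a (unit-act v) i) (x≈y⇒x-y≈0 (ev i)))
             (g , g∈ , z)
             λ h (h∈ , y , z) → orbit-≢0 h∈ v≢0 λ i →
               Unit-cancel u (trans (sym (shifts-eigen A bs (λ j → x-y≈0⇒x≈y (y j)) i)) (z i)))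
        where
        F : Γ → Vector d
        F g = ρ g *ᵥ v
        :F : ∀ i → 𝒫 (λ g → F g i)
        :F i = :∙ (poly i) (λ k → const (v k))
        :shift : ∀ b {F : Γ → Vector d} → (∀ i → 𝒫 (λ g → F g i)) → ∀ i → 𝒫
          (λ g → shift A b (F g) i)
        :shift b p i = :∙ (λ k → const (A i k)) p :⊖ (const b :⊗ p i)
        :shifts : ∀ bs i → 𝒫 (λ g → shifts A bs (F g) i)
        :shifts []       = :F
        :shifts (b ∷ bs) = :shift b {λ g → shifts A bs (F g)} (:shifts bs)
        ≢0⇒entry : ∀ {u : Vector d} → u ≢0 → ¬¬ (∃ λ i → ¬ u i ≈ 0#)
        ≢0⇒entry ne k = ne λ i → stable λ ui≉0 → k (i , ui≉0)

  restrict : ∀ {S d} → IsSubgroup S → Representation S d → Representation (Commutators S) d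
  restrict sub R = record { ρ = ρ ; poly = poly ; unit = unit
    ; homo = λ g∈ h∈ → homo (Commutators-⊆ sub g∈) (Commutators-⊆ sub h∈) }
    where open Representation R

  -- Induction on the derived length. On a minimal stable subspace the commutator subgroup has a
  -- common eigenvector; connectedness and minimality make first the commutators and then all of S
  -- act there by scalars.
  common-eigenvector : ∀ k {S d} → IsSubgroup S → Connected S → (∀ {g} → derived k S g → g ≋ ε) →
    (R : Representation S d) → let open Representation R in
    ∀ {W} → IsSubspace W → Stable W → (∃ λ v → W v × v ≢0) →
    ¬¬ (∃ λ v → W v × v ≢0 × (∀ g → S g → ¬¬ (∃ λ a → Eigen (ρ g) a v)))
  common-eigenvector zero sub conn triv R wsub wstb (v , v∈ , v≢0) = pure
    (v , v∈ , v≢0 , λ g g∈ → pure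
    (1# , λ i → trans (cong-act (triv g∈) v i) (trans (unit-act v i) (sym (*-identityˡ _)))))
    where open Representation R
  common-eigenvector (suc k) {S} {d} sub conn triv R {W} wsub wstb nz =
    minimal-subspace d W wsub wstb (λ f _ → dependent f) nz >>= λ M →
    let open MinimalSubspace M renaming (subspace to sub₀; stb to stb₀; v∈ to y∈; v≢0 to y≢0;
          minimal to min) in
    common-eigenvector k (Commutators-isSubgroup S) (Connected-Commutators sub conn)
      (λ {g} g∈ → triv (≡.subst (λ D → D g) (derived-Commutators k S) g∈)) (restrict sub R) sub₀
      (λ g∈ → stb₀ (Commutators-⊆ sub g∈)) (_ , y∈ , y≢0) >>= λ (v₀ , v₀∈ , v₀≢0 , eig₀) →
    let
      scalar-from : ∀ {h} → S h → ∀ {x a} → W₀ x → x ≢0 → Eigen (ρ h) a x →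
        (∀ {g} → S g → ¬¬ (∃ λ b → Eigen (ρ h) b (ρ g *ᵥ x))) → ∀ v → W₀ v → Eigen (ρ h) a v
      scalar-from {h} h∈ {x} {a} x∈ x≢0 e eig v v∈ i = stable
        (min (EigenOrbit (ρ h) a W₀) (EigenOrbit-subspace sub₀)
          (λ {g} {v} → EigenOrbit-stable sub {ρ h} {a} {W₀} stb₀ {g} {v}) proj₁
          (x , (x∈ , λ g → eigenvalue-constant sub conn (ρ h) x≢0 e eig) , x≢0) v∈ >>= λ (_ , all) →
        pure (trans (*ᵥ-cong (ρ h) (λ j → sym (unit-act v j)) i)
          (trans (all ε S.ε∈ i) (*-congˡ (unit-act v i)))))

      -- The conjugate g⁻¹ n g lies in the commutator subgroup, hence has v₀ as an eigenvector; so n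
      -- has ρ g v₀ as one.
      scalar₀ : ∀ {n} → Commutators S n → ¬¬ (∃ λ a → ∀ v → W₀ v → Eigen (ρ n) a v)
      scalar₀ {n} n∈ = eig₀ n n∈ >>= λ (a , e) → pure
        (a , scalar-from (Commutators-⊆ sub n∈) v₀∈ v₀≢0 e λ {g} g∈ →
        let n∙c∈ = ∙∈ n∈ (comm (S.⁻¹∈ (Commutators-⊆ sub n∈)) (S.⁻¹∈ g∈)) in
        eig₀ _ n∙c∈ >>= λ (b , e′) → pure (b , λ i →
          trans (sym (homo-act (Commutators-⊆ sub n∈) g∈ v₀ i))
            (trans (sym (cong-act (conjugate-by-commutator g n) v₀ i))
          (trans (homo-act g∈ (Commutators-⊆ sub n∙c∈) v₀ i)
            (trans (*ᵥ-cong (ρ g) e′ i) (∙-scaleʳ b (ρ g i) v₀))))))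

      -- For an eigenvector x of h with value a, h g x = [h , g] g h x = b a (g x), where b is the
      -- scalar by which the commutator acts. The orbit of x thus consists of eigenvectors of h.
      scalar : ∀ {h} → S h → ¬¬ (∃ λ a → ∀ v → W₀ v → Eigen (ρ h) a v)
      scalar {h} h∈ = eigenvector (ρ h) sub₀ (stb₀ h∈) y∈ y≢0 >>= λ (x , x∈ , x≢0 , a , e) →
        pure (a , scalar-from h∈ x∈ x≢0 e λ {g} g∈ →
          let c∈ = comm h∈ g∈ in scalar₀ c∈ >>= λ (b , e′) → pure (b * a , λ i →
            trans (sym (homo-act h∈ g∈ x i)) (trans (sym (cong-act (commutator-swap h g) x i))
            (trans (homo-act (Commutators-⊆ sub c∈) (S.∙∈ g∈ h∈) x i)
              (trans (e′ (ρ (g ∙ h) *ᵥ x) (stb₀ (S.∙∈ g∈ h∈) x∈) i)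
            (trans (*-congˡ (trans (homo-act g∈ h∈ x i)
              (trans (*ᵥ-cong (ρ g) e i) (∙-scaleʳ a (ρ g i) x)))) (sym (*-assoc b a _))))))))
    in pure (v₀ , W₀⊆W v₀∈ , v₀≢0 , λ h h∈ → scalar h∈ >>= λ (a , e) → pure (a , e v₀ v₀∈))
    where
    open Representation R
    module S = IsSubgroup sub

  extend : ∀ {n} → Matrix n → Matrix (suc n)
  extend M zero    zero    = 1#
  extend M zero    (suc j) = 0#
  extend M (suc i) zero    = 0#
  extend M (suc i) (suc j) = M i j

  extend-* : ∀ {n} {M N : Matrix n} → M *ₘ N ≈ₘ 1ₘ → extend M *ₘ extend N ≈ₘ 1ₘ
  extend-* {N = N} e zero    zero    = trans
    (+-cong (*-identityˡ _) (∙-0ˡ (λ k → extend N (suc k) zero) (λ _ → refl))) (+-identityʳ _)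
  extend-* {N = N} e zero    (suc j) = trans
    (+-cong (zeroʳ _) (∙-0ˡ (λ k → extend N (suc k) (suc j)) (λ _ → refl))) (+-identityʳ _)
  extend-* {M = M} e (suc i) zero = trans (+-cong (zeroˡ _) (∙-0ʳ (M i) (λ _ → refl)))
    (+-identityʳ _)
  extend-* e (suc i) (suc j) = trans (trans (+-cong (zeroʳ _) (e i j)) (+-identityˡ _))
    (sym (1ₘ-suc i j))

  record Triangularisation {S d} (R : Representation S d) (E : Rel (Fin d) 0ℓ) : Set where
    open Representation R
    field
      P P⁻¹    : Matrix d
      P⁻¹P     : P⁻¹ *ₘ P ≈ₘ 1ₘ
      PP⁻¹     : P *ₘ P⁻¹ ≈ₘ 1ₘ
      P-Supp   : Supp E P
      P⁻¹-Supp : Supp E P⁻¹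
      upper    : ∀ g → S g → Upper (P⁻¹ *ₘ (ρ g *ₘ P))

  module _ {d} {E : Rel (Fin (suc d)) 0ℓ} (E-refl : Reflexive E) (E-sym : Symmetric E)
    (E-trans : Transitive E)
           {v : Vector (suc d)} (v-supp : ∀ i → ¬ E i zero → v i ≈ 0#) (v≢0 : v ≢0) where

    e₀ : Vector (suc d)
    e₀ i = 1ₘ i zero

    -- The coordinate at 0 serves if v does not vanish there. Otherwise a coordinate p with vₚ ≠ 0
    -- is added, which keeps the value 1 at e₀; p lies in the block of 0 because v is supported on
    -- it.
    functional : ¬¬ (∃ λ (φ : Vector (suc d)) → φ zero ≈ 1# × (∀ j → ¬ E zero j → φ j ≈ 0#) × Unit
      (φ ⊙ v))
    functional = ≈0? (v zero) >>= λ
      { (inj₂ u)    → pure ((λ j → 1ₘ zero j) , refl ,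
        (λ j ¬e → 1ₘ-off zero j λ { ≡.refl → ¬e E-refl }) , Unit-cong (sym (1ₘ-∙ v zero)) u)
      ; (inj₁ v₀≈0) → (λ none → v≢0 (λ i → stable λ ne → none (i , ne))) >>= λ (p , vp≉0) →
        ≉0⇒Unit vp≉0 >>= λ u →
          em (E p zero) >>= λ
          { (inj₂ ¬e) → contradiction (v-supp p ¬e) vp≉0
          ; (inj₁ e)  → pure ((λ j → 1ₘ zero j + 1ₘ p j)
              , trans (+-congˡ (1ₘ-off p zero λ { ≡.refl → vp≉0 v₀≈0 })) (+-identityʳ _)
              , (λ j ¬e → trans (+-cong (1ₘ-off zero j λ { ≡.refl → ¬e E-refl })
                (1ₘ-off p j λ { ≡.refl → ¬e (E-sym e) })) (+-identityʳ _))
              , Unit-cong (begin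
                  v p ≈⟨ +-identityˡ _ ⟨
                  0# + v p ≈⟨ +-cong (sym (trans (∙-comm v (1ₘ zero)) (trans (1ₘ-∙ v zero) v₀≈0)))
                    (sym (trans (∙-comm v (1ₘ p)) (1ₘ-∙ v p))) ⟩
                  v ⊙ 1ₘ zero + v ⊙ 1ₘ p ≈⟨ ∙-+ʳ v (1ₘ zero) (1ₘ p) ⟨
                  v ⊙ (λ j → 1ₘ zero j + 1ₘ p j) ≈⟨ ∙-comm v (λ j → 1ₘ zero j + 1ₘ p j) ⟩
                  (λ j → 1ₘ zero j + 1ₘ p j) ⊙ v ∎) u) } }

    record FirstColumn : Set where
      field
        Q Q⁻¹    : Matrix (suc d)
        Q⁻¹Q     : Q⁻¹ *ₘ Q ≈ₘ 1ₘ
        QQ⁻¹     : Q *ₘ Q⁻¹ ≈ₘ 1ₘ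
        Q-Supp   : Supp E Q
        Q⁻¹-Supp : Supp E Q⁻¹
        Qe₀      : ∀ i → Q i zero ≈ v i

    -- Q = 1 + (v - e₀) φ for a functional with φ e₀ = 1 and φ v ≠ 0.
    first-column : ¬¬ FirstColumn
    first-column = functional >>= λ (φ , φ₀ , φ-supp , (y , φv*y)) →
      let a = λ i → v i - e₀ i
          -- (1 + a φ)⁻¹ = 1 - (1 + φ(a))⁻¹ a φ, and 1 + φ(a) = φ(v) has the inverse y.
          b = λ i → - y * a i
          φa : φ ⊙ a ≈ φ ⊙ v - 1#
          φa = trans (∙-subʳ φ v e₀) (+-congˡ (-‿cong (trans (∙-1ₘ φ zero) φ₀)))
          φb : φ ⊙ b ≈ - y * (φ ⊙ v - 1#)
          φb = trans (∙-scaleʳ (- y) φ a) (*-congˡ φa)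
          supp-a : ∀ i → ¬ E i zero → a i ≈ 0#
          supp-a i ¬e = trans (+-cong (v-supp i ¬e)
            (-‿cong (1ₘ-off i zero λ { ≡.refl → ¬e E-refl }))) (-‿inverseʳ 0#)
          supp : ∀ {c : Vector (suc d)} → (∀ i → ¬ E i zero → c i ≈ 0#) → Supp E (rank-one c φ)
          supp {c} hc i j ¬e = trans (+-cong (1ₘ-off i j λ { ≡.refl → ¬e E-refl })
            (entries-≈0 {P = E i zero} {Q = E zero j} (λ (p , q) → ¬e (E-trans p q)) (hc i)
              (φ-supp j))) (+-identityʳ _)
          1-φv : (φ ⊙ v) * y - 1# ≈ 0#
          1-φv = x≈y⇒x-y≈0 φv*y
      in pure record
      { Q = rank-one a φ ; Q⁻¹ = rank-one b φ
      ; QQ⁻¹ = rank-one-* a b φ λ i → begin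
          a i + - y * a i + a i * (φ ⊙ b) ≈⟨ +-congˡ (*-congˡ φb) ⟩
          a i + - y * a i + a i * (- y * (φ ⊙ v - 1#))
            ≈⟨ cancelled (a i) y (φ ⊙ v) ⟩
          - a i * ((φ ⊙ v) * y - 1#) ≈⟨ x*0≈0 1-φv ⟩
          0# ∎
      ; Q⁻¹Q = rank-one-* b a φ λ i → begin
          - y * a i + a i + - y * a i * (φ ⊙ a) ≈⟨ +-congˡ (*-congˡ φa) ⟩
          - y * a i + a i + - y * a i * (φ ⊙ v - 1#)
            ≈⟨ cancelled′ (a i) y (φ ⊙ v) ⟩
          - a i * ((φ ⊙ v) * y - 1#) ≈⟨ x*0≈0 1-φv ⟩
          0# ∎
      ; Q-Supp = supp supp-a
      ; Q⁻¹-Supp = supp λ i ¬e → x*0≈0 (supp-a i ¬e)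
      ; Qe₀ = λ i → trans (+-congˡ (trans (*-congˡ φ₀) (*-identityʳ _)))
        (solve 2 (λ e v → e :+ (v :- e) := v) refl (e₀ i) (v i))
      }
      where
      cancelled : ∀ a y f → a + - y * a + a * (- y * (f - 1#)) ≈ - a * (f * y - 1#)
      cancelled a y f = begin
        a + - y * a + a * (- y * (f - 1#))
          ≈⟨ solve 4 (λ a y f o → a :+ :- y :* a :+ a :* (:- y :* (f :- o)) := (a :- a :* y :* f) :+
            (a :* y :* o :- a :* y)) refl a y f 1# ⟩
        (a - a * y * f) + (a * y * 1# - a * y) ≈⟨ +-congˡ (x≈y⇒x-y≈0 (*-identityʳ _)) ⟩
        (a - a * y * f) + 0# ≈⟨ +-identityʳ _ ⟩
        a - a * y * f ≈⟨ +-congʳ (*-identityʳ a) ⟨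
        a * 1# - a * y * f ≈⟨ solve 4 (λ a y f o → a :* o :- a :* y :* f := :- a :* (f :* y :- o))
          refl a y f 1# ⟩
        - a * (f * y - 1#) ∎
      cancelled′ : ∀ a y f → - y * a + a + - y * a * (f - 1#) ≈ - a * (f * y - 1#)
      cancelled′ a y f = trans (solve 4
        (λ a y f o → :- y :* a :+ a :+ :- y :* a :* (f :- o) := a :+ :- y :* a :+ a :*
          (:- y :* (f :- o))) refl a y f 1#)
        (cancelled a y f)

  conjugate : ∀ {n} {Q Q⁻¹ : Matrix n} → Q *ₘ Q⁻¹ ≈ₘ 1ₘ → ∀ M N →
              (Q⁻¹ *ₘ (M *ₘ Q)) *ₘ (Q⁻¹ *ₘ (N *ₘ Q)) ≈ₘ Q⁻¹ *ₘ ((M *ₘ N) *ₘ Q)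
  conjugate {Q = Q} {Q⁻¹} QQ⁻¹ M N i j = begin
    ((Q⁻¹ *ₘ (M *ₘ Q)) *ₘ (Q⁻¹ *ₘ (N *ₘ Q))) i j
      ≈⟨ *ₘ-assoc Q⁻¹ (M *ₘ Q) (Q⁻¹ *ₘ (N *ₘ Q)) i j ⟩
    (Q⁻¹ *ₘ ((M *ₘ Q) *ₘ (Q⁻¹ *ₘ (N *ₘ Q)))) i j
      ≈⟨ *ₘ-cong₂ Q⁻¹ (λ i j → trans (*ₘ-assoc M Q (Q⁻¹ *ₘ (N *ₘ Q)) i j)
           (trans (*ₘ-cong₂ M (*ₘ-cancelˡ Q Q⁻¹ (N *ₘ Q) QQ⁻¹) i j) (sym (*ₘ-assoc M N Q i j)))) i
             j ⟩
    (Q⁻¹ *ₘ ((M *ₘ N) *ₘ Q)) i j ∎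

  -- The vectors supported on the block of index 0 form a stable subspace, because the matrices ρ g
  -- have support in E. A common eigenvector taken from it becomes the first basis vector by a base
  -- change that respects E, and the recursion runs on the quotient representation.
  triangularise : ∀ k {S d} → IsSubgroup S → Connected S → (∀ {g} → derived k S g → g ≋ ε) →
    (R : Representation S d) {E : Rel (Fin d) 0ℓ} → Reflexive E → Symmetric E → Transitive E →
    (∀ g → S g → Supp E (Representation.ρ R g)) → ¬¬ Triangularisation R E
  triangularise k {d = zero} sub conn triv R _ _ _ _ = pure record
    { P = λ () ; P⁻¹ = λ () ; P⁻¹P = λ () ; PP⁻¹ = λ () ; P-Supp = λ () ; P⁻¹-Supp = λ () ; upper =
      λ _ _ () }
  triangularise k {S} {suc d} sub conn triv R {E} E-refl E-sym E-trans R-Supp =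
    common-eigenvector k sub conn triv R W-subspace W-stable
      ((λ i → 1ₘ i zero) , (λ i ¬e → 1ₘ-off i zero λ { ≡.refl → ¬e E-refl }) , λ e → 1≉0 (e zero))
        >>= λ (v , v-supp , v≢0 , eig) →
    first-column E-refl E-sym E-trans v-supp v≢0 >>= λ F → let open FirstColumn F in
    let
      σ = λ g → Q⁻¹ *ₘ (ρ g *ₘ Q)
      σ-first : ∀ g → S g → ∀ i → σ g (suc i) zero ≈ 0#
      σ-first g g∈ i = stable (eig g g∈ >>= λ (a , e) → pure (begin
        Q⁻¹ (suc i) ⊙ (λ k → (ρ g *ₘ Q) k zero)
          ≈⟨ ∙-cong {u = Q⁻¹ (suc i)} (λ _ → refl)
            (λ k → trans (∙-cong {u = ρ g k} (λ _ → refl) Qe₀)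
              (trans (e k) (*-congˡ (sym (Qe₀ k))))) ⟩
        Q⁻¹ (suc i) ⊙ (λ k → a * Q k zero) ≈⟨ ∙-scaleʳ a (Q⁻¹ (suc i)) (λ k → Q k zero) ⟩
        a * (Q⁻¹ *ₘ Q) (suc i) zero ≈⟨ x*0≈0 (Q⁻¹Q (suc i) zero) ⟩
        0# ∎))
      R′ : Representation S d
      R′ = record
        { ρ    = λ g i j → σ g (suc i) (suc j)
        ; poly = λ i j → :*ₘ {M = λ _ → Q⁻¹} {N = λ g → ρ g *ₘ Q} (λ i j → const (Q⁻¹ i j))
          (:*ₘ {M = ρ} {N = λ _ → Q} poly (λ i j → const (Q i j))) (suc i) (suc j)
        ; homo = λ {g} {h} g∈ h∈ i j → begin
            σ (g ∙ h) (suc i) (suc j)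
              ≈⟨ *ₘ-cong₂ Q⁻¹ (*ₘ-cong₁ Q (homo g∈ h∈)) (suc i) (suc j) ⟩
            (Q⁻¹ *ₘ ((ρ g *ₘ ρ h) *ₘ Q)) (suc i) (suc j)
              ≈⟨ conjugate {Q = Q} {Q⁻¹} QQ⁻¹ (ρ g) (ρ h) (suc i) (suc j) ⟨
            σ g (suc i) zero * σ h zero (suc j) + sum
              (λ k → σ g (suc i) (suc k) * σ h (suc k) (suc j))
              ≈⟨ trans (+-congʳ (0*x≈0 (σ-first g g∈ i))) (+-identityˡ _) ⟩
            sum (λ k → σ g (suc i) (suc k) * σ h (suc k) (suc j)) ∎
        ; unit = λ i j → trans (*ₘ-cong₂ Q⁻¹
          (λ i j → trans (*ₘ-cong₁ Q unit i j) (*ₘ-identityˡ Q i j)) (suc i) (suc j))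
            (trans (Q⁻¹Q (suc i) (suc j)) (1ₘ-suc i j))
        }
      σ-Supp : ∀ g → S g → Supp E (σ g)
      σ-Supp g g∈ = Supp-* E-trans Q⁻¹-Supp (Supp-* E-trans (R-Supp g g∈) Q-Supp)
    in
    triangularise k sub conn triv R′ {λ i j → E (suc i) (suc j)} E-refl E-sym E-trans
      (λ g g∈ i j ¬e → σ-Supp g g∈ (suc i) (suc j) ¬e) >>= λ T →
    let module T = Triangularisation T
        E⁺ = λ {M : Matrix d} (s : Supp (λ i j → E (suc i) (suc j)) M) → extend-Supp {E} E-refl s
    in pure record
      { P        = Q *ₘ extend T.P
      ; P⁻¹      = extend T.P⁻¹ *ₘ Q⁻¹
      ; P⁻¹P     = *ₘ-inverse (extend T.P⁻¹) Q⁻¹ Q (extend T.P) Q⁻¹Q (extend-* T.P⁻¹P)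
      ; PP⁻¹     = *ₘ-inverse Q (extend T.P) (extend T.P⁻¹) Q⁻¹ (extend-* T.PP⁻¹) QQ⁻¹
      ; P-Supp   = Supp-* E-trans Q-Supp (E⁺ T.P-Supp)
      ; P⁻¹-Supp = Supp-* E-trans (E⁺ T.P⁻¹-Supp) Q⁻¹-Supp
      ; upper    = λ g g∈ i j j<i → trans (rearrange (extend T.P⁻¹) Q⁻¹ (ρ g) Q (extend T.P) i j)
                     (extend-upper T.P⁻¹ T.P (σ g) (σ-first g g∈) (T.upper g g∈) i j j<i)
      }
    where
    open Representation R
    W : Vector (suc d) → Set
    W v = ∀ i → ¬ E i zero → v i ≈ 0#
    W-subspace : IsSubspace W
    W-subspace = record
      { resp  = λ e w i ¬e → trans (sym (e i)) (w i ¬e)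
      ; 0∈    = λ _ _ → refl
      ; +∈    = λ u v i ¬e → trans (+-cong (u i ¬e) (v i ¬e)) (+-identityʳ _)
      ; scale = λ c u i ¬e → x*0≈0 (u i ¬e)
      }
    W-stable : Stable W
    W-stable {g} {v} g∈ w i ¬e = sum-≈0 λ k → entries-≈0 (λ (p , q) → ¬e (E-trans p q))
      (R-Supp g g∈ i k) (w k)
    extend-Supp : ∀ {E : Rel (Fin (suc d)) 0ℓ} → Reflexive E → ∀ {M : Matrix d} → Supp
      (λ i j → E (suc i) (suc j)) M → Supp E (extend M)
    extend-Supp rfl s zero    zero    ¬e = contradiction rfl ¬e
    extend-Supp rfl s zero    (suc j) ¬e = refl
    extend-Supp rfl s (suc i) zero    ¬e = refl
    extend-Supp rfl s (suc i) (suc j) ¬e = s i j ¬e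
    rearrange : ∀ {n} (A B M C D : Matrix n) → (A *ₘ B) *ₘ (M *ₘ (C *ₘ D)) ≈ₘ A *ₘ
      ((B *ₘ (M *ₘ C)) *ₘ D)
    rearrange A B M C D i j = trans (*ₘ-assoc A B (M *ₘ (C *ₘ D)) i j) (*ₘ-cong₂ A (λ k l →
      trans (*ₘ-cong₂ B (λ p q → sym (*ₘ-assoc M C D p q)) k l) (sym (*ₘ-assoc B (M *ₘ C) D k l))) i
        j)
    extend-upper : ∀ (P⁻¹ P : Matrix d) (X : Matrix (suc d)) → (∀ i → X (suc i) zero ≈ 0#) →
                   Upper (P⁻¹ *ₘ ((λ i j → X (suc i) (suc j)) *ₘ P)) → Upper
                     (extend P⁻¹ *ₘ (X *ₘ extend P))
    extend-upper P⁻¹ P X X₀ up (suc i) zero _ = trans (+-cong (zeroˡ _) (∙-0ʳ (P⁻¹ i) λ k →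
      trans (+-cong (trans (*-identityʳ _) (X₀ k)) (∙-0ʳ (λ l → X (suc k) (suc l)) (λ _ → refl)))
        (+-identityʳ _))) (+-identityʳ _)
    extend-upper P⁻¹ P X X₀ up (suc i) (suc j) (s≤s j<i) = trans
      (+-cong (zeroˡ _) (∙-cong {u = P⁻¹ i} (λ _ → refl) λ k →
      trans (+-congʳ (zeroʳ _)) (+-identityˡ _))) (trans (+-identityˡ _) (up i j j<i))

-- Transvections and embedded 2 × 2 blocks

module Transvections (𝒞 : ComplexNumbers) where
  open Field 𝒞
  open GeneralLinear 𝒞
  open Linear 𝒞
  open Support 𝒞

  2# ½ : Carrier
  2# = 1# + 1#
  ½  = proj₁ (Unit-nat 1)

  ½+½≈1 : ½ + ½ ≈ 1#
  ½+½≈1 = trans (solve 1 (λ h → h :+ h := (:1 :+ (:1 :+ :0)) :* h) refl ½) (proj₂ (Unit-nat 1))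

  Unit-2 : Unit 2#
  Unit-2 = Unit-cong (+-congˡ (+-identityʳ 1#)) (Unit-nat 1)

  -- The 2 × 2 matrix with rows (1 + p , q) and (r , 1 + s), placed at i and j.
  block : ∀ {n} → Fin n → Fin n → Carrier → Carrier → Carrier → Carrier → Matrix n
  block i j p q r s a b = 1ₘ a b + ((1ₘ a i * p + 1ₘ a j * r) * 1ₘ i b + (1ₘ a i * q + 1ₘ a j * s) *
    1ₘ j b)

  module _ {n} {i j : Fin n} where

    block-cong : ∀ {p q r s p′ q′ r′ s′} → p ≈ p′ → q ≈ q′ → r ≈ r′ → s ≈ s′ →
                 block i j p q r s ≈ₘ block i j p′ q′ r′ s′
    block-cong e₁ e₂ e₃ e₄ a b = +-congˡ (+-cong (*-congʳ (+-cong (*-congˡ e₁) (*-congˡ e₃)))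
                                                (*-congʳ (+-cong (*-congˡ e₂) (*-congˡ e₄))))

    block-1 : block i j 0# 0# 0# 0# ≈ₘ 1ₘ
    block-1 a b = solve 5 (λ d x y u v → d :+
      ((x :* :0 :+ y :* :0) :* u :+ (x :* :0 :+ y :* :0) :* v) := d)
      refl (1ₘ a b) (1ₘ a i) (1ₘ a j) (1ₘ i b) (1ₘ j b)

    module _ (i≢j : i ≢ j) where

      block-* : ∀ p q r s p′ q′ r′ s′ → block i j p q r s *ₘ block i j p′ q′ r′ s′ ≈ₘ
        block i j (p + p′ + (p * p′ + q * r′)) (q + q′ + (p * q′ + q * s′))
                  (r + r′ + (r * p′ + s * r′)) (s + s′ + (r * q′ + s * s′))
      block-* p q r s p′ q′ r′ s′ a b = begin
        block i j p q r s a ∙ col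
          ≈⟨ trans (∙-comm (block i j p q r s a) col) (trans (∙-+ʳ col (1ₘ a) _)
             (+-cong (trans (∙-comm col (1ₘ a)) (1ₘ-∙ col a))
               (trans (∙-+ʳ col (λ k → α * 1ₘ i k) (λ k → β * 1ₘ j k))
             (+-cong (trans (∙-scaleʳ α col (1ₘ i))
               (*-congˡ (trans (∙-comm col (1ₘ i)) (1ₘ-∙ col i))))
                     (trans (∙-scaleʳ β col (1ₘ j))
                       (*-congˡ (trans (∙-comm col (1ₘ j)) (1ₘ-∙ col j)))))))) ⟩
        col a + (α * col i + β * col j)
          ≈⟨ +-congˡ (+-cong (*-congˡ (+-congˡ
            (+-cong (*-congʳ (+-cong (*-congʳ (1ₘ-diag i)) (*-congʳ (1ₘ-off i j i≢j))))
                                                      (*-congʳ (+-cong (*-congʳ (1ₘ-diag i))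
                                                        (*-congʳ (1ₘ-off i j i≢j)))))))
                             (*-congˡ (+-congˡ (+-cong
                               (*-congʳ (+-cong (*-congʳ (1ₘ-off j i (i≢j ∘ ≡.sym)))
                                 (*-congʳ (1ₘ-diag j))))
                                                      (*-congʳ (+-cong (*-congʳ
                                                        (1ₘ-off j i (i≢j ∘ ≡.sym)))
                                                          (*-congʳ (1ₘ-diag j)))))))) ⟩
        col a + (α * (1ₘ i b + ((1# * p′ + 0# * r′) * 1ₘ i b + (1# * q′ + 0# * s′) * 1ₘ j b))
               + β * (1ₘ j b + ((0# * p′ + 1# * r′) * 1ₘ i b + (0# * q′ + 1# * s′) * 1ₘ j b)))
          ≈⟨ solve 13 (λ d x y u v p q r s p′ q′ r′ s′ → let o = :1 ; z = :0 in
               (d :+ ((x :* p′ :+ y :* r′) :* u :+ (x :* q′ :+ y :* s′) :* v))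
               :+ ((x :* p :+ y :* r) :* (u :+
                 ((o :* p′ :+ z :* r′) :* u :+ (o :* q′ :+ z :* s′) :* v))
                :+ (x :* q :+ y :* s) :* (v :+
                  ((z :* p′ :+ o :* r′) :* u :+ (z :* q′ :+ o :* s′) :* v)))
               := d :+ ((x :* (p :+ p′ :+ (p :* p′ :+ q :* r′)) :+ y :*
                 (r :+ r′ :+ (r :* p′ :+ s :* r′))) :* u
                     :+ (x :* (q :+ q′ :+ (p :* q′ :+ q :* s′)) :+ y :*
                       (s :+ s′ :+ (r :* q′ :+ s :* s′))) :* v))
             refl (1ₘ a b) (1ₘ a i) (1ₘ a j) (1ₘ i b) (1ₘ j b) p q r s p′ q′ r′ s′ ⟩
        _ ∎
        where
        col : Vector n
        col k = block i j p′ q′ r′ s′ k b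
        α = 1ₘ a i * p + 1ₘ a j * r
        β = 1ₘ a i * q + 1ₘ a j * s

  elementary : ∀ {n} → Fin n → Fin n → Carrier → Matrix n
  elementary i j t = block i j 0# t 0# 0#

  elementary-flip : ∀ {n} (i j : Fin n) t → elementary j i t ≈ₘ block i j 0# 0# t 0#
  elementary-flip i j t a b = solve 6 (λ d x y u v t → let z = :0 in
      d :+ ((y :* z :+ x :* z) :* v :+ (y :* t :+ x :* z) :* u) := d :+
        ((x :* z :+ y :* t) :* u :+ (x :* z :+ y :* z) :* v))
    refl (1ₘ a b) (1ₘ a i) (1ₘ a j) (1ₘ i b) (1ₘ j b) t

  elementary-entry : ∀ {n} {i j : Fin n} t → elementary i j t i j ≈ 1ₘ i j + t
  elementary-entry {i = i} {j} t = +-congˡ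
    (trans (+-cong (0*x≈0 (trans (+-cong (zeroʳ _) (zeroʳ _)) (+-identityʳ _)))
    (trans (*-cong (trans (+-cong (trans (*-congʳ (1ₘ-diag i)) (*-identityˡ t)) (zeroʳ _))
      (+-identityʳ t)) (1ₘ-diag j)) (*-identityʳ t))) (+-identityˡ t))

  row-shear : ∀ {n} → Fin n → Vector n → Matrix n
  row-shear i φ a b = 1ₘ a b + 1ₘ a i * φ b

  row-shear-act : ∀ {n} i (φ : Vector n) M → row-shear i φ *ₘ M ≈ₘ λ a b → M a b + 1ₘ a i *
    (φ ᵥ* M) b
  row-shear-act i φ M a b = trans (∙-comm (row-shear i φ a) (λ k → M k b))
    (trans (∙-+ʳ (λ k → M k b) (1ₘ a) (λ k → 1ₘ a i * φ k))
    (+-cong (trans (∙-comm (λ k → M k b) (1ₘ a)) (1ₘ-∙ (λ k → M k b) a))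
            (trans (∙-scaleʳ (1ₘ a i) (λ k → M k b) φ) (*-congˡ (∙-comm (λ k → M k b) φ)))))

  row-shear-* : ∀ {n} i (φ ψ : Vector n) → φ i ≈ 0# → row-shear i φ *ₘ row-shear i ψ ≈ₘ row-shear i
    (λ k → φ k + ψ k)
  row-shear-* i φ ψ φi≈0 a b = trans (row-shear-act i φ (row-shear i ψ) a b) (begin
    (1ₘ a b + 1ₘ a i * ψ b) + 1ₘ a i * (φ ∙ (λ k → 1ₘ k b + 1ₘ k i * ψ b))
      ≈⟨ +-congˡ (*-congˡ (trans (∙-+ʳ φ (λ k → 1ₘ k b) (λ k → 1ₘ k i * ψ b)) (+-cong (∙-1ₘ φ b)
           (trans (∙-scaleʳ′ (ψ b) φ (λ k → 1ₘ k i)) (0*x≈0 (trans (∙-1ₘ φ i) φi≈0)))))) ⟩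
    (1ₘ a b + 1ₘ a i * ψ b) + 1ₘ a i * (φ b + 0#)
      ≈⟨ solve 4 (λ d x s f → (d :+ x :* s) :+ x :* (f :+ :0) := d :+ x :* (f :+ s)) refl (1ₘ a b)
        (1ₘ a i) (ψ b) (φ b) ⟩
    1ₘ a b + 1ₘ a i * (φ b + ψ b) ∎)

  row-shear-cong : ∀ {n} (i : Fin n) {φ ψ} → φ ≈ᵥ ψ → row-shear i φ ≈ₘ row-shear i ψ
  row-shear-cong i e a b = +-congˡ (*-congˡ (e b))

-- Matrix groups containing SL₂ are not solvable

module GroupMatrices (𝒞 : ComplexNumbers) {m : ℕ} where
  open Field 𝒞
  open GeneralLinear 𝒞
  open Linear 𝒞
  open Support 𝒞
  open Transvections 𝒞
  open GL
  open Spherical 𝒞 {m} using (GLₙ; G)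
  open Subgroups G

  Mem : Pred GLₙ 0ℓ → Matrix (suc m) → Set
  Mem S x = ∃ λ g → S g × matrix g ≈ₘ x

  inverse-unique : ∀ (g : GLₙ) {y} → matrix g *ₘ y ≈ₘ 1ₘ → inverse g ≈ₘ y
  inverse-unique g {y} e i j = begin
    inverse g i j                       ≈⟨ *ₘ-identityʳ (inverse g) i j ⟨
    (inverse g *ₘ 1ₘ) i j               ≈⟨ *ₘ-cong₂ (inverse g) e i j ⟨
    (inverse g *ₘ (matrix g *ₘ y)) i j  ≈⟨ *ₘ-assoc (inverse g) (matrix g) y i j ⟨
    ((inverse g *ₘ matrix g) *ₘ y) i j  ≈⟨ *ₘ-cong₁ y (inverseˡ g) i j ⟩
    (1ₘ *ₘ y) i j                       ≈⟨ *ₘ-identityˡ y i j ⟩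
    y i j                               ∎

  Mem-resp : ∀ {S x y} → x ≈ₘ y → Mem S x → Mem S y
  Mem-resp x≈y (g , g∈ , e) = g , g∈ , λ i j → trans (e i j) (x≈y i j)

  module _ {S : Pred GLₙ 0ℓ} (sub : IsSubgroup S) where
    private module S = IsSubgroup sub

    Mem-* : ∀ {x y} → Mem S x → Mem S y → Mem S (x *ₘ y)
    Mem-* (g , g∈ , e) (h , h∈ , e′) = _ , S.∙∈ g∈ h∈ , *ₘ-cong e e′

    Mem-inverse : ∀ {x y} → x *ₘ y ≈ₘ 1ₘ → Mem S x → Mem S y
    Mem-inverse {x} {y} xy (g , g∈ , e) = _ , S.⁻¹∈ g∈ , inverse-unique g λ i j → trans
      (*ₘ-cong₁ y e i j) (xy i j)

  Mem-commutator : ∀ {S x y x′ y′} → x *ₘ x′ ≈ₘ 1ₘ → y *ₘ y′ ≈ₘ 1ₘ → Mem S x → Mem S y →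
                   Mem (Commutators S) (((x *ₘ y) *ₘ x′) *ₘ y′)
  Mem-commutator {x = x} {y} {x′} {y′} xx′ yy′ (g , g∈ , e) (h , h∈ , e′) = _ , comm g∈ h∈ ,
    *ₘ-cong {N′ = y′} (*ₘ-cong {N′ = x′} (*ₘ-cong e e′)
      (inverse-unique g λ i j → trans (*ₘ-cong₁ x′ e i j) (xx′ i j)))
            (inverse-unique h λ i j → trans (*ₘ-cong₁ y′ e′ i j) (yy′ i j))

  ContainsSL₂ : Fin (suc m) → Fin (suc m) → Pred GLₙ 0ℓ → Set
  ContainsSL₂ i j S = ∀ t → Mem S (elementary i j t) × Mem S (elementary j i t)

  module _ {S : Pred GLₙ 0ℓ} (sub : IsSubgroup S) {i j : Fin (suc m)} (i≢j : i ≢ j) where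

    block-inverse : ∀ {p q r s p′ q′ r′ s′} →
      p + p′ + (p * p′ + q * r′) ≈ 0# → q + q′ + (p * q′ + q * s′) ≈ 0# →
      r + r′ + (r * p′ + s * r′) ≈ 0# → s + s′ + (r * q′ + s * s′) ≈ 0# →
      block i j p q r s *ₘ block i j p′ q′ r′ s′ ≈ₘ 1ₘ
    block-inverse {p} {q} {r} {s} {p′} {q′} {r′} {s′} e₁ e₂ e₃ e₄ a b =
      trans (block-* i≢j p q r s p′ q′ r′ s′ a b)
        (trans (block-cong e₁ e₂ e₃ e₄ a b) (block-1 {i = i} {j} a b))

    private
      h = ½
      1-2h : ∀ x → x + (1# - (h + h)) ≈ x
      1-2h x = trans (+-congˡ (x≈y⇒x-y≈0 (sym ½+½≈1))) (+-identityʳ x)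

    -- This is diag (2 , ½), recorded by its difference from the identity. It is the product of the
    -- transvections with parameters -2, -½, 1, 1, taken alternately at (i , j) and (j , i).
    torus-element : ContainsSL₂ i j S → Mem S (block i j 1# 0# 0# (- h))
    torus-element sl = Mem-resp
      (λ a b → trans (block-* i≢j _ _ _ _ 0# 0# 1# 0# a b) (block-cong
        (solve 0 (:1 :+ :0 :+ (:1 :* :0 :+ :0 :* :1) := :1) refl)
        (solve 0 (:0 :+ :0 :+ (:1 :* :0 :+ :0 :* :0) := :0) refl)
        (trans (solve 1 (λ h → :- h :+ :1 :+ (:- h :* :0 :+ :- h :* :1) := :0 :+ (:1 :- (h :+ h)))
          refl h) (1-2h 0#))
        (solve 1 (λ h → :- h :+ :0 :+ (:- h :* :0 :+ :- h :* :0) := :- h) refl h) a b))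
      (Mem-* sub UL (Mem-resp (elementary-flip i j 1#) (proj₂ (sl 1#))))
      where
      U : Mem S (block i j 1# (- (1# + 1#)) (- h) 0#)
      U = Mem-resp (λ a b → trans (block-* i≢j 0# (- (1# + 1#)) 0# 0# 0# 0# (- h) 0# a b)
        (block-cong
            (trans (solve 1 (λ h → :0 :+ :0 :+ (:0 :* :0 :+ :- (:1 :+ :1) :* :- h) := h :+ h) refl
              h) ½+½≈1)
            (solve 0 (:- (:1 :+ :1) :+ :0 :+ (:0 :* :0 :+ :- (:1 :+ :1) :* :0) := :- (:1 :+ :1))
              refl)
            (solve 1 (λ h → :0 :+ :- h :+ (:0 :* :0 :+ :0 :* :- h) := :- h) refl h)
            (solve 0 (:0 :+ :0 :+ (:0 :* :0 :+ :0 :* :0) := :0) refl) a b))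
          (Mem-* sub (proj₁ (sl (- (1# + 1#))))
            (Mem-resp (elementary-flip i j (- h)) (proj₂ (sl (- h)))))
      UL : Mem S (block i j 1# 0# (- h) (- h))
      UL = Mem-resp (λ a b → trans (block-* i≢j 1# (- (1# + 1#)) (- h) 0# 0# 1# 0# 0# a b)
        (block-cong
            (solve 0 (:1 :+ :0 :+ (:1 :* :0 :+ :- (:1 :+ :1) :* :0) := :1) refl)
            (solve 0 (:- (:1 :+ :1) :+ :1 :+ (:1 :* :1 :+ :- (:1 :+ :1) :* :0) := :0) refl)
            (solve 1 (λ h → :- h :+ :0 :+ (:- h :* :0 :+ :0 :* :0) := :- h) refl h)
            (solve 1 (λ h → :0 :+ :0 :+ (:- h :* :1 :+ :0 :* :0) := :- h) refl h) a b))
          (Mem-* sub U (proj₁ (sl 1#)))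

    -- [diag (2 , ½) , 1 + t e_ij] = 1 + 3t e_ij.
    elementary-commutator : ContainsSL₂ i j S → ∀ t → Mem (Commutators S) (elementary i j t)
    elementary-commutator sl t =
      let (⅓ , 3*⅓) = Unit-nat 2
          s = t * ⅓
      in Mem-resp (λ a b → begin
          (((block i j 1# 0# 0# (- h) *ₘ block i j 0# s 0# 0#) *ₘ block i j (- h) 0# 0# 1#) *ₘ
            block i j 0# (- s) 0# 0#) a b
            ≈⟨ *ₘ-cong₁ (block i j 0# (- s) 0# 0#)
              (*ₘ-cong₁ (block i j (- h) 0# 0# 1#)
                (λ a b → trans (block-* i≢j 1# 0# 0# (- h) 0# s 0# 0# a b) (block-cong
                 {p′ = 1#} {q′ = s + s} {r′ = 0#} {s′ = - h}
                 (solve 0 (:1 :+ :0 :+ (:1 :* :0 :+ :0 :* :0) := :1) refl)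
                 (solve 1 (λ s → :0 :+ s :+ (:1 :* s :+ :0 :* :0) := s :+ s) refl s)
                 (solve 1 (λ h → :0 :+ :0 :+ (:0 :* :0 :+ :- h :* :0) := :0) refl h)
                 (solve 2 (λ h s → :- h :+ :0 :+ (:0 :* s :+ :- h :* :0) := :- h) refl h s) a b))) a
                   b ⟩
          ((block i j 1# (s + s) 0# (- h) *ₘ block i j (- h) 0# 0# 1#) *ₘ block i j 0# (- s) 0# 0#)
            a b
            ≈⟨ *ₘ-cong₁ (block i j 0# (- s) 0# 0#)
              (λ a b → trans (block-* i≢j 1# (s + s) 0# (- h) (- h) 0# 0# 1# a b) (block-cong
                 {p′ = 0#} {q′ = (s + s) + (s + s)} {r′ = 0#} {s′ = 0#}
                 (trans (solve 2 (λ h s → :1 :+ :- h :+ (:1 :* :- h :+ (s :+ s) :* :0) := :0 :+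
                   (:1 :- (h :+ h))) refl h s) (1-2h 0#))
                 (solve 1 (λ s → (s :+ s) :+ :0 :+ (:1 :* :0 :+ (s :+ s) :* :1) := (s :+ s) :+
                   (s :+ s)) refl s)
                 (solve 1 (λ h → :0 :+ :0 :+ (:0 :* :- h :+ :- h :* :0) := :0) refl h)
                 (trans (solve 1 (λ h → :- h :+ :1 :+ (:0 :* :0 :+ :- h :* :1) := :0 :+
                   (:1 :- (h :+ h))) refl h) (1-2h 0#)) a b)) a b ⟩
          (block i j 0# ((s + s) + (s + s)) 0# 0# *ₘ block i j 0# (- s) 0# 0#) a b
            ≈⟨ trans (block-* i≢j 0# ((s + s) + (s + s)) 0# 0# 0# (- s) 0# 0# a b) (block-cong
                 (solve 1 (λ s → :0 :+ :0 :+ (:0 :* :0 :+ s :* :0) := :0) refl ((s + s) + (s + s)))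
                 (trans (solve 2 (λ t h → let s = t :* h in (((s :+ s) :+ (s :+ s)) :+ :- s) :+
                                                (:0 :* :- s :+ ((s :+ s) :+ (s :+ s)) :* :0)
                     := t :* ((:1 :+ (:1 :+ (:1 :+ :0))) :* h)) refl t ⅓)
                       (trans (*-congˡ 3*⅓) (*-identityʳ t)))
                 (solve 0 (:0 :+ :0 :+ (:0 :* :0 :+ :0 :* :0) := :0) refl)
                 (solve 1 (λ s → :0 :+ :0 :+ (:0 :* :- s :+ :0 :* :0) := :0) refl s) a b) ⟩
          elementary i j t a b ∎)
        (Mem-commutator {x′ = block i j (- h) 0# 0# 1#} {y′ = block i j 0# (- s) 0# 0#}
          (block-inverse {p = 1#} {q = 0#} {r = 0#} {s = - h} {p′ = - h} {q′ = 0#} {r′ = 0#}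
            {s′ = 1#}
            (trans (solve 1 (λ h → :1 :+ :- h :+ (:1 :* :- h :+ :0 :* :0) := :0 :+ (:1 :- (h :+ h)))
              refl h) (1-2h 0#))
            (solve 0 (:0 :+ :0 :+ (:1 :* :0 :+ :0 :* :1) := :0) refl)
            (solve 1 (λ h → :0 :+ :0 :+ (:0 :* :- h :+ :- h :* :0) := :0) refl h)
            (trans (solve 1 (λ h → :- h :+ :1 :+ (:0 :* :0 :+ :- h :* :1) := :0 :+ (:1 :- (h :+ h)))
              refl h) (1-2h 0#)))
          (block-inverse {p = 0#} {q = s} {r = 0#} {s = 0#} {p′ = 0#} {q′ = - s} {r′ = 0#} {s′ = 0#}
            (solve 1 (λ s → :0 :+ :0 :+ (:0 :* :0 :+ s :* :0) := :0) refl s)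
            (solve 1 (λ s → s :+ :- s :+ (:0 :* :- s :+ s :* :0) := :0) refl s)
            (solve 0 (:0 :+ :0 :+ (:0 :* :0 :+ :0 :* :0) := :0) refl)
            (solve 1 (λ s → :0 :+ :0 :+ (:0 :* :- s :+ :0 :* :0) := :0) refl s))
          (torus-element sl) (proj₁ (sl s)))

  swapSL₂ : ∀ {i j S} → ContainsSL₂ i j S → ContainsSL₂ j i S
  swapSL₂ sl t = proj₂ (sl t) , proj₁ (sl t)

  open GroupIdentities G using (Commutators-isSubgroup)

  derived-isSubgroup : ∀ k {S} → IsSubgroup S → IsSubgroup (derived k S)
  derived-isSubgroup zero    sub = sub
  derived-isSubgroup (suc k) {S} sub = Commutators-isSubgroup (derived k S)

  -- Each transvection is a commutator of elements generated by the two root subgroups, so both of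
  -- these survive every step of the derived series.
  derived-ContainsSL₂ : ∀ k {S} → IsSubgroup S → ∀ {i j} → i ≢ j → ContainsSL₂ i j S →
    ContainsSL₂ i j (derived k S)
  derived-ContainsSL₂ zero    sub i≢j sl = sl
  derived-ContainsSL₂ (suc k) sub i≢j sl t =
    let sl′ = derived-ContainsSL₂ k sub i≢j sl ; sub′ = derived-isSubgroup k sub in
    elementary-commutator sub′ i≢j sl′ t , elementary-commutator sub′ (i≢j ∘ ≡.sym) (swapSL₂ sl′) t

  SL₂-not-solvable : ∀ {S} → IsSubgroup S → ∀ {i j} → i ≢ j → ContainsSL₂ i j S → ¬ Solvable S
  SL₂-not-solvable sub {i} {j} i≢j sl (k , triv) =
    let (g , g∈ , e) = proj₁ (derived-ContainsSL₂ k sub i≢j sl 1#) in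
    1≉0 (trans (trans (sym (trans (+-congʳ (1ₘ-off i j i≢j)) (+-identityˡ 1#)))
      (trans (sym (elementary-entry {i = i} {j} 1#)) (trans (sym (e i j)) (triv {g} g∈ i j))))
        (1ₘ-off i j i≢j))

-- The blocks of the Levi subgroup

module Blocks {m : ℕ} (I : Subset m) where
  open import Relation.Binary.PropositionalEquality using (refl; sym)

  SameBlock : Rel (Fin (suc m)) 0ℓ
  SameBlock i j = ∀ d → d ∉ I → toℕ i ℕ.≤ toℕ d ⇔ toℕ j ℕ.≤ toℕ d

  block-refl : Reflexive SameBlock
  block-refl d d∉ = mk⇔ (λ x → x) (λ x → x)

  block-sym : Symmetric SameBlock
  block-sym e d d∉ = mk⇔ (Equivalence.from (e d d∉)) (Equivalence.to (e d d∉))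

  block-trans : Transitive SameBlock
  block-trans e f d d∉ = mk⇔ (Equivalence.to (f d d∉) ∘ Equivalence.to (e d d∉))
    (Equivalence.from (e d d∉) ∘ Equivalence.from (f d d∉))

  private
    ⇔? : ∀ {a b c} → Dec (a ℕ.≤ c ⇔ b ℕ.≤ c)
    ⇔? {a} {b} {c} = map′ (λ (f , g) → mk⇔ f g) (λ e → Equivalence.to e , Equivalence.from e)
      ((a ℕₚ.≤? c →-dec b ℕₚ.≤? c) ×-dec (b ℕₚ.≤? c →-dec a ℕₚ.≤? c))

  abstract
    _block?_ : Decidable SameBlock
    i block? j = Finₚ.all? λ d → ¬? (d ∈? I) →-dec ⇔?

  separated : ∀ {i j} → i <ᶠ j → ¬ SameBlock i j → ∃ λ d → d ∉ I × toℕ i ℕ.≤ toℕ d × toℕ d ℕ.< toℕ j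
  separated {i} {j} i<j ¬e with Finₚ.¬∀⟶∃¬ m _
    (λ d → ¬? (d ∈? I) →-dec ⇔? {toℕ i} {toℕ j} {toℕ d}) ¬e
  ... | d , ¬h with d ∈? I
  ...   | yes d∈ = contradiction (λ d∉ → contradiction d∈ d∉) ¬h
  ...   | no d∉ with toℕ i ℕₚ.≤? toℕ d | toℕ j ℕₚ.≤? toℕ d
  ...     | yes i≤d | no j≰d  = d , d∉ , i≤d , ℕₚ.≰⇒> j≰d
  ...     | yes i≤d | yes j≤d = contradiction (λ _ → mk⇔ (λ _ → j≤d) (λ _ → i≤d)) ¬h
  ...     | no i≰d  | yes j≤d = contradiction (ℕₚ.≤-trans (ℕₚ.<⇒≤ i<j) j≤d) i≰d
  ...     | no i≰d  | no j≰d  = contradiction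
    (λ _ → mk⇔ (λ x → contradiction x i≰d) (λ x → contradiction x j≰d)) ¬h

  not-separated : ∀ {i j} d → d ∉ I → toℕ i ℕ.≤ toℕ d → toℕ d ℕ.< toℕ j → ¬ SameBlock i j
  not-separated d d∉ i≤d d<j e = ℕₚ.<⇒≱ d<j (Equivalence.to (e d d∉) i≤d)

  -- Induction on the right end, bounded by c. Every step from d to d + 1 inside a block has d in I,
  -- since any other d would separate the two ends.
  block-chain : ∀ {P : Rel (Fin (suc m)) 0ℓ} → Transitive P →
    (∀ d → d ∈ I → P (inject₁ d) (suc d)) →
                ∀ c {i j} → toℕ j ℕ.≤ c → i <ᶠ j → SameBlock i j → P i j
  block-chain {P} P-trans step (suc c) {i} {suc d} (s≤s d≤c) (s≤s i≤d) e with d ∈? I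
  ... | no d∉ = contradiction e (not-separated d d∉ i≤d ℕₚ.≤-refl)
  ... | yes d∈ with i ≟ inject₁ d
  ...   | yes refl = step d d∈
  ...   | no i≢d = P-trans (block-chain P-trans step c
    (ℕₚ.≤-trans (ℕₚ.≤-reflexive (Finₚ.toℕ-inject₁ d)) d≤c) i<d e′) (step d d∈)
    where
    i<d : i <ᶠ inject₁ d
    i<d = ℕₚ.≤∧≢⇒< (ℕₚ.≤-trans i≤d (ℕₚ.≤-reflexive (sym (Finₚ.toℕ-inject₁ d))))
      (i≢d ∘ Finₚ.toℕ-injective)
    e′ : SameBlock i (inject₁ d)
    e′ k k∉ = mk⇔ (λ i≤k → ℕₚ.≤-trans (ℕₚ.≤-trans (ℕₚ.≤-reflexive (Finₚ.toℕ-inject₁ d))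
      (ℕₚ.n≤1+n _)) (Equivalence.to (e k k∉) i≤k))
                  (λ d≤k → ℕₚ.≤-trans (ℕₚ.<⇒≤ i<d) d≤k)

-- Inversions, reduced words and standard Coxeter elements

module Transpositions {m : ℕ} where
  open import Relation.Binary.PropositionalEquality
    using (refl; sym; trans; cong; cong₂; subst; subst₂; module ≡-Reasoning)
  open SymmetricGroup {m}

  n : ℕ
  n = suc m

  σ : Fin m → Fin n → Fin n
  σ j i = s j ⟨$⟩ʳ i

  inject₁≢suc : ∀ {m} (j : Fin m) → inject₁ j ≢ suc j
  inject₁≢suc zero    ()
  inject₁≢suc (suc j) e = inject₁≢suc j (Finₚ.suc-injective e)

  transposeˡ : ∀ {n} (x y : Fin n) → PC.transpose x y x ≡ y
  transposeˡ x y rewrite dec-true (x ≟ x) refl = refl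

  transposeʳ : ∀ {n} (x y : Fin n) → PC.transpose x y y ≡ x
  transposeʳ x y with y ≟ x
  ... | yes refl = refl
  ... | no y≢x rewrite dec-true (y ≟ y) refl = refl

  transpose-other : ∀ {n} (x y z : Fin n) → z ≢ x → z ≢ y → PC.transpose x y z ≡ z
  transpose-other x y z z≢x z≢y rewrite dec-false (z ≟ x) z≢x | dec-false (z ≟ y) z≢y = refl

  data Position (j : Fin m) : Fin n → Set where
    left  : Position j (inject₁ j)
    right : Position j (suc j)
    other : ∀ {i} → i ≢ inject₁ j → i ≢ suc j → Position j i

  position : ∀ j i → Position j i
  position j i with i ≟ inject₁ j | i ≟ suc j
  ... | yes refl | _        = left
  ... | no _     | yes refl = right
  ... | no i≢l   | no i≢r   = other i≢l i≢r

  σ-left : ∀ j → σ j (inject₁ j) ≡ suc j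
  σ-left j = transposeˡ (inject₁ j) (suc j)

  σ-right : ∀ j → σ j (suc j) ≡ inject₁ j
  σ-right j = transposeʳ (inject₁ j) (suc j)

  σ-other : ∀ j {i} → i ≢ inject₁ j → i ≢ suc j → σ j i ≡ i
  σ-other j = transpose-other (inject₁ j) (suc j) _

  σˡ : ∀ j i → s j ⟨$⟩ˡ i ≡ σ j i
  σˡ j i with position j i
  ... | left      = trans (transposeʳ (suc j) (inject₁ j)) (sym (σ-left j))
  ... | right     = trans (transposeˡ (suc j) (inject₁ j)) (sym (σ-right j))
  ... | other p q = trans (transpose-other (suc j) (inject₁ j) i q p) (sym (σ-other j p q))

  σ-involutive : ∀ j i → σ j (σ j i) ≡ i
  σ-involutive j i = trans (sym (σˡ j (σ j i))) (Perm.inverseˡ (s j))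

  σ-injective : ∀ j {a b} → σ j a ≡ σ j b → a ≡ b
  σ-injective j {a} {b} e = trans (sym (σ-involutive j a)) (trans (cong (σ j) e) (σ-involutive j b))

  private
    toℕ-left : ∀ (j : Fin m) → toℕ (inject₁ j) ≡ toℕ j
    toℕ-left = Finₚ.toℕ-inject₁
    above-left : ∀ {j : Fin m} {b : Fin n} → inject₁ j <ᶠ b → b ≢ suc j → suc j <ᶠ b
    above-left {j} {b} j<b b≢ = ℕₚ.≤∧≢⇒< (subst (λ x → suc x ℕ.≤ toℕ b) (toℕ-left j) j<b)
      (λ e → b≢ (sym (Finₚ.toℕ-injective e)))
    below-right : ∀ {j : Fin m} {a : Fin n} → a <ᶠ suc j → a ≢ inject₁ j → a <ᶠ inject₁ j
    below-right {j} {a} (s≤s a≤j) a≢ = ℕₚ.≤∧≢⇒< (ℕₚ.≤-trans a≤j (ℕₚ.≤-reflexive (sym (toℕ-left j))))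
      (a≢ ∘ Finₚ.toℕ-injective)

  left<right : ∀ (j : Fin m) → inject₁ j <ᶠ suc j
  left<right j = s≤s (ℕₚ.≤-reflexive (toℕ-left j))

  σ-monotone : ∀ j {a b} → a <ᶠ b → ¬ (a ≡ inject₁ j × b ≡ suc j) → σ j a <ᶠ σ j b
  σ-monotone j {a} {b} a<b ne with position j a | position j b
  ... | left      | left      = contradiction a<b (ℕₚ.<-irrefl refl)
  ... | left      | right     = contradiction (refl , refl) ne
  ... | left      | other p q = subst₂ _<ᶠ_ (sym (σ-left j)) (sym (σ-other j p q))
    (above-left a<b q)
  ... | right     | left      = contradiction (ℕₚ.<-trans (left<right j) a<b) (ℕₚ.<-irrefl refl)
  ... | right     | right     = contradiction a<b (ℕₚ.<-irrefl refl)
  ... | right     | other p q = subst₂ _<ᶠ_ (sym (σ-right j)) (sym (σ-other j p q))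
    (ℕₚ.<-trans (left<right j) a<b)
  ... | other p q | left      = subst₂ _<ᶠ_ (sym (σ-other j p q)) (sym (σ-left j))
    (ℕₚ.<-trans a<b (left<right j))
  ... | other p q | right     = subst₂ _<ᶠ_ (sym (σ-other j p q)) (sym (σ-right j))
    (below-right a<b p)
  ... | other p q | other p′ q′ = subst₂ _<ᶠ_ (sym (σ-other j p q)) (sym (σ-other j p′ q′)) a<b

  -- Only s k itself moves entries across the cut just above position k.
  σ-≤ : ∀ j k → k ≢ j → ∀ i → toℕ i ℕ.≤ toℕ k → toℕ (σ j i) ℕ.≤ toℕ k
  σ-≤ j k k≢j i i≤k with position j i
  ... | left      = subst (λ x → toℕ x ℕ.≤ toℕ k) (sym (σ-left j))
    (ℕₚ.≤∧≢⇒< (subst (ℕ._≤ toℕ k) (toℕ-left j) i≤k) (λ e → k≢j (sym (Finₚ.toℕ-injective e))))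
  ... | right     = subst (λ x → toℕ x ℕ.≤ toℕ k) (sym (σ-right j))
    (ℕₚ.≤-trans (ℕₚ.<⇒≤ (left<right j)) i≤k)
  ... | other p q = subst (λ x → toℕ x ℕ.≤ toℕ k) (sym (σ-other j p q)) i≤k

  σ-> : ∀ j k → k ≢ j → ∀ i → toℕ k ℕ.< toℕ i → toℕ k ℕ.< toℕ (σ j i)
  σ-> j k k≢j i k<i = ℕₚ.≰⇒> λ σi≤k → ℕₚ.<⇒≱ k<i
    (subst (λ x → toℕ x ℕ.≤ toℕ k) (σ-involutive j i) (σ-≤ j k k≢j (σ j i) σi≤k))

  Ascent : Fin m → (Fin n → Fin n) → Set
  Ascent j α = α (inject₁ j) <ᶠ α (suc j)

  Descent : Fin m → (Fin n → Fin n) → Set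
  Descent j α = α (suc j) <ᶠ α (inject₁ j)

  Ascent? : ∀ j α → Dec (Ascent j α)
  Ascent? j α = α (inject₁ j) Finₚ.<? α (suc j)

  Injective : (Fin n → Fin n) → Set
  Injective α = ∀ {a b} → α a ≡ α b → a ≡ b

  ¬Ascent⇒Descent : ∀ {j α} → Injective α → ¬ Ascent j α → Descent j α
  ¬Ascent⇒Descent {j} {α} inj ¬asc with Finₚ.<-cmp (α (inject₁ j)) (α (suc j))
  ... | tri< lt _ _ = contradiction lt ¬asc
  ... | tri≈ _ e _  = contradiction (inj e) (inject₁≢suc j)
  ... | tri> _ _ gt = gt

  inverse-injective : (u : Permutation′ n) → Injective (u ⟨$⟩ˡ_)
  inverse-injective u {a} {b} e = trans (sym (Perm.inverseʳ u))
    (trans (cong (u ⟨$⟩ʳ_) e) (Perm.inverseʳ u))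

  Descent⇒Ascent-σ : ∀ {j α} → Descent j α → Ascent j (α ∘ σ j)
  Descent⇒Ascent-σ {j} {α} = subst₂ (λ x y → α x <ᶠ α y) (sym (σ-left j)) (sym (σ-right j))

  increasing⇒identity : ∀ α → (∀ j → Ascent j α) → ∀ i → α i ≡ i
  increasing⇒identity α asc i = Finₚ.toℕ-injective (ℕₚ.≤-antisym (upper i) (lower i))
    where
    lower : ∀ i → toℕ i ℕ.≤ toℕ (α i)
    lower = FinInduction.<-weakInduction _ z≤n λ j ih →
      ℕₚ.≤-trans (s≤s (ℕₚ.≤-trans (ℕₚ.≤-reflexive (sym (toℕ-left j))) ih)) (asc j)
    upper : ∀ i → toℕ (α i) ℕ.≤ toℕ i
    upper = FinInduction.>-weakInduction _
      (ℕₚ.≤-trans (ℕₚ.≤-pred (Finₚ.toℕ<n (α _))) (ℕₚ.≤-reflexive (sym (Finₚ.toℕ-fromℕ m)))) λ j ih →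
      ℕₚ.≤-trans (ℕₚ.≤-pred (ℕₚ.≤-trans (asc j) ih)) (ℕₚ.≤-reflexive (sym (toℕ-left j)))

  open MonoidSum ℕₚ.+-0-commutativeMonoid
    using (sum; sum-cong-≗; sum-permute; ∑-distrib-+; sum-replicate-zero)

  sum-mono : ∀ {k} {f g : Fin k → ℕ} → (∀ i → f i ℕ.≤ g i) → sum f ℕ.≤ sum g
  sum-mono {zero}  h = z≤n
  sum-mono {suc k} h = ℕₚ.+-mono-≤ (h zero) (sum-mono (h ∘ suc))

  sum-single : ∀ {k} (f : Fin k → ℕ) i → f i ≡ 1 → (∀ j → j ≢ i → f j ≡ 0) → sum f ≡ 1
  sum-single {suc k} f zero    p q = cong₂ ℕ._+_ p
    (trans (sum-cong-≗ (λ j → q (suc j) λ ())) (sum-replicate-zero k))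
  sum-single {suc k} f (suc i) p q = cong₂ ℕ._+_
    (q zero λ ()) (sum-single (f ∘ suc) i p λ j j≢i → q (suc j) (j≢i ∘ Finₚ.suc-injective))

  indicator : ∀ {P : Set} → Dec P → ℕ
  indicator (yes _) = 1
  indicator (no  _) = 0

  indicator-mono : ∀ {P Q : Set} (p : Dec P) (q : Dec Q) → (P → Q) → indicator p ℕ.≤ indicator q
  indicator-mono (yes p) (yes q) f = ℕₚ.≤-refl
  indicator-mono (yes p) (no ¬q) f = contradiction (f p) ¬q
  indicator-mono (no ¬p) _       f = z≤n

  Inversion : (Fin n → Fin n) → Rel (Fin n) 0ℓ
  Inversion α a b = a <ᶠ b × α b <ᶠ α a

  Inversion? : ∀ α → Decidable (Inversion α)
  Inversion? α a b = (a Finₚ.<? b) ×-dec (α b Finₚ.<? α a)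

  ν : (Fin n → Fin n) → ℕ
  ν α = sum λ a → sum λ b → indicator (Inversion? α a b)

  ν-mono : ∀ α β → (∀ {a b} → Inversion α a b → Inversion β a b) → ν α ℕ.≤ ν β
  ν-mono α β f = sum-mono λ a → sum-mono λ b → indicator-mono (Inversion? α a b)
    (Inversion? β a b) f

  ν-cong : ∀ {α β} → (∀ i → α i ≡ β i) → ν α ≡ ν β
  ν-cong {α} {β} e = ℕₚ.≤-antisym (ν-mono α β λ {a} {b} (p , q) → p , subst₂ _<ᶠ_ (e b) (e a) q)
                          (ν-mono β α λ {a} {b} (p , q) → p , subst₂ _<ᶠ_ (sym (e b)) (sym (e a)) q)

  private
    reindex : ∀ j (f : Fin n → Fin n → ℕ) → (sum λ a → sum λ b → f a b) ≡
      (sum λ a → sum λ b → f (σ j a) (σ j b))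
    reindex j f = trans (sum-permute (λ a → sum (f a)) (s j))
      (sum-cong-≗ λ a → sum-permute (f (σ j a)) (s j))

    here : Fin m → Fin n → Fin n → ℕ
    here j a b = indicator ((a ≟ suc j) ×-dec (b ≟ inject₁ j))

    here-sum : ∀ j → (sum λ a → sum λ b → here j a b) ≡ 1
    here-sum j = sum-single (λ a → sum (here j a)) (suc j)
      (sum-single (here j (suc j)) (inject₁ j) at off)
      λ a a≢ → trans (sum-cong-≗ (λ b → away a b λ (p , q) → a≢ p)) (sum-replicate-zero n)
      where
      away : ∀ a b → ¬ (a ≡ suc j × b ≡ inject₁ j) → here j a b ≡ 0
      away a b ne with (a ≟ suc j) ×-dec (b ≟ inject₁ j)
      ... | yes p = contradiction p ne
      ... | no _  = refl
      at : here j (suc j) (inject₁ j) ≡ 1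
      at with (suc j ≟ suc j) ×-dec (inject₁ j ≟ inject₁ j)
      ... | yes _ = refl
      ... | no ne = contradiction (refl , refl) ne
      off : ∀ b → b ≢ inject₁ j → here j (suc j) b ≡ 0
      off b b≢ = away (suc j) b λ (_ , q) → b≢ q

    term : ∀ j α → Ascent j α → ∀ a b →
      indicator (Inversion? (α ∘ σ j) (σ j a) (σ j b)) ≡ indicator (Inversion? α a b) ℕ.+ here j a b
    term j α asc a b with Inversion? (α ∘ σ j) (σ j a)
      (σ j b) | Inversion? α a b | (a ≟ suc j) ×-dec (b ≟ inject₁ j)
    ... | yes (p , q) | yes (p′ , q′) | yes (refl , refl) = contradiction
      (ℕₚ.<-trans p′ (left<right j)) (ℕₚ.<-irrefl refl)
    ... | yes _       | yes _         | no _  = refl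
    ... | yes _       | no _          | yes _ = refl
    ... | yes (p , q) | no ¬inv       | no ne = contradiction
          ( subst₂ _<ᶠ_ (σ-involutive j a) (σ-involutive j b) (σ-monotone j p λ (e , f) →
              ne ( σ-injective j (trans e (sym (σ-right j))) , σ-injective j
                (trans f (sym (σ-left j))) ))
          , subst₂ (λ x y → α x <ᶠ α y) (σ-involutive j b) (σ-involutive j a) q) ¬inv
    ... | no ¬inv | yes (p , q) | _ = contradiction
          ( σ-monotone j p (λ { (refl , refl) → ℕₚ.<-asym q asc })
          , subst₂ (λ x y → α x <ᶠ α y) (sym (σ-involutive j b)) (sym (σ-involutive j a)) q) ¬inv
    ... | no ¬inv | no _ | yes (refl , refl) = contradiction
          ( subst₂ _<ᶠ_ (sym (σ-right j)) (sym (σ-left j)) (left<right j)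
          , subst₂ (λ x y → α x <ᶠ α y) (sym (σ-involutive j (inject₁ j)))
            (sym (σ-involutive j (suc j))) asc) ¬inv
    ... | no _ | no _ | no _ = refl

  -- Reindexing both arguments by `σ j` matches the inversions of α ∘ σ j with those of α, except
  -- for one new inversion, at the positions j and j + 1; `here` marks it in the new indexing.
  ν-ascent : ∀ {j α} → Ascent j α → ν (α ∘ σ j) ≡ suc (ν α)
  ν-ascent {j} {α} asc = begin
    ν (α ∘ σ j)
      ≡⟨ reindex j (λ a b → indicator (Inversion? (α ∘ σ j) a b)) ⟩
    (sum λ a → sum λ b → indicator (Inversion? (α ∘ σ j) (σ j a) (σ j b)))
      ≡⟨ sum-cong-≗ (λ a → trans (sum-cong-≗ (term j α asc a))
        (∑-distrib-+ (λ b → indicator (Inversion? α a b)) (here j a))) ⟩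
    (sum λ a → sum (λ b → indicator (Inversion? α a b)) ℕ.+ sum (here j a))
      ≡⟨ ∑-distrib-+ (λ a → sum (λ b → indicator (Inversion? α a b))) (λ a → sum (here j a)) ⟩
    ν α ℕ.+ (sum λ a → sum λ b → here j a b)
      ≡⟨ cong (ν α ℕ.+_) (here-sum j) ⟩
    ν α ℕ.+ 1
      ≡⟨ ℕₚ.+-comm (ν α) 1 ⟩
    suc (ν α) ∎
    where open ≡-Reasoning

  ν-descent : ∀ {j α} → Descent j α → ν α ≡ suc (ν (α ∘ σ j))
  ν-descent {j} {α} desc = trans (ν-cong (λ i → cong α (sym (σ-involutive j i))))
    (ν-ascent {j} {α ∘ σ j} (Descent⇒Ascent-σ {j} {α} desc))

  inverse-cong : ∀ {u v : Permutation′ n} → u Perm.≈ v → ∀ i → u ⟨$⟩ˡ i ≡ v ⟨$⟩ˡ i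
  inverse-cong {u} {v} e i = begin
    u ⟨$⟩ˡ i                         ≡⟨ cong (u ⟨$⟩ˡ_) (Perm.inverseʳ v) ⟨
    u ⟨$⟩ˡ (v ⟨$⟩ʳ (v ⟨$⟩ˡ i))       ≡⟨ cong (u ⟨$⟩ˡ_) (e (v ⟨$⟩ˡ i)) ⟨
    u ⟨$⟩ˡ (u ⟨$⟩ʳ (v ⟨$⟩ˡ i))       ≡⟨ Perm.inverseˡ u ⟩
    v ⟨$⟩ˡ i                         ∎
    where open ≡-Reasoning

  -- Lengths are read off inverses, because left multiplication by s j composes the inverse with
  -- `σ j` on the right, the operation that the count `ν` is adapted to; J is a condition on w⁻¹ as
  -- well.
  inv : Permutation′ n → Fin n → Fin n
  inv u i = u ⟨$⟩ˡ i

  inv-s· : ∀ j u i → inv (s j · u) i ≡ inv u (σ j i)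
  inv-s· j u i = cong (u ⟨$⟩ˡ_) (σˡ j i)

  ν-id : ν (inv Perm.id) ≡ 0
  ν-id = trans (sum-cong-≗ λ a → trans (sum-cong-≗ (zero-term a)) (sum-replicate-zero n))
    (sum-replicate-zero n)
    where
    zero-term : ∀ a b → indicator (Inversion? (inv Perm.id) a b) ≡ 0
    zero-term a b with Inversion? (inv Perm.id) a b
    ... | yes (p , q) = contradiction q (ℕₚ.<-asym p)
    ... | no _ = refl

  word-length : ∀ js → ν (inv (product js)) ℕ.≤ length js
  word-length []       = ℕₚ.≤-reflexive ν-id
  word-length (j ∷ js) with Ascent? j (inv (product js))
  ... | yes asc = ℕₚ.≤-trans (ℕₚ.≤-reflexive
    (trans (ν-cong (inv-s· j (product js))) (ν-ascent {j} {inv (product js)} asc)))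
      (s≤s (word-length js))
  ... | no ¬asc = ℕₚ.≤-trans (ℕₚ.≤-trans
    (ℕₚ.≤-trans (ℕₚ.≤-reflexive (ν-cong (inv-s· j (product js)))) (ℕₚ.n≤1+n _))
        (ℕₚ.≤-reflexive (sym (ν-descent {j} {inv (product js)}
          (¬Ascent⇒Descent (inverse-injective (product js)) ¬asc)))))
        (ℕₚ.≤-trans (word-length js) (ℕₚ.n≤1+n _))

  s·-involutive : ∀ j u → u Perm.≈ s j · (s j · u)
  s·-involutive j u i = sym (σ-involutive j (u ⟨$⟩ʳ i))

  ν-s· : ∀ j u → ¬ Ascent j (inv u) → ν (inv u) ≡ suc (ν (inv (s j · u)))
  ν-s· j u ¬asc = trans (ν-descent {j} {inv u} (¬Ascent⇒Descent (inverse-injective u) ¬asc))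
    (cong suc (sym (ν-cong (inv-s· j u))))

  all-ascents⇒id : ∀ u → (∀ j → Ascent j (inv u)) → u Perm.≈ Perm.id
  all-ascents⇒id u asc i = trans (cong (u ⟨$⟩ʳ_) (sym (increasing⇒identity (inv u) asc i)))
    (Perm.inverseʳ u)

  reduced-word : ∀ c u → ν (inv u) ≡ c → ∃ λ js → Expresses js u × length js ≡ c
  reduced-word c u e = by-descent c e (Finₚ.any? (λ j → ¬? (Ascent? j (inv u))))
    where
    by-descent : ∀ c → ν (inv u) ≡ c → Dec (∃ λ j → ¬ Ascent j (inv u)) → ∃ λ js → Expresses js u ×
      length js ≡ c
    by-descent c e (no none) = [] , u≈id , trans (sym ν-id)
      (trans (ν-cong (λ i → sym (inverse-cong {u} {Perm.id} u≈id i))) e)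
      where
      u≈id : u Perm.≈ Perm.id
      u≈id = all-ascents⇒id u λ j → decidable-stable (Ascent? j (inv u)) λ ¬asc → none (j , ¬asc)
    by-descent zero    e (yes (j , ¬asc)) = contradiction (trans (sym (ν-s· j u ¬asc)) e) λ ()
    by-descent (suc c) e (yes (j , ¬asc)) =
      let (js , ex , len) = reduced-word c (s j · u)
            (ℕₚ.suc-injective (trans (sym (ν-s· j u ¬asc)) e))
      in j ∷ js , (λ i → trans (s·-involutive j u i) (cong (σ j) (ex i))) , cong suc len

  HasLength-ν : ∀ u → HasLength u (ν (inv u))
  HasLength-ν u = (let (js , ex , len) = reduced-word _ u refl in js , ex , len) ,
    λ js ex → ℕₚ.≤-trans (ℕₚ.≤-reflexive (ν-cong (inverse-cong {u} {product js} ex)))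
      (word-length js)

  HasLength-unique : ∀ {u k} → HasLength u k → k ≡ ν (inv u)
  HasLength-unique {u} ((js , ex , refl) , min) = ℕₚ.≤-antisym
    (let (js′ , ex′ , len′) = reduced-word _ u refl in ℕₚ.≤-trans (min js′ ex′)
           (ℕₚ.≤-reflexive len′))
    (proj₂ (HasLength-ν u) js ex)

  -- For β the inverse of v this means that v permutes the positions up to k among themselves, that
  -- is, s k does not occur in the reduced words of v.
  Unstraddled : (Fin n → Fin n) → Fin m → Set
  Unstraddled β k = ∀ a b → toℕ a ℕ.≤ toℕ k → toℕ k ℕ.< toℕ b → β a <ᶠ β b

  Unstraddled-∘σ : ∀ {β j k} → k ≢ j → Unstraddled β k → Unstraddled (β ∘ σ j) k
  Unstraddled-∘σ {j = j} {k} k≢j h a b a≤k k<b = h (σ j a) (σ j b) (σ-≤ j k k≢j a a≤k)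
    (σ-> j k k≢j b k<b)

  Unstraddled-cong : ∀ {β γ k} → (∀ i → β i ≡ γ i) → Unstraddled β k → Unstraddled γ k
  Unstraddled-cong e h a b a≤k k<b = subst₂ _<ᶠ_ (e a) (e b) (h a b a≤k k<b)

  Unstraddled⇒Ascent : ∀ {β k} → Unstraddled β k → Ascent k β
  Unstraddled⇒Ascent {k = k} h = h (inject₁ k) (suc k) (ℕₚ.≤-reflexive (toℕ-left k)) ℕₚ.≤-refl

  product-Unstraddled : ∀ js {k} → All (k ≢_) js → Unstraddled (inv (product js)) k
  product-Unstraddled []       _          a b a≤k k<b = ℕₚ.≤-<-trans a≤k k<b
  product-Unstraddled (j ∷ js) (k≢j ∷ k∉) = Unstraddled-cong {inv (product js) ∘ σ j}
    (λ i → sym (inv-s· j (product js) i))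
    (Unstraddled-∘σ {inv (product js)} {j} k≢j (product-Unstraddled js k∉))

  Inversion₌ : (Fin n → Fin n) → Rel (Fin n) 0ℓ
  Inversion₌ β a b = a ≡ b ⊎ Inversion β a b

  -- A 2 × 2 submatrix of the inversion matrix with unit diagonal: such β contain
  -- one of the patterns 321 and 3412.
  record Square (S : Rel (Fin n) 0ℓ) : Set where
    field
      r₁ r₂ c₁ c₂ : Fin n
      r₁≢r₂       : r₁ ≢ r₂
      c₁≢c₂       : c₁ ≢ c₂
      s₁₁         : S r₁ c₁
      s₁₂         : S r₁ c₂
      s₂₁         : S r₂ c₁
      s₂₂         : S r₂ c₂

  Square-map : ∀ {S T : Rel (Fin n) 0ℓ} (f : Fin n → Fin n) → Injective f →
    (∀ {a b} → S a b → T (f a) (f b)) → Square S → Square T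
  Square-map f inj g p = record
    { r₁≢r₂ = r₁≢r₂ ∘ inj ; c₁≢c₂ = c₁≢c₂ ∘
      inj ; s₁₁ = g s₁₁ ; s₁₂ = g s₁₂ ; s₂₁ = g s₂₁ ; s₂₂ = g s₂₂ }
    where open Square p

  Inversion-σ : ∀ {β j a b} → Descent j β → Inversion (β ∘ σ j) a b → Inversion β (σ j a) (σ j b)
  Inversion-σ {β} {j} desc (a<b , q) = σ-monotone j a<b
    (λ { (refl , refl) → ℕₚ.<-asym q (Descent⇒Ascent-σ {j} {β} desc) }) , q

  321-Square : ∀ {β a b c} → a <ᶠ b → b <ᶠ c → β b <ᶠ β a → β c <ᶠ β b → Square (Inversion₌ β)
  321-Square {β} {a} {b} {c} a<b b<c p q = record
    { r₁ = a ; r₂ = b ; c₁ = b ; c₂ = c ; r₁≢r₂ = λ { refl → ℕₚ.<-irrefl refl a<b } ; c₁≢c₂ =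
      λ { refl → ℕₚ.<-irrefl refl b<c }
    ; s₁₁ = inj₂ (a<b , p) ; s₁₂ = inj₂ (ℕₚ.<-trans a<b b<c , ℕₚ.<-trans q p) ; s₂₁ =
      inj₁ refl ; s₂₂ = inj₂ (b<c , q) }

  ≢∧≯⇒< : ∀ {x y : Fin n} → x ≢ y → ¬ (y <ᶠ x) → x <ᶠ y
  ≢∧≯⇒< x≢y y≮x = ℕₚ.≤∧≢⇒< (ℕₚ.≮⇒≥ y≮x) (x≢y ∘ Finₚ.toℕ-injective)

  -- A pair that still straddles the cut once the descent at j is undone would combine with that
  -- descent to one of the patterns 321 and 3412.
  unstraddled-without-square : ∀ {β j} → Injective β → Descent j β → ¬ Square (Inversion₌ β) →
    Unstraddled (β ∘ σ j) j
  unstraddled-without-square {β} {j} inj desc none a b a≤j j<b with position j a | position j b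
  ... | left      | left      = contradiction (ℕₚ.≤-trans j<b (ℕₚ.≤-reflexive (toℕ-left j)))
    (ℕₚ.<-irrefl refl)
  ... | left      | right     = Descent⇒Ascent-σ {j} {β} desc
  ... | right     | _         = contradiction a≤j ℕₚ.1+n≰n
  ... | other p q | left      = contradiction (ℕₚ.≤-trans j<b (ℕₚ.≤-reflexive (toℕ-left j)))
    (ℕₚ.<-irrefl refl)
  ... | left      | other p q = subst₂ (λ x y → β x <ᶠ β y) (sym (σ-left j)) (sym (σ-other j p q))
      (≢∧≯⇒< (λ e → q (sym (inj e))) λ lt → none
        (321-Square {β} (left<right j) (right<other j<b q) desc lt))
      where
      right<other : ∀ {b} → toℕ j ℕ.< toℕ b → b ≢ suc j → suc j <ᶠ b
      right<other j<b q = ℕₚ.≤∧≢⇒< j<b (λ e → q (sym (Finₚ.toℕ-injective e)))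
  ... | other p q | right     = subst₂ (λ x y → β x <ᶠ β y) (sym (σ-other j p q)) (sym (σ-right j))
      (≢∧≯⇒< (λ e → p (inj e)) λ lt → none
        (321-Square {β} (other<left a≤j p) (left<right j) lt desc))
      where
      other<left : ∀ {a} → toℕ a ℕ.≤ toℕ j → a ≢ inject₁ j → a <ᶠ inject₁ j
      other<left a≤j p = ℕₚ.≤∧≢⇒< (ℕₚ.≤-trans a≤j (ℕₚ.≤-reflexive (sym (toℕ-left j))))
        (p ∘ Finₚ.toℕ-injective)
  ... | other p q | other p′ q′ = subst₂ (λ x y → β x <ᶠ β y) (sym (σ-other j p q))
    (sym (σ-other j p′ q′))
      (≢∧≯⇒< (λ e → ℕₚ.<⇒≢ (ℕₚ.≤-<-trans a≤j j<b) (cong toℕ (inj e))) λ b<a → square b<a)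
      where
      a<l : a <ᶠ inject₁ j
      a<l = ℕₚ.≤∧≢⇒< (ℕₚ.≤-trans a≤j (ℕₚ.≤-reflexive (sym (toℕ-left j)))) (p ∘ Finₚ.toℕ-injective)
      r<b : suc j <ᶠ b
      r<b = ℕₚ.≤∧≢⇒< j<b (λ e → q′ (sym (Finₚ.toℕ-injective e)))
      square : ¬ (β b <ᶠ β a)
      square b<a with Finₚ.<-cmp (β (inject₁ j)) (β a) | Finₚ.<-cmp (β b) (β (suc j))
      ... | tri< l<a _ _ | _            = none (321-Square {β} a<l (left<right j) l<a desc)
      ... | tri≈ _ e _   | _            = p (sym (inj e))
      ... | tri> _ _ a<l′ | tri< b<r _ _ = none (321-Square {β} (left<right j) r<b desc b<r)
      ... | tri> _ _ a<l′ | tri≈ _ e _   = q′ (inj e)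
      -- Here β has the pattern 3412 at a, j, j + 1, b: the first two positions are inverted with
      -- the last two.
      ... | tri> _ _ a<l′ | tri> _ _ r<b′ = none record
        { r₁ = a ; r₂ = inject₁ j ; c₁ = suc j ; c₂ = b ; r₁≢r₂ = p ; c₁≢c₂ = λ e → q′ (sym e)
        ; s₁₁ = inj₂ (ℕₚ.<-trans a<l (left<right j) , ℕₚ.<-trans r<b′ b<a)
        ; s₁₂ = inj₂ (ℕₚ.<-trans a<l (ℕₚ.<-trans (left<right j) r<b) , b<a)
        ; s₂₁ = inj₂ (left<right j , desc)
        ; s₂₂ = inj₂ (ℕₚ.<-trans (left<right j) r<b , ℕₚ.<-trans b<a a<l′) }

  -- The last component makes the letters distinct: every letter of the rest of the word is
  -- straddled by that rest, whereas the letter j just removed is not. The inversions of s j · v are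
  -- carried to inversions of v by `σ j`, so the absence of squares is inherited.
  standard-coxeter : ∀ c v → ν (inv v) ≡ c → ¬ Square (Inversion₌ (inv v)) →
    ∃ λ js → Unique js × Expresses js v × All (λ k → ¬ Unstraddled (inv v) k) js
  standard-coxeter c v e none = by-descent c e (Finₚ.any? (λ j → ¬? (Ascent? j (inv v))))
    where
    by-descent : ∀ c → ν (inv v) ≡ c → Dec (∃ λ j → ¬ Ascent j (inv v)) →
      ∃ λ js → Unique js × Expresses js v × All (λ k → ¬ Unstraddled (inv v) k) js
    by-descent c e (no all) = [] , [] , all-ascents⇒id v
      (λ j → decidable-stable (Ascent? j (inv v)) λ ¬asc → all (j , ¬asc)) , []
    by-descent zero    e (yes (j , ¬asc)) = contradiction (trans (sym (ν-s· j v ¬asc)) e) λ ()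
    by-descent (suc c) e (yes (j , ¬asc)) =
      let (js , unique , ex , straddled) = standard-coxeter c (s j · v)
            (ℕₚ.suc-injective (trans (sym (ν-s· j v ¬asc)) e))
            (none ∘ Square-map (σ j) (σ-injective j) transfer)
      in j ∷ js
       , All.map (λ { h refl → h (Unstraddled-cong {inv v ∘ σ j}
         (λ i → sym (inv-s· j v i)) unstraddled) }) straddled ∷ unique
       , (λ i → trans (s·-involutive j v i) (cong (σ j) (ex i)))
       , (λ h → ¬asc (Unstraddled⇒Ascent {inv v} h)) ∷ All.map (λ {k} → still {k}) straddled
      where
      desc : Descent j (inv v)
      desc = ¬Ascent⇒Descent (inverse-injective v) ¬asc
      transfer : ∀ {a b} → Inversion₌ (inv (s j · v)) a b → Inversion₌ (inv v) (σ j a) (σ j b)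
      transfer (inj₁ refl) = inj₁ refl
      transfer {a} {b} (inj₂ (a<b , q)) = inj₂
        (Inversion-σ {inv v} {j} desc (a<b , subst₂ _<ᶠ_ (inv-s· j v b) (inv-s· j v a) q))
      unstraddled : Unstraddled (inv v ∘ σ j) j
      unstraddled = unstraddled-without-square {inv v} (inverse-injective v) desc none
      still : ∀ {k} → ¬ Unstraddled (inv (s j · v)) k → ¬ Unstraddled (inv v) k
      still {k} h h′ with k ≟ j
      ... | yes refl = ¬asc (Unstraddled⇒Ascent {inv v} h′)
      ... | no k≢j   = h (Unstraddled-cong {inv v ∘ σ j} (λ i → sym (inv-s· j v i))
        (Unstraddled-∘σ {inv v} {j} k≢j h′))

-- The longest element of the parabolic subgroup and the positions Φ

module LongestElement {m : ℕ} (I : Subset m) where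
  open import Relation.Binary.PropositionalEquality using (refl; sym; trans; cong; subst; subst₂)
  open SymmetricGroup {m}
  open Transpositions {m}
  open Blocks I

  Parabolic-block : ∀ {u} → Parabolic I u → ∀ i → SameBlock i (u ⟨$⟩ʳ i)
  Parabolic-block {u} (js , js⊆I , ex) i = subst (SameBlock i) (sym (ex i)) (word-block js js⊆I i)
    where
    σ-block : ∀ {j} → j ∈ I → ∀ i → SameBlock i (σ j i)
    σ-block {j} j∈ i d d∉ = mk⇔ (σ-≤ j d d≢j i) λ σi≤d → subst (λ x → toℕ x ℕ.≤ toℕ d)
      (σ-involutive j i) (σ-≤ j d d≢j (σ j i) σi≤d)
      where
      d≢j : d ≢ j
      d≢j refl = d∉ j∈
    word-block : ∀ js → All (_∈ I) js → ∀ i → SameBlock i (product js ⟨$⟩ʳ i)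
    word-block []       []         i = block-refl
    word-block (j ∷ js) (j∈ ∷ js⊆) i = block-trans (word-block js js⊆ i)
      (σ-block j∈ (product js ⟨$⟩ʳ i))

  Parabolic-block⁻¹ : ∀ {u} → Parabolic I u → ∀ i → SameBlock i (inv u i)
  Parabolic-block⁻¹ {u} par i = block-sym
    (subst (SameBlock (inv u i)) (Perm.inverseʳ u) (Parabolic-block {u} par (inv u i)))

  -- An index d outside I that separates i from j also separates their images, since f preserves
  -- blocks.
  outside-monotone : ∀ {f : Fin n → Fin n} → (∀ i → SameBlock i (f i)) → ∀ {i j} → i <ᶠ j →
    ¬ SameBlock i j → f i <ᶠ f j
  outside-monotone {f} blk {i} {j} i<j ¬e =
    let (d , d∉ , i≤d , d<j) = separated i<j ¬e in
    ℕₚ.≤-<-trans (Equivalence.to (blk i d d∉) i≤d)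
                 (ℕₚ.≰⇒> λ fj≤d → ℕₚ.<⇒≱ d<j (Equivalence.from (blk j d d∉) fj≤d))

  Reverses : (Fin n → Fin n) → Set
  Reverses α = ∀ {a b} → a <ᶠ b → SameBlock a b → α b <ᶠ α a

  descents⇒Reverses : ∀ {α} → (∀ {j} → j ∈ I → Descent j α) → Reverses α
  descents⇒Reverses {α} desc {a} {b} = block-chain {P = λ a b → α b <ᶠ α a} (λ p q → ℕₚ.<-trans q p)
    (λ d d∈ → desc d∈) _ ℕₚ.≤-refl

  ascents⇒increasing : ∀ {α} → (∀ {j} → j ∈ I → Ascent j α) → ∀ {a b} → a <ᶠ b → SameBlock a b →
    α a <ᶠ α b
  ascents⇒increasing {α} asc {a} {b} = block-chain {P = λ a b → α a <ᶠ α b} ℕₚ.<-trans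
    (λ d d∈ → asc d∈) _ ℕₚ.≤-refl

  reverses-longest : ∀ {w₀} → Parabolic I w₀ → Reverses (inv w₀) → IsLongestElement I w₀
  reverses-longest {w₀} par rev = par , λ v k l v∈ lw lv →
    subst₂ ℕ._≤_ (sym (HasLength-unique {v} lv)) (sym (HasLength-unique {w₀} lw))
      (ν-mono (inv v) (inv w₀) λ {a} {b} (a<b , q) → a<b , rev a<b (in-block v v∈ a<b q))
    where
    in-block : ∀ v → Parabolic I v → ∀ {a b} → a <ᶠ b → inv v b <ᶠ inv v a → SameBlock a b
    in-block v v∈ {a} {b} a<b q with a block? b
    ... | yes e = e
    ... | no ¬e = contradiction (outside-monotone {inv v} (Parabolic-block⁻¹ {v} v∈) a<b ¬e)
      (ℕₚ.<-asym q)

  -- Bubble sort inside the blocks: each step multiplies by some s j with j in I and lowers `ν`. The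
  -- collected letters spell the element that turns out to be the longest one.
  sort-blocks : ∀ c w js v → ν (inv v) ≡ c → v Perm.≈ product js · w → All (_∈ I) js →
    ∃ λ js → All (_∈ I) js × (∀ {j} → j ∈ I → Ascent j (inv (product js · w)))
  sort-blocks c w js v e v≈ js⊆ = by-descent c e
    (Finₚ.any? (λ j → (j ∈? I) ×-dec ¬? (Ascent? j (inv v))))
    where
    by-descent : ∀ c → ν (inv v) ≡ c → Dec (∃ λ j → j ∈ I × ¬ Ascent j (inv v)) →
      ∃ λ js → All (_∈ I) js × (∀ {j} → j ∈ I → Ascent j (inv (product js · w)))
    by-descent c e (no none) = js , js⊆ , λ {j} j∈ → subst₂ _<ᶠ_
      (inverse-cong {v} {product js · w} v≈ _) (inverse-cong {v} {product js · w} v≈ _)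
      (decidable-stable (Ascent? j (inv v)) λ ¬asc → none (j , j∈ , ¬asc))
    by-descent zero    e (yes (j , _ , ¬asc)) = contradiction (trans (sym (ν-s· j v ¬asc)) e) λ ()
    by-descent (suc c) e (yes (j , j∈ , ¬asc)) = sort-blocks c w (j ∷ js) (s j · v)
      (ℕₚ.suc-injective (trans (sym (ν-s· j v ¬asc)) e))
      (λ i → cong (σ j) (v≈ i)) (j∈ ∷ js⊆)

  module _ (w : Permutation′ n) where

    Φ : Rel (Fin n) 0ℓ
    Φ i j = i <ᶠ j × ¬ SameBlock i j × inv w j <ᶠ inv w i

    Φ₌ : Rel (Fin n) 0ℓ
    Φ₌ i j = i ≡ j ⊎ Φ i j

    Φ⇒Inversion : ∀ {w₀} → Parabolic I w₀ → ∀ {i j} → Φ i j → Inversion (inv (w₀ · w)) (w₀ ⟨$⟩ʳ i)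
      (w₀ ⟨$⟩ʳ j)
    Φ⇒Inversion {w₀} par (i<j , ¬e , q) = outside-monotone {w₀ ⟨$⟩ʳ_}
      (Parabolic-block {w₀} par) i<j ¬e ,
      subst₂ (λ x y → inv w x <ᶠ inv w y) (sym (Perm.inverseˡ w₀)) (sym (Perm.inverseˡ w₀)) q

    -- Since w⁻¹ decreases on every block, an element that sorts all blocks must reverse them, hence
    -- is longest. The inversions of the sorted product lie between different blocks and pull back
    -- to Φ, so a square among them would give one in `Φ₌ w`.
    spherical-without-square : (∀ {j} → j ∈ I → J w j) → ¬ Square Φ₌ → IsSpherical I w
    spherical-without-square I⊆J none =
      let (js , js⊆ , asc)    = sort-blocks _ w [] w refl (λ _ → refl) []
          w₀                  = product js
          par                 = js , js⊆ , λ _ → refl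
          increasing          = ascents⇒increasing {inv (w₀ · w)} asc
          Inversion⇒Φ : ∀ {a b} → Inversion (inv (w₀ · w)) a b → Φ (inv w₀ a) (inv w₀ b)
          Inversion⇒Φ = λ {a} {b} (a<b , q) →
            let ¬e = λ e → ℕₚ.<-asym q (increasing a<b e) in
            outside-monotone {inv w₀} (Parabolic-block⁻¹ {w₀} par) a<b ¬e ,
            (λ e → ¬e (block-trans (Parabolic-block⁻¹ {w₀} par a)
              (block-trans e (block-sym (Parabolic-block⁻¹ {w₀} par b))))) , q
          (ks , unique , ex , _) = standard-coxeter _ (w₀ · w) refl
            (none ∘ Square-map (inv w₀) (inverse-injective w₀)
            λ { (inj₁ refl) → inj₁ refl ; (inj₂ i) → inj₂ (Inversion⇒Φ i) })
      in w₀ , reverses-longest {w₀} par (λ {a} {b} → reverses w₀ par increasing {a} {b}) , ks ,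
        unique , ex
      where
      w-reverses : Reverses (inv w)
      w-reverses = descents⇒Reverses {inv w} I⊆J
      reverses : ∀ w₀ → Parabolic I w₀ →
        (∀ {a b} → a <ᶠ b → SameBlock a b → inv (w₀ · w) a <ᶠ inv (w₀ · w) b) → Reverses (inv w₀)
      reverses w₀ par increasing {a} {b} a<b e with Finₚ.<-cmp (inv w₀ a) (inv w₀ b)
      ... | tri> _ _ gt = gt
      ... | tri≈ _ eq _ = contradiction a<b (ℕₚ.<-irrefl (cong toℕ (inverse-injective w₀ eq)))
      ... | tri< lt _ _ = contradiction (increasing a<b e) (ℕₚ.<-asym (w-reverses lt
              (block-trans (block-sym (Parabolic-block⁻¹ {w₀} par a))
                (block-trans e (Parabolic-block⁻¹ {w₀} par b)))))

-- The upper triangular subgroup of the Levi is a Borel subgroup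

+-compose-≤ : ∀ {a b c i k j} → c ℕ.≤ a ℕ.+ b → a ℕ.+ i ℕ.≤ k → b ℕ.+ k ℕ.≤ j → c ℕ.+ i ℕ.≤ j
+-compose-≤ {a} {b} {c} {i} {k} {j} c≤a+b p q = begin
  c ℕ.+ i         ≤⟨ ℕₚ.+-monoˡ-≤ i c≤a+b ⟩
  (a ℕ.+ b) ℕ.+ i ≡⟨ ≡.cong (ℕ._+ i) (ℕₚ.+-comm a b) ⟩
  (b ℕ.+ a) ℕ.+ i ≡⟨ ℕₚ.+-assoc b a i ⟩
  b ℕ.+ (a ℕ.+ i) ≤⟨ ℕₚ.+-monoʳ-≤ b p ⟩
  b ℕ.+ k         ≤⟨ q ⟩
  j               ∎
  where open ℕₚ.≤-Reasoning

module StandardBorel (𝒞 : ComplexNumbers) {m : ℕ} (I : Subset m) where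
  open Field 𝒞
  open GeneralLinear 𝒞
  open Linear 𝒞
  open Support 𝒞
  open Transvections 𝒞
  open GroupMatrices 𝒞 {m}
  open Zariski 𝒞 {m} using (eval-evalₘ; :evalₘ)
  open GL
  open Spherical 𝒞 {m} using (GLₙ; G; var; eval; Closed; Connected; Levi;
    IsBorelSubgroup; ConnectedSolvableClosedSubgroup)
  open Subgroups G hiding (resp; ε∈; ∙∈; ⁻¹∈)

  open Blocks I using () renaming (SameBlock to E; block-refl to E-refl; block-sym to E-sym;
    block-trans to E-trans; _block?_ to E?) public

  R : Rel (Fin (suc m)) 0ℓ
  R i j = E i j × i ≤ᶠ j

  R-Order : Order R
  R-Order = record
    { rfl  = E-refl , ℕₚ.≤-refl
    ; tran = λ (e , p) (f , q) → E-trans e f , ℕₚ.≤-trans p q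
    ; rank = toℕ
    ; mono = λ (_ , i≤j) i≢j → ℕₚ.≤∧≢⇒< i≤j (i≢j ∘ Finₚ.toℕ-injective)
    }
  open Order R-Order using () renaming (rfl to R-refl; tran to R-trans; antisym to R-antisym)

  H : Pred GLₙ 0ℓ
  H g = Supp R (matrix g)

  H-inverse : ∀ {g} → H g → Supp R (inverse g)
  H-inverse {g} h = Order.Supp-inverse R-Order (inverseˡ g) h

  H-isSubgroup : IsSubgroup H
  H-isSubgroup = record
    { resp = λ e h → Supp-≈ e h
    ; ε∈   = Supp-1ₘ {R = R} R-refl
    ; ∙∈   = Supp-* R-trans
    ; ⁻¹∈  = λ {g} → H-inverse {g}
    }

  H⊆Levi : ∀ {g} → H g → Levi I g
  H⊆Levi h i j ¬e = h i j (¬e ∘ proj₁)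

  H-closed : Closed H
  H-closed = (λ p → ∃ λ i → ∃ λ j → ¬ R i j × p ≡ var i j) , λ g → mk⇔
    (λ { h _ (i , j , ¬r , ≡.refl) → h i j ¬r })
    (λ h i j ¬r → h (var i j) (i , j , ¬r , ≡.refl))

  R⇒Upper : ∀ {x} → Supp R x → Upper x
  R⇒Upper s i j j<i = s i j λ (_ , i≤j) → ℕₚ.<⇒≱ j<i i≤j

  H-diag-unit : ∀ {g} → H g → ∀ i → Unit (matrix g i i)
  H-diag-unit {g} h = Order.diag-unit R-Order {y = inverse g} (inverseˡ g) h

  -- Join y and z by a line of matrices with support in R. If an equation of Y fails at z and one of
  -- Z fails at y, then at a generic point of the line the matrix is invertible and both equations
  -- fail, which the covering forbids.
  H-connected : Connected H
  H-connected {Y} {Z} (𝓕 , Y⇔) (𝓖 , Z⇔) cover (y , y∈H , y∈Y) (z , z∈H , z∈Z) empty =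
    ¬∀⇒∃¬ {P = λ (p : ∃ 𝓕) → eval (proj₁ p) z ≈ 0#}
      (λ all → empty z (z∈H , Equivalence.from (Y⇔ z) (λ p p∈ → all (p , p∈)) , z∈Z)) (λ _ → stable)
    λ ((p , p∈) , pz≉0) →
    ¬∀⇒∃¬ {P = λ (q : ∃ 𝓖) → eval (proj₁ q) y ≈ 0#}
      (λ all → empty y (y∈H , y∈Y , Equivalence.from (Z⇔ y) (λ q q∈ → all (q , q∈)))) (λ _ → stable)
    λ ((q , q∈) , qy≉0) →
    Ev-∃ (Ev-∩ (Ev-∀Fin λ i → Curve-eventually≉0 (:line i i) {0#} λ e → Unit⇒≉0
      (H-diag-unit {y} y∈H i) (trans (sym (line-0 i i)) e))
         (Ev-∩ (Curve-eventually≉0 (:evalₘ Curve :line p) {1#} λ e → pz≉0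
           (trans (eval-evalₘ p z (λ i j → sym (line-1 i j))) e))
               (Curve-eventually≉0 (:evalₘ Curve :line q) {0#} λ e → qy≉0
                 (trans (eval-evalₘ q y (λ i j → sym (line-0 i j))) e))))
    λ (k , diag≉0 , p≉0 , q≉0) → ¬¬-∀Fin (λ i → ≉0⇒Unit (diag≉0 i)) λ diag →
    let g = upperGL (line (nat k)) (R⇒Upper (line-Supp (nat k))) diag in
    cover g (line-Supp (nat k))
      ( (λ g∈Y → p≉0 (trans (sym (eval-evalₘ p g λ _ _ → refl)) (Equivalence.to (Y⇔ g) g∈Y p p∈)))
      , (λ g∈Z → q≉0 (trans (sym (eval-evalₘ q g λ _ _ → refl)) (Equivalence.to (Z⇔ g) g∈Z q q∈))))
    where
    line : Carrier → Matrix (suc m)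
    line t i j = matrix y i j + t * (matrix z i j - matrix y i j)
    open PolynomialMatrix Curve
    open PolynomialClass Curve hiding (𝒫)
    :line : 𝒫ₘ line
    :line i j = const (matrix y i j) :⊕ (Curve-id :⊗ const (matrix z i j - matrix y i j))
    line-Supp : ∀ t → Supp R (line t)
    line-Supp t i j ¬r = trans (+-cong (y∈H i j ¬r)
      (x*0≈0 (trans (+-cong (z∈H i j ¬r) (-‿cong (y∈H i j ¬r))) (-‿inverseʳ 0#)))) (+-identityʳ _)
    line-0 : line 0# ≈ₘ matrix y
    line-0 i j = trans (+-congˡ (zeroˡ _)) (+-identityʳ _)
    line-1 : line 1# ≈ₘ matrix z
    line-1 i j = solve 2 (λ y z → y :+ :1 :* (z :- y) := z) refl (matrix y i j) (matrix z i j)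

  Steps : ℕ → Rel (Fin (suc m)) 0ℓ
  Steps k i j = k ℕ.+ toℕ i ℕ.≤ toℕ j

  Steps-compose : ∀ {a b c} → c ℕ.≤ a ℕ.+ b → ∀ {i k j} → Steps a i k → Steps b k j → Steps c i j
  Steps-compose {a} {b} c≤a+b = +-compose-≤ {a} {b} c≤a+b

  infixl 6 _-ₘ_
  _-ₘ_ : Matrix (suc m) → Matrix (suc m) → Matrix (suc m)
  (x -ₘ y) i j = x i j - y i j

  Supp-sub : ∀ {S : Rel (Fin (suc m)) 0ℓ} {x y} → Supp S x → Supp S y → Supp S (x -ₘ y)
  Supp-sub sx sy i j ¬s = trans (+-cong (sx i j ¬s) (-‿cong (sy i j ¬s))) (-‿inverseʳ 0#)

  *ₘ-subˡ : ∀ x y z → (x -ₘ y) *ₘ z ≈ₘ x *ₘ z -ₘ y *ₘ z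
  *ₘ-subˡ x y z i j = trans (∙-comm ((x -ₘ y) i) (λ k → z k j))
    (trans (∙-subʳ (λ k → z k j) (x i) (y i))
    (+-cong (∙-comm (λ k → z k j) (x i)) (-‿cong (∙-comm (λ k → z k j) (y i)))))

  *ₘ-subʳ : ∀ x y z → x *ₘ (y -ₘ z) ≈ₘ x *ₘ y -ₘ x *ₘ z
  *ₘ-subʳ x y z i j = ∙-subʳ (x i) (λ k → y k j) (λ k → z k j)

  bracket : ∀ x y → x *ₘ y -ₘ y *ₘ x ≈ₘ (x -ₘ 1ₘ) *ₘ (y -ₘ 1ₘ) -ₘ (y -ₘ 1ₘ) *ₘ (x -ₘ 1ₘ)
  bracket x y i j = sym (trans (+-cong (expand x y) (-‿cong (expand y x)))
    (solve 5 (λ p q x y o → (p :- y :- (x :- o)) :- (q :- x :- (y :- o)) := p :- q) refl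
      ((x *ₘ y) i j) ((y *ₘ x) i j) (x i j) (y i j) (1ₘ i j)))
    where
    expand : ∀ x y → ((x -ₘ 1ₘ) *ₘ (y -ₘ 1ₘ)) i j ≈ ((x *ₘ y) i j - y i j) - (x i j - 1ₘ i j)
    expand x y = trans (*ₘ-subʳ (x -ₘ 1ₘ) y 1ₘ i j)
      (+-cong (trans (*ₘ-subˡ x 1ₘ y i j) (+-congˡ (-‿cong (*ₘ-identityˡ y i j))))
      (-‿cong (*ₘ-identityʳ (x -ₘ 1ₘ) i j)))

  -- The filtration behind solvability: for k > 0 the entries of g - 1 start at the k-th
  -- superdiagonal, while k = 0 describes H itself.
  Unipotent : ℕ → Pred GLₙ 0ℓ
  Unipotent k g = Supp R (matrix g) × Supp (Steps k) (matrix g -ₘ 1ₘ)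

  private
    upper-Steps : ∀ {x} → Supp R x → Supp (Steps 0) x
    upper-Steps s i j ¬s = s i j (¬s ∘ proj₂)

    upper-Steps-1 : ∀ {x} → Supp R x → Supp (Steps 0) (x -ₘ 1ₘ)
    upper-Steps-1 s = Supp-sub (upper-Steps s) (Supp-1ₘ {R = Steps 0} ℕₚ.≤-refl)

  Unipotent-* : ∀ k {x y} → Supp (Steps k) (x -ₘ 1ₘ) → Supp (Steps 0) y → Supp (Steps k) (y -ₘ 1ₘ) →
                Supp (Steps k) (x *ₘ y -ₘ 1ₘ)
  Unipotent-* k {x} {y} sx sy sy′ i j ¬s = begin
    (x *ₘ y) i j - 1ₘ i j                             ≈⟨ solve 3
      (λ p y o → p :- o := (p :- y) :+ (y :- o)) refl ((x *ₘ y) i j) (y i j) (1ₘ i j) ⟩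
    ((x *ₘ y) i j - y i j) + (y i j - 1ₘ i j)          ≈⟨ +-congʳ
      (trans (*ₘ-subˡ x 1ₘ y i j) (+-congˡ (-‿cong (*ₘ-identityˡ y i j)))) ⟨
    ((x -ₘ 1ₘ) *ₘ y) i j + (y i j - 1ₘ i j)
      ≈⟨ +-cong (Supp-* (Steps-compose {k} {0} {k} (ℕₚ.≤-reflexive (≡.sym (ℕₚ.+-identityʳ k)))) sx
        sy i j ¬s) (sy′ i j ¬s) ⟩
    0# + 0#                                            ≈⟨ +-identityʳ _ ⟩
    0#                                                 ∎

  Unipotent-inverse : ∀ k {x y} → x *ₘ y ≈ₘ 1ₘ → Supp (Steps k) (x -ₘ 1ₘ) → Supp (Steps 0) y → Supp
    (Steps k) (y -ₘ 1ₘ)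
  Unipotent-inverse k {x} {y} xy sx sy i j ¬s = begin
    y i j - 1ₘ i j                       ≈⟨ +-cong (sym (*ₘ-identityˡ y i j))
      (-‿cong (sym (xy i j))) ⟩
    (1ₘ *ₘ y) i j - (x *ₘ y) i j         ≈⟨ solve 2 (λ p q → p :- q := :- (q :- p)) refl _ _ ⟩
    - ((x *ₘ y) i j - (1ₘ *ₘ y) i j)     ≈⟨ -‿cong (*ₘ-subˡ x 1ₘ y i j) ⟨
    - ((x -ₘ 1ₘ) *ₘ y) i j               ≈⟨ -‿cong
      (Supp-* (Steps-compose {k} {0} {k} (ℕₚ.≤-reflexive (≡.sym (ℕₚ.+-identityʳ k)))) sx sy i j
        ¬s) ⟩
    - 0#                                 ≈⟨ trans (sym (+-identityˡ _)) (-‿inverseʳ 0#) ⟩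
    0#                                   ∎

  -- [x , y] - 1 = (x y - y x) x⁻¹ y⁻¹, and upper triangular factors do not lower the depth.
  commutator-Steps : ∀ k {x y x′ y′} → x *ₘ x′ ≈ₘ 1ₘ → y *ₘ y′ ≈ₘ 1ₘ → Supp (Steps k)
    (x *ₘ y -ₘ y *ₘ x) →
    Supp (Steps 0) x′ → Supp (Steps 0) y′ → Supp (Steps k) (((x *ₘ y) *ₘ x′) *ₘ y′ -ₘ 1ₘ)
  commutator-Steps k {x} {y} {x′} {y′} xx′ yy′ s sx′ sy′ = Supp-≈
    {M = (x *ₘ y -ₘ y *ₘ x) *ₘ (x′ *ₘ y′)} (λ i j → trans (*ₘ-subˡ (x *ₘ y) (y *ₘ x) (x′ *ₘ y′) i j)
      (+-cong (sym (*ₘ-assoc (x *ₘ y) x′ y′ i j)) (-‿cong (yxx′y′ i j))))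
    (Supp-* (Steps-compose {k} {0} {k} (ℕₚ.≤-reflexive (≡.sym (ℕₚ.+-identityʳ k)))) s
            (Supp-* (Steps-compose {0} {0} {0} ℕ.z≤n) sx′ sy′))
    where
    yxx′y′ : (y *ₘ x) *ₘ (x′ *ₘ y′) ≈ₘ 1ₘ
    yxx′y′ = *ₘ-inverse y x x′ y′ xx′ yy′

  -- For k = 0 the diagonal of x y - y x vanishes because the diagonal entries commute. For k > 0
  -- the bracket can be taken of x - 1 and y - 1, where depths add up, and 2 k ≥ k + 1.
  bracket-Steps : ∀ k {x y} → Supp R x → Supp R y → Supp (Steps k) (x -ₘ 1ₘ) → Supp (Steps k)
    (y -ₘ 1ₘ) →
                  Supp (Steps (suc k)) (x *ₘ y -ₘ y *ₘ x)
  bracket-Steps zero {x} {y} sx sy _ _ i j ¬s with i ≟ j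
  ... | yes ≡.refl = begin
        (x *ₘ y) i i - (y *ₘ x) i i ≈⟨ +-cong
          (*ₘ-diag {S = R} (λ p q → ≡.sym (R-antisym p q)) sx sy i)
            (-‿cong (*ₘ-diag {S = R} (λ p q → ≡.sym (R-antisym p q)) sy sx i)) ⟩
        x i i * y i i - y i i * x i i ≈⟨ x≈y⇒x-y≈0 (*-comm _ _) ⟩
        0# ∎
  ... | no i≢j = Supp-sub (Supp-* (Steps-compose {0} {0} {0} ℕ.z≤n) (upper-Steps sx)
    (upper-Steps sy))
                          (Supp-* (Steps-compose {0} {0} {0} ℕ.z≤n) (upper-Steps sy)
                            (upper-Steps sx)) i j
                   λ i≤j → ¬s (ℕₚ.≤∧≢⇒< i≤j (i≢j ∘ Finₚ.toℕ-injective))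
  bracket-Steps (suc k) {x} {y} sx sy sx′ sy′ = Supp-≈ (λ i j → sym (bracket x y i j))
    (Supp-sub (Supp-* (Steps-compose {suc k} {suc k} {suc (suc k)} (s≤s (ℕₚ.m≤n+m (suc k) k))) sx′
      sy′)
              (Supp-* (Steps-compose {suc k} {suc k} {suc (suc k)} (s≤s (ℕₚ.m≤n+m (suc k) k))) sy′
                sx′))

  derived-Unipotent : ∀ k {g} → derived k H g → Unipotent k g
  derived-Unipotent zero    h = h , upper-Steps-1 h
  derived-Unipotent (suc k) = go
    where
    go : ∀ {g} → Commutators (derived k H) g → Unipotent (suc k) g
    go (comm {x} {y} x∈ y∈) =
      let (hx , sx) = derived-Unipotent k {x} x∈ ; (hy , sy) = derived-Unipotent k {y} y∈ in
      Supp-* R-trans (Supp-* R-trans (Supp-* R-trans hx hy) (H-inverse {x} hx)) (H-inverse {y} hy) ,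
      commutator-Steps (suc k) {matrix x} {matrix y} {inverse x} {inverse y} (inverseʳ x)
        (inverseʳ y) (bracket-Steps k hx hy sx sy) (upper-Steps (H-inverse {x} hx))
          (upper-Steps (H-inverse {y} hy))
    go (Commutators.resp {x} {y} e c) = let (h , s) = go {x} c in Supp-≈ e h , Supp-≈
                                              (λ i j → +-congʳ (e i j)) s
    go Commutators.ε∈ = Supp-1ₘ {R = R} R-refl , λ i j _ → -‿inverseʳ _
    go (Commutators.∙∈ {x} {y} c d) = let (hx , sx) = go {x} c ; (hy , sy) = go {y} d in
      Supp-* R-trans hx hy , Unipotent-* (suc k) {matrix x} {matrix y} sx (upper-Steps hy) sy
    go (Commutators.⁻¹∈ {x} c) = let (hx , sx) = go {x} c in
      H-inverse {x} hx , Unipotent-inverse (suc k) {matrix x} {inverse x} (inverseʳ x) sx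
        (upper-Steps (H-inverse {x} hx))

  H-solvable : Solvable H
  -- A matrix of size m + 1 has no entries on its superdiagonal of index m + 1.
  H-solvable = suc m , λ {g} d i j → x-y≈0⇒x≈y (proj₂ (derived-Unipotent (suc m) {g} d) i j
    λ le → ℕₚ.<⇒≱ (Finₚ.toℕ<n j) (ℕₚ.≤-trans (ℕₚ.m≤m+n (suc m) (toℕ i)) le))

  Mem-H : ∀ {x y} → x *ₘ y ≈ₘ 1ₘ → y *ₘ x ≈ₘ 1ₘ → Supp R x → Mem H x
  Mem-H {x} {y} xy yx s = record { matrix = x ; inverse = y ; inverseˡ = yx ; inverseʳ = xy } , s ,
    λ _ _ → refl

  elementary-row-shear : ∀ (i j : Fin (suc m)) t → elementary i j t ≈ₘ row-shear i
    (λ b → t * 1ₘ j b)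
  elementary-row-shear i j t a b = solve 6 (λ d x y u v t → let z = :0 in
    d :+ ((x :* z :+ y :* z) :* u :+ (x :* t :+ y :* z) :* v) := d :+ x :* (t :* v)) refl (1ₘ a b)
      (1ₘ a i) (1ₘ a j) (1ₘ i b) (1ₘ j b) t

  Supp-row-shear : ∀ {S : Rel (Fin (suc m)) 0ℓ} → Reflexive S → ∀ i (φ : Vector (suc m)) →
    (∀ b → ¬ S i b → φ b ≈ 0#) → Supp S (row-shear i φ)
  Supp-row-shear {S} rfl i φ h a b ¬s with a ≟ i
  ... | yes ≡.refl = trans (+-cong (1ₘ-off a b λ { ≡.refl → ¬s rfl }) (x*0≈0 (h b ¬s)))
    (+-identityʳ _)
  ... | no a≢i     = trans (+-cong (1ₘ-off a b λ { ≡.refl → ¬s rfl }) (zeroˡ _)) (+-identityʳ _)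

  Mem-H-elementary : ∀ {i j} → i ≢ j → R i j → ∀ t → Mem H (elementary i j t)
  Mem-H-elementary {i} {j} i≢j r t = Mem-resp (λ a b → sym (elementary-row-shear i j t a b))
    (Mem-H {row-shear i φ} {row-shear i (λ b → - φ b)} (inv φ (λ b → - φ b) φi (λ b → -‿inverseʳ _))
           (inv (λ b → - φ b) φ (trans (-‿cong φi) (trans (sym (+-identityˡ _)) (-‿inverseʳ 0#)))
             (λ b → -‿inverseˡ _))
      (Supp-row-shear {R} R-refl i φ λ b ¬s → x*0≈0 (1ₘ-off j b λ { ≡.refl → ¬s r })))
    where
    φ : Vector (suc m)
    φ b = t * 1ₘ j b
    φi : φ i ≈ 0#
    φi = x*0≈0 (1ₘ-off j i (i≢j ∘ ≡.sym))
    inv : ∀ (φ ψ : Vector (suc m)) → φ i ≈ 0# → (∀ b → φ b + ψ b ≈ 0#) → row-shear i φ *ₘ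
      row-shear i ψ ≈ₘ 1ₘ
    inv φ ψ φi e a b = trans (row-shear-* i φ ψ φi a b)
      (trans (+-congˡ (x*0≈0 (e b))) (+-identityʳ _))

  scaling : Fin (suc m) → Carrier → Matrix (suc m)
  scaling j c = row-shear j (λ b → c * 1ₘ j b)

  scaling-* : ∀ j {c c′} → c + c′ + c * c′ ≈ 0# → scaling j c *ₘ scaling j c′ ≈ₘ 1ₘ
  scaling-* j {c} {c′} e a b = begin
    (scaling j c *ₘ scaling j c′) a b
      ≈⟨ row-shear-act j (λ b → c * 1ₘ j b) (scaling j c′) a b ⟩
    scaling j c′ a b + 1ₘ a j * ((λ b → c * 1ₘ j b) ∙ (λ k → scaling j c′ k b))
      ≈⟨ +-congˡ (*-congˡ (trans (∙-scaleˡ c (1ₘ j) (λ k → scaling j c′ k b))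
        (*-congˡ (trans (1ₘ-∙ (λ k → scaling j c′ k b) j) (+-congˡ (*-congʳ (1ₘ-diag j))))))) ⟩
    (1ₘ a b + 1ₘ a j * (c′ * 1ₘ j b)) + 1ₘ a j * (c * (1ₘ j b + 1# * (c′ * 1ₘ j b)))
      ≈⟨ solve 5 (λ d x y c c′ → (d :+ x :* (c′ :* y)) :+ x :* (c :* (y :+ :1 :* (c′ :* y))) := d :+
        (c :+ c′ :+ c :* c′) :* (x :* y)) refl (1ₘ a b) (1ₘ a j) (1ₘ j b) c c′ ⟩
    1ₘ a b + (c + c′ + c * c′) * (1ₘ a j * 1ₘ j b) ≈⟨ +-congˡ (0*x≈0 e) ⟩
    1ₘ a b + 0# ≈⟨ +-identityʳ _ ⟩
    1ₘ a b ∎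

  double halve : Fin (suc m) → Matrix (suc m)
  double j = scaling j 1#
  halve j = scaling j (- ½)

  double-halve : ∀ j → double j *ₘ halve j ≈ₘ 1ₘ
  double-halve j = scaling-* j (trans
    (solve 1 (λ h → :1 :+ :- h :+ :1 :* :- h := :1 :- (h :+ h)) refl ½) (x≈y⇒x-y≈0 (sym ½+½≈1)))

  halve-double : ∀ j → halve j *ₘ double j ≈ₘ 1ₘ
  halve-double j = scaling-* j (trans
    (solve 1 (λ h → :- h :+ :1 :+ :- h :* :1 := :1 :- (h :+ h)) refl ½) (x≈y⇒x-y≈0 (sym ½+½≈1)))

  Mem-H-double : ∀ j → Mem H (double j)
  Mem-H-double j = Mem-H {double j} {halve j} (double-halve j) (halve-double j)
    (Supp-row-shear {R} R-refl j (λ b → 1# * 1ₘ j b) λ b ¬s → x*0≈0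
      (1ₘ-off j b λ { ≡.refl → ¬s R-refl }))

  -- Conjugation by double j halves the j-th entry of φ, so the commutator with
  -- double j isolates that entry.
  isolate : ∀ {i j} → i ≢ j → ∀ (φ : Vector (suc m)) → φ i ≈ 0# →
    ((double j *ₘ row-shear i φ) *ₘ halve j) *ₘ row-shear i (λ b → - φ b) ≈ₘ elementary i j
      (- ½ * φ j)
  isolate {i} {j} i≢j φ φi a b = begin
    (((double j *ₘ row-shear i φ) *ₘ halve j) *ₘ row-shear i (λ b → - φ b)) a b
      ≈⟨ *ₘ-cong₁ (row-shear i (λ b → - φ b)) conj a b ⟩
    (row-shear i φ′ *ₘ row-shear i (λ b → - φ b)) a b
      ≈⟨ row-shear-* i φ′ (λ b → - φ b)
        (trans (+-cong φi (x*0≈0 (1ₘ-off j i (i≢j ∘ ≡.sym)))) (+-identityʳ _)) a b ⟩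
    row-shear i (λ b → φ′ b + - φ b) a b
      ≈⟨ row-shear-cong i (λ b → solve 2 (λ f g → (f :+ g) :+ :- f := g) refl (φ b)
        (- ½ * φ j * 1ₘ j b)) a b ⟩
    row-shear i (λ b → (- ½ * φ j) * 1ₘ j b) a b
      ≈⟨ elementary-row-shear i j (- ½ * φ j) a b ⟨
    elementary i j (- ½ * φ j) a b ∎
    where
    φ′ : Vector (suc m)
    φ′ b = φ b + - ½ * φ j * 1ₘ j b
    φ-halve : ∀ b → (φ ᵥ* halve j) b ≈ φ′ b
    φ-halve b = begin
      φ ∙ (λ k → 1ₘ k b + 1ₘ k j * (- ½ * 1ₘ j b)) ≈⟨ ∙-+ʳ φ (λ k → 1ₘ k b)
        (λ k → 1ₘ k j * (- ½ * 1ₘ j b)) ⟩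
      φ ∙ (λ k → 1ₘ k b) + φ ∙ (λ k → 1ₘ k j * (- ½ * 1ₘ j b))
        ≈⟨ +-cong (∙-1ₘ φ b) (trans (∙-scaleʳ′ (- ½ * 1ₘ j b) φ (λ k → 1ₘ k j))
          (*-congʳ (∙-1ₘ φ j))) ⟩
      φ b + φ j * (- ½ * 1ₘ j b) ≈⟨ +-congˡ
        (solve 3 (λ f h d → f :* (h :* d) := h :* f :* d) refl (φ j) (- ½) (1ₘ j b)) ⟩
      φ′ b ∎
    conj : (double j *ₘ row-shear i φ) *ₘ halve j ≈ₘ row-shear i φ′
    conj a b = begin
      ((double j *ₘ row-shear i φ) *ₘ halve j) a b ≈⟨ *ₘ-assoc (double j) (row-shear i φ)
        (halve j) a b ⟩
      (double j *ₘ (row-shear i φ *ₘ halve j)) a b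
        ≈⟨ *ₘ-cong₂ (double j) (λ a b → trans (row-shear-act i φ (halve j) a b)
          (+-congˡ (*-congˡ (φ-halve b)))) a b ⟩
      (double j *ₘ (λ a b → halve j a b + 1ₘ a i * φ′ b)) a b
        ≈⟨ ∙-+ʳ (double j a) (λ k → halve j k b) (λ k → 1ₘ k i * φ′ b) ⟩
      (double j *ₘ halve j) a b + double j a ∙ (λ k → 1ₘ k i * φ′ b)
        ≈⟨ +-cong (double-halve j a b) (trans (∙-scaleʳ′ (φ′ b) (double j a) (λ k → 1ₘ k i))
          (*-congʳ (trans (∙-1ₘ (double j a) i)
             (trans (+-congˡ (x*0≈0 (trans (*-identityˡ _) (1ₘ-off j i (i≢j ∘ ≡.sym)))))
               (+-identityʳ _))))) ⟩
      row-shear i φ′ a b ∎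

  maximal-index : ∀ {n} {P : Fin n → Set} i → P i →
    ¬¬ (∃ λ k → P k × i ≤ᶠ k × (∀ a → k <ᶠ a → ¬ P a))
  maximal-index {n} {P} = λ i → go n i (ℕₚ.m≤m+n n (toℕ i))
    where
    go : ∀ c i → n ℕ.≤ c ℕ.+ toℕ i → P i → ¬¬ (∃ λ k → P k × i ≤ᶠ k × (∀ a → k <ᶠ a → ¬ P a))
    go zero    i le p = contradiction (ℕₚ.<-≤-trans (Finₚ.toℕ<n i) le) (ℕₚ.<-irrefl ≡.refl)
    go (suc c) i le p = em (∃ λ a → i <ᶠ a × P a) >>= λ
      { (inj₂ none) → pure (i , p , ℕₚ.≤-refl , λ a i<a pa → none (a , i<a , pa))
      ; (inj₁ (a , i<a , pa)) → go c a (ℕₚ.≤-trans le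
        (ℕₚ.≤-trans (ℕₚ.≤-reflexive (≡.sym (ℕₚ.+-suc c (toℕ i)))) (ℕₚ.+-monoʳ-≤ c i<a))) pa >>= λ
          (k , pk , a≤k , max) → pure (k , pk , ℕₚ.≤-trans (ℕₚ.<⇒≤ i<a) a≤k , max) }

  module _ {S : Pred GLₙ 0ℓ} (C : ConnectedSolvableClosedSubgroup (Levi I) S)
    (H⊆S : ∀ {g} → H g → S g) where
    open ConnectedSolvableClosedSubgroup C renaming (isSubgroup to sub; H⊆L to S⊆L)

    private
      Mem-⊆ : ∀ {x} → Mem H x → Mem S x
      Mem-⊆ (g , h , e) = g , H⊆S {g} h , e

    module _ {g : GLₙ} (g∈ : S g) where
      private
        x = matrix g
        h = inverse g
        h-Levi : ∀ i j → ¬ E i j → h i j ≈ 0#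
        h-Levi = S⊆L (IsSubgroup.⁻¹∈ sub g∈)

      -- An entry xᵢⱼ ≠ 0 below the diagonal, lowest in its column, would produce SL₂ in S. An
      -- element b of H clears the rest of column j, so that c = b x has column j equal to xᵢⱼ eᵢ.
      -- Then c (1 + t eⱼₖ) c⁻¹ adds a multiple of row k of c⁻¹ to row i, and the entry of that row
      -- at j is hₖⱼ ≠ 0. Commutation with `double j` isolates it and gives the root subgroup at (i
      -- , j); the opposite one lies in H.
      module _ {i j : Fin (suc m)} (j<i : j <ᶠ i) (Eij : E i j) (below : ∀ a → i <ᶠ a → x a j ≈ 0#)
               {y} (xy : x i j * y ≈ 1#) {k} (j<k : j <ᶠ k) (Ekj : E k j) (u : Unit (h k j)) where
        private
          i≢j : i ≢ j
          i≢j ≡.refl = ℕₚ.<-irrefl ≡.refl j<i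
          k≢j : k ≢ j
          k≢j ≡.refl = ℕₚ.<-irrefl ≡.refl j<k
          v : Vector (suc m)
          v p = x p j * y - 1ₘ p i
          vᵢ : v i ≈ 0#
          vᵢ = trans (+-cong xy (-‿cong (1ₘ-diag i))) (-‿inverseʳ 1#)
          b b⁻¹ c c⁻¹ : Matrix (suc m)
          b = rank-one (λ p → - v p) (1ₘ i)
          b⁻¹ = rank-one v (1ₘ i)
          c = b *ₘ x
          c⁻¹ = h *ₘ b⁻¹
          bb⁻¹ : b *ₘ b⁻¹ ≈ₘ 1ₘ
          bb⁻¹ = rank-one-* (λ p → - v p) v (1ₘ i) λ p → trans
            (+-cong (-‿inverseˡ (v p)) (x*0≈0 (trans (1ₘ-∙ v i) vᵢ))) (+-identityʳ _)
          b⁻¹b : b⁻¹ *ₘ b ≈ₘ 1ₘ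
          b⁻¹b = rank-one-* v (λ p → - v p) (1ₘ i) λ p → trans
            (+-cong (-‿inverseʳ (v p)) (x*0≈0
              (trans (1ₘ-∙ (λ p → - v p) i) (trans (-‿cong vᵢ)
                (trans (sym (+-identityˡ _)) (-‿inverseʳ 0#)))))) (+-identityʳ _)
          b-Supp : Supp R b
          b-Supp p q ¬r with i ≟ q
          ... | no i≢q = trans (+-cong (1ₘ-off p q λ { ≡.refl → ¬r R-refl }) (zeroʳ _))
            (+-identityʳ _)
          ... | yes ≡.refl = trans (+-cong (1ₘ-off p i λ { ≡.refl → ¬r R-refl })
            (0*x≈0 (trans (-‿cong (trans (+-cong (0*x≈0 (xpj (E? p i)))
              (-‿cong (1ₘ-off p i λ { ≡.refl → ¬r R-refl }))) (-‿inverseʳ 0#)))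
                (trans (sym (+-identityˡ _)) (-‿inverseʳ 0#))))) (+-identityʳ _)
            where
            xpj : Dec (E p i) → x p j ≈ 0#
            xpj (yes e) = below p (ℕₚ.≰⇒> λ p≤i → ¬r (e , p≤i))
            xpj (no ¬e) = S⊆L g∈ p j λ e → ¬e (E-trans e (E-sym Eij))
          c-column : ∀ p → c p j ≈ 1ₘ p i * x i j
          c-column p = begin
            (λ q → 1ₘ p q + - v p * 1ₘ i q) ∙ col ≈⟨ ∙-comm (b p) col ⟩
            col ∙ (λ q → 1ₘ p q + - v p * 1ₘ i q) ≈⟨ ∙-+ʳ col (1ₘ p) (λ q → - v p * 1ₘ i q) ⟩
            col ∙ 1ₘ p + col ∙ (λ q → - v p * 1ₘ i q)
              ≈⟨ +-cong (trans (∙-comm col (1ₘ p)) (1ₘ-∙ col p))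
                (trans (∙-scaleʳ (- v p) col (1ₘ i))
                  (*-congˡ (trans (∙-comm col (1ₘ i)) (1ₘ-∙ col i)))) ⟩
            x p j + - (x p j * y - 1ₘ p i) * x i j
              ≈⟨ solve 4 (λ u y d z → u :+ :- (u :* y :- d) :* z := d :* z :+ u :* (:1 :- z :* y))
                refl (x p j) y (1ₘ p i) (x i j) ⟩
            1ₘ p i * x i j + x p j * (1# - x i j * y) ≈⟨ +-congˡ (x*0≈0 (x≈y⇒x-y≈0 (sym xy))) ⟩
            1ₘ p i * x i j + 0# ≈⟨ +-identityʳ _ ⟩
            1ₘ p i * x i j ∎
            where col = λ q → x q j
          c⁻¹-entry : c⁻¹ k j ≈ h k j
          c⁻¹-entry = begin
            h k ∙ (λ q → 1ₘ q j + v q * 1ₘ i j) ≈⟨ ∙-cong {u = h k} {v′ = λ q → 1ₘ q j} (λ _ → refl)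
              (λ q → trans (+-congˡ (x*0≈0 {v q} (1ₘ-off i j i≢j))) (+-identityʳ _)) ⟩
            h k ∙ (λ q → 1ₘ q j) ≈⟨ ∙-1ₘ (h k) j ⟩
            h k j ∎
          cc⁻¹ : c *ₘ c⁻¹ ≈ₘ 1ₘ
          cc⁻¹ = *ₘ-inverse b x h b⁻¹ (inverseʳ g) bb⁻¹
          c⁻¹c : c⁻¹ *ₘ c ≈ₘ 1ₘ
          c⁻¹c = *ₘ-inverse h b⁻¹ b x b⁻¹b (inverseˡ g)
          c⁻¹ₖᵢ : c⁻¹ k i ≈ 0#
          c⁻¹ₖᵢ = Unit-cancel (y , xy) (begin
            x i j * c⁻¹ k i ≈⟨ *-comm _ _ ⟩
            c⁻¹ k i * x i j ≈⟨ *-congʳ (∙-1ₘ (c⁻¹ k) i) ⟨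
            (c⁻¹ k ∙ (λ q → 1ₘ q i)) * x i j ≈⟨ ∙-scaleʳ′ (x i j) (c⁻¹ k) (λ q → 1ₘ q i) ⟨
            c⁻¹ k ∙ (λ q → 1ₘ q i * x i j) ≈⟨ ∙-cong {u = c⁻¹ k} (λ _ → refl) c-column ⟨
            (c⁻¹ *ₘ c) k j ≈⟨ c⁻¹c k j ⟩
            1ₘ k j ≈⟨ 1ₘ-off k j k≢j ⟩
            0# ∎)
          Mem-b : Mem S b
          Mem-b = Mem-⊆ (Mem-H {b} {b⁻¹} bb⁻¹ b⁻¹b b-Supp)
          Mem-c : Mem S c
          Mem-c = Mem-* sub Mem-b (g , g∈ , λ _ _ → refl)
          φ : Carrier → Vector (suc m)
          φ t q = (x i j * t) * c⁻¹ k q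
          φᵢ : ∀ t → φ t i ≈ 0#
          φᵢ t = x*0≈0 c⁻¹ₖᵢ
          Mem-T : ∀ t → Mem S (row-shear i (φ t))
          Mem-T t = Mem-resp (λ p q → begin
              (c *ₘ (elementary j k t *ₘ c⁻¹)) p q
                ≈⟨ *ₘ-cong₂ c (λ p q → trans (*ₘ-cong₁ c⁻¹ (elementary-row-shear j k t) p q)
                  (trans (row-shear-act j (λ b → t * 1ₘ k b) c⁻¹ p q)
                     (+-congˡ (*-congˡ (trans (∙-scaleˡ t (1ₘ k) (λ l → c⁻¹ l q))
                       (*-congˡ (1ₘ-∙ (λ l → c⁻¹ l q) k))))))) p q ⟩
              c p ∙ (λ l → c⁻¹ l q + 1ₘ l j * (t * c⁻¹ k q))
                ≈⟨ trans (∙-+ʳ (c p) (λ l → c⁻¹ l q) (λ l → 1ₘ l j * (t * c⁻¹ k q)))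
                  (+-cong (cc⁻¹ p q)
                     (trans (∙-scaleʳ′ (t * c⁻¹ k q) (c p) (λ l → 1ₘ l j))
                       (*-congʳ (trans (∙-1ₘ (c p) j) (c-column p))))) ⟩
              1ₘ p q + (1ₘ p i * x i j) * (t * c⁻¹ k q)
                ≈⟨ +-congˡ (solve 4 (λ d z t e → (d :* z) :* (t :* e) := d :* ((z :* t) :* e)) refl
                  (1ₘ p i) (x i j) t (c⁻¹ k q)) ⟩
              row-shear i (φ t) p q ∎)
            (Mem-* sub Mem-c (Mem-* sub (Mem-⊆
              (Mem-H-elementary (k≢j ∘ ≡.sym) (E-sym Ekj , ℕₚ.<⇒≤ j<k) t))
                (Mem-inverse sub {c} {c⁻¹} cc⁻¹ Mem-c)))
          T-inverse : ∀ t → row-shear i (φ t) *ₘ row-shear i (λ q → - φ t q) ≈ₘ 1ₘ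
          T-inverse t p q = trans (row-shear-* i (φ t) (λ q → - φ t q) (φᵢ t) p q)
            (trans (+-congˡ (x*0≈0 (-‿inverseʳ _))) (+-identityʳ _))
          Mem-lower : ∀ s → Mem S (elementary i j s)
          Mem-lower s =
            let (z , uz) = Unit-* (Unit-* (y , xy) u) Unit-2
                -- z inverts 2 xᵢⱼ hₖⱼ, and `isolate` multiplies by -½, so the factor -4 makes the
                -- parameter exactly s.
                t = - (s * z * (2# * 2#)) in
            Mem-resp (λ p q → trans (isolate i≢j (φ t) (φᵢ t) p q)
              (block-cong {i = i} {j} refl (begin
                - ½ * ((x i j * t) * c⁻¹ k j) ≈⟨ *-congˡ (*-congˡ c⁻¹-entry) ⟩
                - ½ * ((x i j * t) * h k j)
                  ≈⟨ solve 5 (λ q x s z e → :- q :*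
                    ((x :* :- (s :* z :* ((:1 :+ :1) :* (:1 :+ :1)))) :* e)
                       := (s :* (q :+ q)) :* (((x :* e) :* (:1 :+ :1)) :* z)) refl ½ (x i j) s z
                         (h k j) ⟩
                (s * (½ + ½)) * (((x i j * h k j) * 2#) * z) ≈⟨ *-cong (*-congˡ ½+½≈1) uz ⟩
                (s * 1#) * 1# ≈⟨ trans (*-identityʳ _) (*-identityʳ _) ⟩
                s ∎) refl refl p q))
              (Mem-* sub (Mem-* sub (Mem-* sub (Mem-⊆ (Mem-H-double j)) (Mem-T t))
                (Mem-inverse sub {double j} {halve j} (double-halve j) (Mem-⊆ (Mem-H-double j))))
                         (Mem-inverse sub {row-shear i (φ t)} {row-shear i (λ q → - φ t q)}
                           (T-inverse t) (Mem-T t)))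

        below-diagonal-impossible : ⊥
        below-diagonal-impossible = SL₂-not-solvable sub i≢j
          (λ t → Mem-lower t , Mem-⊆ (Mem-H-elementary (i≢j ∘ ≡.sym) (E-sym Eij , ℕₚ.<⇒≤ j<i) t))
            solvable

      -- Induction on columns. If column j of x has an entry outside R, so has column j of the
      -- inverse h: otherwise h would have support in R up to column j, and `inverse-column` would
      -- give the same for column j of x. Two such entries are what `below-diagonal-impossible`
      -- excludes.
      S-upper : ∀ c j → toℕ j ℕ.< c → ∀ i → ¬ R i j → x i j ≈ 0#
      S-upper (suc c) j (s≤s j≤c) i ¬r with E? i j
      ... | no ¬e = S⊆L g∈ i j ¬e
      ... | yes e = stable λ ne →
        maximal-index {P = λ i → ¬ R i j × ¬ x i j ≈ 0#} i (¬r , ne)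
          λ (i , (¬r , xij≉0) , _ , max) →
        em (∀ k → ¬ R k j → h k j ≈ 0#) λ
        { (inj₁ h-upper) → xij≉0 (proj₂ (Order.inverse-column R-Order {h} {x} (inverseʳ g)
          {suc (toℕ j)}
              (λ a l l<1+j → h-columns h-upper a l (ℕₚ.≤-pred l<1+j))
                (suc (toℕ j)) j ℕₚ.≤-refl ℕₚ.≤-refl) i ¬r)
        ; (inj₂ ¬up) → ¬up λ k ¬rk → stable λ hkj≉0 → ≉0⇒Unit hkj≉0 λ u → ≉0⇒Unit xij≉0 λ (y , xy) →
            in-block i ¬r xij≉0 λ (Eij , j<i) →
            below-diagonal-impossible j<i Eij
              (λ a i<a → stable λ xaj≉0 → max a i<a
                ((λ (_ , a≤j) → ℕₚ.<⇒≱ (ℕₚ.<-trans j<i i<a) a≤j) , xaj≉0))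
              xy (ℕₚ.≰⇒> λ k≤j → ¬rk (block-of k hkj≉0 , k≤j)) (block-of k hkj≉0) u }
        where
        columns : ∀ a l → toℕ l ℕ.< toℕ j → ¬ R a l → x a l ≈ 0#
        columns a l l<j = S-upper c l (ℕₚ.<-≤-trans l<j j≤c) a
        h-columns : (∀ k → ¬ R k j → h k j ≈ 0#) → ∀ a l → toℕ l ℕ.≤ toℕ j → ¬ R a l → h a l ≈ 0#
        h-columns hj a l l≤j ¬r with l ≟ j
        ... | yes ≡.refl = hj a ¬r
        ... | no l≢j = proj₂ (Order.inverse-column R-Order {x} {h} (inverseˡ g) {toℕ j} columns
          (toℕ j) l ℕₚ.≤-refl
                         (ℕₚ.≤∧≢⇒< l≤j (l≢j ∘ Finₚ.toℕ-injective))) a ¬r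
        block-of : ∀ k → ¬ h k j ≈ 0# → E k j
        block-of k ne with E? k j
        ... | yes e = e
        ... | no ¬e = contradiction (h-Levi k j ¬e) ne
        in-block : ∀ i → ¬ R i j → ¬ x i j ≈ 0# → ¬¬ (E i j × j <ᶠ i)
        in-block i ¬r ne with E? i j
        ... | yes e = pure (e , ℕₚ.≰⇒> λ i≤j → ¬r (e , i≤j))
        ... | no ¬e = contradiction (S⊆L g∈ i j ¬e) ne

    H-maximal : ∀ {g} → S g → H g
    H-maximal {g} g∈ i j = S-upper {g} g∈ (suc (toℕ j)) j ℕₚ.≤-refl i

  H-isBorel : IsBorelSubgroup (Levi I) H
  H-isBorel = record { isSubgroup = H-isSubgroup ; H⊆L = λ {g} → H⊆Levi
    {g} ; closed = H-closed ; connected = H-connected ; solvable = H-solvable }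
    , λ S C H⊆S {g} → H-maximal C (λ {g} → H⊆S {g}) {g}

-- Cosets of B and conjugation by w

module Flags (𝒞 : ComplexNumbers) {m : ℕ} (w : Permutation′ (suc m)) where
  open Field 𝒞
  open GeneralLinear 𝒞
  open Linear 𝒞
  open Support 𝒞
  open GL
  open Spherical 𝒞 {m} using (_~_)
  open Transpositions {m} using (inv)

  private
    n : ℕ
    n = suc m

  P P⁻¹ : Matrix n
  P   = permMatrix w
  P⁻¹ = permMatrix (Perm.flip w)

  PP⁻¹ : P *ₘ P⁻¹ ≈ₘ 1ₘ
  PP⁻¹ = inverseʳ (perm w)

  P⁻¹-* : ∀ M i j → (P⁻¹ *ₘ M) i j ≈ M (w ⟨$⟩ʳ i) j
  P⁻¹-* M i j = trans (sum-only (w ⟨$⟩ʳ i) λ k k≢ → 0*x≈0 {M k j}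
    (permMatrix-0 (Perm.flip w) {i} {k} λ e → k≢
      (≡.trans (≡.sym (Perm.inverseʳ w)) (≡.cong (w ⟨$⟩ʳ_) (≡.sym e)))))
    (trans (*-congʳ (permMatrix-1 (Perm.flip w) {i} {w ⟨$⟩ʳ i} (≡.sym (Perm.inverseˡ w))))
      (*-identityˡ _))

  conjugateP : Matrix n → Matrix n
  conjugateP M = P⁻¹ *ₘ (M *ₘ P)

  conjugateP-entry : ∀ M i j → conjugateP M i j ≈ M (w ⟨$⟩ʳ i) (w ⟨$⟩ʳ j)
  conjugateP-entry M i j = trans (P⁻¹-* (M *ₘ P) i j) (*ₘ-permMatrix M w (w ⟨$⟩ʳ i) j)

  P-conjugateP : ∀ M N → (M *ₘ P) *ₘ conjugateP N ≈ₘ (M *ₘ N) *ₘ P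
  P-conjugateP M N i j = begin
    ((M *ₘ P) *ₘ (P⁻¹ *ₘ (N *ₘ P))) i j ≈⟨ *ₘ-assoc M P (P⁻¹ *ₘ (N *ₘ P)) i j ⟩
    (M *ₘ (P *ₘ (P⁻¹ *ₘ (N *ₘ P)))) i j
      ≈⟨ *ₘ-cong₂ M (*ₘ-cancelˡ P P⁻¹ (N *ₘ P) PP⁻¹) i j ⟩
    (M *ₘ (N *ₘ P)) i j ≈⟨ *ₘ-assoc M N P i j ⟨
    ((M *ₘ N) *ₘ P) i j ∎

  -- The order of the rows in which w has its pivots.
  _⊴_ : Rel (Fin n) 0ℓ
  i ⊴ j = inv w i ≤ᶠ inv w j

  -- Support in `_⊴_` thus describes w B w⁻¹, the right factors that can be moved past `P` and
  -- absorbed by the coset.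
  conjugateP-Upper : ∀ {M} → Supp _⊴_ M → Upper (conjugateP M)
  conjugateP-Upper {M} s i j j<i = trans (conjugateP-entry M i j) (s _ _ λ i⊴j →
    ℕₚ.<⇒≱ j<i (≡.subst₂ _≤ᶠ_ (Perm.inverseˡ w) (Perm.inverseˡ w) i⊴j))

  ~-intro : ∀ g h {β : Matrix n} → Upper β → matrix h ≈ₘ matrix g *ₘ β → g ~ h
  ~-intro g h {β} up e i j j<i = begin
    (inverse g *ₘ matrix h) i j ≈⟨ *ₘ-cong₂ (inverse g) e i j ⟩
    (inverse g *ₘ (matrix g *ₘ β)) i j ≈⟨ *ₘ-assoc (inverse g) (matrix g) β i j ⟨
    ((inverse g *ₘ matrix g) *ₘ β) i j ≈⟨ *ₘ-cong₁ β (inverseˡ g) i j ⟩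
    (1ₘ *ₘ β) i j ≈⟨ *ₘ-identityˡ β i j ⟩
    β i j ≈⟨ up i j j<i ⟩
    0# ∎

  ~-elim : ∀ g h → g ~ h → matrix h ≈ₘ matrix g *ₘ (inverse g *ₘ matrix h)
  ~-elim g h _ i j = begin
    matrix h i j ≈⟨ *ₘ-identityˡ (matrix h) i j ⟨
    (1ₘ *ₘ matrix h) i j ≈⟨ *ₘ-cong₁ (matrix h) (inverseʳ g) i j ⟨
    ((matrix g *ₘ inverse g) *ₘ matrix h) i j ≈⟨ *ₘ-assoc (matrix g) (inverse g) (matrix h) i j ⟩
    (matrix g *ₘ (inverse g *ₘ matrix h)) i j ∎

  ~-sym : ∀ g h → g ~ h → h ~ g
  ~-sym g h g~h = Supp⇒Upper (Order.Supp-inverse ≤-Order {inverse g *ₘ matrix h}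
    {inverse h *ₘ matrix g} inverse-product (Upper⇒Supp g~h))
    where
    inverse-product : (inverse h *ₘ matrix g) *ₘ (inverse g *ₘ matrix h) ≈ₘ 1ₘ
    inverse-product = *ₘ-inverse (inverse h) (matrix g) (inverse g) (matrix h) (inverseʳ g)
      (inverseˡ h)

-- Prescribing torus ratios at the inversions of a standard Coxeter element

module Torus (𝒞 : ComplexNumbers) {m : ℕ} where
  open Field 𝒞
  open SymmetricGroup {m}
  open Transpositions {m}

  TorusSolvable : Rel (Fin n) 0ℓ → Set
  TorusSolvable S = ∀ (c : Fin n → Fin n → Carrier) → (∀ i j → S i j → Unit (c i j)) →
    ∃ λ (τ : Fin n → Carrier) → (∀ i → Unit (τ i)) × (∀ i j → S i j → τ i ≈ c i j * τ j)

  -- A new first letter j adds one equation, at the positions j and j + 1, and moves the others by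
  -- `σ j`. As j does not recur, the cut at j leaves one scalar free, which solves the new equation.
  product-torus : ∀ js → Unique js → TorusSolvable (Inversion (inv (product js)))
  product-torus [] _ c u = (λ _ → 1#) , (λ _ → Unit-1) ,
    λ { i j (p , q) → contradiction q (ℕₚ.<-asym p) }
  product-torus (j ∷ js) (j∉ ∷ unique) c u = τ , τ-unit , τ-eq
    where
    v = product js
    β = inv v
    unstraddled : Unstraddled β j
    unstraddled = product-Unstraddled js j∉
    lift : ∀ {a b} → Inversion β a b → Inversion (inv (s j · v)) (σ j a) (σ j b)
    lift {a} {b} (a<b , q) =
      σ-monotone j a<b (λ { (≡.refl , ≡.refl) → ℕₚ.<-asym q (Unstraddled⇒Ascent {β} unstraddled) })
        ,
      ≡.subst₂ _<ᶠ_ (≡.sym (≡.trans (inv-s· j v (σ j b)) (≡.cong β (σ-involutive j b))))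
                    (≡.sym (≡.trans (inv-s· j v (σ j a)) (≡.cong β (σ-involutive j a)))) q
    ih = product-torus js unique (λ a b → c (σ j a) (σ j b)) (λ a b i → u (σ j a) (σ j b) (lift i))
    τ′ = proj₁ ih
    τ′-unit = proj₁ (proj₂ ih)
    τ′-eq = proj₂ (proj₂ ih)
    c₀ = c (inject₁ j) (suc j)
    c₀-unit : Unit c₀
    c₀-unit = u (inject₁ j) (suc j) (left<right j , ≡.subst₂ _<ᶠ_
      (≡.sym (≡.trans (inv-s· j v (suc j)) (≡.cong β (σ-right j))))
      (≡.sym (≡.trans (inv-s· j v (inject₁ j)) (≡.cong β (σ-left j))))
        (Unstraddled⇒Ascent {β} unstraddled))
    denominator : Unit (c₀ * τ′ (inject₁ j))
    denominator = Unit-* c₀-unit (τ′-unit (inject₁ j))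
    factor : Carrier
    -- After the exchange by `σ j` the new equation reads τ′(j + 1) = c₀ · factor · τ′(j).
    factor = τ′ (suc j) * proj₁ denominator
    -- τ′ may be rescaled below the cut at j, which no inversion of v straddles.
    scaled : Fin n → Carrier
    scaled i with toℕ i ℕₚ.≤? toℕ j
    ... | yes _ = factor * τ′ i
    ... | no  _ = τ′ i
    scaled-≤ : ∀ {i} → toℕ i ℕ.≤ toℕ j → scaled i ≈ factor * τ′ i
    scaled-≤ {i} i≤j with toℕ i ℕₚ.≤? toℕ j
    ... | yes _  = refl
    ... | no i≰j = contradiction i≤j i≰j
    scaled-> : ∀ {i} → ¬ toℕ i ℕ.≤ toℕ j → scaled i ≈ τ′ i
    scaled-> {i} i≰j with toℕ i ℕₚ.≤? toℕ j
    ... | yes i≤j = contradiction i≤j i≰j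
    ... | no _    = refl
    scaled-unit : ∀ i → Unit (scaled i)
    scaled-unit i with toℕ i ℕₚ.≤? toℕ j
    ... | yes _ = Unit-* (Unit-* (τ′-unit (suc j)) (Unit-inverse denominator)) (τ′-unit i)
    ... | no  _ = τ′-unit i
    scaled-eq : ∀ {a b} → Inversion β a b → scaled a ≈ c (σ j a) (σ j b) * scaled b
    scaled-eq {a} {b} i@(a<b , q) with toℕ a ℕₚ.≤? toℕ j | toℕ b ℕₚ.≤? toℕ j
    ... | yes _   | yes _   = trans (*-congˡ (τ′-eq a b i))
      (solve 3 (λ f c t → f :* (c :* t) := c :* (f :* t)) refl factor _ (τ′ b))
    ... | yes a≤j | no b≰j  = contradiction q (ℕₚ.<-asym (unstraddled a b a≤j (ℕₚ.≰⇒> b≰j)))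
    ... | no a≰j  | yes b≤j = contradiction (ℕₚ.≤-trans (ℕₚ.<⇒≤ a<b) b≤j) a≰j
    ... | no _    | no _    = τ′-eq a b i
    τ : Fin n → Carrier
    τ i = scaled (σ j i)
    τ-unit : ∀ i → Unit (τ i)
    τ-unit i = scaled-unit (σ j i)
    τ-eq : ∀ a b → Inversion (inv (s j · v)) a b → τ a ≈ c a b * τ b
    τ-eq a b (a<b , q) = by-cases ((a ≟ inject₁ j) ×-dec (b ≟ suc j))
      where
      by-cases : Dec (a ≡ inject₁ j × b ≡ suc j) → τ a ≈ c a b * τ b
      by-cases (no ne) = trans (scaled-eq
        (σ-monotone j a<b ne , ≡.subst₂ _<ᶠ_ (inv-s· j v b) (inv-s· j v a) q))
        (*-congʳ (reflexive (≡.cong₂ c (σ-involutive j a) (σ-involutive j b))))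
      by-cases (yes (≡.refl , ≡.refl)) = begin
          scaled (σ j (inject₁ j)) ≈⟨ reflexive (≡.cong scaled (σ-left j)) ⟩
          scaled (suc j)           ≈⟨ scaled-> (ℕₚ.<⇒≱ (ℕₚ.n<1+n _)) ⟩
          τ′ (suc j)               ≈⟨ *-identityʳ _ ⟨
          τ′ (suc j) * 1#          ≈⟨ *-congˡ (proj₂ denominator) ⟨
          τ′ (suc j) * ((c₀ * τ′ (inject₁ j)) * proj₁ denominator)
            ≈⟨ solve 4 (λ s c t d → s :* ((c :* t) :* d) := c :* ((s :* d) :* t)) refl
              (τ′ (suc j)) c₀ (τ′ (inject₁ j)) (proj₁ denominator) ⟩
          c₀ * (factor * τ′ (inject₁ j)) ≈⟨ *-congˡ
            (scaled-≤ (ℕₚ.≤-reflexive (Finₚ.toℕ-inject₁ j))) ⟨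
          c₀ * scaled (inject₁ j)  ≈⟨ *-congˡ (reflexive (≡.cong scaled (σ-right j))) ⟨
          c₀ * scaled (σ j (suc j)) ∎

-- Sufficiency: the dense orbit of an I-spherical w

module SphericalOrbit (𝒞 : ComplexNumbers) {m : ℕ} (w : Permutation′ (suc m)) (I : Subset m)
  (I⊆J : ∀ {j} → j ∈ I → SymmetricGroup.J w j) where
  open Field 𝒞
  open GeneralLinear 𝒞
  open Linear 𝒞
  open Support 𝒞
  open GL
  open Spherical 𝒞 {m} using (GLₙ; G; Levi; ClosedInFlag; SchubertCell; SchubertVariety; Orbit;
    _DenseIn_; IsLeviSpherical)
  open Zariski 𝒞 {m} using (evalₘ; eval-evalₘ; :evalₘ)
  open Group G using () renaming (_∙_ to _·_)
  open SymmetricGroup {m} using (IsSpherical) renaming (_·_ to _·ₚ_; product to word)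
  open Transpositions {m}
  open LongestElement {m} I using (Φ; Φ₌; Φ⇒Inversion; Reverses; descents⇒Reverses)
  open StandardBorel 𝒞 I
  open Flags 𝒞 w
  open Torus 𝒞 {m}
  open BlockPart E? E-sym E-trans
  open Order R-Order using () renaming (rfl to R-refl; tran to R-trans)

  w-reverses : Reverses (inv w)
  w-reverses = descents⇒Reverses {inv w} I⊆J

  abstract
    Φ₌? : Decidable (Φ₌ w)
    Φ₌? i j = (i ≟ j) ⊎-dec ((i Finₚ.<? j) ×-dec (¬? (E? i j) ×-dec (inv w j Finₚ.<? inv w i)))

  Unipotent-Φ : Matrix n → Set
  Unipotent-Φ x = Supp (Φ₌ w) x × (∀ i → x i i ≈ 1#)

  Φ₌⇒≤ : ∀ {i j} → Φ₌ w i j → i ≤ᶠ j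
  Φ₌⇒≤ (inj₁ ≡.refl)      = ℕₚ.≤-refl
  Φ₌⇒≤ (inj₂ (i<j , _)) = ℕₚ.<⇒≤ i<j

  Unipotent-Φ-upper : ∀ {x} → Unipotent-Φ x → Upper x
  Unipotent-Φ-upper (s , _) = Supp⇒Upper (Supp-⊆ Φ₌⇒≤ s)

  Unipotent-Φ-GL : ∀ x → Unipotent-Φ x → GLₙ
  Unipotent-Φ-GL x u = upperGL x (Unipotent-Φ-upper u) (λ i → Unit-cong (sym (proj₂ u i)) Unit-1)

  blk-Unipotent-Φ : ∀ {x} → Unipotent-Φ x → ∀ {i j} → E i j → x i j ≈ 1ₘ i j
  blk-Unipotent-Φ {x} (s , d) {i} {j} e with i ≟ j
  ... | yes ≡.refl = d i
  ... | no i≢j     = s i j λ { (inj₁ i≡j) → i≢j i≡j ; (inj₂ (_ , ¬e , _)) → ¬e e }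

  cellPoint : GLₙ → ∀ u → Unipotent-Φ u → GLₙ
  cellPoint h u u∈Φ = (h · Unipotent-Φ-GL u u∈Φ) · perm w

  -- The base point of the orbit: with all entries on Φ equal to 1, the torus can move it to
  -- prescribed nonzero entries.
  u₀ : Matrix n
  u₀ i j = if does (Φ₌? i j) then 1# else 0#

  u₀-in : ∀ {i j} → Φ₌ w i j → u₀ i j ≈ 1#
  u₀-in {i} {j} p with Φ₌? i j
  ... | yes _ = refl
  ... | no ¬p = contradiction p ¬p

  u₀-out : Supp (Φ₌ w) u₀
  u₀-out i j ¬p with Φ₌? i j
  ... | yes p = contradiction p ¬p
  ... | no  _ = refl

  u₀-Φ : Unipotent-Φ u₀
  u₀-Φ = u₀-out , λ i → u₀-in (inj₁ ≡.refl)

  Inv₌ : Rel (Fin n) 0ℓ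
  Inv₌ = Inversion₌ (inv w)

  Inv₌-trans : Transitive Inv₌
  Inv₌-trans (inj₁ ≡.refl) q = q
  Inv₌-trans p@(inj₂ _) (inj₁ ≡.refl) = p
  Inv₌-trans (inj₂ (p , p′)) (inj₂ (q , q′)) = inj₂ (ℕₚ.<-trans p q , ℕₚ.<-trans q′ p′)

  Inv₌⇒≤ : ∀ {i j} → Inv₌ i j → i ≤ᶠ j
  Inv₌⇒≤ (inj₁ ≡.refl)     = ℕₚ.≤-refl
  Inv₌⇒≤ (inj₂ (i<j , _)) = ℕₚ.<⇒≤ i<j

  -- As I ⊆ J(w), w⁻¹ reverses every block, so the root subgroups of the standard Borel subgroup of
  -- the Levi are among those of the cell.
  R⇒Inv₌ : ∀ {i j} → R i j → Inv₌ i j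
  R⇒Inv₌ {i} {j} (e , i≤j) = by-cases (i ≟ j)
    where
    by-cases : Dec (i ≡ j) → Inv₌ i j
    by-cases (yes i≡j) = inj₁ i≡j
    by-cases (no i≢j)  = inj₂ (i<j , w-reverses i<j e)
      where i<j = ℕₚ.≤∧≢⇒< i≤j (i≢j ∘ Finₚ.toℕ-injective)

  -- The splitting of U_w · T into the Borel subgroup of the Levi and U_Φ.
  module LeviFactor (x : Matrix n) (x-Supp : Supp Inv₌ x) (x-unit : ∀ i → Unit (x i i)) where

    l : Matrix n
    l = blk x

    l-Supp : Supp R l
    l-Supp i j ¬r = by-cases (E? i j)
      where
      by-cases : Dec (E i j) → l i j ≈ 0#
      by-cases (yes e) = blk-Supp′ {Inv₌} x-Supp i j λ inv → ¬r (e , Inv₌⇒≤ inv)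
      by-cases (no ¬e) = blk-Supp x i j ¬e

    h : GLₙ
    h = upperGL l (R⇒Upper l-Supp) (λ i → Unit-cong (sym (blk-in x E-refl)) (x-unit i))

    h⁻¹-Supp : Supp R (inverse h)
    h⁻¹-Supp = H-inverse {h} l-Supp

    u : Matrix n
    u = inverse h *ₘ x

    u-block : ∀ {i j} → E i j → u i j ≈ 1ₘ i j
    u-block {i} {j} e = trans (sym (blk-in u e))
      (trans (sym (blk-*ˡ (inverse h) x (Supp-⊆ proj₁ h⁻¹-Supp) i j)) (inverseˡ h i j))

    u∈Φ : Unipotent-Φ u
    u∈Φ = (λ i j ¬φ → by-cases ¬φ (E? i j)) , λ i → trans (u-block E-refl) (1ₘ-diag i)
      where
      by-cases : ∀ {i j} → ¬ Φ₌ w i j → Dec (E i j) → u i j ≈ 0#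
      by-cases {i} {j} ¬φ (yes e) = trans (u-block e) (1ₘ-off i j (¬φ ∘ inj₁))
      by-cases {i} {j} ¬φ (no ¬e) = Supp-* {R = R} {S = Inv₌}
        (λ r s → Inv₌-trans (R⇒Inv₌ r) s) h⁻¹-Supp x-Supp i j
        λ { (inj₁ e) → ¬φ (inj₁ e) ; (inj₂ (p , q)) → ¬φ (inj₂ (p , ¬e , q)) }

    h*u≈x : matrix h *ₘ u ≈ₘ x
    h*u≈x i j = *ₘ-cancelˡ (matrix h) (inverse h) x (inverseʳ h) i j

  -- b B/B = h u B/B with h in the Borel subgroup of the Levi and u in U_Φ.
  record Factorisation (b : Matrix n) : Set where
    field
      h        : GLₙ
      h∈H      : H h
      u        : Matrix n
      u∈Φ      : Unipotent-Φ u
      z        : Matrix n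
      z-⊴      : Supp _⊴_ z
      equation : matrix h *ₘ u ≈ₘ b *ₘ z

  -- Positions i < j that w⁻¹ does not invert are cleared by column operations from w B w⁻¹, which
  -- leave the flag unchanged. The result is supported on inversions and the diagonal, where
  -- `LeviFactor` applies.
  factorise : ∀ b → Upper b → (∀ i → Unit (b i i)) → Factorisation b
  factorise b b-up b-unit = record
    { h = L.h ; h∈H = L.l-Supp ; u = L.u ; u∈Φ = L.u∈Φ ; z = z ; z-⊴ = Supp-⊆ ⊴-of z-Supp ;
      equation = L.h*u≈x }
    where
    N : Rel (Fin n) 0ℓ
    N k j = k <ᶠ j × inv w k <ᶠ inv w j
    open ColumnReduction {N = N} (λ k j → (k Finₚ.<? j) ×-dec (inv w k Finₚ.<? inv w j))
      (λ j (j<j , _) → ℕₚ.<-irrefl ≡.refl j<j)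
    z : Matrix n
    z = reduction b
    N₌ : Rel (Fin n) 0ℓ
    N₌ k j = k ≡ j ⊎ N k j
    ⊴-of : ∀ {k j} → N₌ k j → k ⊴ j
    ⊴-of (inj₁ ≡.refl)    = ℕₚ.≤-refl
    ⊴-of (inj₂ (_ , lt)) = ℕₚ.<⇒≤ lt
    N₌⇒≤ : ∀ {k j} → N₌ k j → k ≤ᶠ j
    N₌⇒≤ (inj₁ ≡.refl)    = ℕₚ.≤-refl
    N₌⇒≤ (inj₂ (lt , _)) = ℕₚ.<⇒≤ lt
    z-Supp : Supp N₌ z
    z-Supp k j ¬n = reduction-0 b (¬n ∘ inj₂) (¬n ∘ inj₁)
    product-Supp : Supp Inv₌ (b *ₘ z)
    product-Supp i j ¬inv = by-cases (i ≟ j) (i Finₚ.≤? j) (Finₚ.<-cmp (inv w i) (inv w j))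
      where
      by-cases : Dec (i ≡ j) → Dec (i ≤ᶠ j) → _ → (b *ₘ z) i j ≈ 0#
      by-cases (yes i≡j) _         _             = contradiction (inj₁ i≡j) ¬inv
      by-cases (no i≢j)  (no i≰j)  _             = Supp-* {R = _≤ᶠ_} {S = _≤ᶠ_} ℕₚ.≤-trans
        (Upper⇒Supp b-up) (Supp-⊆ N₌⇒≤ z-Supp) i j i≰j
      by-cases (no i≢j)  (yes i≤j) (tri< lt _ _) = reduced-0 b
        (ℕₚ.≤∧≢⇒< i≤j (i≢j ∘ Finₚ.toℕ-injective) , lt)
      by-cases (no i≢j)  (yes i≤j) (tri≈ _ e _)  = contradiction (inverse-injective w e) i≢j
      by-cases (no i≢j)  (yes i≤j) (tri> _ _ gt) = contradiction
        (inj₂ (ℕₚ.≤∧≢⇒< i≤j (i≢j ∘ Finₚ.toℕ-injective) , gt)) ¬inv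
    product-unit : ∀ i → Unit ((b *ₘ z) i i)
    product-unit i = Unit-cong (sym (*ₘ-diag {R = _≤ᶠ_} {S = _≤ᶠ_}
      (λ p q → Finₚ.toℕ-injective (ℕₚ.≤-antisym q p)) (Upper⇒Supp b-up) (Supp-⊆ N₌⇒≤ z-Supp) i))
      (Unit-* (b-unit i) (Unit-cong (sym (reduction-diag b i)) (pivots-upper b b-up b-unit i)))
    module L = LeviFactor (b *ₘ z) product-Supp product-unit

  module _ (torus : TorusSolvable (Φ w)) where

    x₀ : GLₙ
    x₀ = Unipotent-Φ-GL u₀ u₀-Φ · perm w

    diagonal : (Fin n → Carrier) → Matrix n
    diagonal τ i j = 1ₘ i j * τ j

    diagonal-Supp : ∀ {S : Rel (Fin n) 0ℓ} → Reflexive S → ∀ τ → Supp S (diagonal τ)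
    diagonal-Supp rfl τ i j ¬s = 0*x≈0 (1ₘ-off i j λ { ≡.refl → ¬s rfl })

    diagonal-unit : ∀ {τ} → (∀ i → Unit (τ i)) → ∀ i → Unit (diagonal τ i i)
    diagonal-unit u i = Unit-cong (sym (trans (*-congʳ (1ₘ-diag i)) (*-identityˡ _))) (u i)

    diagonal-diag : ∀ τ i → diagonal τ i i ≈ τ i
    diagonal-diag τ i = trans (*-congʳ (1ₘ-diag i)) (*-identityˡ _)

    -- An element of U_Φ with no vanishing entry on Φ is conjugate to u₀ under the torus.
    generic-in-orbit : ∀ (h : GLₙ) → H h → ∀ u (u∈Φ : Unipotent-Φ u) →
      (∀ i j → Φ w i j → Unit (u i j)) →
                       Orbit H x₀ (cellPoint h u u∈Φ)
    generic-in-orbit h h∈ u u∈Φ u-unit = h · t , Supp-* R-trans h∈ (diagonal-Supp {R} R-refl τ) ,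
      ~-intro (cellPoint h u u∈Φ) ((h · t) · x₀) {conjugateP (diagonal τ)}
        (conjugateP-Upper (diagonal-Supp {_⊴_} ℕₚ.≤-refl τ)) λ i j → begin
        ((matrix h *ₘ T) *ₘ (u₀ *ₘ P)) i j ≈⟨ *ₘ-assoc (matrix h) T (u₀ *ₘ P) i j ⟩
        (matrix h *ₘ (T *ₘ (u₀ *ₘ P))) i j ≈⟨ *ₘ-cong₂ (matrix h)
          (λ i j → trans (sym (*ₘ-assoc T u₀ P i j)) (*ₘ-cong₁ P Tu₀≈uT i j)) i j ⟩
        (matrix h *ₘ ((u *ₘ T) *ₘ P)) i j ≈⟨ *ₘ-assoc (matrix h) (u *ₘ T) P i j ⟨
        ((matrix h *ₘ (u *ₘ T)) *ₘ P) i j ≈⟨ *ₘ-cong₁ P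
          (λ i j → sym (*ₘ-assoc (matrix h) u T i j)) i j ⟩
        (((matrix h *ₘ u) *ₘ T) *ₘ P) i j ≈⟨ P-conjugateP (matrix h *ₘ u) T i j ⟨
        (((matrix h *ₘ u) *ₘ P) *ₘ conjugateP T) i j ∎
      where
      τ = proj₁ (torus u u-unit)
      τ-unit = proj₁ (proj₂ (torus u u-unit))
      τ-eq = proj₂ (proj₂ (torus u u-unit))
      T : Matrix n
      T = diagonal τ
      t : GLₙ
      t = upperGL T (Supp⇒Upper (diagonal-Supp {_≤ᶠ_} ℕₚ.≤-refl τ)) (diagonal-unit τ-unit)
      entry : ∀ i j → τ i * u₀ i j ≈ u i j * τ j
      entry i j with Φ₌? i j
      ... | no ¬φ              = trans (zeroʳ _) (sym (0*x≈0 (proj₁ u∈Φ i j ¬φ)))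
      ... | yes (inj₁ ≡.refl)  = trans (*-comm _ _) (*-congʳ (sym (proj₂ u∈Φ i)))
      ... | yes (inj₂ φ)       = trans (*-identityʳ _) (τ-eq i j φ)
      Tu₀≈uT : T *ₘ u₀ ≈ₘ u *ₘ T
      Tu₀≈uT i j = begin
        (T *ₘ u₀) i j ≈⟨ *ₘ-diagonalˡ u₀ (diagonal-Supp {_≡_} ≡.refl τ) i j ⟩
        T i i * u₀ i j ≈⟨ *-congʳ (diagonal-diag τ i) ⟩
        τ i * u₀ i j ≈⟨ entry i j ⟩
        u i j * τ j ≈⟨ *-congˡ (diagonal-diag τ j) ⟨
        u i j * T j j ≈⟨ *ₘ-diagonalʳ u (diagonal-Supp {_≡_} ≡.refl τ) i j ⟨
        (u *ₘ T) i j ∎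

    module _ {Z : Pred GLₙ 0ℓ} (clZ : ClosedInFlag Z) (orbit⊆Z : Orbit H x₀ ⊆ Z) where

      -- The line from u to u₀ stays in U_Φ, and its entries on Φ are all 1 at t = 1, hence nonzero
      -- for large t. There its points lie in the orbit, so the equations of Z hold along the whole
      -- line, also at t = 0.
      factorised-in-Z : ∀ (h : GLₙ) → H h → ∀ u (u∈Φ : Unipotent-Φ u) → Z (cellPoint h u u∈Φ)
      factorised-in-Z h h∈ u u∈Φ = Equivalence.from (Z⇔ (cellPoint h u u∈Φ)) λ p p∈ → trans
        (eval-evalₘ p (cellPoint h u u∈Φ) λ i j → refl)
        (trans (evalₘ-cong p λ i j → sym (curve-0 i j))
          (Curve-identity (:evalₘ Curve :curve p) (eventually p p∈) 0#))
        where
        open Zariski 𝒞 {m} using (evalₘ-cong)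
        open PolynomialMatrix Curve
        open PolynomialClass Curve using (const; _:⊕_; _:⊗_)
        𝓕 = proj₁ (proj₂ clZ)
        Z⇔ = proj₂ (proj₂ clZ)
        line : Carrier → Matrix n
        line t i j = u i j + t * (u₀ i j - u i j)
        line-Φ : ∀ t → Unipotent-Φ (line t)
        line-Φ t = (λ i j ¬φ → trans (+-cong (proj₁ u∈Φ i j ¬φ)
          (x*0≈0 (trans (+-cong (u₀-out i j ¬φ) (-‿cong (proj₁ u∈Φ i j ¬φ))) (-‿inverseʳ 0#))))
            (+-identityʳ _))
          , λ i → trans (+-cong (proj₂ u∈Φ i)
            (x*0≈0 (trans (+-cong (proj₂ u₀-Φ i) (-‿cong (proj₂ u∈Φ i))) (-‿inverseʳ 1#))))
              (+-identityʳ _)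
        :line : 𝒫ₘ line
        :line i j = const (u i j) :⊕ (Curve-id :⊗ const (u₀ i j - u i j))
        curve : Carrier → Matrix n
        curve t = (matrix h *ₘ line t) *ₘ P
        :curve : 𝒫ₘ curve
        :curve = :*ₘ {N = λ _ → P} (:*ₘ {M = λ _ → matrix h} (λ i j → const (matrix h i j)) :line)
          (λ i j → const (P i j))
        line-0 : line 0# ≈ₘ u
        line-0 i j = trans (+-congˡ (zeroˡ _)) (+-identityʳ _)
        curve-0 : curve 0# ≈ₘ (matrix h *ₘ u) *ₘ P
        curve-0 = *ₘ-cong₁ P (*ₘ-cong₂ (matrix h) line-0)
        generic : Ev (λ k → ∀ i j → Φ w i j → ¬ line (nat k) i j ≈ 0#)
        generic = Ev-∀Fin λ i → Ev-∀Fin λ j → entry i j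
          where
          entry : ∀ i j → Ev (λ k → Φ w i j → ¬ line (nat k) i j ≈ 0#)
          entry i j = by-cases (Φ₌? i j)
            where
            by-cases : Dec (Φ₌ w i j) → Ev (λ k → Φ w i j → ¬ line (nat k) i j ≈ 0#)
            by-cases (no ¬φ)  = Ev-always λ k φ → contradiction (inj₂ φ) ¬φ
            by-cases (yes φ₌) = Ev-map (λ k ne _ → ne)
              (Curve-eventually≉0 (:line i j) {1#} λ e → 1≉0 (trans (sym (u₀-in φ₌))
                (trans (solve 2 (λ u v → v := u :+ :1 :* (v :- u)) refl (u i j) (u₀ i j)) e)))
        eventually : ∀ p → 𝓕 p → Ev (λ k → evalₘ p (curve (nat k)) ≈ 0#)
        eventually p p∈ = Ev-map (λ k ne → stable λ p≉0 →
            ¬¬-∀Fin (λ i → ¬¬-∀Fin λ j → unit k ne i j) λ units →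
            let γₖ = cellPoint h (line (nat k)) (line-Φ (nat k)) in
            p≉0 (trans (sym (eval-evalₘ p γₖ λ i j → refl))
              (Equivalence.to (Z⇔ γₖ) (orbit⊆Z {γₖ}
                (generic-in-orbit h h∈ (line (nat k)) (line-Φ (nat k)) units)) p p∈))) generic
          where
          unit : ∀ k → (∀ i j → Φ w i j → ¬ line (nat k) i j ≈ 0#) → ∀ i j →
            ¬¬ (Φ w i j → Unit (line (nat k) i j))
          unit k ne i j = em (Φ w i j) >>= λ
            { (inj₁ φ)  → ≉0⇒Unit (ne i j φ) >>= λ u → pure λ _ → u
            ; (inj₂ ¬φ) → pure λ φ → contradiction φ ¬φ }

      cell⊆Z : SchubertCell w ⊆ Z
      cell⊆Z {g} (b , b∈B , g~bw) = proj₁ clZ {b · perm w} {g} (~-sym g (b · perm w) g~bw)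
        (proj₁ clZ {cellPoint h u u∈Φ} {b · perm w}
          (~-sym (b · perm w) (cellPoint h u u∈Φ)
            (~-intro (b · perm w) (cellPoint h u u∈Φ) {conjugateP z} (conjugateP-Upper z-⊴)
              λ i j → trans (*ₘ-cong₁ P equation i j) (sym (P-conjugateP (matrix b) z i j))))
          (factorised-in-Z h h∈H u u∈Φ))
        where open Factorisation (factorise (matrix b) b∈B
                (Order.diag-unit ≤-Order {y = inverse b} (inverseˡ b) (Upper⇒Supp b∈B)))

    orbit⊆cell : Orbit H x₀ ⊆ SchubertCell w
    orbit⊆cell {g} (h , h∈ , g~hx) = h · Unipotent-Φ-GL u₀ u₀-Φ ,
      Supp⇒Upper (Supp-* {R = R} {S = _≤ᶠ_} (λ (_ , p) q → ℕₚ.≤-trans p q) h∈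
        (Upper⇒Supp (Unipotent-Φ-upper u₀-Φ))) ,
      λ i j j<i → trans (*ₘ-cong₂ (inverse g) (*ₘ-assoc (matrix h) u₀ P) i j) (g~hx i j j<i)

    orbit-dense : Orbit H x₀ DenseIn SchubertVariety w
    orbit-dense = (λ {g} o Z clZ cell⊆ → cell⊆ {g} (orbit⊆cell {g} o)) ,
      λ {g} g∈X Z clZ orbit⊆ → g∈X Z clZ λ {g} → cell⊆Z {Z} clZ (λ {g} → orbit⊆ {g}) {g}

  spherical⇒Levi-spherical : IsSpherical I w → IsLeviSpherical I w
  spherical⇒Levi-spherical (w₀ , longest , js , unique , ex) = H , H-isBorel , x₀ torus ,
    orbit-dense torus
    where
    inversion : ∀ {i j} → Φ w i j → Inversion (inv (word js)) (w₀ ⟨$⟩ʳ i) (w₀ ⟨$⟩ʳ j)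
    inversion φ = let (p , q) = Φ⇒Inversion w {w₀} (proj₁ longest) φ in
      p , ≡.subst₂ _<ᶠ_ (inverse-cong {w₀ ·ₚ w} {word js} ex _)
        (inverse-cong {w₀ ·ₚ w} {word js} ex _) q

    -- `product-torus` asks for units at every inversion of the word, whereas c is known to be
    -- invertible only on Φ; the default elsewhere is 1.
    on-Φ : (c : Fin n → Fin n → Carrier) → Fin n → Fin n → Carrier
    on-Φ c i j with Φ₌? i j
    ... | yes (inj₂ _) = c i j
    ... | _            = 1#

    on-Φ-unit : ∀ c → (∀ i j → Φ w i j → Unit (c i j)) → ∀ i j → Unit (on-Φ c i j)
    on-Φ-unit c u i j with Φ₌? i j
    ... | yes (inj₂ φ) = u i j φ
    ... | yes (inj₁ _) = Unit-1
    ... | no _         = Unit-1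

    on-Φ-in : ∀ c {i j} → Φ w i j → on-Φ c i j ≈ c i j
    on-Φ-in c {i} {j} φ with Φ₌? i j
    ... | yes (inj₂ _)      = refl
    ... | yes (inj₁ ≡.refl) = contradiction (proj₁ φ) (ℕₚ.<-irrefl ≡.refl)
    ... | no ¬φ             = contradiction (inj₂ φ) ¬φ

    torus : TorusSolvable (Φ w)
    torus c u =
      let c′ = λ a b → on-Φ c (inv w₀ a) (inv w₀ b)
          (τ , τ-unit , τ-eq) = product-torus js unique c′
            (λ a b _ → on-Φ-unit c u (inv w₀ a) (inv w₀ b))
      in (λ i → τ (w₀ ⟨$⟩ʳ i)) , (λ i → τ-unit (w₀ ⟨$⟩ʳ i)) , λ i j φ →
         trans (τ-eq (w₀ ⟨$⟩ʳ i) (w₀ ⟨$⟩ʳ j) (inversion φ)) (*-congʳ (trans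
           (reflexive (≡.cong₂ (on-Φ c) (Perm.inverseˡ w₀) (Perm.inverseˡ w₀))) (on-Φ-in c φ)))

-- Polynomial normal forms of points and their scaling behaviour

module Invariants (𝒞 : ComplexNumbers) {m : ℕ} (w : Permutation′ (suc m)) (I : Subset m)
  (I⊆J : ∀ {j} → j ∈ I → SymmetricGroup.J w j) where
  open Field 𝒞
  open GeneralLinear 𝒞
  open Linear 𝒞
  open Support 𝒞
  open GL
  open Spherical 𝒞 {m} using (GLₙ; Polynomial)
  open Zariski 𝒞 {m} using (evalₘ)
  open Transpositions {m}
  open LongestElement {m} I using (Φ₌)
  open StandardBorel 𝒞 I
  open Flags 𝒞 w
  open SphericalOrbit 𝒞 w I I⊆J
  open BlockPart E? E-sym E-trans

  MatrixPolynomial : PolynomialClass (Matrix n)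
  MatrixPolynomial = record
    { 𝒫     = λ f → ∃ λ p → ∀ x → evalₘ p x ≈ f x
    ; resp  = λ e (p , h) → p , λ x → trans (h x) (e x)
    ; const = λ c → Polynomial.con c , λ _ → refl
    ; _:⊕_  = λ (p , h) (q , k) → (p Polynomial.:+ q) , λ x → +-cong (h x) (k x)
    ; _:⊗_  = λ (p , h) (q , k) → (p Polynomial.:* q) , λ x → *-cong (h x) (k x)
    }

  module MP = PolynomialClass MatrixPolynomial
  open PolynomialMatrix MatrixPolynomial

  Π : ∀ {k} → (Fin k → Carrier) → Carrier
  Π {zero}  f = 1#
  Π {suc k} f = f zero * Π (f ∘ suc)

  Π-unit : ∀ {k} {f : Fin k → Carrier} → (∀ i → Unit (f i)) → Unit (Π f)
  Π-unit {zero}  u = Unit-1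
  Π-unit {suc k} u = Unit-* (u zero) (Π-unit (u ∘ suc))

  Π-unit⁻ : ∀ {k} {f : Fin k → Carrier} → Unit (Π f) → ∀ i → Unit (f i)
  Π-unit⁻ {suc k} u zero    = Unit-*⁻ˡ u
  Π-unit⁻ {suc k} u (suc i) = Π-unit⁻ (Unit-*⁻ʳ u) i

  :Π : ∀ {k} {f : Matrix n → Fin k → Carrier} → (∀ i → MP.𝒫 (λ x → f x i)) → MP.𝒫 (λ x → Π (f x))
  :Π {zero}  h = MP.const 1#
  :Π {suc k} h = h zero MP.:⊗ :Π (h ∘ suc)

  _◁_ : Rel (Fin n) 0ℓ
  i ◁ j = inv w i <ᶠ inv w j

  open ColumnReduction {N = _◁_} (λ i j → inv w i Finₚ.<? inv w j) (λ j → ℕₚ.<-irrefl ≡.refl)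

  -- Column reduction of M w⁻¹ by w B w⁻¹, which leaves a matrix in w B⁻ w⁻¹, and
  -- then row reduction by its block part, without division.
  pivotColumns reducer reduced levi unipotent : Matrix n → Matrix n
  pivotColumns M = M *ₘ P⁻¹
  reducer M      = reduction (pivotColumns M)
  reduced M      = pivotColumns M *ₘ reducer M
  levi M         = blk (reduced M)
  unipotent M    = adj (levi M) *ₘ reduced M

  -- Where it is invertible, the column reduction is by an invertible matrix. Used as a factor, it
  -- turns statements about this open set into polynomial equations that hold everywhere.
  D : Matrix n → Carrier
  D M = Π (pivots (pivotColumns M))

  leviDen : Matrix n → Carrier
  leviDen M = den (levi M)

  private
    :id : 𝒫ₘ (λ M → M)
    :id i j = Polynomial.var i j , λ _ → refl
    :pivotColumns : 𝒫ₘ pivotColumns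
    :pivotColumns = :*ₘ {N = λ _ → P⁻¹} :id (λ i j → MP.const (P⁻¹ i j))
    :reduced : 𝒫ₘ reduced
    :reduced = :*ₘ :pivotColumns (:reduction MatrixPolynomial :pivotColumns)

  :unipotent : 𝒫ₘ unipotent
  :unipotent = :*ₘ (:adj (:blk MatrixPolynomial :reduced)) :reduced

  :D : MP.𝒫 D
  :D = :Π (:pivots MatrixPolynomial :pivotColumns)

  _⊵_ : Rel (Fin n) 0ℓ
  i ⊵ j = inv w j ≤ᶠ inv w i

  ⊴-Order : Order _⊴_
  ⊴-Order = record
    { rfl = ℕₚ.≤-refl ; tran = ℕₚ.≤-trans ; rank = toℕ ∘ inv w
    ; mono = λ i≤j i≢j → ℕₚ.≤∧≢⇒< i≤j (i≢j ∘ inverse-injective w ∘ Finₚ.toℕ-injective) }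

  ⊵-Order : Order _⊵_
  ⊵-Order = record
    { rfl = ℕₚ.≤-refl ; tran = λ p q → ℕₚ.≤-trans q p ; rank = λ i → n ℕ.∸ toℕ (inv w i)
    ; mono = λ {i} {j} j≤i i≢j → ℕₚ.∸-monoʳ-<
      (ℕₚ.≤∧≢⇒< j≤i (i≢j ∘ ≡.sym ∘ inverse-injective w ∘ Finₚ.toℕ-injective))
        (ℕₚ.<⇒≤ (Finₚ.toℕ<n (inv w i))) }

  R⇒⊵ : ∀ {i j} → R i j → i ⊵ j
  R⇒⊵ r = by-cases (R⇒Inv₌ r)
    where
    by-cases : ∀ {i j} → Inv₌ i j → i ⊵ j
    by-cases (inj₁ ≡.refl)   = ℕₚ.≤-refl
    by-cases (inj₂ (_ , q)) = ℕₚ.<⇒≤ q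

  -- w B w⁻¹ and its opposite meet in the torus, which makes the reduced form of a point unique up
  -- to diagonal factors.
  ⊵∩⊴⇒diagonal : ∀ {τ} → Supp _⊴_ τ → Supp _⊵_ τ → Diagonal τ
  ⊵∩⊴⇒diagonal s s′ i j i≢j = by-cases (Finₚ.<-cmp (inv w i) (inv w j))
    where
    by-cases : _ → _ ≈ 0#
    by-cases (tri< lt _ _) = s′ i j (ℕₚ.<⇒≱ lt)
    by-cases (tri≈ _ e _)  = contradiction (inverse-injective w e) i≢j
    by-cases (tri> _ _ gt) = s i j (ℕₚ.<⇒≱ gt)

  reducer-⊴ : ∀ M → Supp _⊴_ (reducer M)
  reducer-⊴ M i j ¬i⊴j = reduction-0 (pivotColumns M) (λ lt → ¬i⊴j (ℕₚ.<⇒≤ lt))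
    λ { ≡.refl → ¬i⊴j ℕₚ.≤-refl }

  reduced-⊵ : ∀ M → Supp _⊵_ (reduced M)
  reduced-⊵ M i j ¬i⊵j = reduced-0 (pivotColumns M) (ℕₚ.≰⇒> ¬i⊵j)

  levi-R : ∀ M → Supp R (levi M)
  levi-R M i j ¬r = by-cases (E? i j)
    where
    by-cases : Dec (E i j) → levi M i j ≈ 0#
    by-cases (no ¬e) = blk-Supp (reduced M) i j ¬e
    by-cases (yes e) = blk-Supp′ {_⊵_} (reduced-⊵ M) i j λ i⊵j → ¬r
      (e , ℕₚ.≮⇒≥ λ j<i → ℕₚ.<⇒≱ (w-reverses j<i (E-sym e)) i⊵j)

  conjugated-unit : ∀ {z : Matrix n} → Supp _⊴_ z → (∀ i → Unit (z i i)) → GLₙ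
  conjugated-unit {z = z} s u = upperGL (conjugateP z) (conjugateP-Upper s)
    (λ i → Unit-cong (sym (conjugateP-entry z i i)) (u _))

  -- z⁻¹ is obtained from the inverse of the upper triangular matrix w⁻¹ z w.
  inverse-⊴ : ∀ z → Supp _⊴_ z → (∀ i → Unit (z i i)) → ∃ λ y → z *ₘ y ≈ₘ 1ₘ × y *ₘ z ≈ₘ 1ₘ
  inverse-⊴ z s u = y , zy , yz
    where
    g : GLₙ
    g = conjugated-unit {z} s u
    y : Matrix n
    y = P *ₘ (inverse g *ₘ P⁻¹)
    P⁻¹P : P⁻¹ *ₘ P ≈ₘ 1ₘ
    P⁻¹P = inverseˡ (perm w)
    z≈ : z ≈ₘ P *ₘ (conjugateP z *ₘ P⁻¹)
    z≈ i j = begin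
      z i j ≈⟨ *ₘ-identityˡ z i j ⟨
      (1ₘ *ₘ z) i j ≈⟨ *ₘ-cong₁ z PP⁻¹ i j ⟨
      ((P *ₘ P⁻¹) *ₘ z) i j ≈⟨ *ₘ-assoc P P⁻¹ z i j ⟩
      (P *ₘ (P⁻¹ *ₘ z)) i j ≈⟨ *ₘ-cong₂ P (λ i j → begin
        (P⁻¹ *ₘ z) i j ≈⟨ *ₘ-cong₂ P⁻¹ (λ i j → trans (sym (*ₘ-identityʳ z i j))
          (trans (*ₘ-cong₂ z (λ i j → sym (PP⁻¹ i j)) i j) (sym (*ₘ-assoc z P P⁻¹ i j)))) i j ⟩
        (P⁻¹ *ₘ ((z *ₘ P) *ₘ P⁻¹)) i j ≈⟨ *ₘ-assoc P⁻¹ (z *ₘ P) P⁻¹ i j ⟨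
        (conjugateP z *ₘ P⁻¹) i j ∎) i j ⟩
      (P *ₘ (conjugateP z *ₘ P⁻¹)) i j ∎
    cancel : ∀ A C → A *ₘ C ≈ₘ 1ₘ → (P *ₘ (A *ₘ P⁻¹)) *ₘ (P *ₘ (C *ₘ P⁻¹)) ≈ₘ 1ₘ
    cancel A C e i j = trans (*ₘ-assoc P (A *ₘ P⁻¹) (P *ₘ (C *ₘ P⁻¹)) i j)
      (trans (*ₘ-cong₂ P (λ i j →
      trans (*ₘ-assoc A P⁻¹ (P *ₘ (C *ₘ P⁻¹)) i j)
        (trans (*ₘ-cong₂ A (*ₘ-cancelˡ P⁻¹ P (C *ₘ P⁻¹) P⁻¹P) i j)
        (*ₘ-cancelˡ A C P⁻¹ e i j))) i j) (PP⁻¹ i j))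
    zy : z *ₘ y ≈ₘ 1ₘ
    zy i j = trans (*ₘ-cong₁ y z≈ i j) (cancel (conjugateP z) (inverse g) (inverseʳ g) i j)
    yz : y *ₘ z ≈ₘ 1ₘ
    yz i j = trans (*ₘ-cong₂ y z≈ i j) (cancel (inverse g) (conjugateP z) (inverseˡ g) i j)

  reducer-unit : ∀ {M} → Unit (D M) → ∀ i → Unit (reducer M i i)
  reducer-unit {M} u i = Unit-cong (sym (reduction-diag (pivotColumns M) i))
    (Π-unit⁻ {f = pivots (pivotColumns M)} u i)

  module Generic {M : Matrix n} (u : Unit (D M)) where
    z⁻¹ : Matrix n
    z⁻¹ = proj₁ (inverse-⊴ (reducer M) (reducer-⊴ M) (reducer-unit {M} u))
    zz⁻¹ : reducer M *ₘ z⁻¹ ≈ₘ 1ₘ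
    zz⁻¹ = proj₁ (proj₂ (inverse-⊴ (reducer M) (reducer-⊴ M) (reducer-unit {M} u)))
    z⁻¹z : z⁻¹ *ₘ reducer M ≈ₘ 1ₘ
    z⁻¹z = proj₂ (proj₂ (inverse-⊴ (reducer M) (reducer-⊴ M) (reducer-unit {M} u)))

    module _ (M⁻¹ : Matrix n) (M⁻¹M : M⁻¹ *ₘ M ≈ₘ 1ₘ) where
      reduced⁻¹ : Matrix n
      reduced⁻¹ = z⁻¹ *ₘ (P *ₘ M⁻¹)

      reduced-inverseˡ : reduced⁻¹ *ₘ reduced M ≈ₘ 1ₘ
      reduced-inverseˡ = *ₘ-inverse z⁻¹ (P *ₘ M⁻¹) (M *ₘ P⁻¹) (reducer M)
        (*ₘ-inverse P M⁻¹ M P⁻¹ M⁻¹M PP⁻¹) z⁻¹z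

      reduced-unit : ∀ i → Unit (reduced M i i)
      reduced-unit = Order.diag-unit ⊵-Order {y = reduced⁻¹} reduced-inverseˡ (reduced-⊵ M)

      levi-unit : ∀ i → Unit (levi M i i)
      levi-unit i = Unit-cong (sym (blk-in (reduced M) E-refl)) (reduced-unit i)

      leviDen-unit : Unit (leviDen M)
      leviDen-unit = den-upper (levi M) (R⇒Upper (levi-R M)) levi-unit

  -- Where the block part is invertible, `unipotent M` is therefore its inverse times the reduced
  -- matrix, up to the scalar `leviDen M`: the U_Φ coordinate of the point, up to scaling.
  levi-unipotent : ∀ M i j → (levi M *ₘ unipotent M) i j ≈ leviDen M * reduced M i j
  levi-unipotent M i j = begin
    (levi M *ₘ (adj (levi M) *ₘ reduced M)) i j ≈⟨ *ₘ-assoc (levi M) (adj (levi M))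
      (reduced M) i j ⟨
    ((levi M *ₘ adj (levi M)) *ₘ reduced M) i j ≈⟨ *ₘ-cong₁ (reduced M)
      (adj-inverseʳ (levi M)) i j ⟩
    ((λ k → leviDen M * 1ₘ i k) ∙ (λ k → reduced M k j)) ≈⟨ ∙-scaleˡ (leviDen M) (1ₘ i)
      (λ k → reduced M k j) ⟩
    leviDen M * (1ₘ i ∙ (λ k → reduced M k j)) ≈⟨ *-congˡ (1ₘ-∙ (λ k → reduced M k j) i) ⟩
    leviDen M * reduced M i j ∎

  -- û₀ is the unipotent part of v with block part K, and û that of v τ with block part K τ, each up
  -- to a scalar. Cancelling K leaves d₀ τ û = d û₀ τ.
  covariance : ∀ {K K⁻¹ τ û û₀ v : Matrix n} {d d₀} → K⁻¹ *ₘ K ≈ₘ 1ₘ → Diagonal τ →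
    (∀ i j → (K *ₘ û₀) i j ≈ d₀ * v i j) → (∀ i j → ((K *ₘ τ) *ₘ û) i j ≈ d * (v *ₘ τ) i j) →
    ∀ i j → (d₀ * τ i i) * û i j ≈ (d * τ j j) * û₀ i j
  covariance {K} {K⁻¹} {τ} {û} {û₀} {v} {d} {d₀} K⁻¹K dτ e₀ e i j = begin
    (d₀ * τ i i) * û i j ≈⟨ *-assoc d₀ (τ i i) (û i j) ⟩
    d₀ * (τ i i * û i j) ≈⟨ *-congˡ (*ₘ-diagonalˡ û dτ i j) ⟨
    A i j ≈⟨ cancelled A i j ⟨
    (K⁻¹ *ₘ (K *ₘ A)) i j ≈⟨ *ₘ-cong₂ K⁻¹ KA≈KB i j ⟩
    (K⁻¹ *ₘ (K *ₘ C)) i j ≈⟨ cancelled C i j ⟩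
    C i j ≈⟨ *-congˡ (*ₘ-diagonalʳ û₀ dτ i j) ⟩
    d * (û₀ i j * τ j j) ≈⟨ solve 3 (λ d u t → d :* (u :* t) := (d :* t) :* u) refl d (û₀ i j)
      (τ j j) ⟩
    (d * τ j j) * û₀ i j ∎
    where
    A C : Matrix n
    A i j = d₀ * (τ *ₘ û) i j
    C i j = d * (û₀ *ₘ τ) i j
    cancelled : ∀ X → K⁻¹ *ₘ (K *ₘ X) ≈ₘ X
    cancelled X i j = *ₘ-cancelˡ K⁻¹ K X K⁻¹K i j
    KA≈KB : K *ₘ A ≈ₘ K *ₘ C
    KA≈KB i j = begin
      (K *ₘ A) i j ≈⟨ ∙-scaleʳ d₀ (K i) (λ k → (τ *ₘ û) k j) ⟩
      d₀ * (K *ₘ (τ *ₘ û)) i j ≈⟨ *-congˡ (trans (sym (*ₘ-assoc K τ û i j)) (e i j)) ⟩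
      d₀ * (d * (v *ₘ τ) i j) ≈⟨ solve 3 (λ a b x → a :* (b :* x) := b :* (a :* x)) refl d₀ d
        ((v *ₘ τ) i j) ⟩
      d * (d₀ * (v *ₘ τ) i j) ≈⟨ *-congˡ (∙-scaleˡ d₀ (v i) (λ k → τ k j)) ⟨
      d * ((λ k → d₀ * v i k) ∙ (λ k → τ k j)) ≈⟨ *-congˡ
        (∙-cong {v = λ k → τ k j} (λ k → sym (e₀ i k)) (λ _ → refl)) ⟩
      d * ((K *ₘ û₀) *ₘ τ) i j ≈⟨ *-congˡ (*ₘ-assoc K û₀ τ i j) ⟩
      d * (K *ₘ (û₀ *ₘ τ)) i j ≈⟨ ∙-scaleʳ d (K i) (λ k → (û₀ *ₘ τ) k j) ⟨
      (K *ₘ C) i j ∎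

  -- The ambiguity in a unipotent coordinate: torus factors on both sides, with the scalar
  -- denominators absorbed into them.
  record Equivalent (û û₀ : Matrix n) : Set where
    field
      row column   : Fin n → Carrier
      row-unit     : ∀ i → Unit (row i)
      column-unit  : ∀ i → Unit (column i)
      scaled       : ∀ i j → row i * û i j ≈ column j * û₀ i j

  -- The reduced form of M is h · reduced(M₀) · τ. By its construction τ lies in w B w⁻¹, and as a
  -- quotient of two matrices of the opposite group also in that one; so it is diagonal. Taking
  -- block parts, which commutes with h and τ, gives levi(M) = h · levi(M₀) · τ, so that h cancels
  -- and only scalings remain.
  Equivalent-orbit : ∀ {M M₀ M⁻¹ M₀⁻¹ β : Matrix n} → M⁻¹ *ₘ M ≈ₘ 1ₘ → M₀⁻¹ *ₘ M₀ ≈ₘ 1ₘ → Unit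
    (D M) → Unit (D M₀) →
    ∀ h → H h → Upper β → M ≈ₘ matrix h *ₘ (M₀ *ₘ β) → Equivalent (unipotent M) (unipotent M₀)
  Equivalent-orbit {M} {M₀} {M⁻¹} {M₀⁻¹} {β} M⁻¹M M₀⁻¹M₀ uM uM₀ h h∈ β-up eq = record
    { row = λ i → leviDen M₀ * τ i i ; column = λ j → leviDen M * τ j j
    ; row-unit = λ i → Unit-* (G₀.leviDen-unit M₀⁻¹ M₀⁻¹M₀) (τ-unit i) ; column-unit = λ j → Unit-*
      (G.leviDen-unit M⁻¹ M⁻¹M) (τ-unit j)
    ; scaled = covariance {K = K} {K⁻¹ = inverse ℓ₀GL *ₘ inverse h} {v = v}
        (*ₘ-inverse (inverse ℓ₀GL) (inverse h) (matrix h) ℓ₀ (inverseˡ h) (inverseˡ ℓ₀GL))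
        τ-diagonal
        (λ i j → begin
          ((matrix h *ₘ ℓ₀) *ₘ unipotent M₀) i j ≈⟨ *ₘ-assoc (matrix h) ℓ₀ (unipotent M₀) i j ⟩
          (matrix h *ₘ (ℓ₀ *ₘ unipotent M₀)) i j ≈⟨ *ₘ-cong₂ (matrix h) (levi-unipotent M₀) i j ⟩
          (matrix h *ₘ (λ i j → leviDen M₀ * reduced M₀ i j)) i j ≈⟨ ∙-scaleʳ (leviDen M₀)
            (matrix h i) (λ k → reduced M₀ k j) ⟩
          leviDen M₀ * v i j ∎)
        (λ i j → begin
          ((K *ₘ τ) *ₘ unipotent M) i j ≈⟨ *ₘ-cong₁ (unipotent M) Kτ≈ℓ i j ⟩
          (levi M *ₘ unipotent M) i j ≈⟨ levi-unipotent M i j ⟩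
          leviDen M * reduced M i j ≈⟨ *-congˡ (reduced≈ i j) ⟩
          leviDen M * (v *ₘ τ) i j ∎) }
    where
    module G  = Generic {M} uM
    module G₀ = Generic {M₀} uM₀
    ℓ₀ : Matrix n
    ℓ₀ = levi M₀
    ℓ₀GL : GLₙ
    ℓ₀GL = upperGL ℓ₀ (R⇒Upper (levi-R M₀)) (G₀.levi-unit M₀⁻¹ M₀⁻¹M₀)
    K v y τ : Matrix n
    K = matrix h *ₘ ℓ₀
    v = matrix h *ₘ reduced M₀
    y = P *ₘ (β *ₘ P⁻¹)
    τ = G₀.z⁻¹ *ₘ (y *ₘ reducer M)
    reduced≈ : reduced M ≈ₘ v *ₘ τ
    reduced≈ i j = begin
      ((M *ₘ P⁻¹) *ₘ z) i j ≈⟨ *ₘ-cong₁ z (*ₘ-cong₁ P⁻¹ eq) i j ⟩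
      (((matrix h *ₘ (M₀ *ₘ β)) *ₘ P⁻¹) *ₘ z) i j ≈⟨ *ₘ-cong₁ z
        (*ₘ-assoc (matrix h) (M₀ *ₘ β) P⁻¹) i j ⟩
      ((matrix h *ₘ ((M₀ *ₘ β) *ₘ P⁻¹)) *ₘ z) i j ≈⟨ *ₘ-assoc (matrix h) ((M₀ *ₘ β) *ₘ P⁻¹) z i j ⟩
      (matrix h *ₘ (((M₀ *ₘ β) *ₘ P⁻¹) *ₘ z)) i j ≈⟨ *ₘ-cong₂ (matrix h) inner i j ⟩
      (matrix h *ₘ (reduced M₀ *ₘ τ)) i j ≈⟨ *ₘ-assoc (matrix h) (reduced M₀) τ i j ⟨
      (v *ₘ τ) i j ∎
      where
      z z₀ : Matrix n
      z = reducer M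
      z₀ = reducer M₀
      inner : ((M₀ *ₘ β) *ₘ P⁻¹) *ₘ z ≈ₘ reduced M₀ *ₘ τ
      inner i j = sym (begin
        (((M₀ *ₘ P⁻¹) *ₘ z₀) *ₘ (G₀.z⁻¹ *ₘ (y *ₘ z))) i j ≈⟨ *ₘ-assoc (M₀ *ₘ P⁻¹) z₀
          (G₀.z⁻¹ *ₘ (y *ₘ z)) i j ⟩
        ((M₀ *ₘ P⁻¹) *ₘ (z₀ *ₘ (G₀.z⁻¹ *ₘ (y *ₘ z)))) i j
          ≈⟨ *ₘ-cong₂ (M₀ *ₘ P⁻¹) (*ₘ-cancelˡ z₀ G₀.z⁻¹ (y *ₘ z) G₀.zz⁻¹) i j ⟩
        ((M₀ *ₘ P⁻¹) *ₘ (y *ₘ z)) i j ≈⟨ *ₘ-assoc (M₀ *ₘ P⁻¹) y z i j ⟨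
        (((M₀ *ₘ P⁻¹) *ₘ y) *ₘ z) i j ≈⟨ *ₘ-cong₁ z (λ i j → begin
          ((M₀ *ₘ P⁻¹) *ₘ (P *ₘ (β *ₘ P⁻¹))) i j ≈⟨ *ₘ-assoc M₀ P⁻¹ (P *ₘ (β *ₘ P⁻¹)) i j ⟩
          (M₀ *ₘ (P⁻¹ *ₘ (P *ₘ (β *ₘ P⁻¹)))) i j ≈⟨ *ₘ-cong₂ M₀
            (*ₘ-cancelˡ P⁻¹ P (β *ₘ P⁻¹) (inverseˡ (perm w))) i j ⟩
          (M₀ *ₘ (β *ₘ P⁻¹)) i j ≈⟨ *ₘ-assoc M₀ β P⁻¹ i j ⟨
          ((M₀ *ₘ β) *ₘ P⁻¹) i j ∎) i j ⟩
        (((M₀ *ₘ β) *ₘ P⁻¹) *ₘ z) i j ∎)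
    y-⊴ : Supp _⊴_ y
    y-⊴ i j ¬s = trans (P-row (β *ₘ P⁻¹) i j)
      (trans (*ₘ-permMatrix β (Perm.flip w) (inv w i) j) (β-up _ _ (ℕₚ.≰⇒> ¬s)))
      where
      P-row : ∀ N i j → (P *ₘ N) i j ≈ N (inv w i) j
      P-row N i j = trans (sum-only (inv w i) λ k k≢ → 0*x≈0 {N k j}
        (permMatrix-0 w {i} {k} λ e → k≢ (≡.trans (≡.sym (Perm.inverseˡ w))
          (≡.cong (inv w) (≡.sym e)))))
        (trans (*-congʳ (permMatrix-1 w {i} {inv w i} (≡.sym (Perm.inverseʳ w)))) (*-identityˡ _))
    τ-⊴ : Supp _⊴_ τ
    τ-⊴ = Supp-* {R = _⊴_} {S = _⊴_} {M = G₀.z⁻¹} {N = y *ₘ reducer M} ℕₚ.≤-trans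
      (Order.Supp-inverse ⊴-Order {reducer M₀} {G₀.z⁻¹} G₀.z⁻¹z (reducer-⊴ M₀))
        (Supp-* {R = _⊴_} {S = _⊴_} ℕₚ.≤-trans y-⊴ (reducer-⊴ M))
    v-⊵ : Supp _⊵_ v
    v-⊵ = Supp-* {R = _⊵_} {S = _⊵_} (λ p q → ℕₚ.≤-trans q p) (Supp-⊆ R⇒⊵ h∈) (reduced-⊵ M₀)
    v⁻¹ : Matrix n
    v⁻¹ = G₀.reduced⁻¹ M₀⁻¹ M₀⁻¹M₀ *ₘ inverse h
    v⁻¹v : v⁻¹ *ₘ v ≈ₘ 1ₘ
    v⁻¹v = *ₘ-inverse (G₀.reduced⁻¹ M₀⁻¹ M₀⁻¹M₀) (inverse h) (matrix h) (reduced M₀) (inverseˡ h)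
      (G₀.reduced-inverseˡ M₀⁻¹ M₀⁻¹M₀)
    τ-⊵ : Supp _⊵_ τ
    τ-⊵ = Supp-≈ {M = v⁻¹ *ₘ reduced M}
      (λ i j → trans (*ₘ-cong₂ v⁻¹ reduced≈ i j) (*ₘ-cancelˡ v⁻¹ v τ v⁻¹v i j))
      (Supp-* {R = _⊵_} {S = _⊵_} {M = v⁻¹} {N = reduced M} (λ p q → ℕₚ.≤-trans q p)
        (Order.Supp-inverse ⊵-Order {v} {v⁻¹} v⁻¹v v-⊵) (reduced-⊵ M))
    τ-diagonal : Diagonal τ
    τ-diagonal = ⊵∩⊴⇒diagonal τ-⊴ τ-⊵
    τ-unit : ∀ i → Unit (τ i i)
    τ-unit i = Unit-*⁻ʳ (Unit-cong (trans (reduced≈ i i) (*ₘ-diagonalʳ v τ-diagonal i i))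
      (G.reduced-unit M⁻¹ M⁻¹M i))
    τ-E : Supp E τ
    τ-E = Supp-⊆ {R = _≡_} (λ { ≡.refl → E-refl }) τ-diagonal
    Kτ≈ℓ : K *ₘ τ ≈ₘ levi M
    Kτ≈ℓ i j = begin
      ((matrix h *ₘ ℓ₀) *ₘ τ) i j ≈⟨ *ₘ-cong₁ τ
        (blk-*ˡ (matrix h) (reduced M₀) (Supp-⊆ proj₁ h∈)) i j ⟩
      (blk v *ₘ τ) i j ≈⟨ blk-*ʳ v τ τ-E i j ⟩
      blk (v *ₘ τ) i j ≈⟨ blk-cong (λ i j → sym (reduced≈ i j)) i j ⟩
      levi M i j ∎

  D-unipotent : ∀ u → Unipotent-Φ u → Unit (D (u *ₘ P))
  D-unipotent u u∈Φ = Π-unit (pivots-upper (pivotColumns (u *ₘ P))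
    (λ i j j<i → trans (uPP⁻¹ i j) (Unipotent-Φ-upper u∈Φ i j j<i))
    (λ i → Unit-cong (sym (trans (uPP⁻¹ i i) (proj₂ u∈Φ i))) Unit-1))
    where
    uPP⁻¹ : (u *ₘ P) *ₘ P⁻¹ ≈ₘ u
    uPP⁻¹ i j = trans (*ₘ-assoc u P P⁻¹ i j) (trans (*ₘ-cong₂ u PP⁻¹ i j) (*ₘ-identityʳ u i j))

  Φ₌⇒⊵ : ∀ {i j} → Φ₌ w i j → i ⊵ j
  Φ₌⇒⊵ (inj₁ ≡.refl)          = ℕₚ.≤-refl
  Φ₌⇒⊵ (inj₂ (_ , _ , q)) = ℕₚ.<⇒≤ q

  -- The coordinate computed at u w recovers u up to scaling: u lies in the group opposite to w B
  -- w⁻¹ already, so its reducer is diagonal, and its block part is the identity.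
  Equivalent-unipotent : ∀ u → Unipotent-Φ u → Equivalent (unipotent (u *ₘ P)) u
  Equivalent-unipotent u u∈Φ = record
    { row = λ i → 1# * z i i ; column = λ j → leviDen M * z j j
    ; row-unit = λ i → Unit-* Unit-1 (reducer-unit {M} uM i)
    ; column-unit = λ j → Unit-* (G.leviDen-unit (P⁻¹ *ₘ inverse uGL) M⁻¹M) (reducer-unit {M} uM j)
    ; scaled = covariance {K = 1ₘ} {K⁻¹ = 1ₘ} {v = u} (*ₘ-identityˡ 1ₘ) z-diagonal
        (λ i j → trans (*ₘ-identityˡ u i j) (sym (*-identityˡ _)))
        (λ i j → begin
          ((1ₘ *ₘ z) *ₘ unipotent M) i j ≈⟨ *ₘ-cong₁ (unipotent M) z≈levi i j ⟩
          (levi M *ₘ unipotent M) i j ≈⟨ levi-unipotent M i j ⟩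
          leviDen M * reduced M i j ≈⟨ *-congˡ (reduced≈ i j) ⟩
          leviDen M * (u *ₘ z) i j ∎) }
    where
    M z : Matrix n
    M = u *ₘ P
    z = reducer M
    uM : Unit (D M)
    uM = D-unipotent u u∈Φ
    module G = Generic {M} uM
    uGL : GLₙ
    uGL = Unipotent-Φ-GL u u∈Φ
    M⁻¹M : (P⁻¹ *ₘ inverse uGL) *ₘ (u *ₘ P) ≈ₘ 1ₘ
    M⁻¹M = *ₘ-inverse P⁻¹ (inverse uGL) u P (inverseˡ uGL) (inverseˡ (perm w))
    reduced≈ : reduced M ≈ₘ u *ₘ z
    reduced≈ = *ₘ-cong₁ z (λ i j → trans (*ₘ-assoc u P P⁻¹ i j)
      (trans (*ₘ-cong₂ u PP⁻¹ i j) (*ₘ-identityʳ u i j)))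
    z-⊵ : Supp _⊵_ z
    z-⊵ = Supp-≈ {M = inverse uGL *ₘ reduced M}
      (λ i j → trans (*ₘ-cong₂ (inverse uGL) reduced≈ i j)
        (*ₘ-cancelˡ (inverse uGL) u z (inverseˡ uGL) i j))
      (Supp-* {R = _⊵_} {S = _⊵_} (λ p q → ℕₚ.≤-trans q p)
        (Order.Supp-inverse ⊵-Order {u} {inverse uGL} (inverseˡ uGL) (Supp-⊆ Φ₌⇒⊵ (proj₁ u∈Φ)))
          (reduced-⊵ M))
    z-diagonal : Diagonal z
    z-diagonal = ⊵∩⊴⇒diagonal (reducer-⊴ M) z-⊵
    blk-u : blk u ≈ₘ 1ₘ
    blk-u i j = sym (blk-unique {M = u} (Supp-1ₘ {R = E} E-refl)
      (λ e → sym (blk-Unipotent-Φ u∈Φ e)) i j)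
    z≈levi : 1ₘ *ₘ z ≈ₘ levi M
    z≈levi i j = begin
      (1ₘ *ₘ z) i j ≈⟨ *ₘ-cong₁ z blk-u i j ⟨
      (blk u *ₘ z) i j ≈⟨ blk-*ʳ u z (Supp-⊆ {R = _≡_} (λ { ≡.refl → E-refl }) z-diagonal) i j ⟩
      blk (u *ₘ z) i j ≈⟨ blk-cong (λ i j → sym (reduced≈ i j)) i j ⟩
      levi M i j ∎

-- The Schubert variety is stable under the Levi subgroup

module LeviStability (𝒞 : ComplexNumbers) {m : ℕ} (w : Permutation′ (suc m)) (I : Subset m)
  (I⊆J : ∀ {j} → j ∈ I → SymmetricGroup.J w j) where
  open Field 𝒞
  open GeneralLinear 𝒞
  open Linear 𝒞
  open Support 𝒞
  open GL
  open Spherical 𝒞 {m} using (GLₙ; G; B; SchubertCell; SchubertVariety)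
  open Group G using (_⁻¹) renaming (_∙_ to _·_)
  open Zariski 𝒞 {m} using (evalₘ; eval-evalₘ; evalₘ-cong; :evalₘ)
  open Transpositions {m}
  open Blocks I using (separated)
  open StandardBorel 𝒞 I
  open Flags 𝒞 w
  open SphericalOrbit 𝒞 w I I⊆J
  open Invariants 𝒞 w I I⊆J using (conjugated-unit)
  open BlockPart E? E-sym E-trans

  Lower : Rel (Fin n) 0ℓ
  Lower i j = E i j × j <ᶠ i

  open ColumnReduction {N = Lower} (λ i j → E? i j ×-dec (j Finₚ.<? i))
    (λ j (_ , j<j) → ℕₚ.<-irrefl ≡.refl j<j)

  BlockUpper : Rel (Fin n) 0ℓ
  BlockUpper i j = E i j ⊎ i <ᶠ j

  BlockUpper-trans : Transitive BlockUpper
  BlockUpper-trans         (inj₁ e)   (inj₁ f)   = inj₁ (E-trans e f)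
  BlockUpper-trans         (inj₂ i<k) (inj₂ k<j) = inj₂ (ℕₚ.<-trans i<k k<j)
  BlockUpper-trans {i} {k} {j} (inj₁ e) (inj₂ k<j) = by-cases (E? k j)
    where
    by-cases : Dec (E k j) → BlockUpper i j
    by-cases (yes f) = inj₁ (E-trans e f)
    by-cases (no ¬f) = let (d , d∉ , k≤d , d<j) = separated k<j ¬f in
      inj₂ (ℕₚ.≤-<-trans (Equivalence.from (e d d∉) k≤d) d<j)
  BlockUpper-trans {i} {k} {j} (inj₂ i<k) (inj₁ f) = by-cases (E? i k)
    where
    by-cases : Dec (E i k) → BlockUpper i j
    by-cases (yes e) = inj₁ (E-trans e f)
    by-cases (no ¬e) = let (d , d∉ , i≤d , d<k) = separated i<k ¬e in
      inj₂ (ℕₚ.≤-<-trans i≤d (ℕₚ.≰⇒> λ j≤d → ℕₚ.<⇒≱ d<k (Equivalence.from (f d d∉) j≤d)))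

  reduction-Supp : ∀ x {i j} → ¬ (i ≡ j ⊎ Lower i j) → reduction x i j ≈ 0#
  reduction-Supp x ¬s = reduction-0 x (¬s ∘ inj₂) (¬s ∘ inj₁)

  reduction-⊴ : ∀ x → Supp _⊴_ (reduction x)
  reduction-⊴ x i j ¬s = reduction-Supp x λ
    { (inj₁ ≡.refl)      → ¬s ℕₚ.≤-refl
    ; (inj₂ (e , j<i)) → ¬s (ℕₚ.<⇒≤ (w-reverses j<i (E-sym e))) }

  reduction-E : ∀ x → Supp E (reduction x)
  reduction-E x i j ¬e = reduction-Supp x λ { (inj₁ ≡.refl) → ¬e E-refl ; (inj₂ (e , _)) → ¬e e }

  -- g u w B = (g u z) w B, where z in w B w⁻¹ makes g z upper triangular.
  generic-in-cell : ∀ (g : GLₙ) → Supp E (matrix g) → (∀ j → Unit (pivots (matrix g) j)) →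
                    ∀ u (u∈Φ : Unipotent-Φ u) → SchubertCell w (cellPoint g u u∈Φ)
  generic-in-cell g g∈ pivot-unit u u∈Φ = b , (λ i j j<i → trans (matrix-b i j) (upper i j j<i)) ,
    ~-intro γ (b · perm w) {conjugateP z} (conjugateP-Upper (reduction-⊴ (matrix g)))
      λ i j → trans (*ₘ-assoc (matrix γ *ₘ conjugateP z) P⁻¹ P i j)
        (trans (*ₘ-cong₂ (matrix γ *ₘ conjugateP z) (inverseˡ (perm w)) i j)
          (*ₘ-identityʳ (matrix γ *ₘ conjugateP z) i j))
    where
    z : Matrix n
    z = reduction (matrix g)
    γ β b : GLₙ
    γ = cellPoint g u u∈Φ
    β = conjugated-unit {z} (reduction-⊴ (matrix g))
      (λ i → Unit-cong (sym (reduction-diag (matrix g) i)) (pivot-unit i))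
    b = (γ · β) · (perm w ⁻¹)
    matrix-b : (matrix γ *ₘ conjugateP z) *ₘ P⁻¹ ≈ₘ (matrix g *ₘ u) *ₘ z
    matrix-b i j = begin
      ((((matrix g *ₘ u) *ₘ P) *ₘ conjugateP z) *ₘ P⁻¹) i j ≈⟨ *ₘ-cong₁ P⁻¹
        (P-conjugateP (matrix g *ₘ u) z) i j ⟩
      ((((matrix g *ₘ u) *ₘ z) *ₘ P) *ₘ P⁻¹) i j ≈⟨ *ₘ-assoc ((matrix g *ₘ u) *ₘ z) P P⁻¹ i j ⟩
      (((matrix g *ₘ u) *ₘ z) *ₘ (P *ₘ P⁻¹)) i j ≈⟨ *ₘ-cong₂ ((matrix g *ₘ u) *ₘ z) PP⁻¹ i j ⟩
      (((matrix g *ₘ u) *ₘ z) *ₘ 1ₘ) i j ≈⟨ *ₘ-identityʳ ((matrix g *ₘ u) *ₘ z) i j ⟩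
      ((matrix g *ₘ u) *ₘ z) i j ∎
    blk-u : blk u ≈ₘ 1ₘ
    blk-u i j = sym (blk-unique {M = u} (Supp-1ₘ {R = E} E-refl)
      (λ e → sym (blk-Unipotent-Φ u∈Φ e)) i j)
    blk-product : blk ((matrix g *ₘ u) *ₘ z) ≈ₘ matrix g *ₘ z
    blk-product i j = begin
      blk ((matrix g *ₘ u) *ₘ z) i j ≈⟨ blk-*ʳ (matrix g *ₘ u) z (reduction-E (matrix g)) i j ⟨
      (blk (matrix g *ₘ u) *ₘ z) i j ≈⟨ *ₘ-cong₁ z (λ i j → sym (blk-*ˡ (matrix g) u g∈ i j)) i j ⟩
      ((matrix g *ₘ blk u) *ₘ z) i j ≈⟨ *ₘ-cong₁ z
        (λ i j → trans (*ₘ-cong₂ (matrix g) blk-u i j) (*ₘ-identityʳ (matrix g) i j)) i j ⟩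
      (matrix g *ₘ z) i j ∎
    product-Supp : Supp BlockUpper ((matrix g *ₘ u) *ₘ z)
    product-Supp = Supp-* {M = matrix g *ₘ u} {N = z} BlockUpper-trans
      (Supp-* {M = matrix g} {N = u} BlockUpper-trans (Supp-⊆ inj₁ g∈)
        (Supp-⊆ Φ₌⇒BlockUpper (proj₁ u∈Φ)))
      (Supp-⊆ inj₁ (reduction-E (matrix g)))
      where
      open LongestElement {m} I using (Φ₌)
      Φ₌⇒BlockUpper : ∀ {i j} → Φ₌ w i j → BlockUpper i j
      Φ₌⇒BlockUpper (inj₁ ≡.refl)     = inj₁ E-refl
      Φ₌⇒BlockUpper (inj₂ (i<j , _)) = inj₂ i<j
    upper : Upper ((matrix g *ₘ u) *ₘ z)
    upper i j j<i = by-cases (E? i j)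
      where
      by-cases : Dec (E i j) → ((matrix g *ₘ u) *ₘ z) i j ≈ 0#
      by-cases (no ¬e) = product-Supp i j λ { (inj₁ e) → ¬e e ; (inj₂ i<j) → ℕₚ.<-asym i<j j<i }
      by-cases (yes e) = trans (sym (blk-in ((matrix g *ₘ u) *ₘ z) e))
        (trans (blk-product i j) (reduced-0 (matrix g) (e , j<i)))

  -- Join 1 to q inside the block diagonal matrices. Pivots and denominators do not vanish at 1,
  -- hence not at generic points of the line, where `generic-in-cell` applies; equations of a closed
  -- set containing the cell then extend to t = 1.
  Levi-stable : ∀ (q : GLₙ) → Supp E (matrix q) → ∀ u (u∈Φ : Unipotent-Φ u) → SchubertVariety w
    (cellPoint q u u∈Φ)
  Levi-stable q q∈ u u∈Φ Z (_ , 𝓕 , Z⇔) cell⊆Z = Equivalence.from (Z⇔ (cellPoint q u u∈Φ)) λ p p∈ →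
    trans (eval-evalₘ p (cellPoint q u u∈Φ) λ i j → refl)
      (trans (evalₘ-cong p λ i j → sym (curve-1 i j))
        (Curve-identity (:evalₘ Curve :curve p) (eventually p p∈) 1#))
    where
    open PolynomialMatrix Curve
    open PolynomialClass Curve using (const; _:⊕_; _:⊗_)
    line curve : Carrier → Matrix n
    line t i j = 1ₘ i j + t * (matrix q i j - 1ₘ i j)
    curve t = (line t *ₘ u) *ₘ P
    line-E : ∀ t → Supp E (line t)
    line-E t i j ¬e = trans (+-cong 0ᵢⱼ
      (x*0≈0 (trans (+-cong (q∈ i j ¬e) (-‿cong 0ᵢⱼ)) (-‿inverseʳ 0#)))) (+-identityʳ _)
      where 0ᵢⱼ = 1ₘ-off i j λ { ≡.refl → ¬e E-refl }
    :line : 𝒫ₘ line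
    :line i j = const (1ₘ i j) :⊕ (Curve-id :⊗ const (matrix q i j - 1ₘ i j))
    :curve : 𝒫ₘ curve
    :curve = :*ₘ {N = λ _ → P} (:*ₘ {N = λ _ → u} :line (λ i j → const (u i j)))
      (λ i j → const (P i j))
    curve-1 : curve 1# ≈ₘ (matrix q *ₘ u) *ₘ P
    curve-1 = *ₘ-cong₁ P (*ₘ-cong₁ u λ i j → solve 2 (λ d q → d :+ :1 :* (q :- d) := q) refl
      (1ₘ i j) (matrix q i j))
    line-0 : line 0# ≈ₘ 1ₘ
    line-0 i j = trans (+-congˡ (zeroˡ _)) (+-identityʳ _)
    line-0-upper : Upper (line 0#)
    line-0-upper i j j<i = trans (line-0 i j) (1ₘ-off i j λ { ≡.refl → ℕₚ.<-irrefl ≡.refl j<i })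
    line-0-unit : ∀ i → Unit (line 0# i i)
    line-0-unit i = Unit-cong (sym (trans (line-0 i i) (1ₘ-diag i))) Unit-1
    generic : Ev (λ k → ¬ den (line (nat k)) ≈ 0# × ∀ j → ¬ pivots (line (nat k)) j ≈ 0#)
    generic = Ev-∩ (Curve-eventually≉0 (:den :line) {0#}
      (Unit⇒≉0 (den-upper (line 0#) line-0-upper line-0-unit)))
      (Ev-∀Fin λ j → Curve-eventually≉0 (:pivots Curve :line j) {0#}
        (Unit⇒≉0 (pivots-upper (line 0#) line-0-upper line-0-unit j)))
    eventually : ∀ p → 𝓕 p → Ev (λ k → evalₘ p (curve (nat k)) ≈ 0#)
    eventually p p∈ = Ev-map (λ k (den≉0 , piv≉0) → stable λ p≉0 →
      ≉0⇒Unit den≉0 λ den-unit → ¬¬-∀Fin (λ j → ≉0⇒Unit (piv≉0 j)) λ piv-unit →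
      let g = toGL (line (nat k)) den-unit
          γ = cellPoint g u u∈Φ in
      p≉0 (trans (sym (eval-evalₘ p γ λ i j → refl))
        (Equivalence.to (Z⇔ γ) (cell⊆Z {γ} (generic-in-cell g (line-E (nat k)) piv-unit u u∈Φ)) p
          p∈))) generic

-- Necessity: a square excludes a dense orbit

module Necessity (𝒞 : ComplexNumbers) {m : ℕ} (w : Permutation′ (suc m)) (I : Subset m)
  (I⊆J : ∀ {j} → j ∈ I → SymmetricGroup.J w j) where
  open Field 𝒞
  open GeneralLinear 𝒞
  open Linear 𝒞
  open Support 𝒞
  open GL
  open Spherical 𝒞 {m}
    using (GLₙ; G; Polynomial; eval; B; _~_; Closed; closure; SchubertVariety; Orbit;
      ConnectedSolvableClosedSubgroup; IsLeviSpherical)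
  open Group G using (_⁻¹) renaming (_∙_ to _·_)
  open Subgroups G using (IsSubgroup)
  open Zariski 𝒞 {m}
  open SymmetricGroup {m} using (IsSpherical)
  open Transpositions {m}
  open LongestElement {m} I using (Φ; Φ₌; spherical-without-square)
  open StandardBorel 𝒞 I
  open Flags 𝒞 w
  open SphericalOrbit 𝒞 w I I⊆J
  open Invariants 𝒞 w I I⊆J
  open LeviStability 𝒞 w I I⊆J using (Levi-stable)
  open LieKolchin 𝒞 G Regular (λ {f} p {g} {h} → regular-cong {f} p {g} {h}) Closed Closed-zeros
    (λ {Z} c {g} {h} → Closed-resp {Z} c {g} {h}) (λ {Z} c {g} → Closed-stable {Z} c {g})
    (λ c y {Z} → Closed-preimage (Rational-commutator c y))
    using (Representation; Triangularisation; triangularise)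

  ~-trans : ∀ f g h → f ~ g → g ~ h → f ~ h
  ~-trans f g h f~g g~h = ~-intro f h {(inverse f *ₘ matrix g) *ₘ (inverse g *ₘ matrix h)}
    (Supp⇒Upper (Supp-* {R = _≤ᶠ_} {S = _≤ᶠ_} {M = inverse f *ₘ matrix g}
      {N = inverse g *ₘ matrix h} ℕₚ.≤-trans (Upper⇒Supp f~g) (Upper⇒Supp g~h))) λ i j → begin
    matrix h i j ≈⟨ ~-elim g h g~h i j ⟩
    (matrix g *ₘ (inverse g *ₘ matrix h)) i j ≈⟨ *ₘ-cong₁ (inverse g *ₘ matrix h)
      (~-elim f g f~g) i j ⟩
    ((matrix f *ₘ (inverse f *ₘ matrix g)) *ₘ (inverse g *ₘ matrix h)) i j ≈⟨ *ₘ-assoc (matrix f)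
      (inverse f *ₘ matrix g) (inverse g *ₘ matrix h) i j ⟩
    (matrix f *ₘ ((inverse f *ₘ matrix g) *ₘ (inverse g *ₘ matrix h))) i j ∎

  standard : ∀ S → Representation S n
  standard S = record { ρ = matrix ; poly = :matrix ; homo = λ _ _ i j → refl ; unit = λ i j →
    refl }

  module _ {S : Pred GLₙ 0ℓ} (S-subgroup : IsSubgroup S) {x : GLₙ}
    (dense : SchubertVariety w ⊆ closure (Orbit S x))
           (S-Levi : ∀ g → S g → Supp E (matrix g)) (T : Triangularisation (standard S) E) where
    private
      module S = IsSubgroup S-subgroup
      open Triangularisation T renaming
        (P to Q; P⁻¹ to Q⁻¹; P⁻¹P to Q⁻¹Q; PP⁻¹ to QQ⁻¹; P-Supp to Q-Supp; P⁻¹-Supp to Q⁻¹-Supp)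

      q : GLₙ
      q = record { matrix = Q ; inverse = Q⁻¹ ; inverseˡ = Q⁻¹Q ; inverseʳ = QQ⁻¹ }

    VanishesOnOrbit : Polynomial → Set
    VanishesOnOrbit p = ∀ o → Orbit S x o → eval p o ≈ 0#

    ZariskiClosure : Pred GLₙ 0ℓ
    ZariskiClosure g = ∀ p → VanishesOnOrbit p → eval p g ≈ 0#

    Orbit-resp : ∀ o o′ → o ~ o′ → Orbit S x o → Orbit S x o′
    Orbit-resp o o′ o~o′ (s , s∈ , o~sx) = s , s∈ , ~-trans o′ o (s · x) (~-sym o o′ o~o′) o~sx

    -- The orbit, as a set of matrices, is stable under right multiplication by β in B; so a
    -- polynomial vanishing on it still does after substituting o β for o.
    ZariskiClosure-resp : ∀ {g h} → g ~ h → ZariskiClosure g → ZariskiClosure h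
    ZariskiClosure-resp {g} {h} g~h g∈ p p-vanishes =
      let β       = inverse g *ₘ matrix h
          (p′ , e) = :evalₘ Regular {M = λ o → matrix o *ₘ β}
            (PolynomialMatrix.:*ₘ Regular {N = λ _ → β} :matrix (:constₘ β)) p
      in begin
      eval p h                    ≈⟨ eval-evalₘ p h (~-elim g h g~h) ⟩
      evalₘ p (matrix g *ₘ β)     ≈⟨ e g ⟨
      eval p′ g                   ≈⟨ g∈ p′
        (λ o o∈ → trans (e o) (trans (sym (eval-evalₘ p (o · (g ⁻¹ · h)) λ i j → refl))
                                       (p-vanishes (o · (g ⁻¹ · h))
                                         (Orbit-resp o (o · (g ⁻¹ · h))
                                           (~-intro o (o · (g ⁻¹ · h)) {β} g~h λ i j → refl)
                                             o∈)))) ⟩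
      0#                          ∎

    translate : GLₙ → Matrix n
    translate g = Q⁻¹ *ₘ matrix g

    -- A polynomial vanishing on Q⁻¹ S x B vanishes on Q⁻¹ X_w, which contains U_Φ w.
    vanishes-on-cell : ∀ {F} → MP.𝒫 F → (∀ g → Orbit S x g → F (translate g) ≈ 0#) → ∀ u →
      Unipotent-Φ u → F (u *ₘ P) ≈ 0#
    vanishes-on-cell {F} (p , eF) F-vanishes u u∈Φ = begin
      F (u *ₘ P)                       ≈⟨ eF (u *ₘ P) ⟨
      evalₘ p (u *ₘ P)                 ≈⟨ evalₘ-cong p Q⁻¹Qu ⟨
      evalₘ p (translate (cellPoint q u u∈Φ)) ≈⟨ e (cellPoint q u u∈Φ) ⟨
      eval p′ (cellPoint q u u∈Φ)
        ≈⟨ dense {cellPoint q u u∈Φ} (Levi-stable q Q-Supp u u∈Φ) ZariskiClosure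
             ((λ {g} {h} → ZariskiClosure-resp {g} {h}) , VanishesOnOrbit , λ g → mk⇔ (λ z → z)
               (λ z → z))
             (λ {o} o∈ p p-vanishes → p-vanishes o o∈) p′
               (λ o o∈ → trans (e o) (trans (eF (translate o)) (F-vanishes o o∈))) ⟩
      0# ∎
      where
      pulled-back = :evalₘ Regular {M = translate}
        (PolynomialMatrix.:*ₘ Regular {M = λ _ → Q⁻¹} (:constₘ Q⁻¹) :matrix) p
      p′ = proj₁ pulled-back
      e = proj₂ pulled-back
      Q⁻¹Qu : Q⁻¹ *ₘ ((Q *ₘ u) *ₘ P) ≈ₘ u *ₘ P
      Q⁻¹Qu i j = begin
        (Q⁻¹ *ₘ ((Q *ₘ u) *ₘ P)) i j ≈⟨ *ₘ-assoc Q⁻¹ (Q *ₘ u) P i j ⟨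
        ((Q⁻¹ *ₘ (Q *ₘ u)) *ₘ P) i j ≈⟨ *ₘ-cong₁ P (*ₘ-cancelˡ Q⁻¹ Q u Q⁻¹Q) i j ⟩
        (u *ₘ P) i j ∎

    -- k = s s₀⁻¹ carries g₀ to g up to a right factor β from B. Its conjugate Q⁻¹ k Q lies in H: it
    -- is upper triangular by the choice of Q, and block diagonal because k and Q are.
    orbit-Equivalent : ∀ g g₀ → Orbit S x g → Orbit S x g₀ → Unit (D (translate g)) → Unit
      (D (translate g₀)) →
                       Equivalent (unipotent (translate g)) (unipotent (translate g₀))
    orbit-Equivalent g g₀ (s , s∈ , g~sx) (s₀ , s₀∈ , g₀~s₀x) uD uD₀ =
      Equivalent-orbit {translate g} {translate g₀} {inverse g *ₘ Q} {inverse g₀ *ₘ Q} {β}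
        (translate-inverse g) (translate-inverse g₀) uD uD₀ h h∈H β-upper equation
      where
      translate-inverse : ∀ g → (inverse g *ₘ Q) *ₘ (Q⁻¹ *ₘ matrix g) ≈ₘ 1ₘ
      translate-inverse g = *ₘ-inverse (inverse g) Q Q⁻¹ (matrix g) QQ⁻¹ (inverseˡ g)
      k h : GLₙ
      k = s · (s₀ ⁻¹)
      h = (q ⁻¹) · (k · q)
      k∈ : S k
      k∈ = S.∙∈ s∈ (S.⁻¹∈ s₀∈)
      h∈H : H h
      h∈H i j ¬r = by-cases (E? i j)
        where
        by-cases : Dec (E i j) → (Q⁻¹ *ₘ (matrix k *ₘ Q)) i j ≈ 0#
        by-cases (yes e) = upper k k∈ i j (ℕₚ.≰⇒> λ i≤j → ¬r (e , i≤j))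
        by-cases (no ¬e) = Supp-* {M = Q⁻¹} {N = matrix k *ₘ Q} E-trans Q⁻¹-Supp
          (Supp-* {M = matrix k} {N = Q} E-trans (S-Levi k k∈) Q-Supp) i j ¬e
      a b β : Matrix n
      a = inverse g₀ *ₘ (matrix s₀ *ₘ matrix x)
      b = (inverse x *ₘ inverse s) *ₘ matrix g
      β = a *ₘ b
      β-upper : Upper β
      β-upper = Supp⇒Upper (Supp-* {R = _≤ᶠ_} {S = _≤ᶠ_} {M = a} {N = b} ℕₚ.≤-trans
        (Upper⇒Supp g₀~s₀x) (Upper⇒Supp (~-sym g (s · x) g~sx)))
      g₀β : matrix g₀ *ₘ β ≈ₘ matrix s₀ *ₘ (inverse s *ₘ matrix g)
      g₀β i j = begin
        (matrix g₀ *ₘ (a *ₘ b)) i j ≈⟨ *ₘ-assoc (matrix g₀) a b i j ⟨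
        ((matrix g₀ *ₘ (inverse g₀ *ₘ (matrix s₀ *ₘ matrix x))) *ₘ b) i j
          ≈⟨ *ₘ-cong₁ b (*ₘ-cancelˡ (matrix g₀) (inverse g₀) (matrix s₀ *ₘ matrix x) (inverseʳ g₀))
            i j ⟩
        ((matrix s₀ *ₘ matrix x) *ₘ b) i j ≈⟨ *ₘ-assoc (matrix s₀) (matrix x) b i j ⟩
        (matrix s₀ *ₘ (matrix x *ₘ ((inverse x *ₘ inverse s) *ₘ matrix g))) i j
          ≈⟨ *ₘ-cong₂ (matrix s₀) (λ i j → trans
            (*ₘ-cong₂ (matrix x) (*ₘ-assoc (inverse x) (inverse s) (matrix g)) i j)
               (*ₘ-cancelˡ (matrix x) (inverse x) (inverse s *ₘ matrix g) (inverseʳ x) i j)) i j ⟩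
        (matrix s₀ *ₘ (inverse s *ₘ matrix g)) i j ∎
      kg₀β : matrix k *ₘ (matrix g₀ *ₘ β) ≈ₘ matrix g
      kg₀β i j = begin
        ((matrix s *ₘ inverse s₀) *ₘ (matrix g₀ *ₘ β)) i j ≈⟨ *ₘ-cong₂
          (matrix s *ₘ inverse s₀) g₀β i j ⟩
        ((matrix s *ₘ inverse s₀) *ₘ (matrix s₀ *ₘ (inverse s *ₘ matrix g))) i j ≈⟨ *ₘ-assoc
          (matrix s) (inverse s₀) (matrix s₀ *ₘ (inverse s *ₘ matrix g)) i j ⟩
        (matrix s *ₘ (inverse s₀ *ₘ (matrix s₀ *ₘ (inverse s *ₘ matrix g)))) i j
          ≈⟨ *ₘ-cong₂ (matrix s) (*ₘ-cancelˡ (inverse s₀) (matrix s₀) (inverse s *ₘ matrix g)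
            (inverseˡ s₀)) i j ⟩
        (matrix s *ₘ (inverse s *ₘ matrix g)) i j ≈⟨ *ₘ-assoc (matrix s) (inverse s)
          (matrix g) i j ⟨
        ((matrix s *ₘ inverse s) *ₘ matrix g) i j ≈⟨ *ₘ-cong₁ (matrix g) (inverseʳ s) i j ⟩
        (1ₘ *ₘ matrix g) i j ≈⟨ *ₘ-identityˡ (matrix g) i j ⟩
        matrix g i j ∎
      equation : Q⁻¹ *ₘ matrix g ≈ₘ (Q⁻¹ *ₘ (matrix k *ₘ Q)) *ₘ ((Q⁻¹ *ₘ matrix g₀) *ₘ β)
      equation i j = sym (begin
        ((Q⁻¹ *ₘ (matrix k *ₘ Q)) *ₘ ((Q⁻¹ *ₘ matrix g₀) *ₘ β)) i j ≈⟨ *ₘ-assoc Q⁻¹ (matrix k *ₘ Q)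
          ((Q⁻¹ *ₘ matrix g₀) *ₘ β) i j ⟩
        (Q⁻¹ *ₘ ((matrix k *ₘ Q) *ₘ ((Q⁻¹ *ₘ matrix g₀) *ₘ β))) i j ≈⟨ *ₘ-cong₂ Q⁻¹ (λ i j → begin
          ((matrix k *ₘ Q) *ₘ ((Q⁻¹ *ₘ matrix g₀) *ₘ β)) i j ≈⟨ *ₘ-assoc (matrix k) Q
            ((Q⁻¹ *ₘ matrix g₀) *ₘ β) i j ⟩
          (matrix k *ₘ (Q *ₘ ((Q⁻¹ *ₘ matrix g₀) *ₘ β))) i j ≈⟨ *ₘ-cong₂ (matrix k)
            (λ i j → trans (*ₘ-cong₂ Q (*ₘ-assoc Q⁻¹ (matrix g₀) β) i j)
              (*ₘ-cancelˡ Q Q⁻¹ (matrix g₀ *ₘ β) QQ⁻¹ i j)) i j ⟩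
          (matrix k *ₘ (matrix g₀ *ₘ β)) i j ≈⟨ kg₀β i j ⟩
          matrix g i j ∎) i j ⟩
        (Q⁻¹ *ₘ matrix g) i j ∎)

    module _ (square : Square (Φ₌ w)) where
      open Square square

      mₐ mᵦ : Matrix n → Carrier
      mₐ u = u r₁ c₁ * u r₂ c₂
      mᵦ u = u r₁ c₂ * u r₂ c₁

      proportional : ∀ {û û₀} → Equivalent û û₀ → ∃ λ κ → ∃ λ κ′ → Unit κ × Unit κ′ ×
                     κ * mₐ û ≈ κ′ * mₐ û₀ × κ * mᵦ û ≈ κ′ * mᵦ û₀
      proportional {û} {û₀} e = row r₁ * row r₂ , column c₁ * column c₂ ,
        Unit-* (row-unit r₁) (row-unit r₂) , Unit-* (column-unit c₁) (column-unit c₂) ,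
        pair r₁ r₂ c₁ c₂ , trans (pair r₁ r₂ c₂ c₁) (*-congʳ (*-comm (column c₂) (column c₁)))
        where
        open Equivalent e
        pair : ∀ a b c d → (row a * row b) * (û a c * û b d) ≈ (column c * column d) *
          (û₀ a c * û₀ b d)
        pair a b c d = begin
          (row a * row b) * (û a c * û b d) ≈⟨ solve 4
            (λ p q x y → (p :* q) :* (x :* y) := (p :* x) :* (q :* y)) refl (row a) (row b) (û a c)
              (û b d) ⟩
          (row a * û a c) * (row b * û b d) ≈⟨ *-cong (scaled a c) (scaled b d) ⟩
          (column c * û₀ a c) * (column d * û₀ b d) ≈⟨ solve 4
            (λ p q x y → (p :* x) :* (q :* y) := (p :* q) :* (x :* y)) refl (column c) (column d)
              (û₀ a c) (û₀ b d) ⟩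
          (column c * column d) * (û₀ a c * û₀ b d) ∎

      cross : ∀ {û û₀} → Equivalent û û₀ → mₐ û * mᵦ û₀ ≈ mₐ û₀ * mᵦ û
      cross {û} {û₀} e = let (κ , κ′ , uκ , uκ′ , eₐ , eᵦ) = proportional e in Unit-cancelˡ uκ
                               (begin
        κ * (mₐ û * mᵦ û₀)   ≈⟨ *-assoc κ _ _ ⟨
        (κ * mₐ û) * mᵦ û₀   ≈⟨ *-congʳ eₐ ⟩
        (κ′ * mₐ û₀) * mᵦ û₀ ≈⟨ solve 3 (λ k a b → (k :* a) :* b := a :* (k :* b)) refl κ′ (mₐ û₀)
          (mᵦ û₀) ⟩
        mₐ û₀ * (κ′ * mᵦ û₀) ≈⟨ *-congˡ eᵦ ⟨
        mₐ û₀ * (κ * mᵦ û)   ≈⟨ solve 3 (λ k a b → a :* (k :* b) := k :* (a :* b)) refl κ (mₐ û₀)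
          (mᵦ û) ⟩
        κ * (mₐ û₀ * mᵦ û)   ∎)

      :mₐ : MP.𝒫 (λ M → mₐ (unipotent M))
      :mₐ = :unipotent r₁ c₁ MP.:⊗ :unipotent r₂ c₂

      :mᵦ : MP.𝒫 (λ M → mᵦ (unipotent M))
      :mᵦ = :unipotent r₁ c₂ MP.:⊗ :unipotent r₂ c₁

      -- The ratio mₐ : mᵦ is constant on an orbit, but not on U_Φ.
      constant-ratio : ∀ g₀ → Orbit S x g₀ → Unit (D (translate g₀)) → ∀ u → Unipotent-Φ u →
        mₐ u * mᵦ (unipotent (translate g₀)) ≈ mₐ (unipotent (translate g₀)) * mᵦ u
      constant-ratio g₀ g₀∈ uD₀ u u∈Φ =
        let (κ , κ′ , uκ , uκ′ , eₐ , eᵦ) = proportional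
              (Equivalent-unipotent u u∈Φ) in Unit-cancelˡ uκ′ (begin
        κ′ * (mₐ u * b₀)   ≈⟨ *-assoc κ′ _ _ ⟨
        (κ′ * mₐ u) * b₀   ≈⟨ *-congʳ eₐ ⟨
        (κ * mₐ û) * b₀    ≈⟨ *-assoc κ _ _ ⟩
        κ * (mₐ û * b₀)    ≈⟨ *-congˡ (x-y≈0⇒x≈y (Unit-cancel (D-unipotent u u∈Φ) vanishes)) ⟩
        κ * (a₀ * mᵦ û)    ≈⟨ solve 3 (λ k a b → k :* (a :* b) := a :* (k :* b)) refl κ a₀ (mᵦ û) ⟩
        a₀ * (κ * mᵦ û)    ≈⟨ *-congˡ eᵦ ⟩
        a₀ * (κ′ * mᵦ u)   ≈⟨ solve 3 (λ k a b → a :* (k :* b) := k :* (a :* b)) refl κ′ a₀ (mᵦ u) ⟩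
        κ′ * (a₀ * mᵦ u)   ∎)
        where
        a₀ b₀ : Carrier
        a₀ = mₐ (unipotent (translate g₀))
        b₀ = mᵦ (unipotent (translate g₀))
        û : Matrix n
        û = unipotent (u *ₘ P)
        -- The factor `D` makes F vanish also at those points of the orbit where the normal form
        -- breaks down.
        F : Matrix n → Carrier
        F M = D M * (mₐ (unipotent M) * b₀ - a₀ * mᵦ (unipotent M))
        vanishes : F (u *ₘ P) ≈ 0#
        vanishes = vanishes-on-cell {F} (:D MP.:⊗
          ((:mₐ MP.:⊗ MP.const b₀) MP.:⊖ (MP.const a₀ MP.:⊗ :mᵦ)))
          (λ g g∈ → stable λ ne → ≈0? (D (translate g)) λ
            { (inj₁ D≈0) → ne (0*x≈0 D≈0)
            ; (inj₂ uD)  → ne (x*0≈0 (x≈y⇒x-y≈0 (cross (orbit-Equivalent g g₀ g∈ g₀∈ uD uD₀)))) }) u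
              u∈Φ

      bump : Fin n → Fin n → Matrix n
      bump r c i j = u₀ i j + 1ₘ i r * 1ₘ j c

      bump-off : ∀ {r c i j} → ¬ (i ≡ r × j ≡ c) → bump r c i j ≈ u₀ i j
      bump-off {r} {c} {i} {j} ne = trans (+-congˡ (by-cases (i ≟ r))) (+-identityʳ _)
        where
        by-cases : Dec (i ≡ r) → 1ₘ i r * 1ₘ j c ≈ 0#
        by-cases (no i≢r)     = 0*x≈0 (1ₘ-off i r i≢r)
        by-cases (yes ≡.refl) = x*0≈0 (1ₘ-off j c λ j≡c → ne (≡.refl , j≡c))

      bump-at : ∀ {r c} → Φ₌ w r c → bump r c r c ≈ 1# + 1#
      bump-at {r} {c} φ = +-cong (u₀-in φ) (trans (*-cong (1ₘ-diag r) (1ₘ-diag c)) (*-identityˡ 1#))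

      bump-Φ : ∀ {r c} → Φ w r c → Unipotent-Φ (bump r c)
      bump-Φ {r} {c} φ = (λ i j ¬φ → trans
        (bump-off {r} {c} {i} {j} λ { (≡.refl , ≡.refl) → ¬φ (inj₂ φ) }) (u₀-out i j ¬φ))
        , λ i → trans (bump-off {r} {c} {i} {i}
          λ { (≡.refl , ≡.refl) → ℕₚ.<-irrefl ≡.refl (proj₁ φ) }) (u₀-in (inj₁ ≡.refl))

      -- At u₀ both monomials are 1, so a = b by `constant-ratio`. Doubling an entry of the square
      -- that lies on Φ doubles only one of them, which forces a = 0. Of the positions (r₁ , c₁) and
      -- (r₁ , c₂) at least one is on Φ, since c₁ ≠ c₂.
      monomial-vanishes : ∀ g₀ → Orbit S x g₀ → Unit (D (translate g₀)) → mₐ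
        (unipotent (translate g₀)) ≈ 0#
      monomial-vanishes g₀ g₀∈ uD₀ = by-cases s₁₁ s₁₂
        where
        a b : Carrier
        a = mₐ (unipotent (translate g₀))
        b = mᵦ (unipotent (translate g₀))
        1*1 : ∀ {p q} → p ≈ 1# → q ≈ 1# → p * q ≈ 1#
        1*1 e f = trans (*-cong e f) (*-identityˡ 1#)
        b≈a : b ≈ a
        b≈a = trans (sym (trans (*-congʳ (1*1 (u₀-in s₁₁) (u₀-in s₂₂))) (*-identityˡ b)))
          (trans (constant-ratio g₀ g₀∈ uD₀ u₀ u₀-Φ)
            (trans (*-congˡ (1*1 (u₀-in s₁₂) (u₀-in s₂₁))) (*-identityʳ a)))
        doubled⇒≈0 : ∀ {p q y} → p ≈ 1# + 1# → q ≈ 1# → y ≈ y * (p * q) → y ≈ 0#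
        doubled⇒≈0 {p} {q} {y} e f h = begin
          y ≈⟨ solve 1 (λ y → y := y :* ((:1 :+ :1) :* :1) :- y) refl y ⟩
          y * ((1# + 1#) * 1#) - y ≈⟨ +-congʳ (*-congˡ (*-cong e f)) ⟨
          y * (p * q) - y ≈⟨ x≈y⇒x-y≈0 (sym h) ⟩
          0# ∎
        by-cases : Φ₌ w r₁ c₁ → Φ₌ w r₁ c₂ → a ≈ 0#
        by-cases (inj₂ φ) _ = trans (sym b≈a)
          (doubled⇒≈0 {bump r₁ c₁ r₁ c₁} {bump r₁ c₁ r₂ c₂} (bump-at (inj₂ φ))
            (trans (bump-off {r₁} {c₁} {r₂} {c₂} λ (e , _) → r₁≢r₂ (≡.sym e)) (u₀-in s₂₂))
          (sym (trans (*-comm b _) (trans (constant-ratio g₀ g₀∈ uD₀ (bump r₁ c₁) (bump-Φ φ))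
            (trans (*-congˡ (1*1 (trans (bump-off {r₁} {c₁} {r₁} {c₂} λ (_ , e) → c₁≢c₂ (≡.sym e))
              (u₀-in s₁₂))
                                 (trans (bump-off {r₁} {c₁} {r₂} {c₁} λ (e , _) → r₁≢r₂ (≡.sym e))
                                   (u₀-in s₂₁))))
                   (trans (*-identityʳ a) (sym b≈a)))))))
        by-cases (inj₁ _) (inj₂ φ) = doubled⇒≈0 {bump r₁ c₂ r₁ c₂} {bump r₁ c₂ r₂ c₁}
          (bump-at (inj₂ φ))
            (trans (bump-off {r₁} {c₂} {r₂} {c₁} λ (e , _) → r₁≢r₂ (≡.sym e)) (u₀-in s₂₁))
          (trans (sym b≈a) (trans (sym (trans
            (*-congʳ (1*1 (trans (bump-off {r₁} {c₂} {r₁} {c₁} λ (_ , e) → c₁≢c₂ e) (u₀-in s₁₁))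
                                                            (trans (bump-off {r₁} {c₂} {r₂} {c₂}
                                                              λ (e , _) → r₁≢r₂ (≡.sym e))
                                                                (u₀-in s₂₂)))) (*-identityˡ b)))
            (constant-ratio g₀ g₀∈ uD₀ (bump r₁ c₂) (bump-Φ φ))))
        by-cases (inj₁ e) (inj₁ f) = contradiction (≡.trans (≡.sym e) f) c₁≢c₂

      -- `D` times the first monomial vanishes on the whole orbit, hence by density at u₀ w; but `D`
      -- is invertible there and the monomial is 1 at u₀.
      not-dense : ⊥
      not-dense = 1≉0 (trans (sym (trans (*-cong (u₀-in s₁₁) (u₀-in s₂₂)) (*-identityˡ 1#)))
        (Unit-cancel uκ′ (trans (sym eₐ)
        (x*0≈0 (Unit-cancel (D-unipotent u₀ u₀-Φ) vanishes)))))
        where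
        F : Matrix n → Carrier
        F M = D M * mₐ (unipotent M)
        vanishes : F (u₀ *ₘ P) ≈ 0#
        vanishes = vanishes-on-cell {F} (:D MP.:⊗ :mₐ)
          (λ g g∈ → stable λ ne → ≈0? (D (translate g)) λ
            { (inj₁ D≈0) → ne (0*x≈0 D≈0)
            ; (inj₂ uD)  → ne (x*0≈0 (monomial-vanishes g g∈ uD)) }) u₀ u₀-Φ
        ratio = proportional (Equivalent-unipotent u₀ u₀-Φ)
        uκ′ = proj₁ (proj₂ (proj₂ (proj₂ ratio)))
        eₐ = proj₁ (proj₂ (proj₂ (proj₂ (proj₂ ratio))))

  Levi-spherical⇒spherical : IsLeviSpherical I w → IsSpherical I w
  Levi-spherical⇒spherical (S , (C , _) , x , (_ , dense)) = spherical-without-square w I⊆J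
    λ square →
    triangularise (proj₁ solvable) isSubgroup connected (λ {g} → proj₂ solvable {g})
      (standard S) E-refl E-sym E-trans (λ g g∈ → H⊆L g∈) λ T →
    not-dense isSubgroup {x} dense (λ g g∈ → H⊆L g∈) T square
    where open ConnectedSolvableClosedSubgroup C

theorem1p5 : (𝒞 : ComplexNumbers) (m : ℕ) (w : Permutation′ (suc m)) (I : Subset m) →
    (_∈ I) ⊆ SymmetricGroup.J w →
    Spherical.IsLeviSpherical 𝒞 I w ⇔ SymmetricGroup.IsSpherical I w
theorem1p5 𝒞 m w I I⊆J = mk⇔ (Necessity.Levi-spherical⇒spherical 𝒞 w I I⊆J)
  (SphericalOrbit.spherical⇒Levi-spherical 𝒞 w I I⊆J)
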